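{- Let $L$ be an $\mathcal{O}$-lattice in the hermitian space $(V,\Phi)$ over $E$ and let $m=\operatorname{rank}_E(V)$. If $E/K$ is ramified, $m$ is even and $L\cong H(s_1)\perp H(s_2)\perp\dots\perp H(s_{m/2})$ for some integers $s_1,\dots,s_{m/2}$ with $s_i\equiv e \pmod 2$ for all $1\le i\le m/2$, then $\mathcal{E}(L)=\mathcal{E}_1$. In all other cases, $\mathcal{E}(L)=\mathcal{E}_0$.
   Context: Local setting. $K$ is a field of characteristic different from $2$, complete with respect to a surjective discrete valuation $\operatorname{ord}\colon K\to\mathbb{Z}\cup\{\infty\}$ with finite residue field; $\mathfrak{o}$ is its valuation ring and $\mathfrak{p}$ the maximal ideal of $\mathfrak{o}$. $E=K[X]/(X^2-a)$ is an étale $K$-algebra of dimension $2$ (either a quadratic field extension of $K$ or $E\cong K\oplus K$), and $\overline{\phantom{x}}\colon E\to E$ is the $K$-linear automorphism of $E$ with fixed field $K$. Put $\operatorname{Nr}(\alpha)=\alpha\overline{\alpha}$ and $\operatorname{Tr}(\alpha)=\alpha+\overline{\alpha}$. Let $\mathcal{O}=\{\alpha\in E : \operatorname{Tr}(\alpha)\in\mathfrak{o},\ \operatorname{Nr}(\alpha)\in\mathfrak{o}\}$ be the integral closure of $\mathfrak{o}$ in $E$. Let $\mathfrak{D}$ be the different of $\mathcal{O}$ over $\mathfrak{o}$, i.e. the inverse of the fractional ideal $\mathfrak{D}^{ -1}=\{\alpha\in E:\operatorname{Tr}(\alpha\mathcal{O})\subseteq\mathfrak{o}\}$. If $E\cong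 K\oplus K$ put $\mathfrak{P}=\mathfrak{p}\mathcal{O}$; otherwise $\mathfrak{P}$ is the maximal ideal of $\mathcal{O}$. Then $\mathfrak{D}=\mathfrak{P}^e$ for an integer $e\ge 0$, which defines $e$. "$E/K$ is ramified" means that $E$ is a field and $\mathfrak{p}\mathcal{O}=\mathfrak{P}^2$. Hermitian spaces and lattices. $(V,\Phi)$ is a hermitian space over $E$: $V\neq 0$ is a finitely generated free $E$-module and $\Phi\colon V\times V\to E$ is non-degenerate, $E$-linear in the first argument, and satisfies $\Phi(w,v)=\overline{\Phi(v,w)}$. An $\mathcal{O}$-lattice in $V$ is a finitely generated $\mathcal{O}$-submodule of $V$ containing a $K$-basis of $V$. The unitary group $\mathrm{U}(V,\Phi)$ consists of all $\varphi\in\mathrm{GL}(V)$ with $\Phi(\varphi(x),\varphi(y))=\Phi(x,y)$ for all $x,y\in V$, and $\operatorname{Aut}(L)=\{\varphi\in\mathrm{U}(V,\Phi):\varphi(L)=L\}$. $\cong$ denotes isometry of hermitian lattices and $\perp$ denotes orthogonal sum. If $E/K$ is ramified, fix a prime element $\pi$ of $\mathcal{O}$; for $i\in\mathbb{Z}$, $H(i)$ denotes the free hermitian $\mathcal{O}$-lattice of rank $2$ with Gram matrix $\begin{pmatrix}0&\pi^i\\ \overline{\pi}^i&0\end{pmatrix}$ (its isometry class does not depend on the choice of $\pi$). Put $\mathcal{E}_0=\{u\in\mathcal{O}^*: u\overline{u}=1\}$, $\mathcal{E}_1=\{u\,\overline{u}^{ -1}: u\in\mathcal{O}^*\}\subseteq\mathcal{E}_0$,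 and $\mathcal{E}(L)=\{\det(\varphi):\varphi\in\operatorname{Aut}(L)\}$, a subgroup of $\mathcal{E}_0$. -}

module Defs where

open import Level using (_⊔_) renaming (suc to lsuc)
open import Algebra.Bundles using (AbelianGroup; CommutativeRing; Semiring)
open import Algebra.Module.Bundles using (Module)
open import Algebra.Module.Morphism.Structures using (IsModuleIsomorphism)
open import Algebra.Morphism.Structures using (IsRingIsomorphism)
import Algebra.Construct.DirectProduct as ×-Algebra
import Algebra.Definitions.RawMonoid as RawMonoidDefs
import Algebra.Definitions.RawSemiring as RawSemiringDefs
import Algebra.Module.Construct.DirectProduct as ×-Module
import Algebra.Module.Construct.TensorUnit as TensorUnit
import Algebra.Module.Construct.Zero as Zero
import Algebra.Solver.Ring.NaturalCoefficients.Default as RingSolver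
open import Data.Fin.Base using (Fin; zero; suc; toℕ; punchIn)
open import Data.Integer.Base as ℤ using (ℤ; +_; -[1+_])
open import Data.Integer.Divisibility using (_∣_)
open import Data.Nat.Base as ℕ using (ℕ; zero; suc)
open import Data.Product.Base using (Σ; ∃; ∃₂; _×_; _,_; proj₁; proj₂)
open import Data.Sum.Base using (_⊎_)
open import Data.Unit.Polymorphic using (⊤)
open import Data.Vec.Functional using (Vector)
open import Function.Base using (id; _∘_)
open import Relation.Binary.PropositionalEquality.Core using (_≡_)
open import Relation.Nullary.Construct.Add.Supremum using (_⁺; [_]; ⊤⁺)
open import Relation.Nullary.Negation.Core using (¬_)
open import Relation.Unary using (Pred; _∈_; _∉_; _⊆_; _≐_; _⟨×⟩_)
import Relation.Binary.Construct.Add.Supremum.NonStrict as AddSupremum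

------------------------------------------------------------------------
-- ℤ ∪ {∞}

ℤ∞ : Set
ℤ∞ = ℤ ⁺

open AddSupremum ℤ._≤_ public using () renaming (_≤⁺_ to _≤∞_)

infixl 6 _+∞_
infixl 7 _⊓∞_

_+∞_ : ℤ∞ → ℤ∞ → ℤ∞
[ m ] +∞ [ n ] = [ m ℤ.+ n ]
[ m ] +∞ ⊤⁺    = ⊤⁺
⊤⁺    +∞ _     = ⊤⁺

_⊓∞_ : ℤ∞ → ℤ∞ → ℤ∞
[ m ] ⊓∞ [ n ] = [ m ℤ.⊓ n ]
[ m ] ⊓∞ ⊤⁺    = [ m ]
⊤⁺    ⊓∞ n     = n

------------------------------------------------------------------------
-- Fields and determinants

record IsField {c ℓ} (R : CommutativeRing c ℓ) : Set (c ⊔ ℓ) where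
  open CommutativeRing R
  field
    1≉0     : ¬ (1# ≈ 0#)
    inverse : ∀ x → ¬ (x ≈ 0#) → ∃ λ y → x * y ≈ 1#

module _ {c ℓ} (R : CommutativeRing c ℓ) where
  open CommutativeRing R hiding (zero)
  open RawSemiringDefs (Semiring.rawSemiring semiring) using (sum; _^_)

  -- Laplace expansion along the first row.
  det : ∀ {n} → (Fin n → Fin n → Carrier) → Carrier
  det {zero}  A = 1#
  det {suc n} A = sum λ j →
    (- 1#) ^ toℕ j * A zero j * det (λ i k → A (suc i) (punchIn j k))

------------------------------------------------------------------------
-- Complete discretely valued fields with finite residue field

record LocalField c ℓ : Set (lsuc (c ⊔ ℓ)) where
  field
    commutativeRing : CommutativeRing c ℓ

  open CommutativeRing commutativeRing public

  field
    isField  : IsField commutativeRing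
    ord      : Carrier → ℤ∞
    ord-cong : ∀ {x y} → x ≈ y → ord x ≡ ord y
    ord-0    : ord 0# ≡ ⊤⁺
    ord-∞    : ∀ x → ord x ≡ ⊤⁺ → x ≈ 0#
    ord-*    : ∀ x y → ord (x * y) ≡ ord x +∞ ord y
    ord-+    : ∀ x y → (ord x ⊓∞ ord y) ≤∞ ord (x + y)
    ord-surj : ∀ n → ∃ λ x → ord x ≡ n

  𝔬 : Pred Carrier _
  𝔬 x = [ + 0 ] ≤∞ ord x

  𝔭 : Pred Carrier _
  𝔭 x = [ + 1 ] ≤∞ ord x

  Cauchy : (ℕ → Carrier) → Set
  Cauchy s = ∀ (n : ℤ) → ∃ λ N → ∀ i j → N ℕ.≤ i → N ℕ.≤ j →
             [ n ] ≤∞ ord (s i - s j)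

  _⟶_ : (ℕ → Carrier) → Carrier → Set
  s ⟶ x = ∀ (n : ℤ) → ∃ λ N → ∀ i → N ℕ.≤ i → [ n ] ≤∞ ord (s i - x)

  field
    complete : ∀ s → Cauchy s → ∃ λ x → s ⟶ x

    -- Finiteness of 𝔬/𝔭: representatives r₁,…,r_q of the residue classes.
    q                : ℕ
    residue          : Fin q → Carrier
    residue-integral : ∀ i → residue i ∈ 𝔬
    residue-distinct : ∀ i j → residue i - residue j ∈ 𝔭 → i ≡ j
    residue-onto     : ∀ x → x ∈ 𝔬 → ∃ λ i → x - residue i ∈ 𝔭

------------------------------------------------------------------------
-- The quadratic algebra E = K[X]/(X² − a)

module QuadraticAlgebra {c ℓ} (F : LocalField c ℓ)
                        (a : LocalField.Carrier F) where

  private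
    module K where
      open LocalField F public
    open RingSolver K.commutativeSemiring using (solve; _:=_; _:+_; _:*_; con)

  -- (x , y) stands for the class of x + yX.
  E : CommutativeRing c ℓ
  E = record
    { Carrier = K.Carrier × K.Carrier
    ; _≈_     = _≈ₑ_
    ; _+_     = _+ₑ_
    ; _*_     = _*ₑ_
    ; -_      = -ₑ_
    ; 0#      = 0ₑ
    ; 1#      = 1ₑ
    ; isCommutativeRing = record
      { isRing = record
        { +-isAbelianGroup = Add.isAbelianGroup
        ; *-cong     = λ (p , q) (r , s) →
            K.+-cong (K.*-cong p r) (K.*-cong K.refl (K.*-cong q s)) ,
            K.+-cong (K.*-cong p s) (K.*-cong q r)
        ; *-assoc    = λ (x , y) (z , w) (u , v) →
            solve 7 (λ a x y z w u v →
                (x :* z :+ a :* (y :* w)) :* u :+ a :* ((x :* w :+ y :* z) :* v)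
                := x :* (z :* u :+ a :* (w :* v)) :+ a :* (y :* (z :* v :+ w :* u)))
              K.refl a x y z w u v ,
            solve 7 (λ a x y z w u v →
                (x :* z :+ a :* (y :* w)) :* v :+ (x :* w :+ y :* z) :* u
                := x :* (z :* v :+ w :* u) :+ y :* (z :* u :+ a :* (w :* v)))
              K.refl a x y z w u v
        ; *-identity =
            (λ (x , y) →
              solve 3 (λ a x y → con 1 :* x :+ a :* (con 0 :* y) := x) K.refl a x y ,
              solve 3 (λ a x y → con 1 :* y :+ con 0 :* x := y) K.refl a x y) ,
            (λ (x , y) →
              solve 3 (λ a x y → x :* con 1 :+ a :* (y :* con 0) := x) K.refl a x y ,
              solve 3 (λ a x y → x :* con 0 :+ y :* con 1 := y) K.refl a x y)
        ; distrib    =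
            (λ (x , y) (z , w) (u , v) →
              solve 7 (λ a x y z w u v →
                  x :* (z :+ u) :+ a :* (y :* (w :+ v))
                  := (x :* z :+ a :* (y :* w)) :+ (x :* u :+ a :* (y :* v)))
                K.refl a x y z w u v ,
              solve 7 (λ a x y z w u v →
                  x :* (w :+ v) :+ y :* (z :+ u)
                  := (x :* w :+ y :* z) :+ (x :* v :+ y :* u))
                K.refl a x y z w u v) ,
            (λ (x , y) (z , w) (u , v) →
              solve 7 (λ a x y z w u v →
                  (z :+ u) :* x :+ a :* ((w :+ v) :* y)
                  := (z :* x :+ a :* (w :* y)) :+ (u :* x :+ a :* (v :* y)))
                K.refl a x y z w u v ,
              solve 7 (λ a x y z w u v →
                  (z :+ u) :* y :+ (w :+ v) :* x
                  := (z :* y :+ w :* x) :+ (u :* y :+ v :* x))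
                K.refl a x y z w u v)
        }
      ; *-comm = λ (x , y) (z , w) →
          solve 5 (λ a x y z w →
              x :* z :+ a :* (y :* w) := z :* x :+ a :* (w :* y))
            K.refl a x y z w ,
          solve 5 (λ a x y z w → x :* w :+ y :* z := z :* y :+ w :* x)
            K.refl a x y z w
      }
    }
    where
    module Add = AbelianGroup (×-Algebra.abelianGroup K.+-abelianGroup K.+-abelianGroup)
    open Add renaming (_≈_ to _≈ₑ_; _∙_ to _+ₑ_; _⁻¹ to -ₑ_; ε to 0ₑ)
    _*ₑ_ : K.Carrier × K.Carrier → K.Carrier × K.Carrier → K.Carrier × K.Carrier
    (x , y) *ₑ (z , w) = x K.* z K.+ a K.* (y K.* w) , x K.* w K.+ y K.* z
    1ₑ : K.Carrier × K.Carrier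
    1ₑ = K.1# , K.0#

  open CommutativeRing E public hiding (zero)
  open RawSemiringDefs (Semiring.rawSemiring semiring) using (sum; _^_)

  Subset : Set (lsuc (c ⊔ ℓ))
  Subset = Pred Carrier (c ⊔ ℓ)

  ι : K.Carrier → Carrier
  ι x = x , K.0#

  conj : Carrier → Carrier
  conj (x , y) = x , K.- y

  Nr Tr : Carrier → Carrier
  Nr α = α * conj α
  Tr α = α + conj α

  K² : CommutativeRing c ℓ
  K² = ×-Algebra.commutativeRing K.commutativeRing K.commutativeRing

  -- An isomorphism of K-algebras E ≅ K ⊕ K.
  record Split : Set (c ⊔ ℓ) where
    private module K² = CommutativeRing K²
    field
      to                : Carrier → K.Carrier × K.Carrier
      isRingIsomorphism : IsRingIsomorphism rawRing K².rawRing to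
      to-ι              : ∀ k → to (ι k) K².≈ (k , k)

  -- For char K ≠ 2, X² − a is separable exactly when one of these holds.
  IsÉtale : Set (c ⊔ ℓ)
  IsÉtale = IsField E ⊎ Split

  ----------------------------------------------------------------------
  -- Integers, ideals, and the different

  ι𝔬 ι𝔭 : Subset
  ι𝔬 α = ∃ λ k → k ∈ K.𝔬 × α ≈ ι k
  ι𝔭 α = ∃ λ k → k ∈ K.𝔭 × α ≈ ι k

  𝒪 : Subset
  𝒪 α = Tr α ∈ ι𝔬 × Nr α ∈ ι𝔬

  𝒪ˣ : Subset
  𝒪ˣ α = α ∈ 𝒪 × ∃ λ β → β ∈ 𝒪 × α * β ≈ 1#

  infixl 7 _·_
  infixr 8 _^ᴵ_

  -- Finite sums Σ xᵢyᵢ with xᵢ ∈ I and yᵢ ∈ J.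
  _·_ : Subset → Subset → Subset
  (I · J) α = ∃ λ n → ∃₂ λ (x y : Vector Carrier n) →
    (∀ i → x i ∈ I) × (∀ i → y i ∈ J) × α ≈ sum (λ i → x i * y i)

  _^ᴵ_ : Subset → ℕ → Subset
  I ^ᴵ zero  = 𝒪
  I ^ᴵ suc n = I · I ^ᴵ n

  𝔭𝒪 : Subset
  𝔭𝒪 = ι𝔭 · 𝒪

  record IsIdeal (I : Subset) : Set (c ⊔ ℓ) where
    field
      ⊆𝒪    : I ⊆ 𝒪
      resp  : ∀ {x y} → x ≈ y → x ∈ I → y ∈ I
      0∈    : 0# ∈ I
      +-mem : ∀ {x y} → x ∈ I → y ∈ I → x + y ∈ I
      *-mem : ∀ {r x} → r ∈ 𝒪 → x ∈ I → r * x ∈ I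

  record IsMaximalIdeal (I : Subset) : Set (lsuc (c ⊔ ℓ)) where
    field
      isIdeal : IsIdeal I
      proper  : 1# ∉ I
      maximal : ∀ J → IsIdeal J → 1# ∉ J → I ⊆ J → J ⊆ I

  Is𝔓 : Subset → Set (lsuc (c ⊔ ℓ))
  Is𝔓 𝔓 = (Split → 𝔓 ≐ 𝔭𝒪) × (¬ Split → IsMaximalIdeal 𝔓)

  𝔇⁻¹ : Subset
  𝔇⁻¹ α = ∀ β → β ∈ 𝒪 → Tr (α * β) ∈ ι𝔬

  𝔇 : Subset
  𝔇 α = ∀ β → β ∈ 𝔇⁻¹ → α * β ∈ 𝒪

  Ramified : Subset → Set (c ⊔ ℓ)
  Ramified 𝔓 = IsField E × 𝔭𝒪 ≐ 𝔓 ^ᴵ 2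

  -- π generates 𝔓; its inverse in E is carried along for negative powers.
  IsPrimeElement : Subset → (π π⁻¹ : Carrier) → Set (c ⊔ ℓ)
  IsPrimeElement 𝔓 π π⁻¹ =
    𝔓 ≐ (λ α → ∃ λ β → β ∈ 𝒪 × α ≈ π * β) × π * π⁻¹ ≈ 1#

  zpow : (x x⁻¹ : Carrier) → ℤ → Carrier
  zpow x x⁻¹ (+ n)    = x ^ n
  zpow x x⁻¹ -[1+ n ] = x⁻¹ ^ suc n

  ----------------------------------------------------------------------
  -- Hermitian spaces and lattices

  module _ {v ℓv} (V : Module E v ℓv) where
    open Module V
    open RawMonoidDefs +ᴹ-rawMonoid using () renaming (sum to sumᴹ)

    linComb : ∀ {n} → Vector Carrier n → Vector Carrierᴹ n → Carrierᴹ
    linComb r b = sumᴹ λ i → r i *ₗ b i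

    -- b is a basis of V as an R-module, where R acts through f : R → E.
    record IsBasis {r ℓr} (R : CommutativeRing r ℓr)
                   (f : CommutativeRing.Carrier R → Carrier)
                   {n} (b : Vector Carrierᴹ n) : Set (r ⊔ ℓr ⊔ v ⊔ ℓv) where
      private module R = CommutativeRing R
      field
        spans       : ∀ x → ∃ λ (r : Vector R.Carrier n) → x ≈ᴹ linComb (f ∘ r) b
        independent : ∀ (r : Vector R.Carrier n) → linComb (f ∘ r) b ≈ᴹ 0ᴹ →
                      ∀ i → r i R.≈ R.0#

      coord : Carrierᴹ → Vector R.Carrier n
      coord x = proj₁ (spans x)

    record IsHermitian (Φ : Carrierᴹ → Carrierᴹ → Carrier) : Set (c ⊔ ℓ ⊔ v ⊔ ℓv) where
      field
        Φ-cong        : ∀ {x x′ y y′} → x ≈ᴹ x′ → y ≈ᴹ y′ → Φ x y ≈ Φ x′ y′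
        Φ-+           : ∀ x x′ y → Φ (x +ᴹ x′) y ≈ Φ x y + Φ x′ y
        Φ-*           : ∀ r x y → Φ (r *ₗ x) y ≈ r * Φ x y
        Φ-conj        : ∀ x y → Φ y x ≈ conj (Φ x y)
        nondegenerate : ∀ x → (∀ y → Φ x y ≈ 0#) → x ≈ᴹ 0ᴹ

    record IsLattice {p} (L : Pred Carrierᴹ p) : Set (c ⊔ ℓ ⊔ v ⊔ ℓv ⊔ p) where
      field
        resp               : ∀ {x y} → x ≈ᴹ y → x ∈ L → y ∈ L
        0∈                 : 0ᴹ ∈ L
        +-mem              : ∀ {x y} → x ∈ L → y ∈ L → x +ᴹ y ∈ L
        *-mem              : ∀ {r x} → r ∈ 𝒪 → x ∈ L → r *ₗ x ∈ L
        finitely-generated : ∃ λ n → ∃ λ (g : Vector Carrierᴹ n) →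
          (∀ i → g i ∈ L) ×
          (∀ x → x ∈ L → ∃ λ r → (∀ i → r i ∈ 𝒪) × x ≈ᴹ linComb r g)
        contains-K-basis   : ∃ λ n → ∃ λ (b : Vector Carrierᴹ n) →
          (∀ i → b i ∈ L) × IsBasis K.commutativeRing ι b

  -- Bare data: the hermitian and lattice axioms are in HermitianLattice.
  record FormedLattice v ℓv p : Set (c ⊔ ℓ ⊔ lsuc (v ⊔ ℓv ⊔ p)) where
    field
      space : Module E v ℓv
    open Module space public
    field
      Φ       : Carrierᴹ → Carrierᴹ → Carrier
      lattice : Pred Carrierᴹ p

  -- A lattice in a hermitian space of rank m.
  record HermitianLattice (m : ℕ) v ℓv p : Set (c ⊔ ℓ ⊔ lsuc (v ⊔ ℓv ⊔ p)) where
    field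
      formedLattice : FormedLattice v ℓv p
    open FormedLattice formedLattice public
    field
      basis       : Vector Carrierᴹ m
      isBasis     : IsBasis space E id basis
      isHermitian : IsHermitian space Φ
      isLattice   : IsLattice space lattice

  module _ {v ℓv p w ℓw q} (L : FormedLattice v ℓv p) (M : FormedLattice w ℓw q) where
    private
      module L = FormedLattice L
      module M = FormedLattice M

    -- φ is defined on the ambient spaces; an 𝒪-linear isometry of lattices
    -- extends to them uniquely.
    record IsIsometry (φ : L.Carrierᴹ → M.Carrierᴹ)
                      : Set (c ⊔ ℓ ⊔ v ⊔ ℓv ⊔ w ⊔ ℓw ⊔ p ⊔ q) where
      field
        isModuleIsomorphism : IsModuleIsomorphism L.rawModule M.rawModule φ
        preserves-Φ         : ∀ x y → M.Φ (φ x) (φ y) ≈ L.Φ x y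
        image               : (λ y → ∃ λ x → x ∈ L.lattice × φ x M.≈ᴹ y) ≐ M.lattice

    infix 4 _≅_
    _≅_ : Set (c ⊔ ℓ ⊔ v ⊔ ℓv ⊔ w ⊔ ℓw ⊔ p ⊔ q)
    _≅_ = ∃ IsIsometry

  infixr 6 _⊥_
  _⊥_ : ∀ {v ℓv p w ℓw q} → FormedLattice v ℓv p → FormedLattice w ℓw q →
        FormedLattice (v ⊔ w) (ℓv ⊔ ℓw) (p ⊔ q)
  L ⊥ M = record
    { space   = ×-Module.⟨module⟩ L.space M.space
    ; Φ       = λ (x , y) (x′ , y′) → L.Φ x x′ + M.Φ y y′
    ; lattice = L.lattice ⟨×⟩ M.lattice
    }
    where
    module L = FormedLattice L
    module M = FormedLattice M

  ⨁ : ∀ {n} → Vector (FormedLattice c ℓ (c ⊔ ℓ)) n → FormedLattice c ℓ (c ⊔ ℓ)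
  ⨁ {zero}  L = record
    { space = Zero.⟨module⟩ ; Φ = λ _ _ → 0# ; lattice = λ _ → ⊤ }
  ⨁ {suc n} L = L zero ⊥ ⨁ (L ∘ suc)

  H : (π π⁻¹ : Carrier) → ℤ → FormedLattice c ℓ (c ⊔ ℓ)
  H π π⁻¹ i = record
    { space   = ×-Module.⟨module⟩ TensorUnit.⟨module⟩ TensorUnit.⟨module⟩
    ; Φ       = λ (x₁ , x₂) (y₁ , y₂) →
                  x₁ * zpow π π⁻¹ i * conj y₂ +
                  x₂ * zpow (conj π) (conj π⁻¹) i * conj y₁
    ; lattice = 𝒪 ⟨×⟩ 𝒪
    }

  ----------------------------------------------------------------------
  -- Determinants of automorphisms

  𝓔₀ 𝓔₁ : Subset
  𝓔₀ u = u ∈ 𝒪ˣ × u * conj u ≈ 1#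
  𝓔₁ x = ∃₂ λ u w → u ∈ 𝒪ˣ × conj u * w ≈ 1# × x ≈ u * w

  module _ {m v ℓv p} (L : HermitianLattice m v ℓv p) where
    open HermitianLattice L

    Aut : Pred (Carrierᴹ → Carrierᴹ) (c ⊔ ℓ ⊔ v ⊔ ℓv ⊔ p)
    Aut = IsIsometry formedLattice formedLattice

    -- The j-th column of the matrix of φ holds the coordinates of φ(bⱼ).
    detEnd : (Carrierᴹ → Carrierᴹ) → Carrier
    detEnd φ = det E λ i j → IsBasis.coord isBasis (φ (basis j)) i

    𝓔 : Pred Carrier (c ⊔ ℓ ⊔ v ⊔ ℓv ⊔ p)
    𝓔 u = ∃ λ φ → φ ∈ Aut × u ≈ detEnd φ

    -- m = 2k is even and L ≅ H(s₁) ⊥ … ⊥ H(s_k) with all sᵢ ≡ e (mod 2).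
    IsSumOfH : (e : ℕ) (π π⁻¹ : Carrier) → Set (c ⊔ ℓ ⊔ v ⊔ ℓv ⊔ p)
    IsSumOfH e π π⁻¹ = ∃ λ k → m ≡ 2 ℕ.* k × ∃ λ (s : Vector ℤ k) →
      (∀ i → + 2 ∣ s i ℤ.- + e) × formedLattice ≅ ⨁ (H π π⁻¹ ∘ s)

{-# OPTIONS --safe #-}

-- Let w be the valuation of the norm of E/K.  If s ∈ L satisfies Φ(L,s) ⊆ 𝔓ʲ,
-- the quasi-reflection x ↦ x - Φ(x,s) (1 - u) Φ(s,s)⁻¹ s is an automorphism of L
-- of determinant u as soon as w(Φ(s,s)) ≤ j + w(1 - u).  For u of norm 1 one
-- has w(1 - u) ≥ h, where - h is the largest valuation of an element κ of
-- trace 1; and w(1 - u) ≥ h + 1 if E/K is ramified and u ∈ 𝓔₁.  Call s good if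
-- w(Φ(s,s)) ≤ j + h.  Starting from a pair of generators with w(Φ(x,y)) minimal,
-- either x, y or a combination of the two is good, or E/K is ramified,
-- w(Φ(x,y)) ≡ h + 1 ≡ e (mod 2), and Hensel's lemma turns (x , y) into a
-- hyperbolic plane that splits off.  So either L has a good vector and
-- 𝓔(L) = 𝓔₀, or L is one of the exceptional orthogonal sums.  If E ≅ K ⊕ K, the
-- two idempotents of E combine such a pair into a vector s with Φ(L,s) = Φ(s,s)𝒪.
--
-- In the exceptional sums, Φ(s,L) ⊆ 𝔓ʲ with j ≡ h (mod 2) forces
-- w(Φ(s,s)) > j + h.  For an automorphism φ consider Wall's form
-- χ(x,y) = Φ(x - φ x, y), and a pair for which w(χ(x,y)) is minimal.  If this
-- minimum j is attained on the diagonal, the property just stated gives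
-- j ≡ h + 1, and a quasi-reflection of determinant -c/c̄ with w(c) ≡ h + 1 makes
-- one more vector fixed; otherwise two quasi-reflections with w(c c′) even fix a
-- plane.  Hence det φ = α/ᾱ with w(α) even, that is, det φ ∈ 𝓔₁.

module Submission where

open import Level using (Lift; lift; _⊔_)
open import Algebra.Bundles using (CommutativeRing; Semiring)
open import Algebra.Module.Bundles using (Module)
open import Algebra.Module.Morphism.Structures using (IsModuleIsomorphism)
open import Algebra.Morphism.Structures using (IsRingIsomorphism)
import Algebra.Definitions.RawMonoid as RawMonoidDefs
import Algebra.Definitions.RawSemiring as RawSemiringDefs
import Algebra.Properties.Ring as RingProperties
import Algebra.Properties.Semiring.Mult.TCOptimised as Multiples
import Algebra.Solver.Ring
open import Algebra.Solver.Ring.AlmostCommutativeRing using (fromCommutativeRing; _-Raw-AlmostCommutative⟶_)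
open import Data.Empty using (⊥; ⊥-elim)
open import Data.Fin.Base as Fin using (Fin; zero; suc; toℕ; punchIn; punchOut; combine; remQuot)
import Data.Fin.Properties as Fin
open import Data.Integer.Base as ℤ using (ℤ; +_; -[1+_])
open import Data.Integer.Divisibility using (_∣_)
import Data.Integer.Divisibility.Signed as Signed
import Data.Integer.Properties as ℤ
open import Data.List.Base using (List; []; _∷_; _++_; map; length; tabulate)
import Data.List.Properties as List
open import Data.Maybe.Base using (Maybe; just; nothing)
open import Data.Nat.Base as ℕ using (ℕ; zero; suc; NonZero; z≤n; s≤s)
import Data.Nat.Properties as ℕ
open import Data.Product.Base using (∃; ∃₂; _×_; _,_; proj₁; proj₂)
open import Data.Sum.Base using (_⊎_; inj₁; inj₂; [_,_]′)
open import Data.Unit.Polymorphic using (tt)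
open import Data.Vec.Base as Vec using (Vec)
open import Data.Vec.Functional using (Vector)
open import Function.Base using (id; _∘_; case_of_)
open import Relation.Binary.PropositionalEquality.Core as ≡ using (_≡_; _≢_)
import Relation.Binary.PropositionalEquality.Properties as ≡
import Relation.Binary.Construct.Add.Supremum.NonStrict as AddSupremum
import Relation.Binary.Reasoning.Setoid as SetoidReasoning
import Relation.Binary.Reflection as Reflection
open import Relation.Nullary.Construct.Add.Supremum using ([_]; ⊤⁺)
open import Relation.Nullary.Decidable.Core using (Dec; yes; no)
open import Relation.Nullary.Negation.Core using (¬_)
open import Relation.Unary using (Pred; _∈_; _⊆_; _≐_)
open import Defs
open AddSupremum ℤ._≤_ using ([_]; _≤⊤⁺; ≤⁺-dec; [≤]-injective; ≤⁺-trans)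

module IntegerCoefficients {c ℓ} (R : CommutativeRing c ℓ) where
  open CommutativeRing R
  open RingProperties ring using (-‿involutive; -‿+-comm; -0#≈0#; -‿distribˡ-*; -‿distribʳ-*)
  open Multiples semiring using (×-homo-+; ×1-homo-*; 1+×) renaming (_×_ to _⋆_)
  open SetoidReasoning setoid

  ⟦_⟧ᶻ : ℤ → Carrier
  ⟦ + n ⟧ᶻ      = n ⋆ 1#
  ⟦ -[1+ n ] ⟧ᶻ = - (suc n ⋆ 1#)

  ⟦⟧ᶻ-⊖ : ∀ m n → ⟦ m ℤ.⊖ n ⟧ᶻ ≈ m ⋆ 1# - n ⋆ 1#
  ⟦⟧ᶻ-⊖ zero zero = sym (-‿inverseʳ 0#)
  ⟦⟧ᶻ-⊖ zero (suc n) = sym (+-identityˡ _)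
  ⟦⟧ᶻ-⊖ (suc m) zero = trans (sym (+-identityʳ _)) (+-congˡ (sym -0#≈0#))
  ⟦⟧ᶻ-⊖ (suc m) (suc n) = begin
    ⟦ suc m ℤ.⊖ suc n ⟧ᶻ                ≡⟨ ≡.cong ⟦_⟧ᶻ (ℤ.[1+m]⊖[1+n]≡m⊖n m n) ⟩
    ⟦ m ℤ.⊖ n ⟧ᶻ                        ≈⟨ ⟦⟧ᶻ-⊖ m n ⟩
    x - y                               ≈⟨ +-congʳ (+-identityˡ x) ⟨
    (0# + x) - y                        ≈⟨ +-congʳ (+-congʳ (-‿inverseʳ 1#)) ⟨
    ((1# - 1#) + x) - y                 ≈⟨ +-congʳ (+-assoc _ _ _) ⟩
    (1# + (- 1# + x)) - y               ≈⟨ +-congʳ (+-congˡ (+-comm _ _)) ⟩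
    (1# + (x - 1#)) - y                 ≈⟨ +-congʳ (+-assoc _ _ _) ⟨
    ((1# + x) - 1#) - y                 ≈⟨ +-assoc _ _ _ ⟩
    (1# + x) + (- 1# - y)               ≈⟨ +-congˡ (-‿+-comm 1# y) ⟩
    (1# + x) - (1# + y)                 ≈⟨ +-cong (1+× m 1#) (-‿cong (1+× n 1#)) ⟨
    suc m ⋆ 1# - suc n ⋆ 1#             ∎
    where
    x = m ⋆ 1#
    y = n ⋆ 1#

  ⟦⟧ᶻ-+ : ∀ i j → ⟦ i ℤ.+ j ⟧ᶻ ≈ ⟦ i ⟧ᶻ + ⟦ j ⟧ᶻ
  ⟦⟧ᶻ-+ (+ m) (+ n) = ×-homo-+ 1# m n
  ⟦⟧ᶻ-+ (+ m) -[1+ n ] = ⟦⟧ᶻ-⊖ m (suc n)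
  ⟦⟧ᶻ-+ -[1+ m ] (+ n) = trans (⟦⟧ᶻ-⊖ n (suc m)) (+-comm _ _)
  ⟦⟧ᶻ-+ -[1+ m ] -[1+ n ] = begin
    - (suc (suc (m ℕ.+ n)) ⋆ 1#)  ≡⟨ ≡.cong (λ k → - (suc k ⋆ 1#)) (ℕ.+-suc m n) ⟨
    - ((suc m ℕ.+ suc n) ⋆ 1#)    ≈⟨ -‿cong (×-homo-+ 1# (suc m) (suc n)) ⟩
    - (suc m ⋆ 1# + suc n ⋆ 1#)   ≈⟨ -‿+-comm _ _ ⟨
    ⟦ -[1+ m ] ⟧ᶻ + ⟦ -[1+ n ] ⟧ᶻ ∎

  ⟦⟧ᶻ-neg : ∀ i → ⟦ ℤ.- i ⟧ᶻ ≈ - ⟦ i ⟧ᶻ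
  ⟦⟧ᶻ-neg (+ zero) = sym -0#≈0#
  ⟦⟧ᶻ-neg (+ suc n) = refl
  ⟦⟧ᶻ-neg -[1+ n ] = sym (-‿involutive _)

  ⟦⟧ᶻ-* : ∀ i j → ⟦ i ℤ.* j ⟧ᶻ ≈ ⟦ i ⟧ᶻ * ⟦ j ⟧ᶻ
  ⟦⟧ᶻ-*+ : ∀ m j → ⟦ + m ℤ.* j ⟧ᶻ ≈ ⟦ + m ⟧ᶻ * ⟦ j ⟧ᶻ
  ⟦⟧ᶻ-*+ m (+ n) = begin
    ⟦ + m ℤ.* + n ⟧ᶻ  ≡⟨ ≡.cong ⟦_⟧ᶻ (≡.sym (ℤ.pos-* m n)) ⟩
    (m ℕ.* n) ⋆ 1#    ≈⟨ ×1-homo-* m n ⟩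
    (m ⋆ 1#) * (n ⋆ 1#) ∎
  ⟦⟧ᶻ-*+ m -[1+ n ] = begin
    ⟦ + m ℤ.* (ℤ.- (+ suc n)) ⟧ᶻ  ≡⟨ ≡.cong ⟦_⟧ᶻ (≡.sym (ℤ.neg-distribʳ-* (+ m) (+ suc n))) ⟩
    ⟦ ℤ.- (+ m ℤ.* (+ suc n)) ⟧ᶻ  ≈⟨ ⟦⟧ᶻ-neg (+ m ℤ.* (+ suc n)) ⟩
    - ⟦ + m ℤ.* (+ suc n) ⟧ᶻ      ≈⟨ -‿cong (⟦⟧ᶻ-*+ m (+ suc n)) ⟩
    - ((m ⋆ 1#) * (suc n ⋆ 1#))   ≈⟨ -‿distribʳ-* _ _ ⟩
    (m ⋆ 1#) * - (suc n ⋆ 1#)     ∎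
  ⟦⟧ᶻ-* (+ m) j = ⟦⟧ᶻ-*+ m j
  ⟦⟧ᶻ-* -[1+ m ] j = begin
    ⟦ (ℤ.- (+ suc m)) ℤ.* j ⟧ᶻ    ≡⟨ ≡.cong ⟦_⟧ᶻ (≡.sym (ℤ.neg-distribˡ-* (+ suc m) j)) ⟩
    ⟦ ℤ.- (+ suc m ℤ.* j) ⟧ᶻ      ≈⟨ ⟦⟧ᶻ-neg (+ suc m ℤ.* j) ⟩
    - ⟦ + suc m ℤ.* j ⟧ᶻ          ≈⟨ -‿cong (⟦⟧ᶻ-*+ (suc m) j) ⟩
    - ((suc m ⋆ 1#) * ⟦ j ⟧ᶻ)     ≈⟨ -‿distribˡ-* _ _ ⟩
    - (suc m ⋆ 1#) * ⟦ j ⟧ᶻ       ∎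

  homomorphism : CommutativeRing.rawRing ℤ.+-*-commutativeRing -Raw-AlmostCommutative⟶ fromCommutativeRing R
  homomorphism = record
    { ⟦_⟧    = ⟦_⟧ᶻ
    ; +-homo = ⟦⟧ᶻ-+
    ; *-homo = ⟦⟧ᶻ-*
    ; -‿homo = ⟦⟧ᶻ-neg
    ; 0-homo = refl
    ; 1-homo = refl
    }

  coefficients≟ : ∀ i j → Maybe (⟦ i ⟧ᶻ ≈ ⟦ j ⟧ᶻ)
  coefficients≟ i j with i ℤ.≟ j
  ... | yes i≡j = just (reflexive (≡.cong ⟦_⟧ᶻ i≡j))
  ... | no  _   = nothing

infix  4 _:=_
infixl 6 _:+_ _:-_
infixl 7 _:*_
infix  8 :-_

-- Ring expressions with integer coefficients.  They do not mention the ring,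
-- so instances of the solver share them.
data Expr (n : ℕ) : Set where
  con       : ℤ → Expr n
  var       : Fin n → Expr n
  _:+_ _:*_ : Expr n → Expr n → Expr n
  :-_       : Expr n → Expr n

_:-_ : ∀ {n} → Expr n → Expr n → Expr n
x :- y = x :+ :- y

_:=_ : ∀ {n} → Expr n → Expr n → Expr n × Expr n
_:=_ = _,_

private
  module Solver {c ℓ} (R : CommutativeRing c ℓ) =
    Algebra.Solver.Ring (CommutativeRing.rawRing ℤ.+-*-commutativeRing) (fromCommutativeRing R)
      (IntegerCoefficients.homomorphism R) (IntegerCoefficients.coefficients≟ R)

module RingSolver {c ℓ} (R : CommutativeRing c ℓ) where
  private module R = CommutativeRing R

  polynomial : ∀ {n} → Expr n → Solver.Polynomial R n
  polynomial (con i)  = Solver.con i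
  polynomial (var i)  = Solver.var i
  polynomial (p :+ q) = Solver.op Solver.[+] (polynomial p) (polynomial q)
  polynomial (p :* q) = Solver.op Solver.[*] (polynomial p) (polynomial q)
  polynomial (:- p)   = Solver.:- polynomial p

  ⟦_⟧ : ∀ {n} → Expr n → Vec R.Carrier n → R.Carrier
  ⟦ con i ⟧ ρ  = IntegerCoefficients.⟦_⟧ᶻ R i
  ⟦ var i ⟧ ρ  = Vec.lookup ρ i
  ⟦ p :+ q ⟧ ρ = ⟦ p ⟧ ρ R.+ ⟦ q ⟧ ρ
  ⟦ p :* q ⟧ ρ = ⟦ p ⟧ ρ R.* ⟦ q ⟧ ρ
  ⟦ :- p ⟧ ρ   = R.- ⟦ p ⟧ ρ

  ⟦polynomial⟧ : ∀ {n} (e : Expr n) ρ → Solver.⟦_⟧ R (polynomial e) ρ ≡ ⟦ e ⟧ ρ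
  ⟦polynomial⟧ (con i) ρ  = ≡.refl
  ⟦polynomial⟧ (var i) ρ  = ≡.refl
  ⟦polynomial⟧ (p :+ q) ρ = ≡.cong₂ R._+_ (⟦polynomial⟧ p ρ) (⟦polynomial⟧ q ρ)
  ⟦polynomial⟧ (p :* q) ρ = ≡.cong₂ R._*_ (⟦polynomial⟧ p ρ) (⟦polynomial⟧ q ρ)
  ⟦polynomial⟧ (:- p) ρ   = ≡.cong R.-_ (⟦polynomial⟧ p ρ)

  ⟦_⟧⇓ : ∀ {n} → Expr n → Vec R.Carrier n → R.Carrier
  ⟦ e ⟧⇓ = Solver.⟦_⟧↓ R (polynomial e)

  correct : ∀ {n} (e : Expr n) ρ → ⟦ e ⟧⇓ ρ R.≈ ⟦ e ⟧ ρ
  correct e ρ = R.trans (Solver.correct R (polynomial e) ρ) (R.reflexive (⟦polynomial⟧ e ρ))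

  solve = Reflection.solve R.setoid var ⟦_⟧ ⟦_⟧⇓ correct

-- Determinants

module Determinants {c ℓ} (R : CommutativeRing c ℓ) where
  open CommutativeRing R hiding (zero)
  open RingSolver R using (solve)
  open SetoidReasoning setoid
  open RawSemiringDefs (Semiring.rawSemiring semiring) using (sum; _^_)

  -0#≈0# : - 0# ≈ 0#
  -0#≈0# = solve 0 (:- con (+ 0) := con (+ 0)) refl

  -‿involutive : ∀ x → - - x ≈ x
  -‿involutive = solve 1 (λ x → :- :- x := x) refl

  neg-zero : ∀ {x} → x ≈ 0# → - x ≈ 0#
  neg-zero x≈0 = trans (-‿cong x≈0) -0#≈0#

  module _ {x} {X : Set x} where

    -- The interior product by f, so that a determinant is an iterated
    -- interior product of its rows.
    ι : (X → Carrier) → (List X → Carrier) → List X → Carrier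
    ι f G []       = 0#
    ι f G (x ∷ xs) = f x * G xs - ι f (λ ys → G (x ∷ ys)) xs

    ι-cong : ∀ {f g G H} → (∀ x → f x ≈ g x) → (∀ xs → G xs ≈ H xs) → ∀ xs → ι f G xs ≈ ι g H xs
    ι-cong f≈g G≈H [] = refl
    ι-cong f≈g G≈H (x ∷ xs) =
      +-cong (*-cong (f≈g x) (G≈H xs)) (-‿cong (ι-cong f≈g (λ ys → G≈H (x ∷ ys)) xs))

    ι-congʳ : ∀ f {G H} → (∀ xs → G xs ≈ H xs) → ∀ xs → ι f G xs ≈ ι f H xs
    ι-congʳ f = ι-cong {f} (λ _ → refl)

    ι-zero : ∀ f {G} → (∀ xs → G xs ≈ 0#) → ∀ xs → ι f G xs ≈ 0#
    ι-zero f G≈0 [] = refl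
    ι-zero f G≈0 (x ∷ xs) = begin
      f x * _ - _        ≈⟨ +-cong (*-congˡ (G≈0 xs)) (-‿cong (ι-zero f (λ ys → G≈0 (x ∷ ys)) xs)) ⟩
      f x * 0# - 0#      ≈⟨ solve 1 (λ u → u :* con (+ 0) :- con (+ 0) := con (+ 0)) refl (f x) ⟩
      0#                 ∎

    ι-linear : ∀ f a G H xs → ι f (λ ys → a * G ys - H ys) xs ≈ a * ι f G xs - ι f H xs
    ι-linear f a G H [] = solve 1 (λ a → con (+ 0) := a :* con (+ 0) :- con (+ 0)) refl a
    ι-linear f a G H (x ∷ xs) = begin
      f x * (a * G xs - H xs) - ι f (λ ys → a * G (x ∷ ys) - H (x ∷ ys)) xs
        ≈⟨ +-congˡ (-‿cong (ι-linear f a (λ ys → G (x ∷ ys)) (λ ys → H (x ∷ ys)) xs)) ⟩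
      f x * (a * G xs - H xs) - (a * ι f (λ ys → G (x ∷ ys)) xs - ι f (λ ys → H (x ∷ ys)) xs)
        ≈⟨ solve 6 (λ p a g h u v → p :* (a :* g :- h) :- (a :* u :- v) := a :* (p :* g :- u) :- (p :* h :- v))
             refl (f x) a (G xs) (H xs) _ _ ⟩
      a * ι f G (x ∷ xs) - ι f H (x ∷ xs) ∎

    ι-neg : ∀ f {G H} → (∀ ys → G ys ≈ - H ys) → ∀ xs → ι f G xs ≈ - ι f H xs
    ι-neg f {G} {H} G≈-H xs = begin
      ι f G xs                       ≈⟨ ι-congʳ f (λ ys → trans (G≈-H ys) (sym (lem ys))) xs ⟩
      ι f (λ ys → 0# * G ys - H ys) xs ≈⟨ ι-linear f 0# G H xs ⟩
      0# * ι f G xs - ι f H xs       ≈⟨ solve 2 (λ u v → con (+ 0) :* u :- v := :- v) refl _ _ ⟩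
      - ι f H xs                     ∎
      where
      lem : ∀ ys → 0# * G ys - H ys ≈ - H ys
      lem ys = solve 2 (λ u v → con (+ 0) :* u :- v := :- v) refl (G ys) (H ys)

    ι-linearˡ : ∀ {f g h} a → (∀ x → h x ≈ a * f x + g x) → ∀ G xs → ι h G xs ≈ a * ι f G xs + ι g G xs
    ι-linearˡ a h≈ G [] = solve 1 (λ a → con (+ 0) := a :* con (+ 0) :+ con (+ 0)) refl a
    ι-linearˡ {f} {g} {h} a h≈ G (x ∷ xs) = begin
      h x * G xs - ι h G′ xs                              ≈⟨ +-cong (*-congʳ (h≈ x)) (-‿cong (ι-linearˡ a h≈ G′ xs)) ⟩
      (a * f x + g x) * G xs - (a * ι f G′ xs + ι g G′ xs)
        ≈⟨ solve 6 (λ a f g G u v → (a :* f :+ g) :* G :- (a :* u :+ v) := a :* (f :* G :- u) :+ (g :* G :- v))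
             refl a (f x) (g x) (G xs) _ _ ⟩
      a * ι f G (x ∷ xs) + ι g G (x ∷ xs) ∎
      where G′ = λ ys → G (x ∷ ys)

    ι-swap : ∀ f g G xs → ι f (ι g G) xs ≈ - ι g (ι f G) xs
    ι-swap f g G [] = sym -0#≈0#
    ι-swap f g G (x ∷ xs) = begin
      f x * ι g G xs - ι f (λ ys → g x * G ys - ι g G′ ys) xs
        ≈⟨ +-congˡ (-‿cong (ι-linear f (g x) G (ι g G′) xs)) ⟩
      f x * ι g G xs - (g x * ι f G xs - ι f (ι g G′) xs)
        ≈⟨ +-congˡ (-‿cong (+-congˡ (-‿cong (ι-swap f g G′ xs)))) ⟩
      f x * ι g G xs - (g x * ι f G xs - - ι g (ι f G′) xs)
        ≈⟨ solve 5 (λ a b u v w → a :* u :- (b :* v :- :- w) := :- (b :* v :- (a :* u :- w)))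
             refl (f x) (g x) _ _ _ ⟩
      - (g x * ι f G xs - (f x * ι g G xs - ι g (ι f G′) xs))
        ≈⟨ -‿cong (+-congˡ (-‿cong (ι-linear g (f x) G (ι f G′) xs))) ⟨
      - ι g (ι f G) (x ∷ xs) ∎
      where G′ = λ ys → G (x ∷ ys)

    ι-square : ∀ f G xs → ι f (ι f G) xs ≈ 0#
    ι-square f G [] = refl
    ι-square f G (x ∷ xs) = begin
      f x * ι f G xs - ι f (λ ys → f x * G ys - ι f G′ ys) xs
        ≈⟨ +-congˡ (-‿cong (ι-linear f (f x) G (ι f G′) xs)) ⟩
      f x * ι f G xs - (f x * ι f G xs - ι f (ι f G′) xs)
        ≈⟨ solve 2 (λ u w → u :- (u :- w) := w) refl _ _ ⟩
      ι f (ι f G′) xs ≈⟨ ι-square f G′ xs ⟩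
      0# ∎
      where G′ = λ ys → G (x ∷ ys)

    record Alternating (G : List X → Carrier) : Set (x ⊔ ℓ) where
      field
        swap   : ∀ ps y z qs → G (ps ++ y ∷ z ∷ qs) ≈ - G (ps ++ z ∷ y ∷ qs)
        repeat : ∀ ps y qs → G (ps ++ y ∷ y ∷ qs) ≈ 0#

      tail : ∀ y → Alternating (λ ys → G (y ∷ ys))
      tail y = record { swap = λ ps → swap (y ∷ ps) ; repeat = λ ps → repeat (y ∷ ps) }

    repeat-far : ∀ {G} → Alternating G → ∀ y ps qs → G (y ∷ ps ++ y ∷ qs) ≈ 0#
    repeat-far alt y [] qs = Alternating.repeat alt [] y qs
    repeat-far alt y (p ∷ ps) qs =
      trans (Alternating.swap alt [] y p _) (neg-zero (repeat-far (Alternating.tail alt p) y ps qs))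

    ι-swapʳ : ∀ f {G} → Alternating G → ∀ ps y z qs → ι f G (ps ++ y ∷ z ∷ qs) ≈ - ι f G (ps ++ z ∷ y ∷ qs)
    ι-swapʳ f {G} alt [] y z qs = begin
      f y * G (z ∷ qs) - (f z * G (y ∷ qs) - ι f (λ ys → G (y ∷ z ∷ ys)) qs)
        ≈⟨ +-congˡ (-‿cong (+-congˡ (-‿cong (ι-neg f (λ ys → swap [] y z ys) qs)))) ⟩
      f y * G (z ∷ qs) - (f z * G (y ∷ qs) - - ι f (λ ys → G (z ∷ y ∷ ys)) qs)
        ≈⟨ solve 3 (λ u v w → u :- (v :- :- w) := :- (v :- (u :- w))) refl _ _ _ ⟩
      - ι f G (z ∷ y ∷ qs) ∎
      where open Alternating alt
    ι-swapʳ f {G} alt (p ∷ ps) y z qs = begin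
      f p * G (ps ++ y ∷ z ∷ qs) - ι f G′ (ps ++ y ∷ z ∷ qs)
        ≈⟨ +-cong (*-congˡ (swap ps y z qs)) (-‿cong (ι-swapʳ f (tail p) ps y z qs)) ⟩
      f p * - G (ps ++ z ∷ y ∷ qs) - - ι f G′ (ps ++ z ∷ y ∷ qs)
        ≈⟨ solve 3 (λ u v w → u :* :- v :- :- w := :- (u :* v :- w)) refl _ _ _ ⟩
      - ι f G (p ∷ ps ++ z ∷ y ∷ qs) ∎
      where
      open Alternating alt
      G′ = λ ys → G (p ∷ ys)

    ι-repeatʳ : ∀ f {G} → Alternating G → ∀ ps y qs → ι f G (ps ++ y ∷ y ∷ qs) ≈ 0#
    ι-repeatʳ f {G} alt [] y qs = begin
      f y * G (y ∷ qs) - (f y * G (y ∷ qs) - ι f (λ ys → G (y ∷ y ∷ ys)) qs)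
        ≈⟨ solve 2 (λ u w → u :- (u :- w) := w) refl _ _ ⟩
      ι f (λ ys → G (y ∷ y ∷ ys)) qs ≈⟨ ι-zero f (repeat [] y) qs ⟩
      0# ∎
      where open Alternating alt
    ι-repeatʳ f {G} alt (p ∷ ps) y qs = begin
      f p * G (ps ++ y ∷ y ∷ qs) - ι f G′ (ps ++ y ∷ y ∷ qs)
        ≈⟨ +-cong (*-congˡ (repeat ps y qs)) (-‿cong (ι-repeatʳ f (tail p) ps y qs)) ⟩
      f p * 0# - 0# ≈⟨ solve 1 (λ u → u :* con (+ 0) :- con (+ 0) := con (+ 0)) refl _ ⟩
      0# ∎
      where
      open Alternating alt
      G′ = λ ys → G (p ∷ ys)

    ι-alternating : ∀ f {G} → Alternating G → Alternating (ι f G)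
    ι-alternating f alt = record { swap = ι-swapʳ f alt ; repeat = ι-repeatʳ f alt }

    ι-column-linear : ∀ (f : X → Carrier) {x y z} a → f z ≈ a * f x + f y → ∀ {G} →
      (∀ ps qs → G (ps ++ z ∷ qs) ≈ a * G (ps ++ x ∷ qs) + G (ps ++ y ∷ qs)) → ∀ ps qs →
      ι f G (ps ++ z ∷ qs) ≈ a * ι f G (ps ++ x ∷ qs) + ι f G (ps ++ y ∷ qs)
    ι-column-linear f {x} {y} {z} a f≈ {G} G≈ [] qs = begin
      f z * G qs - ι f (λ ys → G (z ∷ ys)) qs
        ≈⟨ +-cong (*-congʳ f≈) (-‿cong (trans
             (ι-congʳ f (λ ys → trans (G≈ [] ys) (solve 3 (λ a u v → a :* u :+ v := a :* u :- :- v) refl a _ _)) qs)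
             (ι-linear f a (λ ys → G (x ∷ ys)) (λ ys → - G (y ∷ ys)) qs))) ⟩
      (a * f x + f y) * G qs - (a * ι f (λ ys → G (x ∷ ys)) qs - ι f (λ ys → - G (y ∷ ys)) qs)
        ≈⟨ +-congˡ (-‿cong (+-congˡ (-‿cong (ι-neg f (λ _ → refl) qs)))) ⟩
      (a * f x + f y) * G qs - (a * ι f (λ ys → G (x ∷ ys)) qs - - ι f (λ ys → G (y ∷ ys)) qs)
        ≈⟨ solve 6 (λ a p q g u v → (a :* p :+ q) :* g :- (a :* u :- :- v) := a :* (p :* g :- u) :+ (q :* g :- v))
             refl a (f x) (f y) (G qs) _ _ ⟩
      a * ι f G (x ∷ qs) + ι f G (y ∷ qs) ∎
    ι-column-linear f {x} {y} {z} a f≈ {G} G≈ (p ∷ ps) qs = begin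
      f p * G (ps ++ z ∷ qs) - ι f (λ ys → G (p ∷ ys)) (ps ++ z ∷ qs)
        ≈⟨ +-cong (*-congˡ (G≈ ps qs)) (-‿cong (ι-column-linear f a f≈ (λ ps qs → G≈ (p ∷ ps) qs) ps qs)) ⟩
      f p * (a * G (ps ++ x ∷ qs) + G (ps ++ y ∷ qs)) - (a * _ + _)
        ≈⟨ solve 6 (λ p a g h u v → p :* (a :* g :+ h) :- (a :* u :+ v) := a :* (p :* g :- u) :+ (p :* h :- v))
             refl (f p) a _ _ _ _ ⟩
      a * ι f G (p ∷ ps ++ x ∷ qs) + ι f G (p ∷ ps ++ y ∷ qs) ∎

  module _ {x y} {F : Set y} {X : Set x} where

    D : (F → X → Carrier) → List F → List X → Carrier
    D r [] []       = 1#
    D r [] (_ ∷ _)  = 0#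
    D r (f ∷ fs) xs = ι (r f) (D r fs) xs

    D-cong : ∀ {r s} → (∀ f x → r f x ≈ s f x) → ∀ fs xs → D r fs xs ≈ D s fs xs
    D-cong r≈s [] [] = refl
    D-cong r≈s [] (x ∷ xs) = refl
    D-cong r≈s (f ∷ fs) xs = ι-cong (r≈s f) (D-cong r≈s fs) xs

    D-rows : ∀ r xs → Alternating (λ fs → D r fs xs)
    D-rows r xs = record { swap = λ ps y z qs → sw ps y z qs xs ; repeat = λ ps y qs → rp ps y qs xs }
      where
      sw : ∀ ps f g qs xs → D r (ps ++ f ∷ g ∷ qs) xs ≈ - D r (ps ++ g ∷ f ∷ qs) xs
      sw [] f g qs xs = ι-swap (r f) (r g) (D r qs) xs
      sw (p ∷ ps) f g qs xs = ι-neg (r p) (sw ps f g qs) xs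
      rp : ∀ ps f qs xs → D r (ps ++ f ∷ f ∷ qs) xs ≈ 0#
      rp [] f qs xs = ι-square (r f) (D r qs) xs
      rp (p ∷ ps) f qs xs = ι-zero (r p) (rp ps f qs) xs

    D-columns : ∀ r fs → Alternating (D r fs)
    D-columns r [] = record
      { swap   = λ { [] y z qs → sym -0#≈0# ; (p ∷ ps) y z qs → sym -0#≈0# }
      ; repeat = λ { [] y qs → refl ; (p ∷ ps) y qs → refl }
      }
    D-columns r (f ∷ fs) = ι-alternating (r f) (D-columns r fs)

    D-row-linear : ∀ r {f g h} a → (∀ x → r h x ≈ a * r f x + r g x) → ∀ ps qs xs →
      D r (ps ++ h ∷ qs) xs ≈ a * D r (ps ++ f ∷ qs) xs + D r (ps ++ g ∷ qs) xs
    D-row-linear r a h≈ [] qs xs = ι-linearˡ a h≈ (D r qs) xs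
    D-row-linear r {f} {g} {h} a h≈ (p ∷ ps) qs xs = begin
      ι (r p) (D r (ps ++ h ∷ qs)) xs
        ≈⟨ ι-congʳ (r p) (λ ys → trans (D-row-linear r a h≈ ps qs ys)
             (solve 3 (λ a u v → a :* u :+ v := a :* u :- :- v) refl a _ _)) xs ⟩
      ι (r p) (λ ys → a * D r (ps ++ f ∷ qs) ys - - D r (ps ++ g ∷ qs) ys) xs
        ≈⟨ ι-linear (r p) a (D r (ps ++ f ∷ qs)) (λ ys → - D r (ps ++ g ∷ qs) ys) xs ⟩
      a * _ - ι (r p) (λ ys → - D r (ps ++ g ∷ qs) ys) xs
        ≈⟨ +-congˡ (-‿cong (ι-neg (r p) (λ _ → refl) xs)) ⟩
      a * _ - - ι (r p) (D r (ps ++ g ∷ qs)) xs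
        ≈⟨ +-congˡ (-‿involutive _) ⟩
      a * _ + ι (r p) (D r (ps ++ g ∷ qs)) xs ∎

    D-column-linear : ∀ r {x y z} a fs → (∀ f → r f z ≈ a * r f x + r f y) → ∀ ps qs →
      D r fs (ps ++ z ∷ qs) ≈ a * D r fs (ps ++ x ∷ qs) + D r fs (ps ++ y ∷ qs)
    D-column-linear r a [] r≈ [] qs = solve 1 (λ a → con (+ 0) := a :* con (+ 0) :+ con (+ 0)) refl a
    D-column-linear r a [] r≈ (_ ∷ _) qs = solve 1 (λ a → con (+ 0) := a :* con (+ 0) :+ con (+ 0)) refl a
    D-column-linear r a (f ∷ fs) r≈ = ι-column-linear (r f) a (r≈ f) (D-column-linear r a fs r≈)

    D-identity : ∀ r {n} (f : Fin n → F) (x : Fin n → X) → (∀ i → r (f i) (x i) ≈ 1#) →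
      (∀ i j → i ≢ j → r (f i) (x j) ≈ 0#) → D r (tabulate f) (tabulate x) ≈ 1#
    D-identity r {zero} f x one off = refl
    D-identity r {suc n} f x one off = begin
      r (f zero) (x zero) * D r fs xs - ι (r (f zero)) (λ ys → D r fs (x zero ∷ ys)) xs
        ≈⟨ +-cong (*-cong (one zero) (D-identity r (f ∘ suc) (x ∘ suc) (one ∘ suc)
                    (λ i j i≢j → off (suc i) (suc j) (i≢j ∘ Fin.suc-injective))))
             (-‿cong (vanish (x ∘ suc) (λ j → off zero (suc j) λ ()) (λ ys → D r fs (x zero ∷ ys)))) ⟩
      1# * 1# - 0# ≈⟨ solve 0 (con (+ 1) :* con (+ 1) :- con (+ 0) := con (+ 1)) refl ⟩
      1# ∎
      where
      fs = tabulate (f ∘ suc)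
      xs = tabulate (x ∘ suc)
      vanish : ∀ {k} (z : Fin k → X) → (∀ j → r (f zero) (z j) ≈ 0#) → ∀ G → ι (r (f zero)) G (tabulate z) ≈ 0#
      vanish {zero} z z≈ G = refl
      vanish {suc k} z z≈ G = begin
        r (f zero) (z zero) * _ - _ ≈⟨ +-cong (*-congʳ (z≈ zero)) (-‿cong (vanish (z ∘ suc) (z≈ ∘ suc) _)) ⟩
        0# * _ - 0# ≈⟨ solve 1 (λ u → con (+ 0) :* u :- con (+ 0) := con (+ 0)) refl _ ⟩
        0# ∎

  sum-cong : ∀ {n} {s t : Vector Carrier n} → (∀ i → s i ≈ t i) → sum s ≈ sum t
  sum-cong {zero} s≈t = refl
  sum-cong {suc n} s≈t = +-cong (s≈t zero) (sum-cong (s≈t ∘ suc))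

  sum-neg : ∀ {n} (t : Vector Carrier n) → sum (λ i → - t i) ≈ - sum t
  sum-neg {zero} t = sym -0#≈0#
  sum-neg {suc n} t = begin
    - t zero + sum (λ i → - t (suc i)) ≈⟨ +-congˡ (sum-neg (t ∘ suc)) ⟩
    - t zero - sum (t ∘ suc)           ≈⟨ solve 2 (λ u v → :- u :- v := :- (u :+ v)) refl _ _ ⟩
    - (t zero + sum (t ∘ suc))         ∎

  ι-sum : ∀ {x} {X : Set x} (f : X → Carrier) G {n} (x : Fin (suc n) → X) → ι f G (tabulate x) ≈
          sum (λ j → (- 1#) ^ toℕ j * f (x j) * G (tabulate (x ∘ punchIn j)))
  ι-sum f G {zero} x =
    solve 2 (λ u v → u :* v :- con (+ 0) := con (+ 1) :* u :* v :+ con (+ 0)) refl (f (x zero)) (G [])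
  ι-sum f G {suc n} x = begin
    f (x zero) * G (tabulate (x ∘ suc)) - ι f (λ ys → G (x zero ∷ ys)) (tabulate (x ∘ suc))
      ≈⟨ +-congˡ (-‿cong (ι-sum f (λ ys → G (x zero ∷ ys)) (x ∘ suc))) ⟩
    f (x zero) * G (tabulate (x ∘ suc)) - sum t
      ≈⟨ +-cong (*-congʳ (sym (*-identityˡ _))) (sym (trans (sum-cong lem) (sum-neg t))) ⟩
    sum (λ j → (- 1#) ^ toℕ j * f (x j) * G (tabulate (x ∘ punchIn j))) ∎
    where
    t : Vector Carrier (suc n)
    t j = (- 1#) ^ toℕ j * f (x (suc j)) * G (x zero ∷ tabulate (x ∘ suc ∘ punchIn j))
    lem : ∀ j → (- 1#) ^ suc (toℕ j) * f (x (suc j)) * G (x zero ∷ tabulate (x ∘ suc ∘ punchIn j)) ≈ - t j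
    lem j = solve 3 (λ p u v → :- con (+ 1) :* p :* u :* v := :- (p :* u :* v)) refl ((- 1#) ^ toℕ j) _ _

  det≈D : ∀ {x y} {F : Set y} {X : Set x} (r : F → X → Carrier) {n} (f : Fin n → F) (x : Fin n → X) →
          det R (λ i j → r (f i) (x j)) ≈ D r (tabulate f) (tabulate x)
  det≈D r {zero} f x = refl
  det≈D r {suc n} f x = trans
    (sum-cong (λ j → *-congˡ {x = (- 1#) ^ toℕ j * r (f zero) (x j)} (det≈D r (f ∘ suc) (x ∘ punchIn j))))
    (sym (ι-sum (r (f zero)) (D r (tabulate (f ∘ suc))) x))

  module _ {a} {A : Set a} where
    data Pick (p : A) : List A → List A → Set a where
      here  : ∀ {qs} → Pick p qs (p ∷ qs)
      there : ∀ {q qs rs} → Pick p qs rs → Pick p (q ∷ qs) (q ∷ rs)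

    Pick-length : ∀ {p qs rs} → Pick p qs rs → length rs ≡ suc (length qs)
    Pick-length here = ≡.refl
    Pick-length (there h) = ≡.cong suc (Pick-length h)

    ∑ : (A → Carrier) → List A → Carrier
    ∑ f [] = 0#
    ∑ f (p ∷ ps) = f p + ∑ f ps

    ∑∖ : (A → List A → Carrier) → List A → Carrier
    ∑∖ Θ [] = 0#
    ∑∖ Θ (p ∷ ps) = Θ p ps + ∑∖ (λ q qs → Θ q (p ∷ qs)) ps

    ∑∖-cong : ∀ {Θ Ψ} rs → (∀ p qs → Pick p qs rs → Θ p qs ≈ Ψ p qs) → ∑∖ Θ rs ≈ ∑∖ Ψ rs
    ∑∖-cong [] Θ≈Ψ = refl
    ∑∖-cong (p ∷ ps) Θ≈Ψ = +-cong (Θ≈Ψ p ps here) (∑∖-cong ps (λ q qs h → Θ≈Ψ q (p ∷ qs) (there h)))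

    ∑∖-const : ∀ f rs → ∑ f rs ≈ ∑∖ (λ p _ → f p) rs
    ∑∖-const f [] = refl
    ∑∖-const f (p ∷ ps) = +-congˡ (∑∖-const f ps)

    ∑-pick : ∀ f {p qs rs} → Pick p qs rs → ∑ f rs ≈ f p + ∑ f qs
    ∑-pick f here = refl
    ∑-pick f (there {q} {qs} {rs} h) = trans (+-congˡ (∑-pick f h))
      (solve 3 (λ u v w → u :+ (v :+ w) := v :+ (u :+ w)) refl _ _ _)

    ∑∖-neg : ∀ Θ rs → ∑∖ (λ p qs → - Θ p qs) rs ≈ - ∑∖ Θ rs
    ∑∖-neg Θ [] = sym -0#≈0#
    ∑∖-neg Θ (p ∷ ps) = trans (+-congˡ (∑∖-neg (λ q qs → Θ q (p ∷ qs)) ps))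
      (solve 2 (λ u v → :- u :- v := :- (u :+ v)) refl _ _)

  module _ {x y} {X : Set x} {F : Set y} (r : F → X → Carrier) where

    Expands : (List F → Carrier) → List (X × F) → Set _
    Expands G bs = ∀ ps g qs → G (ps ++ g ∷ qs) ≈ ∑ (λ (b , c) → r g b * G (ps ++ c ∷ qs)) bs

    ι-pick : ∀ g (H : List X → Carrier) (M : List F → Carrier) → Alternating M → ∀ bs →
      ∑∖ (λ (b , c) bs′ → r g b * (H (map proj₁ bs′) * M (c ∷ map proj₂ bs′))) bs ≈
      ι (r g) H (map proj₁ bs) * M (map proj₂ bs)
    ι-pick g H M alt [] = sym (zeroˡ _)
    ι-pick g H M alt ((b , c) ∷ bs) = begin
      r g b * (H bs₁ * M (c ∷ bs₂)) + ∑∖ _ bs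
        ≈⟨ +-congˡ (trans (∑∖-cong bs (λ (b′ , c′) qs _ →
             trans (*-congˡ (*-congˡ (Alternating.swap alt [] c′ c _)))
                   (solve 3 (λ u v w → u :* (v :* :- w) := :- (u :* (v :* w))) refl _ _ _)))
             (∑∖-neg _ bs)) ⟩
      r g b * (H bs₁ * M (c ∷ bs₂)) - ∑∖ _ bs
        ≈⟨ +-congˡ (-‿cong (ι-pick g (λ ys → H (b ∷ ys)) (λ ys → M (c ∷ ys)) (Alternating.tail alt c) bs)) ⟩
      r g b * (H bs₁ * M (c ∷ bs₂)) - ι (r g) (λ ys → H (b ∷ ys)) bs₁ * M (c ∷ bs₂)
        ≈⟨ solve 4 (λ u h m w → u :* (h :* m) :- w :* m := (u :* h :- w) :* m) refl _ _ _ _ ⟩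
      ι (r g) H (b ∷ bs₁) * M (c ∷ bs₂) ∎
      where
      bs₁ = map proj₁ bs
      bs₂ = map proj₂ bs

    -- Uniqueness of the determinant: an alternating form is determined by its
    -- value at a spanning family with at most as many members as arguments.
    alternating-unique : ∀ gs G → Alternating G → ∀ bs → Expands G bs → length bs ℕ.≤ length gs →
      G gs ≈ D r gs (map proj₁ bs) * G (map proj₂ bs)
    alternating-unique [] G alt [] exp _ = sym (*-identityˡ _)
    alternating-unique (g ∷ gs) G alt bs exp bs≤ = begin
      G (g ∷ gs)                             ≈⟨ exp [] g gs ⟩
      ∑ (λ (b , c) → r g b * G (c ∷ gs)) bs  ≈⟨ ∑∖-const _ bs ⟩
      ∑∖ (λ (b , c) _ → r g b * G (c ∷ gs)) bs
        ≈⟨ ∑∖-cong bs (λ (b , c) qs h → *-congˡ (alternating-unique gs (λ ys → G (c ∷ ys))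
             (Alternating.tail alt c) qs (expands′ h) (shorter h))) ⟩
      ∑∖ (λ (b , c) qs → r g b * (D r gs (map proj₁ qs) * G (c ∷ map proj₂ qs))) bs
        ≈⟨ ι-pick g (D r gs) G alt bs ⟩
      D r (g ∷ gs) (map proj₁ bs) * G (map proj₂ bs) ∎
      where
      shorter : ∀ {p qs} → Pick p qs bs → length qs ℕ.≤ length gs
      shorter h = ℕ.≤-pred (≡.subst (ℕ._≤ suc (length gs)) (Pick-length h) bs≤)
      expands′ : ∀ {b c qs} → Pick (b , c) qs bs → Expands (λ ys → G (c ∷ ys)) qs
      expands′ {b} {c} {qs} h ps g′ rs = begin
        G (c ∷ ps ++ g′ ∷ rs) ≈⟨ exp (c ∷ ps) g′ rs ⟩
        ∑ _ bs                ≈⟨ ∑-pick _ h ⟩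
        r g′ b * G (c ∷ ps ++ c ∷ rs) + ∑ _ qs ≈⟨ +-congʳ (*-congˡ (repeat-far alt c ps rs)) ⟩
        r g′ b * 0# + ∑ _ qs  ≈⟨ solve 2 (λ u v → u :* con (+ 0) :+ v := v) refl _ _ ⟩
        ∑ (λ (b , c′) → r g′ b * G (c ∷ ps ++ c′ ∷ rs)) qs ∎

-- Parity and valuations

module ℤ-Solver = RingSolver ℤ.+-*-commutativeRing

Even Odd : ℤ → Set
Even n = ∃ λ k → n ≡ k ℤ.+ k
Odd  n = ∃ λ k → n ≡ + 1 ℤ.+ (k ℤ.+ k)

cert : ∀ {m n} p → + 0 ℤ.≤ p → n ≡ m ℤ.+ p → m ℤ.≤ n
cert {m} p 0≤p ≡.refl = ≡.subst (ℤ._≤ m ℤ.+ p) (ℤ.+-identityʳ m) (ℤ.+-monoʳ-≤ m 0≤p)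

nonneg-+ : ∀ {m n} → + 0 ℤ.≤ m → + 0 ℤ.≤ n → + 0 ℤ.≤ m ℤ.+ n
nonneg-+ = ℤ.+-mono-≤

diff : ∀ {m n} → m ℤ.≤ n → + 0 ℤ.≤ n ℤ.- m
diff = ℤ.i≤j⇒0≤j-i

nonneg : ∀ {n} → + 0 ℤ.≤ + n
nonneg = ℤ.+≤+ z≤n

double-inj : ∀ i j → i ℤ.+ i ≡ j ℤ.+ j → i ≡ j
double-inj i j eq = ℤ.*-cancelˡ-≡ (+ 2) i j (≡.trans (lem i) (≡.trans eq (≡.sym (lem j))))
  where
  open ℤ-Solver using (solve)
  lem : ∀ i → + 2 ℤ.* i ≡ i ℤ.+ i
  lem = solve 1 (λ i → con (+ 2) :* i := i :+ i) ≡.refl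

double-mono⁻¹ : ∀ {i j} → i ℤ.+ i ℤ.≤ j ℤ.+ j → i ℤ.≤ j
double-mono⁻¹ {i} {j} h with ℤ.≤-total i j
... | inj₁ i≤j = i≤j
... | inj₂ j≤i = ℤ.≤-reflexive (double-inj i j (ℤ.≤-antisym h (ℤ.+-mono-≤ j≤i j≤i)))

even-neg : ∀ {m} → Even m → Even (ℤ.- m)
even-neg (k , ≡.refl) = ℤ.- k , ℤ.neg-distrib-+ k k

odd-neg : ∀ {m} → Odd m → Odd (ℤ.- m)
odd-neg (k , ≡.refl) = ℤ.- (+ 1 ℤ.+ k) ,
  ℤ-Solver.solve 1 (λ k → :- (con (+ 1) :+ (k :+ k)) := con (+ 1) :+ (:- (con (+ 1) :+ k) :- (con (+ 1) :+ k))) ≡.refl k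

opaque
  parity : ∀ n → Even n ⊎ Odd n
  parity (+ n) = go n
    where
    open ℤ-Solver using (solve)
    go : ∀ m → Even (+ m) ⊎ Odd (+ m)
    go zero = inj₁ (+ 0 , ≡.refl)
    go (suc m) with go m
    ... | inj₁ (k , eq) = inj₂ (k , ≡.cong ℤ.suc eq)
    ... | inj₂ (k , eq) = inj₁ (+ 1 ℤ.+ k , ≡.trans (≡.cong ℤ.suc eq)
            (solve 1 (λ k → con (+ 1) :+ (con (+ 1) :+ (k :+ k)) := (con (+ 1) :+ k) :+ (con (+ 1) :+ k)) ≡.refl k))
  parity -[1+ n ] with parity (+ suc n)
  ... | inj₁ e = inj₁ (even-neg e)
  ... | inj₂ o = inj₂ (odd-neg o)

even-odd : ∀ {n} → Even n → Odd n → ⊥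
even-odd (k , eq) (l , eq′) = go (k ℤ.- l) (≡.trans
    (solve 2 (λ k l → (k :- l) :+ (k :- l) := (k :+ k) :- (l :+ l)) ≡.refl k l)
    (≡.trans (≡.cong (ℤ._- (l ℤ.+ l)) (≡.trans (≡.sym eq) eq′))
      (solve 1 (λ l → con (+ 1) :+ (l :+ l) :- (l :+ l) := con (+ 1)) ≡.refl l)))
  where
  open ℤ-Solver using (solve)
  go : ∀ d → d ℤ.+ d ≡ + 1 → ⊥
  go (+ zero) ()
  go (+ suc zero) ()
  go (+ suc (suc n)) ()
  go -[1+ n ] ()

even-+ : ∀ {m n} → Even m → Even n → Even (m ℤ.+ n)
even-+ (k , ≡.refl) (l , ≡.refl) = k ℤ.+ l ,
  ℤ-Solver.solve 2 (λ k l → (k :+ k) :+ (l :+ l) := (k :+ l) :+ (k :+ l)) ≡.refl k l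

≤-or-> : ∀ m n → (m ℤ.≤ n) ⊎ (+ 1 ℤ.+ n ℤ.≤ m)
≤-or-> m n with m ℤ.≤? n
... | yes m≤n = inj₁ m≤n
... | no m≰n = inj₂ (ℤ.i<j⇒suc[i]≤j (ℤ.≰⇒> m≰n))

suc-cancel-≤ : ∀ {m n} → + 1 ℤ.+ m ℤ.≤ + 1 ℤ.+ n → m ℤ.≤ n
suc-cancel-≤ {m} {n} h = cert ((+ 1 ℤ.+ n) ℤ.- (+ 1 ℤ.+ m)) (diff h)
  (solve 2 (λ m n → n := m :+ ((con (+ 1) :+ n) :- (con (+ 1) :+ m))) ≡.refl m n)
  where open ℤ-Solver using (solve)

suc≰ : ∀ {n} → ¬ (+ 1 ℤ.+ n ℤ.≤ n)
suc≰ h = ℤ.<-irrefl ≡.refl (ℤ.suc[i]≤j⇒i<j h)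

record IsValuation {c ℓ} (R : CommutativeRing c ℓ) (w : CommutativeRing.Carrier R → ℤ∞) : Set (c ⊔ ℓ) where
  open CommutativeRing R
  field
    w-cong : ∀ {x y} → x ≈ y → w x ≡ w y
    w-0    : w 0# ≡ ⊤⁺
    w-1    : w 1# ≡ [ + 0 ]
    w-*    : ∀ x y → w (x * y) ≡ w x +∞ w y
    w-+    : ∀ x y → (w x ⊓∞ w y) ≤∞ w (x + y)

module Valuations {c ℓ} (R : CommutativeRing c ℓ) (w : CommutativeRing.Carrier R → ℤ∞) (isValuation : IsValuation R w) where
  open CommutativeRing R
  open IsValuation isValuation
  open RingSolver R using (solve)
  private module Z = ℤ-Solver

  V W : ℤ → Carrier → Set
  V n x = [ n ] ≤∞ w x
  W n x = w x ≡ [ n ]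

  V-resp : ∀ {n x y} → x ≈ y → V n x → V n y
  V-resp x≈y = ≡.subst (_ ≤∞_) (w-cong x≈y)

  W-resp : ∀ {n x y} → x ≈ y → W n x → W n y
  W-resp x≈y = ≡.trans (≡.sym (w-cong x≈y))

  V-cast : ∀ {m n x} → m ≡ n → V m x → V n x
  V-cast ≡.refl v = v

  W-cast : ∀ {m n x} → m ≡ n → W m x → W n x
  W-cast ≡.refl v = v

  V-0 : ∀ {n} → V n 0#
  V-0 {n} = ≡.subst ([ n ] ≤∞_) (≡.sym w-0) ([ n ] ≤⊤⁺)

  V-zero : ∀ {n x} → x ≈ 0# → V n x
  V-zero x≈0 = V-resp (sym x≈0) V-0

  V-mono : ∀ {m n x} → m ℤ.≤ n → V n x → V m x
  V-mono m≤n = ≤⁺-trans ℤ.≤-trans [ m≤n ]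

  W⇒V : ∀ {n x} → W n x → V n x
  W⇒V {n} eq = ≡.subst ([ n ] ≤∞_) (≡.sym eq) [ ℤ.≤-refl ]

  W-V : ∀ {m n x} → W m x → V n x → n ℤ.≤ m
  W-V {n = n} eq v = [≤]-injective (≡.subst ([ n ] ≤∞_) eq v)

  ≤-W : ∀ {m n x} → W m x → n ℤ.≤ m → V n x
  ≤-W Wx n≤m = V-mono n≤m (W⇒V Wx)

  W-unique : ∀ {m n x} → W m x → W n x → m ≡ n
  W-unique eq eq′ = [-]-injective (≡.trans (≡.sym eq) eq′)
    where
    [-]-injective : ∀ {m n : ℤ} → [ m ] ≡ [ n ] → m ≡ n
    [-]-injective ≡.refl = ≡.refl

  W-≉0 : ∀ {n x} → W n x → ¬ (x ≈ 0#)
  W-≉0 eq x≈0 = case ≡.trans (≡.sym eq) (≡.trans (w-cong x≈0) w-0) of λ ()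

  opaque
    finite : ∀ x → w x ≡ ⊤⁺ ⊎ ∃ λ n → W n x
    finite x with w x
    ... | [ n ] = inj₂ (n , ≡.refl)
    ... | ⊤⁺    = inj₁ ≡.refl

  opaque
    V? : ∀ n x → Dec (V n x)
    V? n x = ≤⁺-dec ℤ._≤?_ [ n ] (w x)

  V-⊤ : ∀ {n x} → w x ≡ ⊤⁺ → V n x
  V-⊤ {n} eq = ≡.subst ([ n ] ≤∞_) (≡.sym eq) ([ n ] ≤⊤⁺)

  opaque
    V-or-W : ∀ n x → V n x ⊎ ∃ λ k → W k x × + 1 ℤ.+ k ℤ.≤ n
    V-or-W n x with finite x
    ... | inj₁ eq = inj₁ (V-⊤ eq)
    ... | inj₂ (k , Wk) with ≤-or-> n k
    ... | inj₁ n≤k = inj₁ (≤-W Wk n≤k)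
    ... | inj₂ k<n = inj₂ (k , Wk , k<n)

  V-all : ∀ {x} → (∀ n → V n x) → w x ≡ ⊤⁺
  V-all {x} v with finite x
  ... | inj₁ eq = eq
  ... | inj₂ (k , Wk) = ⊥-elim (suc≰ (W-V Wk (v (+ 1 ℤ.+ k))))

  V-+ : ∀ {n x y} → V n x → V n y → V n (x + y)
  V-+ {n} {x} {y} vx vy = ≤⁺-trans ℤ.≤-trans (glb (w x) (w y) vx vy) (w-+ x y)
    where
    glb : ∀ p q → [ n ] ≤∞ p → [ n ] ≤∞ q → [ n ] ≤∞ (p ⊓∞ q)
    glb [ p ] [ q ] [ a ] [ b ] = [ ℤ.⊓-glb a b ]
    glb [ p ] ⊤⁺ a b = a
    glb ⊤⁺ q a b = b

  V-* : ∀ {m n x y} → V m x → V n y → V (m ℤ.+ n) (x * y)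
  V-* {m} {n} {x} {y} vx vy = ≡.subst ([ m ℤ.+ n ] ≤∞_) (≡.sym (w-* x y)) (go (w x) (w y) vx vy)
    where
    go : ∀ p q → [ m ] ≤∞ p → [ n ] ≤∞ q → [ m ℤ.+ n ] ≤∞ (p +∞ q)
    go [ p ] [ q ] [ a ] [ b ] = [ ℤ.+-mono-≤ a b ]
    go [ p ] ⊤⁺ a b = _ ≤⊤⁺
    go ⊤⁺ q a b = _ ≤⊤⁺

  W-* : ∀ {m n x y} → W m x → W n y → W (m ℤ.+ n) (x * y)
  W-* {x = x} {y} wx wy = ≡.trans (w-* x y) (≡.cong₂ _+∞_ wx wy)

  V-cancel : ∀ {k n x y} → W k x → V (k ℤ.+ n) (x * y) → V n y
  V-cancel {k} {n} {x} {y} wx vxy with finite y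
  ... | inj₁ eq = V-⊤ eq
  ... | inj₂ (l , Wl) = ≤-W Wl (cert ((k ℤ.+ l) ℤ.- (k ℤ.+ n)) (diff (W-V (W-* wx Wl) vxy))
          (Z.solve 3 (λ k l n → l := n :+ ((k :+ l) :- (k :+ n))) ≡.refl k l n))

  W-1 : W (+ 0) 1#
  W-1 = w-1

  W-inv : ∀ {n x y} → x * y ≈ 1# → W n x → W (ℤ.- n) y
  W-inv {n} {x} {y} xy≈1 wx with finite y
  ... | inj₁ eq = ⊥-elim (case ≡.trans (≡.sym W-1) (≡.trans (w-cong (sym xy≈1))
          (≡.trans (w-* x y) (≡.cong₂ _+∞_ wx eq))) of λ ())
  ... | inj₂ (l , Wl) = W-cast (≡.trans (Z.solve 2 (λ n l → l := (n :+ l) :- n) ≡.refl n l)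
          (≡.trans (≡.cong (ℤ._- n) (W-unique (W-* wx Wl) (W-resp (sym xy≈1) W-1))) (ℤ.+-identityˡ _))) Wl

  W--1 : W (+ 0) (- 1#)
  W--1 with finite (- 1#)
  ... | inj₁ eq = ⊥-elim (case ≡.trans (≡.sym W-1) (≡.trans (w-cong (solve 0 (con (+ 1) := con -[1+ 0 ] :* con -[1+ 0 ]) refl))
          (≡.trans (w-* _ _) (≡.cong₂ _+∞_ eq eq))) of λ ())
  ... | inj₂ (l , Wl) = W-cast (double-inj l (+ 0) (W-unique (W-* Wl Wl)
          (W-resp (solve 0 (con (+ 1) := con -[1+ 0 ] :* con -[1+ 0 ]) refl) W-1))) Wl

  W-neg : ∀ {n x} → W n x → W n (- x)
  W-neg {n} {x} wx = W-resp (solve 1 (λ x → con -[1+ 0 ] :* x := :- x) refl x) (W-cast (ℤ.+-identityˡ n) (W-* W--1 wx))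

  V-neg : ∀ {n x} → V n x → V n (- x)
  V-neg {n} {x} vx = V-resp (solve 1 (λ x → con -[1+ 0 ] :* x := :- x) refl x) (V-cast (ℤ.+-identityˡ n) (V-* (W⇒V W--1) vx))

  V-sub : ∀ {n x y} → V n x → V n y → V n (x - y)
  V-sub vx vy = V-+ vx (V-neg vy)

  W-+ : ∀ {n x y} → W n x → V (+ 1 ℤ.+ n) y → W n (x + y)
  W-+ {n} {x} {y} wx vy with V-or-W (+ 1 ℤ.+ n) (x + y)
  ... | inj₁ v = ⊥-elim (suc≰ (W-V wx (V-resp (solve 2 (λ x y → (x :+ y) :- y := x) refl x y) (V-sub v vy))))
  ... | inj₂ (k , Wk , k<n) = W-cast (ℤ.≤-antisym (suc-cancel-≤ k<n) (W-V Wk (V-+ (W⇒V wx) (V-mono (ℤ.i≤j⇒i≤1+j ℤ.≤-refl) vy)))) Wk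

  W-+ʳ : ∀ {n x y} → V (+ 1 ℤ.+ n) x → W n y → W n (x + y)
  W-+ʳ vx wy = W-resp (+-comm _ _) (W-+ wy vx)

record IsConjugation {c ℓ} (R : CommutativeRing c ℓ) (conj : CommutativeRing.Carrier R → CommutativeRing.Carrier R) : Set (c ⊔ ℓ) where
  open CommutativeRing R
  field
    conj-cong       : ∀ {x y} → x ≈ y → conj x ≈ conj y
    conj-+          : ∀ x y → conj (x + y) ≈ conj x + conj y
    conj-*          : ∀ x y → conj (x * y) ≈ conj x * conj y
    conj-involutive : ∀ x → conj (conj x) ≈ x

  conj-0 : conj 0# ≈ 0#
  conj-0 = trans (solve 1 (λ u → u := (u :+ u) :- u) refl (conj 0#))
    (trans (+-congʳ (trans (sym (conj-+ 0# 0#)) (conj-cong (+-identityˡ 0#)))) (-‿inverseʳ _))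
    where open RingSolver R using (solve)

  conj-1 : conj 1# ≈ 1#
  conj-1 = trans (sym (*-identityˡ _)) (trans (*-congʳ (sym (conj-involutive 1#)))
    (trans (sym (conj-* (conj 1#) 1#)) (trans (conj-cong (*-identityʳ _)) (conj-involutive 1#))))

  conj-neg : ∀ x → conj (- x) ≈ - conj x
  conj-neg x = trans (solve 2 (λ u v → v := (u :+ v) :- u) refl (conj x) _)
    (trans (+-congʳ (trans (sym (conj-+ x (- x))) (trans (conj-cong (-‿inverseʳ x)) conj-0))) (+-identityˡ _))
    where open RingSolver R using (solve)

  conj-sub : ∀ x y → conj (x - y) ≈ conj x - conj y
  conj-sub x y = trans (conj-+ x (- y)) (+-congˡ (conj-neg y))

odd-+ : ∀ {m n} → Odd m → Odd n → Even (m ℤ.+ n)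
odd-+ (k , ≡.refl) (l , ≡.refl) = + 1 ℤ.+ (k ℤ.+ l) ,
  solve 2 (λ k l → (con (+ 1) :+ (k :+ k)) :+ (con (+ 1) :+ (l :+ l)) :=
    (con (+ 1) :+ (k :+ l)) :+ (con (+ 1) :+ (k :+ l))) ≡.refl k l
  where open ℤ-Solver using (solve)

even-odd-+ : ∀ {m n} → Even m → Odd n → Odd (m ℤ.+ n)
even-odd-+ (k , ≡.refl) (l , ≡.refl) = k ℤ.+ l ,
  solve 2 (λ k l → (k :+ k) :+ (con (+ 1) :+ (l :+ l)) := con (+ 1) :+ ((k :+ l) :+ (k :+ l))) ≡.refl k l
  where open ℤ-Solver using (solve)

even-double : ∀ n → Even (n ℤ.+ n)
even-double n = n , ≡.refl

record IsRamified {c ℓ} (R : CommutativeRing c ℓ) (conj : CommutativeRing.Carrier R → CommutativeRing.Carrier R)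
                  (w : CommutativeRing.Carrier R → ℤ∞) (h : ℤ) : Set (c ⊔ ℓ) where
  open CommutativeRing R
  field
    δ       : Carrier
    δ-skew  : conj δ ≈ - δ
    d       : ℤ
    W-δ     : w δ ≡ [ d ]
    odd-d+h : Odd (d ℤ.+ h)
    ϖ       : Carrier
    W-ϖ     : w ϖ ≡ [ + 1 ]

-- The quadratic extension E/K seen through the normalised valuation w of the
-- norm; an element is real when conj fixes it.  κ has trace 1 and maximal
-- valuation - h among such elements, so that for ramified E/K the different
-- is the (h + 1)-st power of the maximal ideal.
record IsQuadratic {c ℓ} (R : CommutativeRing c ℓ) (conj : CommutativeRing.Carrier R → CommutativeRing.Carrier R)
                   (w : CommutativeRing.Carrier R → ℤ∞) : Set (c ⊔ ℓ) where
  open CommutativeRing R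
  field
    isValuation   : IsValuation R w
    w-conj        : ∀ x → w (conj x) ≡ w x
    w-∞           : ∀ x → w x ≡ ⊤⁺ → x ≈ 0#
    inverse       : ∀ x → ¬ (x ≈ 0#) → ∃ λ y → x * y ≈ 1#
    h             : ℤ
    κ             : Carrier
    κ-trace       : κ + conj κ ≈ 1#
    W-κ           : w κ ≡ [ ℤ.- h ]
    trace-bound   : ∀ n x → [ n ] ≤∞ w x → [ n ℤ.+ h ] ≤∞ w (x + conj x)
    real-even     : ∀ n x → conj x ≈ x → w x ≡ [ n ] → Even n
    real-exists   : ∀ k → ∃ λ x → conj x ≈ x × w x ≡ [ k ℤ.+ k ]
    hensel        : ∀ z → conj z ≈ z → [ + 1 ] ≤∞ w z → ∃ λ y → conj y ≈ y × [ + 0 ] ≤∞ w y × y ≈ 1# + z * (y * y)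
    inert⊎ramified : (∀ n x → w x ≡ [ n ] → Even (n ℤ.+ h)) ⊎ IsRamified R conj w h

-- E ≅ K ⊕ K, with w the valuation of the first component and e₁ = (1 , 0).
record IsSplit {c ℓ} (R : CommutativeRing c ℓ) (conj : CommutativeRing.Carrier R → CommutativeRing.Carrier R)
               (w : CommutativeRing.Carrier R → ℤ∞) : Set (c ⊔ ℓ) where
  open CommutativeRing R
  field
    isValuation   : IsValuation R w
    e₁            : Carrier
    idempotent    : e₁ * e₁ ≈ e₁
    orthogonal    : e₁ * conj e₁ ≈ 0#
    W-e₁          : w e₁ ≡ [ + 0 ]
    w-e₂          : w (conj e₁) ≡ ⊤⁺
    w-∞           : ∀ x → w x ≡ ⊤⁺ → w (conj x) ≡ ⊤⁺ → x ≈ 0#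
    inverse       : ∀ {m n} x → w x ≡ [ m ] → w (conj x) ≡ [ n ] → ∃ λ y → x * y ≈ 1#

opaque
  minimum : ∀ {n} (f : Fin n → ℤ∞) → (∀ i → f i ≡ ⊤⁺) ⊎ ∃₂ λ i k → f i ≡ [ k ] × ∀ j → [ k ] ≤∞ f j
  minimum {zero} f = inj₁ λ ()
  minimum {suc n} f with f zero in eq | minimum (f ∘ suc)
  ... | ⊤⁺    | inj₁ all = inj₁ λ { zero → eq ; (suc i) → all i }
  ... | [ k ] | inj₁ all = inj₂ (zero , k , eq , λ
          { zero → ≡.subst ([ k ] ≤∞_) (≡.sym eq) [ ℤ.≤-refl ]
          ; (suc j) → ≡.subst ([ k ] ≤∞_) (≡.sym (all j)) ([ k ] ≤⊤⁺) })
  ... | ⊤⁺    | inj₂ (i , l , eq′ , least) = inj₂ (suc i , l , eq′ , λ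
          { zero → ≡.subst ([ l ] ≤∞_) (≡.sym eq) ([ l ] ≤⊤⁺)
          ; (suc j) → least j })
  ... | [ k ] | inj₂ (i , l , eq′ , least) with ℤ.≤-total k l
  ...   | inj₁ k≤l = inj₂ (zero , k , eq , λ
          { zero → ≡.subst ([ k ] ≤∞_) (≡.sym eq) [ ℤ.≤-refl ]
          ; (suc j) → ≤⁺-trans ℤ.≤-trans [ k≤l ] (least j) })
  ...   | inj₂ l≤k = inj₂ (suc i , l , eq′ , λ
          { zero → ≡.subst ([ l ] ≤∞_) (≡.sym eq) [ l≤k ]
          ; (suc j) → least j })

opaque
  minimum₂ : ∀ {n} (f : Fin n → Fin n → ℤ∞) → (∀ i j → f i j ≡ ⊤⁺) ⊎
             ∃₂ λ i j → ∃ λ k → f i j ≡ [ k ] × ∀ i′ j′ → [ k ] ≤∞ f i′ j′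
  minimum₂ {n} f with minimum {n ℕ.* n} (λ p → f (proj₁ (remQuot {n} n p)) (proj₂ (remQuot {n} n p)))
  ... | inj₁ all = inj₁ λ i j → ≡.trans (≡.cong (λ (i , j) → f i j) (≡.sym (Fin.remQuot-combine i j))) (all (combine i j))
  ... | inj₂ (p , k , eq , least) = inj₂ (proj₁ (remQuot {n} n p) , proj₂ (remQuot {n} n p) , k , eq , λ i j →
          ≡.subst ([ k ] ≤∞_) (≡.cong (λ (i , j) → f i j) (Fin.remQuot-combine i j)) (least (combine i j)))

opaque
  cover : ∀ {n} (a i : Fin (suc n)) → i ≡ a ⊎ ∃ λ k → i ≡ punchIn a k
  cover a i with a Fin.≟ i
  ... | yes a≡i = inj₁ (≡.sym a≡i)
  ... | no  a≢i = inj₂ (punchOut a≢i , ≡.sym (Fin.punchIn-punchOut a≢i))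

-- Linear algebra and hermitian lattices

module LinearAlgebra {c ℓ v ℓv} (R : CommutativeRing c ℓ) (M : Module R v ℓv) where
  open CommutativeRing R hiding (zero)
  open Determinants R
  open RingSolver R using (solve)
  open Module M using (Carrierᴹ; _≈ᴹ_; _+ᴹ_; _*ₗ_; 0ᴹ; -ᴹ_; +ᴹ-cong; *ₗ-cong; +ᴹ-identityʳ; +ᴹ-identityˡ; *ₗ-identityˡ;
    *ₗ-zeroˡ; *ₗ-zeroʳ; *ₗ-assoc; *ₗ-distribˡ; *ₗ-distribʳ; +ᴹ-comm; +ᴹ-assoc; -ᴹ‿inverseʳ; ≈ᴹ-refl;
    ≈ᴹ-sym; ≈ᴹ-trans; +ᴹ-rawMonoid)
  open RawMonoidDefs +ᴹ-rawMonoid using () renaming (sum to sumᴹ)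
  open SetoidReasoning setoid

  record Functional (h : Carrierᴹ → Carrier) : Set (c ⊔ ℓ ⊔ v ⊔ ℓv) where
    field
      cong   : ∀ {x y} → x ≈ᴹ y → h x ≈ h y
      linear : ∀ a x y → h (a *ₗ x +ᴹ y) ≈ a * h x + h y

    0-homo : h 0ᴹ ≈ 0#
    0-homo = begin
      h 0ᴹ                          ≈⟨ solve 1 (λ u → u := (con (+ 1) :* u :+ u) :- u) refl _ ⟩
      (1# * h 0ᴹ + h 0ᴹ) - h 0ᴹ     ≈⟨ +-congʳ (linear 1# 0ᴹ 0ᴹ) ⟨
      h (1# *ₗ 0ᴹ +ᴹ 0ᴹ) - h 0ᴹ     ≈⟨ +-congʳ (cong (≈ᴹ-trans (+ᴹ-identityʳ _) (*ₗ-zeroʳ 1#))) ⟩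
      h 0ᴹ - h 0ᴹ                   ≈⟨ -‿inverseʳ _ ⟩
      0#                            ∎

    scale : ∀ a x → h (a *ₗ x) ≈ a * h x
    scale a x = begin
      h (a *ₗ x)          ≈⟨ cong (+ᴹ-identityʳ _) ⟨
      h (a *ₗ x +ᴹ 0ᴹ)    ≈⟨ linear a x 0ᴹ ⟩
      a * h x + h 0ᴹ      ≈⟨ +-congˡ 0-homo ⟩
      a * h x + 0#        ≈⟨ +-identityʳ _ ⟩
      a * h x             ∎

    add : ∀ x y → h (x +ᴹ y) ≈ h x + h y
    add x y = begin
      h (x +ᴹ y)          ≈⟨ cong (+ᴹ-cong (*ₗ-identityˡ x) ≈ᴹ-refl) ⟨
      h (1# *ₗ x +ᴹ y)    ≈⟨ linear 1# x y ⟩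
      1# * h x + h y      ≈⟨ +-congʳ (*-identityˡ _) ⟩
      h x + h y           ∎

    negate : ∀ x → h (-ᴹ x) ≈ - h x
    negate x = begin
      h (-ᴹ x)                   ≈⟨ solve 2 (λ u v → u := (v :+ u) :- v) refl _ (h x) ⟩
      (h x + h (-ᴹ x)) - h x     ≈⟨ +-congʳ (add x (-ᴹ x)) ⟨
      h (x +ᴹ -ᴹ x) - h x        ≈⟨ +-congʳ (trans (cong (-ᴹ‿inverseʳ x)) 0-homo) ⟩
      0# - h x                   ≈⟨ +-identityˡ _ ⟩
      - h x                      ∎

  record LinearMap (φ : Carrierᴹ → Carrierᴹ) : Set (c ⊔ ℓ ⊔ v ⊔ ℓv) where
    field
      cong   : ∀ {x y} → x ≈ᴹ y → φ x ≈ᴹ φ y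
      linear : ∀ a x y → φ (a *ₗ x +ᴹ y) ≈ᴹ a *ₗ φ x +ᴹ φ y

    0-homo : φ 0ᴹ ≈ᴹ 0ᴹ
    0-homo = ≈ᴹ-trans (≈ᴹ-trans (≈ᴹ-sym (+ᴹ-identityʳ _)) (≈ᴹ-trans (+ᴹ-cong ≈ᴹ-refl (≈ᴹ-sym (-ᴹ‿inverseʳ (φ 0ᴹ)))) (≈ᴹ-sym (+ᴹ-assoc _ _ _))))
      (≈ᴹ-trans (+ᴹ-cong (≈ᴹ-sym (≈ᴹ-trans (cong (≈ᴹ-sym (≈ᴹ-trans (+ᴹ-cong (*ₗ-zeroʳ 1#) ≈ᴹ-refl) (+ᴹ-identityʳ 0ᴹ))))
        (≈ᴹ-trans (linear 1# 0ᴹ 0ᴹ) (+ᴹ-cong (*ₗ-identityˡ _) ≈ᴹ-refl)))) ≈ᴹ-refl) (-ᴹ‿inverseʳ _))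

  record Form (G : List Carrierᴹ → Carrier) : Set (c ⊔ ℓ ⊔ v ⊔ ℓv) where
    field
      alternating : Alternating G
      linear      : ∀ ps qs {x y z} a → z ≈ᴹ a *ₗ x +ᴹ y →
                    G (ps ++ z ∷ qs) ≈ a * G (ps ++ x ∷ qs) + G (ps ++ y ∷ qs)

    tail : ∀ x → Form (λ ys → G (x ∷ ys))
    tail x = record { alternating = Alternating.tail alternating x ; linear = λ ps → linear (x ∷ ps) }

    functional : ∀ ps qs → Functional (λ x → G (ps ++ x ∷ qs))
    functional ps qs = record
      { cong = λ {x} {y} x≈y → trans (linear ps qs {y} {y} 0# (≈ᴹ-trans x≈y
          (≈ᴹ-sym (≈ᴹ-trans (+ᴹ-cong (*ₗ-zeroˡ y) ≈ᴹ-refl) (+ᴹ-identityˡ y)))))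
          (solve 1 (λ u → con (+ 0) :* u :+ u := u) refl _)
      ; linear = λ a x y → linear ps qs a ≈ᴹ-refl
      }

  ι-form : ∀ {h G} → Functional h → Form G → Form (ι h G)
  ι-form {h} {G} H F = record
    { alternating = ι-alternating h alternating
    ; linear      = λ ps qs {x} {y} {z} a z≈ →
        ι-column-linear h a (trans (Functional.cong H z≈) (Functional.linear H a x y))
          (λ ps qs → linear ps qs a z≈) ps qs
    }
    where open Form F

  rows-form : ∀ {x} {X : Set x} (r : Carrierᴹ → X → Carrier) → (∀ x → Functional (λ v → r v x)) →
              ∀ xs → Form (λ vs → D r vs xs)
  rows-form r r-functional xs = record
    { alternating = D-rows r xs
    ; linear      = λ ps qs {x} {y} {z} a z≈ → D-row-linear r a
        (λ i → trans (Functional.cong (r-functional i) z≈) (Functional.linear (r-functional i) a x y)) ps qs xs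
    }

  columns-form : ∀ {x} {X : Set x} (r : X → Carrierᴹ → Carrier) → (∀ x → Functional (r x)) →
                 ∀ xs → Form (D r xs)
  columns-form r r-functional xs = record
    { alternating = D-columns r xs
    ; linear      = λ ps qs {x} {y} {z} a z≈ → D-column-linear r a xs
        (λ i → trans (Functional.cong (r-functional i) z≈) (Functional.linear (r-functional i) a x y)) ps qs
    }

  form-map : ∀ {G} → Form G → ∀ {f} → Functional f → ∀ s xs →
    G (map (λ x → (- f x) *ₗ s +ᴹ x) xs) ≈ G xs - ι f (λ ys → G (s ∷ ys)) xs
  form-map F Ff s [] = solve 1 (λ u → u := u :- con (+ 0)) refl _
  form-map {G} F {f} Ff s (x ∷ xs) = begin
    G (t x ∷ map t xs)                              ≈⟨ linear [] (map t xs) (- f x) ≈ᴹ-refl ⟩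
    (- f x) * G (s ∷ map t xs) + G (x ∷ map t xs)   ≈⟨ +-cong (*-congˡ (form-map (tail s) Ff s xs)) (form-map (tail x) Ff s xs) ⟩
    (- f x) * (G (s ∷ xs) - ι f (λ ys → G (s ∷ s ∷ ys)) xs) + (G (x ∷ xs) - ι f (λ ys → G (x ∷ s ∷ ys)) xs)
      ≈⟨ +-cong (*-congˡ (+-congˡ (-‿cong (ι-zero f (Alternating.repeat alternating [] s) xs))))
           (+-congˡ (-‿cong (ι-neg f (λ ys → Alternating.swap alternating [] x s ys) xs))) ⟩
    (- f x) * (G (s ∷ xs) - 0#) + (G (x ∷ xs) - - ι f (λ ys → G (s ∷ x ∷ ys)) xs)
      ≈⟨ solve 4 (λ f u v w → (:- f) :* (u :- con (+ 0)) :+ (v :- :- w) := v :- (f :* u :- w)) refl (f x) _ _ _ ⟩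
    G (x ∷ xs) - ι f (λ ys → G (s ∷ ys)) (x ∷ xs) ∎
    where
    open Form F
    t = λ x → (- f x) *ₗ s +ᴹ x

  ι-short : ∀ {x} {X : Set x} (f : X → Carrier) {G} xs → (∀ ys → suc (length ys) ≡ length xs → G ys ≈ 0#) → ι f G xs ≈ 0#
  ι-short f [] G≈0 = refl
  ι-short f (x ∷ xs) G≈0 = trans
    (+-cong (*-congˡ (G≈0 xs ≡.refl)) (-‿cong (ι-short f xs (λ ys h → G≈0 (x ∷ ys) (≡.cong suc h)))))
    (solve 1 (λ u → u :* con (+ 0) :- con (+ 0) := con (+ 0)) refl _)

  D-short : ∀ {x y} {X : Set x} {Y : Set y} (r : X → Y → Carrier) fs xs → length xs ℕ.< length fs → D r fs xs ≈ 0#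
  D-short r [] xs ()
  D-short r (f ∷ fs) xs (s≤s xs≤fs) = ι-short (r f) xs
    (λ ys h → D-short r fs ys (≡.subst (ℕ._≤ length fs) (≡.sym h) xs≤fs))

  D-map : ∀ {x y z w} {X : Set x} {Y : Set y} {Z : Set z} {W : Set w} (r : X → Y → Carrier) (p : Z → X) (q : W → Y) fs xs →
          D r (map p fs) (map q xs) ≈ D (λ f x → r (p f) (q x)) fs xs
  D-map r p q [] [] = refl
  D-map r p q [] (x ∷ xs) = refl
  D-map r p q (f ∷ fs) xs = trans (ι-map (r (p f)) (D r (map p fs)) xs) (ι-congʳ _ (D-map r p q fs) xs)
    where
    ι-map : ∀ g G xs → ι g G (map q xs) ≈ ι (g ∘ q) (G ∘ map q) xs
    ι-map g G [] = refl
    ι-map g G (x ∷ xs) = +-congˡ (-‿cong (ι-map g (λ ys → G (q x ∷ ys)) xs))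

  record Basis (n : ℕ) : Set (c ⊔ ℓ ⊔ v ⊔ ℓv) where
    field
      b          : Fin n → Carrierᴹ
      coord      : Carrierᴹ → Fin n → Carrier
      functional : ∀ i → Functional (λ x → coord x i)
      expand     : ∀ x → x ≈ᴹ sumᴹ (λ i → coord x i *ₗ b i)
      diagonal   : ∀ i → coord (b i) i ≈ 1#
      off        : ∀ i j → i ≢ j → coord (b i) j ≈ 0#

    indices : List (Fin n)
    indices = tabulate id

    vectors : List Carrierᴹ
    vectors = tabulate b

    pairs : List (Fin n × Carrierᴹ)
    pairs = tabulate (λ i → i , b i)

    pairs₁ : map proj₁ pairs ≡ indices
    pairs₁ = List.map-tabulate (λ i → i , b i) proj₁

    pairs₂ : map proj₂ pairs ≡ vectors
    pairs₂ = List.map-tabulate (λ i → i , b i) proj₂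

    length-pairs : length pairs ≡ n
    length-pairs = List.length-tabulate _

    length-vectors : length vectors ≡ n
    length-vectors = List.length-tabulate _

    expand-functional : ∀ {h} → Functional h → ∀ x → h x ≈ ∑ (λ (i , y) → coord x i * h y) pairs
    expand-functional {h} H x = trans (Functional.cong H (expand x)) (go id)
      where
      go : ∀ {k} (p : Fin k → Fin n) → h (sumᴹ (λ i → coord x (p i) *ₗ b (p i))) ≈
           ∑ (λ (i , y) → coord x i * h y) (tabulate (λ i → p i , b (p i)))
      go {zero} p = Functional.0-homo H
      go {suc k} p = trans (Functional.linear H _ _ _) (+-congˡ (go (p ∘ suc)))

    volume : List Carrierᴹ → Carrier
    volume vs = D coord vs indices

    volume-form : Form volume
    volume-form = rows-form coord functional indices

    form-unique : ∀ {G} → Form G → ∀ vs → n ℕ.≤ length vs → G vs ≈ volume vs * G vectors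
    form-unique {G} F vs n≤ = begin
      G vs ≈⟨ alternating-unique coord vs G (Form.alternating F) pairs
                (λ ps g qs → expand-functional (Form.functional F ps qs) g)
                (≡.subst (ℕ._≤ length vs) (≡.sym length-pairs) n≤) ⟩
      D coord vs (map proj₁ pairs) * G (map proj₂ pairs)
        ≡⟨ ≡.cong₂ (λ is xs → D coord vs is * G xs) pairs₁ pairs₂ ⟩
      volume vs * G vectors ∎

    volume-basis : volume vectors ≈ 1#
    volume-basis = D-identity coord b id diagonal off

    detEnd : (Carrierᴹ → Carrierᴹ) → Carrier
    detEnd φ = det R (λ i j → coord (φ (b j)) i)

    detEnd≈volume : ∀ φ → detEnd φ ≈ volume (map φ vectors)
    detEnd≈volume φ = begin
      detEnd φ                           ≈⟨ det≈D (λ i x → coord x i) id (φ ∘ b) ⟩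
      G (tabulate (φ ∘ b))               ≡⟨ ≡.cong G (List.map-tabulate b φ) ⟨
      G (map φ vectors)                  ≈⟨ form-unique F (map φ vectors)
        (ℕ.≤-reflexive (≡.sym (≡.trans (List.length-map φ vectors) length-vectors))) ⟩
      volume (map φ vectors) * G vectors ≈⟨ *-congˡ (D-identity (λ i x → coord x i) id b diagonal
                                              (λ i j i≢j → off j i (i≢j ∘ ≡.sym))) ⟩
      volume (map φ vectors) * 1#        ≈⟨ *-identityʳ _ ⟩
      volume (map φ vectors)             ∎
      where
      G = D (λ i x → coord x i) indices
      F : Form G
      F = columns-form (λ i x → coord x i) functional indices

    detEnd-cong : ∀ {φ ψ} → (∀ x → φ x ≈ᴹ ψ x) → detEnd φ ≈ detEnd ψ
    detEnd-cong {φ} {ψ} φ≈ψ = trans (det≈D (λ (i : Fin n) j → coord (φ (b j)) i) id id)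
      (trans (D-cong (λ i j → Functional.cong (functional i) (φ≈ψ (b j))) (tabulate id) (tabulate id))
        (sym (det≈D (λ (i : Fin n) j → coord (ψ (b j)) i) id id)))

    length-map-vectors : ∀ (φ : Carrierᴹ → Carrierᴹ) → n ≡ length (map φ vectors)
    length-map-vectors φ = ≡.sym (≡.trans (List.length-map φ vectors) length-vectors)

    detEnd-id : detEnd id ≈ 1#
    detEnd-id = trans (detEnd≈volume id) (trans (reflexive (≡.cong volume (List.map-id vectors))) volume-basis)

    detEnd-∘ : ∀ {φ} ψ → LinearMap φ → detEnd (φ ∘ ψ) ≈ detEnd φ * detEnd ψ
    detEnd-∘ {φ} ψ φ-linear = begin
      detEnd (φ ∘ ψ)                   ≈⟨ detEnd≈volume (φ ∘ ψ) ⟩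
      volume (map (φ ∘ ψ) vectors)     ≡⟨ ≡.cong volume (List.map-∘ vectors) ⟩
      volume (map φ (map ψ vectors))   ≈⟨ G≈ (map ψ vectors) ⟩
      G (map ψ vectors)                ≈⟨ form-unique G-form (map ψ vectors) (ℕ.≤-reflexive (length-map-vectors ψ)) ⟩
      volume (map ψ vectors) * G vectors ≈⟨ *-cong (detEnd≈volume ψ) (trans (detEnd≈volume φ) (G≈ vectors)) ⟨
      detEnd ψ * detEnd φ              ≈⟨ *-comm _ _ ⟩
      detEnd φ * detEnd ψ              ∎
      where
      module φ = LinearMap φ-linear
      G : List Carrierᴹ → Carrier
      G vs = D (coord ∘ φ) vs indices
      G-form : Form G
      G-form = rows-form (coord ∘ φ) (λ i → record
        { cong   = λ x≈y → Functional.cong (functional i) (φ.cong x≈y)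
        ; linear = λ a x y → trans (Functional.cong (functional i) (φ.linear a x y))
                               (Functional.linear (functional i) a (φ x) (φ y)) }) indices
      G≈ : ∀ vs → volume (map φ vs) ≈ G vs
      G≈ vs = trans (reflexive (≡.cong (D coord (map φ vs)) (≡.sym (List.map-id indices)))) (D-map coord φ id vs indices)

    -- The interior product of the volume form with f is alternating in
    -- n + 1 arguments, hence zero.
    detEnd-transvection : ∀ {f} → Functional f → ∀ s → detEnd (λ x → (- f x) *ₗ s +ᴹ x) ≈ 1# - f s
    detEnd-transvection {f} F s = begin
      detEnd t                                       ≈⟨ detEnd≈volume t ⟩
      volume (map t vectors)                         ≈⟨ form-map volume-form F s vectors ⟩
      volume vectors - J                             ≈⟨ solve 3 (λ u f j → u :- j := u :- f :* u :+ (f :* u :- j)) refl _ (f s) _ ⟩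
      volume vectors - f s * volume vectors + (f s * volume vectors - J)
        ≈⟨ +-cong (+-cong volume-basis (-‿cong (trans (*-congˡ volume-basis) (*-identityʳ _)))) top ⟩
      1# - f s + 0#                                  ≈⟨ +-identityʳ _ ⟩
      1# - f s ∎
      where
      t = λ x → (- f x) *ₗ s +ᴹ x
      J = ι f (λ ys → volume (s ∷ ys)) vectors
      top : ι f volume (s ∷ vectors) ≈ 0#
      top = trans (form-unique (ι-form F volume-form) (s ∷ vectors)
                    (ℕ.≤-trans (ℕ.≤-reflexive (≡.sym length-vectors)) (ℕ.n≤1+n _)))
                  (trans (*-congʳ (D-short coord (s ∷ vectors) indices
                     (ℕ.≤-reflexive (≡.cong suc (≡.trans (List.length-tabulate id) (≡.sym length-vectors))))))
                   (zeroˡ _))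

  basis-≤ : ¬ (1# ≈ 0#) → ∀ {m n} → Basis m → Basis n → n ℕ.≤ m
  basis-≤ 1≉0 {m} {n} B C = ℕ.≮⇒≥ λ m<n → 1≉0 (begin
    1#                ≈⟨ C.volume-basis ⟨
    C.volume C.vectors ≈⟨ B.form-unique C.volume-form C.vectors
                            (ℕ.≤-trans (ℕ.<⇒≤ m<n) (ℕ.≤-reflexive (≡.sym C.length-vectors))) ⟩
    B.volume C.vectors * C.volume B.vectors ≈⟨ *-congʳ (D-short B.coord C.vectors B.indices
      (≡.subst₂ ℕ._<_ (≡.sym (List.length-tabulate id)) (≡.sym C.length-vectors) m<n)) ⟩
    0# * C.volume B.vectors ≈⟨ zeroˡ _ ⟩
    0# ∎)
    where
    module B = Basis B
    module C = Basis C

  sumᴹ-cong : ∀ {n} {s t : Fin n → Carrierᴹ} → (∀ i → s i ≈ᴹ t i) → sumᴹ s ≈ᴹ sumᴹ t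
  sumᴹ-cong {zero} s≈t = ≈ᴹ-refl
  sumᴹ-cong {suc n} s≈t = +ᴹ-cong (s≈t zero) (sumᴹ-cong (s≈t ∘ suc))

  regroup : ∀ p q s x y a → a *ₗ (p *ₗ s +ᴹ x) +ᴹ (q *ₗ s +ᴹ y) ≈ᴹ (a * p + q) *ₗ s +ᴹ (a *ₗ x +ᴹ y)
  regroup p q s x y a = ≈ᴹ-trans (+ᴹ-cong (≈ᴹ-trans (*ₗ-distribˡ _ _ _) (+ᴹ-cong (≈ᴹ-sym (*ₗ-assoc _ _ _)) ≈ᴹ-refl)) ≈ᴹ-refl)
    (≈ᴹ-trans (interchange _ _ _ _) (+ᴹ-cong (≈ᴹ-sym (*ₗ-distribʳ _ _ _)) ≈ᴹ-refl))
    where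
    interchange : ∀ w x y z → (w +ᴹ x) +ᴹ (y +ᴹ z) ≈ᴹ (w +ᴹ y) +ᴹ (x +ᴹ z)
    interchange w x y z = ≈ᴹ-trans (+ᴹ-assoc _ _ _) (≈ᴹ-trans (+ᴹ-cong ≈ᴹ-refl
      (≈ᴹ-trans (≈ᴹ-sym (+ᴹ-assoc _ _ _)) (≈ᴹ-trans (+ᴹ-cong (+ᴹ-comm _ _) ≈ᴹ-refl) (+ᴹ-assoc _ _ _)))) (≈ᴹ-sym (+ᴹ-assoc _ _ _)))

  combination-linear : ∀ {n} a (r s : Fin n → Carrier) (b : Fin n → Carrierᴹ) →
    a *ₗ sumᴹ (λ i → r i *ₗ b i) +ᴹ sumᴹ (λ i → s i *ₗ b i) ≈ᴹ sumᴹ (λ i → (a * r i + s i) *ₗ b i)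
  combination-linear {zero} a r s b = ≈ᴹ-trans (+ᴹ-identityʳ _) (*ₗ-zeroʳ a)
  combination-linear {suc n} a r s b = ≈ᴹ-trans (regroup _ _ _ _ _ _) (+ᴹ-cong ≈ᴹ-refl (combination-linear a (r ∘ suc) (s ∘ suc) (b ∘ suc)))

  module _ {n} (b : Fin n → Carrierᴹ) (coord : Carrierᴹ → Fin n → Carrier)
           (expand : ∀ x → x ≈ᴹ sumᴹ (λ i → coord x i *ₗ b i))
           (independent : ∀ (r : Fin n → Carrier) → sumᴹ (λ i → r i *ₗ b i) ≈ᴹ 0ᴹ → ∀ i → r i ≈ 0#) where

    coordinates-unique : ∀ r s → sumᴹ (λ i → r i *ₗ b i) ≈ᴹ sumᴹ (λ i → s i *ₗ b i) → ∀ i → r i ≈ s i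
    coordinates-unique r s eq i = begin
      r i                        ≈⟨ solve 2 (λ r s → r := s :- ((:- con (+ 1)) :* r :+ s)) refl (r i) (s i) ⟩
      s i - ((- 1#) * r i + s i) ≈⟨ +-congˡ (-‿cong (independent (λ i → (- 1#) * r i + s i) (≈ᴹ-trans (≈ᴹ-sym (combination-linear (- 1#) r s b))
                                      (≈ᴹ-trans (+ᴹ-cong (*ₗ-cong refl eq) (≈ᴹ-sym (*ₗ-identityˡ _))) (≈ᴹ-trans (≈ᴹ-sym (*ₗ-distribʳ _ _ _))
                                        (≈ᴹ-trans (*ₗ-cong (-‿inverseˡ 1#) ≈ᴹ-refl) (*ₗ-zeroˡ _))))) i)) ⟩
      s i - 0#                   ≈⟨ solve 1 (λ s → s :- con (+ 0) := s) refl (s i) ⟩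
      s i                        ∎

    private
      δ : ∀ {n} → Fin n → Fin n → Carrier
      δ zero    zero    = 1#
      δ zero    (suc j) = 0#
      δ (suc i) zero    = 0#
      δ (suc i) (suc j) = δ i j

      δ-diagonal : ∀ {n} (i : Fin n) → δ i i ≈ 1#
      δ-diagonal zero = refl
      δ-diagonal (suc i) = δ-diagonal i

      δ-off : ∀ {n} (i j : Fin n) → i ≢ j → δ i j ≈ 0#
      δ-off zero    zero    i≢j = ⊥-elim (i≢j ≡.refl)
      δ-off zero    (suc j) i≢j = refl
      δ-off (suc i) zero    i≢j = refl
      δ-off (suc i) (suc j) i≢j = δ-off i j (i≢j ∘ ≡.cong suc)

      zero-sum : ∀ {n} (b : Fin n → Carrierᴹ) → sumᴹ (λ i → 0# *ₗ b i) ≈ᴹ 0ᴹ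
      zero-sum {zero} b = ≈ᴹ-refl
      zero-sum {suc n} b = ≈ᴹ-trans (+ᴹ-cong (*ₗ-zeroˡ _) (zero-sum (b ∘ suc))) (+ᴹ-identityʳ _)

      δ-sum : ∀ {n} (b : Fin n → Carrierᴹ) i → sumᴹ (λ j → δ i j *ₗ b j) ≈ᴹ b i
      δ-sum {suc n} b zero = ≈ᴹ-trans (+ᴹ-cong (*ₗ-identityˡ _) (zero-sum (b ∘ suc))) (+ᴹ-identityʳ _)
      δ-sum {suc n} b (suc i) = ≈ᴹ-trans (+ᴹ-cong (*ₗ-zeroˡ _) (δ-sum (b ∘ suc) i)) (+ᴹ-identityˡ _)

      coord-b : ∀ i j → coord (b i) j ≈ δ i j
      coord-b i = coordinates-unique (coord (b i)) (δ i) (≈ᴹ-trans (≈ᴹ-sym (expand (b i))) (≈ᴹ-sym (δ-sum b i)))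

    independent⇒basis : Basis n
    independent⇒basis = record
      { b = b ; coord = coord
      ; functional = λ i → record
        { cong   = λ {x} {y} x≈y → coordinates-unique (coord x) (coord y) (≈ᴹ-trans (≈ᴹ-sym (expand x)) (≈ᴹ-trans x≈y (expand y))) i
        ; linear = λ a x y → coordinates-unique (coord (a *ₗ x +ᴹ y)) (λ i → a * coord x i + coord y i)
            (≈ᴹ-trans (≈ᴹ-sym (expand _)) (≈ᴹ-trans (+ᴹ-cong (*ₗ-cong refl (expand x)) (expand y)) (combination-linear a (coord x) (coord y) b))) i
        }
      ; expand = expand
      ; diagonal = λ i → trans (coord-b i i) (δ-diagonal i)
      ; off = λ i j i≢j → trans (coord-b i j) (δ-off i j i≢j)
      }

  data Triangular : List Carrierᴹ → Set (c ⊔ ℓ ⊔ v ⊔ ℓv) where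
    []   : Triangular []
    cons : ∀ {x xs} h → Functional h → h x ≈ 1# → (∀ G → ι h G xs ≈ 0#) → Triangular xs → Triangular (x ∷ xs)

  triangular : ∀ {n} (h : Fin n → Carrierᴹ → Carrier) (x : Fin n → Carrierᴹ) → (∀ i → Functional (h i)) →
    (∀ i → h i (x i) ≈ 1#) → (∀ i j → i ≢ j → h i (x j) ≈ 0#) → Triangular (tabulate x)
  triangular {zero} h x H one off = []
  triangular {suc n} h x H one off = cons (h zero) (H zero) (one zero)
    (vanish (x ∘ suc) (λ j → off zero (suc j) λ ()))
    (triangular (h ∘ suc) (x ∘ suc) (H ∘ suc) (one ∘ suc) (λ i j i≢j → off (suc i) (suc j) (i≢j ∘ Fin.suc-injective)))
    where
    vanish : ∀ {k} (z : Fin k → Carrierᴹ) → (∀ j → h zero (z j) ≈ 0#) → ∀ G → ι (h zero) G (tabulate z) ≈ 0#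
    vanish {zero} z z≈ G = refl
    vanish {suc k} z z≈ G = trans (+-cong (*-congʳ (z≈ zero)) (-‿cong (vanish (z ∘ suc) (z≈ ∘ suc) _)))
      (solve 1 (λ u → con (+ 0) :* u :- con (+ 0) := con (+ 0)) refl _)

  contract : (List Carrierᴹ → Carrier) → List Carrierᴹ → Carrierᴹ
  contract G [] = 0ᴹ
  contract G (x ∷ xs) = G xs *ₗ x +ᴹ -ᴹ contract (λ ys → G (x ∷ ys)) xs

  functional-contract : ∀ {h} → Functional h → ∀ G xs → h (contract G xs) ≈ ι h G xs
  functional-contract H G [] = Functional.0-homo H
  functional-contract {h} H G (x ∷ xs) = begin
    h (G xs *ₗ x +ᴹ -ᴹ contract G′ xs)     ≈⟨ Functional.linear H _ _ _ ⟩
    G xs * h x + h (-ᴹ contract G′ xs)     ≈⟨ +-cong (*-comm _ _) (trans (Functional.negate H _) (-‿cong (functional-contract H G′ xs))) ⟩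
    ι h G (x ∷ xs) ∎
    where G′ = λ ys → G (x ∷ ys)

  -- McCoy's argument: expanding a minor along a column gives a vector that is
  -- orthogonal to everything once multiplied by r.
  annihilates-minors : ∀ (Ψ : Carrierᴹ → Carrierᴹ → Carrier) → (∀ y → Functional (Ψ y)) →
    (∀ x → (∀ y → Ψ y x ≈ 0#) → x ≈ᴹ 0ᴹ) → ∀ r {xs} → Triangular xs →
    (∀ ys → length ys ≡ length xs → r * D Ψ ys xs ≈ 0#) → r ≈ 0#
  annihilates-minors Ψ Ψ-functional nondeg r [] rD≈0 = trans (sym (*-identityʳ r)) (rD≈0 [] ≡.refl)
  annihilates-minors Ψ Ψ-functional nondeg r {x ∷ xs} (cons h H one vanish t) rD≈0 =
    annihilates-minors Ψ Ψ-functional nondeg r t λ ys len → begin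
      r * D Ψ ys xs                       ≈⟨ solve 2 (λ r d → r :* d := r :* (con (+ 1) :* d :- con (+ 0))) refl r _ ⟩
      r * (1# * D Ψ ys xs - 0#)           ≈⟨ *-congˡ (+-cong (*-congʳ (sym one)) (-‿cong (sym (vanish _)))) ⟩
      r * ι h (D Ψ ys) (x ∷ xs)           ≈⟨ *-congˡ (functional-contract H (D Ψ ys) (x ∷ xs)) ⟨
      r * h (contract (D Ψ ys) (x ∷ xs))  ≈⟨ Functional.scale H r _ ⟨
      h (r *ₗ contract (D Ψ ys) (x ∷ xs)) ≈⟨ Functional.cong H (nondeg _ (λ y → trans (Functional.scale (Ψ-functional y) r _)
          (trans (*-congˡ (functional-contract (Ψ-functional y) (D Ψ ys) (x ∷ xs))) (rD≈0 (y ∷ ys) (≡.cong suc len))))) ⟩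
      h 0ᴹ                                ≈⟨ Functional.0-homo H ⟩
      0#                                  ∎

  module Hulls {p} (L : Pred Carrierᴹ p) where
    data Hull : Pred Carrierᴹ (c ⊔ v ⊔ ℓv ⊔ p) where
      gen  : ∀ {x} → L x → Hull x
      null : ∀ {x} → x ≈ᴹ 0ᴹ → Hull x
      comb : ∀ {a x y z} → Hull x → Hull y → z ≈ᴹ a *ₗ x +ᴹ y → Hull z

    hull-sum : ∀ {n} (r : Fin n → Carrier) (b : Fin n → Carrierᴹ) → (∀ i → L (b i)) → Hull (sumᴹ (λ i → r i *ₗ b i))
    hull-sum {zero} r b b∈ = null ≈ᴹ-refl
    hull-sum {suc n} r b b∈ = comb (gen (b∈ zero)) (hull-sum (r ∘ suc) (b ∘ suc) (b∈ ∘ suc)) ≈ᴹ-refl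

    hull-trivial : (∀ x → Hull x) → (∀ x → L x → x ≈ᴹ 0ᴹ) → ∀ x → x ≈ᴹ 0ᴹ
    hull-trivial hull zeros x = go (hull x)
      where
      go : ∀ {x} → Hull x → x ≈ᴹ 0ᴹ
      go (gen x∈) = zeros _ x∈
      go (null x≈0) = x≈0
      go (comb s t z≈) = ≈ᴹ-trans z≈ (≈ᴹ-trans (+ᴹ-cong (≈ᴹ-trans (*ₗ-cong refl (go s)) (*ₗ-zeroʳ _)) (go t)) (+ᴹ-identityʳ _))

    hull-dense : (∀ x → Hull x) → ∀ {φ} → LinearMap φ → (∀ x → L x → φ x ≈ᴹ x) → ∀ x → φ x ≈ᴹ x
    hull-dense hull {φ} φ-linear fixed x = go (hull x)
      where
      open LinearMap φ-linear
      go : ∀ {x} → Hull x → φ x ≈ᴹ x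
      go (gen x∈) = fixed _ x∈
      go (null x≈0) = ≈ᴹ-trans (cong x≈0) (≈ᴹ-trans 0-homo (≈ᴹ-sym x≈0))
      go (comb s t z≈) = ≈ᴹ-trans (cong z≈) (≈ᴹ-trans (linear _ _ _) (≈ᴹ-trans (+ᴹ-cong (*ₗ-cong refl (go s)) (go t)) (≈ᴹ-sym z≈)))

    hull-zero : (∀ x → Hull x) → ∀ {f} → Functional f → (∀ x → L x → f x ≈ 0#) → ∀ x → f x ≈ 0#
    hull-zero hull {f} F zeros x = go (hull x)
      where
      open Functional F
      go : ∀ {x} → Hull x → f x ≈ 0#
      go (gen x∈) = zeros _ x∈
      go (null x≈0) = trans (cong x≈0) 0-homo
      go (comb s t z≈) = trans (cong z≈) (trans (linear _ _ _) (trans (+-cong (trans (*-congˡ (go s)) (zeroʳ _)) (go t)) (+-identityˡ _)))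

  module Hermitian (conj : Carrier → Carrier) (isConjugation : IsConjugation R conj) where
    open IsConjugation isConjugation

    Nr : Carrier → Carrier
    Nr x = x * conj x

    record IsForm (Φ : Carrierᴹ → Carrierᴹ → Carrier) : Set (c ⊔ ℓ ⊔ v ⊔ ℓv) where
      field
        Φ-cong        : ∀ {x x′ y y′} → x ≈ᴹ x′ → y ≈ᴹ y′ → Φ x y ≈ Φ x′ y′
        Φ-+           : ∀ x x′ y → Φ (x +ᴹ x′) y ≈ Φ x y + Φ x′ y
        Φ-*           : ∀ r x y → Φ (r *ₗ x) y ≈ r * Φ x y
        Φ-conj        : ∀ x y → Φ y x ≈ conj (Φ x y)
        nondegenerate : ∀ x → (∀ y → Φ x y ≈ 0#) → x ≈ᴹ 0ᴹ

      Φ-functional : ∀ y → Functional (λ x → Φ x y)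
      Φ-functional y = record
        { cong   = λ x≈ → Φ-cong x≈ ≈ᴹ-refl
        ; linear = λ a x z → trans (Φ-+ (a *ₗ x) z y) (+-congʳ (Φ-* a x y))
        }

      Φ-linearˡ : ∀ a x y z → Φ (a *ₗ x +ᴹ y) z ≈ a * Φ x z + Φ y z
      Φ-linearˡ a x y z = Functional.linear (Φ-functional z) a x y

      Φ-linearʳ : ∀ a x y z → Φ z (a *ₗ x +ᴹ y) ≈ conj a * Φ z x + Φ z y
      Φ-linearʳ a x y z = begin
        Φ z (a *ₗ x +ᴹ y)                  ≈⟨ Φ-conj _ _ ⟩
        conj (Φ (a *ₗ x +ᴹ y) z)           ≈⟨ conj-cong (Φ-linearˡ a x y z) ⟩
        conj (a * Φ x z + Φ y z)           ≈⟨ trans (conj-+ _ _) (+-congʳ (conj-* _ _)) ⟩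
        conj a * conj (Φ x z) + conj (Φ y z) ≈⟨ +-cong (*-congˡ (Φ-conj x z)) (Φ-conj y z) ⟨
        conj a * Φ z x + Φ z y             ∎

      Φ-0ˡ : ∀ y → Φ 0ᴹ y ≈ 0#
      Φ-0ˡ y = Functional.0-homo (Φ-functional y)

      Φ-0ʳ : ∀ y → Φ y 0ᴹ ≈ 0#
      Φ-0ʳ y = trans (Φ-conj 0ᴹ y) (trans (conj-cong (Φ-0ˡ y)) conj-0)

      self-real : ∀ x → conj (Φ x x) ≈ Φ x x
      self-real x = sym (Φ-conj x x)

    record IsIntegers {o} (𝒪 : Pred Carrier o) : Set (c ⊔ ℓ ⊔ o) where
      field
        𝒪-resp : ∀ {x y} → x ≈ y → 𝒪 x → 𝒪 y
        𝒪-0    : 𝒪 0#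
        𝒪-1    : 𝒪 1#
        𝒪-+    : ∀ {x y} → 𝒪 x → 𝒪 y → 𝒪 (x + y)
        𝒪-*    : ∀ {x y} → 𝒪 x → 𝒪 y → 𝒪 (x * y)
        𝒪-neg  : ∀ {x} → 𝒪 x → 𝒪 (- x)
        𝒪-conj : ∀ {x} → 𝒪 x → 𝒪 (conj x)

    module Formed (Φ : Carrierᴹ → Carrierᴹ → Carrier) (isForm : IsForm Φ) where
      open IsForm isForm

      record Isometry (φ : Carrierᴹ → Carrierᴹ) : Set (c ⊔ ℓ ⊔ v ⊔ ℓv) where
        field
          isLinear  : LinearMap φ
          preserves : ∀ x y → Φ (φ x) (φ y) ≈ Φ x y
        open LinearMap isLinear public

      module _ {n} (B : Basis n) where
        open Basis B

        private
          Φ′ : Carrierᴹ → Carrierᴹ → Carrier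
          Φ′ y x = Φ x y

        conj-D : ∀ xs ys → conj (D Φ xs ys) ≈ D Φ′ xs ys
        conj-D [] [] = conj-1
        conj-D [] (y ∷ ys) = conj-0
        conj-D (x ∷ xs) ys = go (Φ x) (Φ′ x) (λ y → sym (Φ-conj x y)) (conj-D xs) ys
          where
          go : ∀ f g → (∀ y → conj (f y) ≈ g y) → ∀ {G H} → (∀ ys → conj (G ys) ≈ H ys) → ∀ ys → conj (ι f G ys) ≈ ι g H ys
          go f g f≈g G≈H [] = conj-0
          go f g f≈g {G} {H} G≈H (y ∷ ys) = trans (conj-sub _ _)
            (+-cong (trans (conj-* _ _) (*-cong (f≈g y) (G≈H ys))) (-‿cong (go f g f≈g (λ zs → G≈H (y ∷ zs)) ys)))

        gram : Carrier
        gram = D Φ vectors vectors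

        gram-rows : ∀ xs ys → n ≡ length xs → D Φ xs ys ≈ volume xs * D Φ vectors ys
        gram-rows xs ys n≡ = form-unique (rows-form Φ Φ-functional ys) xs (ℕ.≤-reflexive n≡)

        gram-columns : ∀ ys → n ≡ length ys → D Φ vectors ys ≈ conj (volume ys) * gram
        gram-columns ys n≡ = begin
          D Φ vectors ys               ≈⟨ conj-involutive _ ⟨
          conj (conj (D Φ vectors ys)) ≈⟨ conj-cong (trans (conj-D vectors ys)
            (form-unique (columns-form Φ′ Φ-functional vectors) ys (ℕ.≤-reflexive n≡))) ⟩
          conj (volume ys * D Φ′ vectors vectors) ≈⟨ conj-* _ _ ⟩
          conj (volume ys) * conj (D Φ′ vectors vectors) ≈⟨ *-congˡ (trans (conj-cong (sym (conj-D vectors vectors))) (conj-involutive _)) ⟩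
          conj (volume ys) * gram ∎

        gram-regular : ∀ r → r * gram ≈ 0# → r ≈ 0#
        gram-regular r rG≈0 = trans (sym (conj-involutive r)) (trans (conj-cong conj-r≈0) conj-0)
          where
          conj-r≈0 : conj r ≈ 0#
          conj-r≈0 = annihilates-minors Φ′ Φ-functional nondegenerate (conj r)
            (triangular (λ i x → coord x i) b functional diagonal (λ i j i≢j → off j i (i≢j ∘ ≡.sym)))
            λ ys len → begin
              conj r * D Φ′ ys vectors         ≈⟨ *-congˡ (conj-D ys vectors) ⟨
              conj r * conj (D Φ ys vectors)   ≈⟨ conj-* _ _ ⟨
              conj (r * D Φ ys vectors)        ≈⟨ conj-cong (*-congˡ (gram-rows ys vectors (≡.sym (≡.trans len length-vectors)))) ⟩
              conj (r * (volume ys * gram))    ≈⟨ conj-cong (solve 3 (λ r v g → r :* (v :* g) := v :* (r :* g)) refl r _ _) ⟩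
              conj (volume ys * (r * gram))    ≈⟨ conj-cong (trans (*-congˡ rG≈0) (zeroʳ _)) ⟩
              conj 0#                          ≈⟨ conj-0 ⟩
              0#                               ∎

        detEnd-norm : ∀ {φ} → Isometry φ → Nr (detEnd φ) ≈ 1#
        detEnd-norm {φ} I = begin
          Nr d                    ≈⟨ solve 1 (λ u → u := u :- con (+ 1) :+ con (+ 1)) refl _ ⟩
          (Nr d - 1#) + 1#        ≈⟨ +-congʳ (gram-regular (Nr d - 1#) (begin
            (Nr d - 1#) * gram    ≈⟨ solve 2 (λ u g → (u :- con (+ 1)) :* g := u :* g :- g) refl _ _ ⟩
            Nr d * gram - gram    ≈⟨ +-congʳ (sym step) ⟩
            gram - gram           ≈⟨ -‿inverseʳ _ ⟩
            0#                    ∎)) ⟩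
          0# + 1#                 ≈⟨ +-identityˡ _ ⟩
          1#                      ∎
          where
          d = detEnd φ
          step : gram ≈ Nr d * gram
          step = begin
            gram                                      ≈⟨ D-cong (Isometry.preserves I) vectors vectors ⟨
            D (λ x y → Φ (φ x) (φ y)) vectors vectors ≈⟨ D-map Φ φ φ vectors vectors ⟨
            D Φ (map φ vectors) (map φ vectors)       ≈⟨ gram-rows (map φ vectors) (map φ vectors) (length-map-vectors φ) ⟩
            volume (map φ vectors) * D Φ vectors (map φ vectors) ≈⟨ *-congˡ (gram-columns (map φ vectors) (length-map-vectors φ)) ⟩
            volume (map φ vectors) * (conj (volume (map φ vectors)) * gram)
              ≈⟨ *-cong (detEnd≈volume φ) (*-congʳ (conj-cong (detEnd≈volume φ))) ⟨
            d * (conj d * gram)                       ≈⟨ *-assoc _ _ _ ⟨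
            Nr d * gram ∎

      quasi : Carrier → Carrierᴹ → Carrierᴹ → Carrierᴹ
      quasi c s x = (- (Φ x s * c)) *ₗ s +ᴹ x

      quasi-functional : ∀ c s → Functional (λ x → Φ x s * c)
      quasi-functional c s = record
        { cong   = λ x≈y → *-congʳ (Φ-cong x≈y ≈ᴹ-refl)
        ; linear = λ a x y → trans (*-congʳ (Φ-linearˡ a x y s))
            (solve 4 (λ a x y c → (a :* x :+ y) :* c := a :* (x :* c) :+ y :* c) refl a _ _ c)
        }

      detEnd-quasi : ∀ {n} (B : Basis n) c s → Basis.detEnd B (quasi c s) ≈ 1# - Φ s s * c
      detEnd-quasi B c s = Basis.detEnd-transvection B (quasi-functional c s) s

      Balanced : Carrier → Carrierᴹ → Set ℓ
      Balanced c s = c + conj c ≈ c * conj c * Φ s s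

      quasi-linear : ∀ c s → LinearMap (quasi c s)
      quasi-linear c s = record
        { cong   = λ x≈y → +ᴹ-cong (*ₗ-cong (-‿cong (Functional.cong F x≈y)) ≈ᴹ-refl) x≈y
        ; linear = λ a x y → ≈ᴹ-trans (+ᴹ-cong (*ₗ-cong (trans (-‿cong (Functional.linear F a x y))
              (solve 3 (λ a x y → :- (a :* x :+ y) := a :* :- x :- y) refl a _ _)) ≈ᴹ-refl) ≈ᴹ-refl)
            (≈ᴹ-sym (regroup _ _ s x y a))
        }
        where F = quasi-functional c s

      quasi-isometry : ∀ c s → Balanced c s → Isometry (quasi c s)
      quasi-isometry c s bal = record { isLinear = quasi-linear c s ; preserves = pres }
        where
        pres : ∀ x y → Φ (quasi c s x) (quasi c s y) ≈ Φ x y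
        pres x y = begin
          Φ (p *ₗ s +ᴹ x) (q *ₗ s +ᴹ y)       ≈⟨ Φ-linearˡ _ _ _ _ ⟩
          p * Φ s (q *ₗ s +ᴹ y) + Φ x (q *ₗ s +ᴹ y) ≈⟨ +-cong (*-congˡ (Φ-linearʳ _ _ _ _)) (Φ-linearʳ _ _ _ _) ⟩
          p * (conj q * Φ s s + Φ s y) + (conj q * Φ x s + Φ x y)
            ≈⟨ +-cong (*-congˡ (+-congʳ (*-congʳ conj-q))) (+-congʳ (*-congʳ conj-q)) ⟩
          p * (- (Φ s y * conj c) * Φ s s + Φ s y) + (- (Φ s y * conj c) * Φ x s + Φ x y)
            ≈⟨ solve 6 (λ xs sy ss xy c c̄ →
                 (:- (xs :* c)) :* (:- (sy :* c̄) :* ss :+ sy) :+ (:- (sy :* c̄) :* xs :+ xy) :=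
                 xy :+ xs :* sy :* (c :* c̄ :* ss :- (c :+ c̄))) refl (Φ x s) (Φ s y) (Φ s s) (Φ x y) c (conj c) ⟩
          Φ x y + Φ x s * Φ s y * (c * conj c * Φ s s - (c + conj c))
            ≈⟨ +-congˡ (*-congˡ (trans (+-congʳ (sym bal)) (-‿inverseʳ _))) ⟩
          Φ x y + Φ x s * Φ s y * 0#          ≈⟨ trans (+-congˡ (zeroʳ _)) (+-identityʳ _) ⟩
          Φ x y ∎
          where
          p = - (Φ x s * c)
          q = - (Φ y s * c)
          conj-q : conj q ≈ - (Φ s y * conj c)
          conj-q = trans (conj-neg _) (-‿cong (trans (conj-* _ _) (*-congʳ (sym (Φ-conj y s)))))

      quasi-inverse : ∀ c d s → c + d ≈ c * d * Φ s s → ∀ x → quasi d s (quasi c s x) ≈ᴹ x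
      quasi-inverse c d s bal x = ≈ᴹ-trans (≈ᴹ-sym (+ᴹ-assoc _ _ _)) (≈ᴹ-trans
        (+ᴹ-cong (≈ᴹ-trans (≈ᴹ-sym (*ₗ-distribʳ _ _ _)) (≈ᴹ-trans (*ₗ-cong coeff ≈ᴹ-refl) (*ₗ-zeroˡ s))) ≈ᴹ-refl)
        (+ᴹ-identityˡ x))
        where
        coeff : - (Φ (quasi c s x) s * d) + - (Φ x s * c) ≈ 0#
        coeff = begin
          - (Φ (quasi c s x) s * d) + - (Φ x s * c) ≈⟨ +-congʳ (-‿cong (*-congʳ (Φ-linearˡ _ _ _ _))) ⟩
          - ((- (Φ x s * c) * Φ s s + Φ x s) * d) + - (Φ x s * c)
            ≈⟨ solve 4 (λ xs ss c d → :- ((:- (xs :* c) :* ss :+ xs) :* d) :+ :- (xs :* c) :=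
                 xs :* (c :* d :* ss :- (c :+ d))) refl (Φ x s) (Φ s s) c d ⟩
          Φ x s * (c * d * Φ s s - (c + d)) ≈⟨ *-congˡ (trans (+-congʳ (sym bal)) (-‿inverseʳ _)) ⟩
          Φ x s * 0# ≈⟨ zeroʳ _ ⟩
          0# ∎

      module Lattices {o} (𝒪 : Pred Carrier o) (isIntegers : IsIntegers 𝒪) where
        open IsIntegers isIntegers public

        record IsSubmodule {p} (L : Pred Carrierᴹ p) : Set (c ⊔ v ⊔ ℓv ⊔ o ⊔ p) where
          field
            L-resp : ∀ {x y} → x ≈ᴹ y → L x → L y
            L-0    : L 0ᴹ
            L-+    : ∀ {x y} → L x → L y → L (x +ᴹ y)
            L-*    : ∀ {r x} → 𝒪 r → L x → L (r *ₗ x)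

          L-comb : ∀ {r x y} → 𝒪 r → L x → L y → L (r *ₗ x +ᴹ y)
          L-comb r x y = L-+ (L-* r x) y

        data Span {p} (S : Pred Carrierᴹ p) : Pred Carrierᴹ (c ⊔ v ⊔ ℓv ⊔ o ⊔ p) where
          gen  : ∀ {x} → S x → Span S x
          null : ∀ {x} → x ≈ᴹ 0ᴹ → Span S x
          comb : ∀ {a x y z} → 𝒪 a → Span S x → Span S y → z ≈ᴹ a *ₗ x +ᴹ y → Span S z

        span-⊆ : ∀ {p q} {S : Pred Carrierᴹ p} {L : Pred Carrierᴹ q} → IsSubmodule L → S ⊆ L → Span S ⊆ L
        span-⊆ LM S⊆ (gen x) = S⊆ x
        span-⊆ LM S⊆ (null x≈0) = IsSubmodule.L-resp LM (≈ᴹ-sym x≈0) (IsSubmodule.L-0 LM)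
        span-⊆ LM S⊆ (comb a x y z≈) = IsSubmodule.L-resp LM (≈ᴹ-sym z≈) (IsSubmodule.L-comb LM a (span-⊆ LM S⊆ x) (span-⊆ LM S⊆ y))

        span-sum : ∀ {p} {S : Pred Carrierᴹ p} {n} (r : Fin n → Carrier) (b : Fin n → Carrierᴹ) → (∀ i → 𝒪 (r i)) → (∀ i → S (b i)) →
                   Span S (sumᴹ (λ i → r i *ₗ b i))
        span-sum {n = zero} r b r∈ b∈ = null ≈ᴹ-refl
        span-sum {n = suc n} r b r∈ b∈ = comb (r∈ zero) (gen (b∈ zero)) (span-sum (r ∘ suc) (b ∘ suc) (r∈ ∘ suc) (b∈ ∘ suc)) ≈ᴹ-refl

        span-submodule : ∀ {p} {S : Pred Carrierᴹ p} → IsSubmodule (Span S)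
        span-submodule = record
          { L-resp = λ x≈y x → comb 𝒪-1 x (null ≈ᴹ-refl) (≈ᴹ-trans (≈ᴹ-sym x≈y) (≈ᴹ-sym (≈ᴹ-trans (+ᴹ-identityʳ _) (*ₗ-identityˡ _))))
          ; L-0    = null ≈ᴹ-refl
          ; L-+    = λ x y → comb 𝒪-1 x y (+ᴹ-cong (≈ᴹ-sym (*ₗ-identityˡ _)) ≈ᴹ-refl)
          ; L-*    = λ r x → comb r x (null ≈ᴹ-refl) (≈ᴹ-sym (+ᴹ-identityʳ _))
          }

        record Automorphism {p} (L : Pred Carrierᴹ p) (φ : Carrierᴹ → Carrierᴹ) : Set (c ⊔ ℓ ⊔ v ⊔ ℓv ⊔ p) where
          field
            isometry  : Isometry φ
            stable    : ∀ {x} → L x → L (φ x)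
            inverse   : Carrierᴹ → Carrierᴹ
            inverse-stable : ∀ {x} → L x → L (inverse x)
            inverseʳ  : ∀ x → φ (inverse x) ≈ᴹ x
            inverseˡ  : ∀ x → inverse (φ x) ≈ᴹ x
            inverse-cong : ∀ {x y} → x ≈ᴹ y → inverse x ≈ᴹ inverse y

        reflect : ∀ {p} {L : Pred Carrierᴹ p} → IsSubmodule L → ∀ {n} (B : Basis n) {s α′ u} → L s →
          Φ s s * α′ ≈ 1# → 𝒪 u → Nr u ≈ 1# → (∀ x → L x → 𝒪 (Φ x s * ((1# - u) * α′))) →
          ∃ λ φ → Automorphism L φ × u ≈ Basis.detEnd B φ
        reflect {L = L} LM B {s} {α′} {u} s∈ αα′≈1 u∈ Nru≈1 int = quasi γ s , record
          { isometry = quasi-isometry γ s balanced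
          ; stable   = λ {x} x∈ → L-comb (𝒪-neg (int x x∈)) s∈ x∈
          ; inverse  = quasi (conj γ) s
          ; inverse-stable = λ {x} x∈ → L-comb (𝒪-neg (𝒪-resp (lem x) (𝒪-* (𝒪-neg (𝒪-conj u∈)) (int x x∈)))) s∈ x∈
          ; inverseʳ = quasi-inverse (conj γ) γ s (trans (+-comm _ _) (trans balanced (*-congʳ (*-comm _ _))))
          ; inverseˡ = quasi-inverse γ (conj γ) s balanced
          ; inverse-cong = LinearMap.cong (quasi-linear (conj γ) s)
          } , sym (trans (detEnd-quasi B γ s) (begin
            1# - α * ((1# - u) * α′)     ≈⟨ solve 3 (λ α u α′ → con (+ 1) :- α :* ((con (+ 1) :- u) :* α′) :=
                                              con (+ 1) :- (con (+ 1) :- u) :* (α :* α′)) refl α u α′ ⟩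
            1# - (1# - u) * (α * α′)     ≈⟨ +-congˡ (-‿cong (*-congˡ αα′≈1)) ⟩
            1# - (1# - u) * 1#           ≈⟨ solve 1 (λ u → con (+ 1) :- (con (+ 1) :- u) :* con (+ 1) := u) refl u ⟩
            u                            ∎))
          where
          open IsSubmodule LM
          α = Φ s s
          γ = (1# - u) * α′
          conj-α′ : conj α′ ≈ α′
          conj-α′ = begin
            conj α′                ≈⟨ *-identityʳ _ ⟨
            conj α′ * 1#           ≈⟨ *-congˡ αα′≈1 ⟨
            conj α′ * (α * α′)     ≈⟨ solve 3 (λ x a y → x :* (a :* y) := (a :* x) :* y) refl _ _ _ ⟩
            (α * conj α′) * α′     ≈⟨ *-congʳ (*-congʳ (sym (self-real s))) ⟩
            (conj α * conj α′) * α′ ≈⟨ *-congʳ (trans (sym (conj-* _ _)) (trans (conj-cong αα′≈1) conj-1)) ⟩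
            1# * α′                ≈⟨ *-identityˡ _ ⟩
            α′                     ∎
          conj-γ : conj γ ≈ (1# - conj u) * α′
          conj-γ = trans (conj-* _ _) (*-cong (trans (conj-sub _ _) (+-congʳ conj-1)) conj-α′)
          balanced : Balanced γ s
          balanced = begin
            γ + conj γ                                     ≈⟨ +-congˡ conj-γ ⟩
            (1# - u) * α′ + (1# - conj u) * α′             ≈⟨ solve 3 (λ u ū a → (con (+ 1) :- u) :* a :+ (con (+ 1) :- ū) :* a :=
                                                                (con (+ 1) :- u :- ū :+ con (+ 1)) :* a) refl u (conj u) α′ ⟩
            (1# - u - conj u + 1#) * α′                    ≈⟨ *-congʳ (+-congˡ Nru≈1) ⟨
            (1# - u - conj u + Nr u) * α′                  ≈⟨ trans (sym (*-identityʳ _)) (*-congˡ (sym αα′≈1)) ⟩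
            ((1# - u - conj u + Nr u) * α′) * (α * α′)     ≈⟨ solve 4 (λ u ū a α → ((con (+ 1) :- u :- ū :+ u :* ū) :* a) :* (α :* a) :=
                                                                ((con (+ 1) :- u) :* a) :* ((con (+ 1) :- ū) :* a) :* α) refl u (conj u) α′ α ⟩
            γ * ((1# - conj u) * α′) * α                   ≈⟨ *-congʳ (*-congˡ conj-γ) ⟨
            γ * conj γ * α ∎
          lem : ∀ x → (- conj u) * (Φ x s * γ) ≈ Φ x s * conj γ
          lem x = begin
            (- conj u) * (Φ x s * γ)            ≈⟨ solve 4 (λ ū x u a → (:- ū) :* (x :* ((con (+ 1) :- u) :* a)) := x :* ((u :* ū :- ū) :* a))
                                                     refl (conj u) (Φ x s) u α′ ⟩
            Φ x s * ((Nr u - conj u) * α′)      ≈⟨ *-congˡ (trans (*-congʳ (+-congʳ Nru≈1)) (sym conj-γ)) ⟩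
            Φ x s * conj γ                      ∎

      module Quadratic (w : Carrier → ℤ∞) (isQuadratic : IsQuadratic R conj w) where
        open IsQuadratic isQuadratic
        open Valuations R w isValuation
        private module Z = ℤ-Solver

        Tr : Carrier → Carrier
        Tr x = x + conj x

        V-conj : ∀ {n x} → V n x → V n (conj x)
        V-conj {n} {x} = ≡.subst ([ n ] ≤∞_) (≡.sym (w-conj x))

        W-conj : ∀ {n x} → W n x → W n (conj x)
        W-conj {n} {x} = ≡.trans (w-conj x)

        V-Tr : ∀ {n x} → V n x → V (n ℤ.+ h) (Tr x)
        V-Tr {n} {x} = trace-bound n x

        0≤h : + 0 ℤ.≤ h
        0≤h = ≡.subst (+ 0 ℤ.≤_) (≡.trans (ℤ.+-identityˡ _) (ℤ.neg-involutive h)) (diff (W-V W-1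
          (V-resp κ-trace (V-+ (W⇒V W-κ) (V-conj (W⇒V W-κ))))))

        opaque
          x≈0⊎W : ∀ x → x ≈ 0# ⊎ ∃ λ n → W n x
          x≈0⊎W x with finite x
          ... | inj₁ eq = inj₁ (w-∞ x eq)
          ... | inj₂ h = inj₂ h

        opaque
          invert : ∀ {n x} → W n x → ∃ λ y → x * y ≈ 1# × W (ℤ.- n) y
          invert {n} {x} wx with inverse x (W-≉0 wx)
          ... | y , xy≈1 = y , xy≈1 , W-inv xy≈1 wx

        V-2 : V h (1# + 1#)
        V-2 = V-resp (+-congˡ conj-1) (V-cast (ℤ.+-identityˡ h) (V-Tr (W⇒V W-1)))

        V-skew-part : ∀ {n x} → V n x → V (n ℤ.+ h) (conj x - x)
        V-skew-part {n} {x} vx = V-resp (solve 2 (λ x x̄ → (x :+ x̄) :- (con (+ 1) :+ con (+ 1)) :* x := x̄ :- x) refl x (conj x))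
          (V-sub (V-Tr vx) (V-cast (ℤ.+-comm h n) (V-* V-2 vx)))

        unit-norm-bound : ∀ {u} → u * conj u ≈ 1# → V h (1# - u)
        unit-norm-bound {u} Nru≈1 with x≈0⊎W (1# + u)
        ... | inj₁ 1+u≈0 = V-resp (begin
                1# + 1#              ≈⟨ solve 1 (λ u → con (+ 1) :+ con (+ 1) := (con (+ 1) :+ u) :+ (con (+ 1) :- u)) refl u ⟩
                (1# + u) + (1# - u)  ≈⟨ +-congʳ 1+u≈0 ⟩
                0# + (1# - u)        ≈⟨ +-identityˡ _ ⟩
                1# - u               ∎) V-2
        ... | inj₂ (n , Wn) = V-cancel (W-conj Wn) (V-resp (begin
                conj (1# + u) - (1# + u)           ≈⟨ +-congʳ (trans (conj-+ _ _) (+-congʳ conj-1)) ⟩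
                (1# + conj u) - (1# + u)           ≈⟨ +-congʳ (+-congʳ (sym Nru≈1)) ⟩
                (u * conj u + conj u) - (1# + u)   ≈⟨ solve 2 (λ u ū → (u :* ū :+ ū) :- (con (+ 1) :+ u) :=
                                                        con (+ 1) :* ū :+ u :* ū :- con (+ 1) :- u) refl u (conj u) ⟩
                1# * conj u + u * conj u - 1# - u  ≈⟨ +-congʳ (+-congˡ (-‿cong (sym Nru≈1))) ⟩
                1# * conj u + u * conj u - u * conj u - u
                  ≈⟨ solve 2 (λ u ū → con (+ 1) :* ū :+ u :* ū :- u :* ū :- u := ū :- u) refl u (conj u) ⟩
                conj u - u                         ≈⟨ solve 2 (λ u ū → ū :- u := ((con (+ 1) :+ ū) :* (con (+ 1) :- u)) :+ (u :* ū :- con (+ 1))) refl u (conj u) ⟩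
                (1# + conj u) * (1# - u) + (u * conj u - 1#) ≈⟨ +-congˡ (trans (+-congʳ Nru≈1) (-‿inverseʳ _)) ⟩
                (1# + conj u) * (1# - u) + 0#      ≈⟨ +-identityʳ _ ⟩
                (1# + conj u) * (1# - u)           ≈⟨ *-congʳ (trans (conj-+ _ _) (+-congʳ conj-1)) ⟨
                conj (1# + u) * (1# - u)           ∎) (V-skew-part (W⇒V Wn)))

        EvenRatio : Carrier → Set (c ⊔ ℓ)
        EvenRatio u = ∃₂ λ x n → W n x × Even n × u * conj x ≈ x

        EvenRatio-resp : ∀ {u v} → u ≈ v → EvenRatio u → EvenRatio v
        EvenRatio-resp u≈v (x , n , Wn , e , eq) = x , n , Wn , e , trans (*-congʳ (sym u≈v)) eq

        EvenRatio-1 : EvenRatio 1#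
        EvenRatio-1 = 1# , + 0 , W-1 , (+ 0 , ≡.refl) , trans (*-identityˡ _) conj-1

        EvenRatio-* : ∀ {u v} → EvenRatio u → EvenRatio v → EvenRatio (u * v)
        EvenRatio-* {u} {v} (x , m , Wx , e , eq) (y , n , Wy , f , eq′) =
          x * y , m ℤ.+ n , W-* Wx Wy , even-+ e f , (begin
            u * v * conj (x * y)             ≈⟨ *-congˡ (conj-* x y) ⟩
            u * v * (conj x * conj y)        ≈⟨ solve 4 (λ u v x y → u :* v :* (x :* y) := (u :* x) :* (v :* y)) refl u v _ _ ⟩
            (u * conj x) * (v * conj y)      ≈⟨ *-cong eq eq′ ⟩
            x * y                            ∎)

        module Ramified (ram : IsRamified R conj w h) where
          open IsRamified ram

          skew-odd : ∀ {n x} → conj x ≈ - x → W n x → Odd (n ℤ.+ h)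
          skew-odd {n} {x} x-skew Wx with real-even (n ℤ.+ d) (x * δ) (begin
              conj (x * δ)      ≈⟨ conj-* x δ ⟩
              conj x * conj δ   ≈⟨ *-cong x-skew δ-skew ⟩
              (- x) * (- δ)     ≈⟨ solve 2 (λ x d → (:- x) :* (:- d) := x :* d) refl x δ ⟩
              x * δ             ∎) (W-* Wx W-δ)
          ... | e = ≡.subst Odd (Z.solve 3 (λ n d h → ((n :+ d) :- (d :+ d)) :+ (d :+ h) := n :+ h) ≡.refl n d h)
                      (even-odd-+ (even-+ e (even-neg (even-double d))) odd-d+h)

          EvenRatio-neg : ∀ {n D x} → W n x → Odd (n ℤ.+ h) → D * conj x ≈ - x → EvenRatio D
          EvenRatio-neg {n} {D} {x} Wx o eq = δ * x , d ℤ.+ n , W-* W-δ Wx ,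
            ≡.subst Even (Z.solve 3 (λ n d h → ((n :+ h) :+ (d :+ h)) :- (h :+ h) := d :+ n) ≡.refl n d h)
              (even-+ (odd-+ o odd-d+h) (even-neg (even-double h))) , (begin
            D * conj (δ * x)        ≈⟨ *-congˡ (trans (conj-* δ x) (*-congʳ δ-skew)) ⟩
            D * ((- δ) * conj x)    ≈⟨ solve 3 (λ D d x → D :* ((:- d) :* x) := (:- d) :* (D :* x)) refl D δ _ ⟩
            (- δ) * (D * conj x)    ≈⟨ *-congˡ eq ⟩
            (- δ) * (- x)           ≈⟨ solve 2 (λ x d → (:- d) :* (:- x) := d :* x) refl x δ ⟩
            δ * x                   ∎)

          trace-exact : ∀ {n x} → W n x → Even (n ℤ.+ h) → ¬ V (+ 1 ℤ.+ (n ℤ.+ h)) (Tr x)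
          trace-exact {n} {x} Wx e vr = even-odd e (skew-odd γ-skew Wγ)
            where
            r = Tr x
            γ = x - r * κ
            Wγ : W n γ
            Wγ = W-+ Wx (V-neg (V-cast (Z.solve 2 (λ n h → (con (+ 1) :+ (n :+ h)) :- h := con (+ 1) :+ n) ≡.refl n h)
                   (V-* vr (W⇒V W-κ))))
            γ-skew : conj γ ≈ - γ
            γ-skew = begin
              conj (x - r * κ)            ≈⟨ conj-sub _ _ ⟩
              conj x - conj (r * κ)       ≈⟨ +-congˡ (-‿cong (trans (conj-* _ _) (*-congʳ (trans (conj-+ _ _) (+-congˡ (conj-involutive x)))))) ⟩
              conj x - (conj x + x) * conj κ
                ≈⟨ solve 4 (λ x x̄ k k̄ → x̄ :- (x̄ :+ x) :* k̄ := (x̄ :+ x) :* (con (+ 1) :- (k :+ k̄)) :- (x :- (x :+ x̄) :* k)) refl x (conj x) κ (conj κ) ⟩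
              (conj x + x) * (1# - (κ + conj κ)) - γ ≈⟨ +-congʳ (trans (*-congˡ (trans (+-congˡ (-‿cong κ-trace)) (-‿inverseʳ _))) (zeroʳ _)) ⟩
              0# - γ                      ≈⟨ +-identityˡ _ ⟩
              - γ                         ∎

          even-ratio-bound : ∀ {u} → EvenRatio u → V (+ 1 ℤ.+ h) (1# - u)
          even-ratio-bound {u} (x , n , Wx , e , eq) = V-cancel (W-conj Wx) (V-resp (begin
              conj x - x              ≈⟨ +-congˡ (-‿cong eq) ⟨
              conj x - u * conj x     ≈⟨ solve 2 (λ u x → x :- u :* x := x :* (con (+ 1) :- u)) refl u _ ⟩
              conj x * (1# - u)       ∎) (V-cast (Z.solve 2 (λ n h → con (+ 1) :+ (n :+ h) := n :+ (con (+ 1) :+ h)) ≡.refl n h) improved))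
            where
            skew : conj (conj x - x) ≈ - (conj x - x)
            skew = begin
              conj (conj x - x)     ≈⟨ trans (conj-sub _ _) (+-congʳ (conj-involutive x)) ⟩
              x - conj x            ≈⟨ solve 2 (λ x x̄ → x :- x̄ := :- (x̄ :- x)) refl x _ ⟩
              - (conj x - x)        ∎
            improved : V (+ 1 ℤ.+ (n ℤ.+ h)) (conj x - x)
            improved with x≈0⊎W (conj x - x)
            ... | inj₁ ≈0 = V-zero ≈0
            ... | inj₂ (k , Wk) with ≤-or-> (+ 1 ℤ.+ (n ℤ.+ h)) k
            ...   | inj₁ le = ≤-W Wk le
            ...   | inj₂ gt = ⊥-elim (even-odd (≡.subst Even
                        (Z.solve 2 (λ n h → n :+ (h :+ h) := (n :+ h) :+ h) ≡.refl n h)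
                        (even-+ e (even-double h)))
                      (≡.subst (λ k → Odd (k ℤ.+ h)) (ℤ.≤-antisym (suc-cancel-≤ gt) (W-V Wk (V-skew-part (W⇒V Wx)))) (skew-odd skew Wk)))

        𝒪 : Carrier → Set
        𝒪 = V (+ 0)

        isIntegers : IsIntegers 𝒪
        isIntegers = record
          { 𝒪-resp = V-resp ; 𝒪-0 = V-0 ; 𝒪-1 = W⇒V W-1 ; 𝒪-+ = V-+ ; 𝒪-* = V-* ; 𝒪-neg = V-neg ; 𝒪-conj = V-conj }

        open Lattices 𝒪 isIntegers

        split-off : ∀ a x y → y ≈ᴹ a *ₗ x +ᴹ ((- a) *ₗ x +ᴹ y)
        split-off a x y = ≈ᴹ-sym (≈ᴹ-trans (≈ᴹ-sym (+ᴹ-assoc _ _ _)) (≈ᴹ-trans (+ᴹ-cong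
          (≈ᴹ-trans (≈ᴹ-sym (*ₗ-distribʳ _ _ _)) (≈ᴹ-trans (*ₗ-cong (-‿inverseʳ a) ≈ᴹ-refl) (*ₗ-zeroˡ x))) ≈ᴹ-refl) (+ᴹ-identityˡ y)))

        record GoodVector {p} (b : ℤ) (L : Pred Carrierᴹ p) : Set (c ⊔ ℓ ⊔ v ⊔ ℓv ⊔ p) where
          field
            s     : Carrierᴹ
            j k   : ℤ
            s∈    : L s
            bound : ∀ x → L x → V j (Φ x s)
            W-ss  : W k (Φ s s)
            k≤    : k ℤ.≤ j ℤ.+ b

        good-det : ∀ {p b} {L : Pred Carrierᴹ p} → IsSubmodule L → GoodVector b L → ∀ {n} (B : Basis n) u →
          u * conj u ≈ 1# → V b (1# - u) → ∃ λ φ → Automorphism L φ × u ≈ Basis.detEnd B φ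
        good-det {b = b} LM G B u Nru≈1 vu with invert (GoodVector.W-ss G)
        ... | α′ , αα′≈1 , Wα′ = reflect LM B s∈ αα′≈1 u∈ Nru≈1
                (λ x x∈ → V-mono (≡.subst (+ 0 ℤ.≤_) (Z.solve 3 (λ j b k → (j :+ b) :- k := j :+ (b :- k)) ≡.refl j b k) (diff k≤))
                  (V-* (bound x x∈) (V-* vu (W⇒V Wα′))))
          where
          open GoodVector G
          u∈ : 𝒪 u
          u∈ with V-or-W (+ 0) u
          ... | inj₁ v = v
          ... | inj₂ (k , Wk , k<0) with W-unique (W-* Wk (W-conj Wk)) (W-resp (sym Nru≈1) W-1)
          ...   | eq = ⊥-elim (suc≰ (ℤ.≤-trans k<0 (ℤ.≤-reflexive (≡.sym (double-inj k (+ 0) eq)))))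

        record Frame {p} (M : Pred Carrierᴹ p) : Set (c ⊔ ℓ ⊔ v ⊔ ℓv ⊔ p) where
          field
            k     : ℕ
            x y   : Fin k → Carrierᴹ
            σ     : Fin k → ℤ
            odd   : ∀ i → Odd (σ i ℤ.+ h)
            x∈    : ∀ i → M (x i)
            y∈    : ∀ i → M (y i)
            xx    : ∀ i j → Φ (x i) (x j) ≈ 0#
            yy    : ∀ i j → Φ (y i) (y j) ≈ 0#
            xy    : ∀ i j → i ≢ j → Φ (x i) (y j) ≈ 0#
            W-xy  : ∀ i → W (σ i) (Φ (x i) (y i))
            spans : M ⊆ Span (λ z → ∃ λ i → z ≡ x i ⊎ z ≡ y i)

        ⟨_⟩ : ∀ {n} → (Fin n → Carrierᴹ) → Pred Carrierᴹ _
        ⟨ g ⟩ = Span (λ z → ∃ λ i → z ≡ g i)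

        at : ∀ {n} (g : Fin n → Carrierᴹ) i → ⟨ g ⟩ (g i)
        at g i = gen (i , ≡.refl)

        sym-zero : ∀ {x y} → Φ x y ≈ 0# → Φ y x ≈ 0#
        sym-zero {x} {y} eq = trans (Φ-conj x y) (trans (conj-cong eq) conj-0)

        span-V : ∀ {p} {S : Pred Carrierᴹ p} {j} y → (∀ z → S z → V j (Φ z y)) → ∀ {x} → Span S x → V j (Φ x y)
        span-V y h (gen s) = h _ s
        span-V y h (null x≈0) = V-zero (trans (Φ-cong x≈0 ≈ᴹ-refl) (Φ-0ˡ y))
        span-V {j = j} y h (comb a s t z≈) = V-resp (sym (trans (Φ-cong z≈ ≈ᴹ-refl) (Φ-linearˡ _ _ _ _)))
          (V-+ (V-cast (ℤ.+-identityˡ j) (V-* a (span-V y h s))) (span-V y h t))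

        span-orthogonal : ∀ {p} {S : Pred Carrierᴹ p} y → (∀ z → S z → Φ z y ≈ 0#) → ∀ {x} → Span S x → Φ x y ≈ 0#
        span-orthogonal y h (gen s) = h _ s
        span-orthogonal y h (null x≈0) = trans (Φ-cong x≈0 ≈ᴹ-refl) (Φ-0ˡ y)
        span-orthogonal y h (comb a s t z≈) = trans (trans (Φ-cong z≈ ≈ᴹ-refl) (Φ-linearˡ _ _ _ _))
          (trans (+-cong (trans (*-congˡ (span-orthogonal y h s)) (zeroʳ _)) (span-orthogonal y h t)) (+-identityʳ _))

        gens-V : ∀ {n} {g : Fin n → Carrierᴹ} {j} → (∀ i k → V j (Φ (g i) (g k))) → ∀ {x y} → ⟨ g ⟩ x → ⟨ g ⟩ y → V j (Φ x y)
        gens-V {g = g} h {x} {y} x∈ y∈ = span-V y (λ { z (i , ≡.refl) →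
          V-resp (sym (Φ-conj y (g i))) (V-conj (span-V (g i) (λ { z (k , ≡.refl) → h k i }) y∈)) }) x∈

        NonDegenerate : ∀ {n} → (Fin n → Carrierᴹ) → Set _
        NonDegenerate g = ∀ x → ⟨ g ⟩ x → (∀ i → Φ x (g i) ≈ 0#) → x ≈ᴹ 0ᴹ

        -- Taking t = z κ / Φ x y with z real makes the trace term equal to z.
        Φ-plane : ∀ t x y → Φ (t *ₗ x +ᴹ y) (t *ₗ x +ᴹ y) ≈ (t * conj t * Φ x x + Φ y y) + Tr (t * Φ x y)
        Φ-plane t x y = begin
          Φ (t *ₗ x +ᴹ y) (t *ₗ x +ᴹ y)  ≈⟨ Φ-linearˡ _ _ _ _ ⟩
          t * Φ x (t *ₗ x +ᴹ y) + Φ y (t *ₗ x +ᴹ y) ≈⟨ +-cong (*-congˡ (Φ-linearʳ _ _ _ _)) (Φ-linearʳ _ _ _ _) ⟩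
          t * (conj t * Φ x x + Φ x y) + (conj t * Φ y x + Φ y y) ≈⟨ +-congˡ (+-congʳ (*-congˡ (Φ-conj x y))) ⟩
          t * (conj t * Φ x x + Φ x y) + (conj t * conj (Φ x y) + Φ y y)
            ≈⟨ solve 6 (λ t t̄ a b p p̄ → t :* (t̄ :* a :+ p) :+ (t̄ :* p̄ :+ b) := (t :* t̄ :* a :+ b) :+ (t :* p :+ t̄ :* p̄))
                 refl t (conj t) (Φ x x) (Φ y y) (Φ x y) (conj (Φ x y)) ⟩
          (t * conj t * Φ x x + Φ y y) + (t * Φ x y + conj t * conj (Φ x y)) ≈⟨ +-congˡ (+-congˡ (conj-* _ _)) ⟨
          (t * conj t * Φ x x + Φ y y) + Tr (t * Φ x y) ∎

        module _ {x y ρ′} (ρρ′≈1 : Φ x y * ρ′ ≈ 1#) {z} (z-real : conj z ≈ z) where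
          private t = z * κ * ρ′

          Tr-solved : Tr (t * Φ x y) ≈ z
          Tr-solved = begin
            Tr (t * Φ x y)        ≈⟨ +-cong tρ (conj-cong tρ) ⟩
            z * κ + conj (z * κ)  ≈⟨ +-congˡ (trans (conj-* z κ) (*-congʳ z-real)) ⟩
            z * κ + z * conj κ    ≈⟨ distribˡ _ _ _ ⟨
            z * (κ + conj κ)      ≈⟨ trans (*-congˡ κ-trace) (*-identityʳ z) ⟩
            z ∎
            where
            tρ : t * Φ x y ≈ z * κ
            tρ = trans (solve 3 (λ p ρ ρ′ → p :* ρ′ :* ρ := p :* (ρ :* ρ′)) refl (z * κ) (Φ x y) ρ′) (trans (*-congˡ ρρ′≈1) (*-identityʳ _))

        -- An isotropic vector x + t y with t in the maximal ideal: t = α z times a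
        -- multiple of κ, where z = 1 + η z² is supplied by Hensel's lemma.
        isotropic : ∀ {x y j} → W j (Φ x y) → V (+ 1 ℤ.+ (j ℤ.+ h)) (Φ x x) → V (+ 1 ℤ.+ (j ℤ.+ h)) (Φ y y) →
          ∃ λ t → V (+ 1) t × Φ (t *ₗ y +ᴹ x) (t *ₗ y +ᴹ x) ≈ 0#
        isotropic {x} {y} {j} Wρ vα vβ with invert (W-resp (sym (Φ-conj x y)) (W-conj Wρ))
        ... | ρ′ , ρρ′≈1 , Wρ′ with hensel (α * β * (κ * conj κ) * (ρ′ * conj ρ′)) η-real (V-mono bound
                  (V-* (V-* (V-* vα vβ) (V-* (W⇒V W-κ) (W⇒V (W-conj W-κ)))) (V-* (W⇒V Wρ′) (W⇒V (W-conj Wρ′)))))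
              where
              α = Φ x x
              β = Φ y y
              nr-real : ∀ x → conj (x * conj x) ≈ x * conj x
              nr-real x = trans (conj-* _ _) (trans (*-congˡ (conj-involutive x)) (*-comm _ _))
              η-real : conj (α * β * (κ * conj κ) * (ρ′ * conj ρ′)) ≈ α * β * (κ * conj κ) * (ρ′ * conj ρ′)
              η-real = trans (conj-* _ _) (*-cong (trans (conj-* _ _) (*-cong (trans (conj-* _ _) (*-cong (self-real x) (self-real y))) (nr-real κ))) (nr-real ρ′))
              bound : + 1 ℤ.≤ (+ 1 ℤ.+ (j ℤ.+ h)) ℤ.+ (+ 1 ℤ.+ (j ℤ.+ h)) ℤ.+ (ℤ.- h ℤ.+ ℤ.- h) ℤ.+ (ℤ.- j ℤ.+ ℤ.- j)
              bound = cert (+ 1) nonneg (Z.solve 2 (λ j h → (con (+ 1) :+ (j :+ h)) :+ (con (+ 1) :+ (j :+ h)) :+ (:- h :- h) :+ (:- j :- j)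
                        := con (+ 1) :+ con (+ 1)) ≡.refl j h)
        ...   | z , z-real , vz , z≈ = t , vt , (begin
                  Φ (t *ₗ y +ᴹ x) (t *ₗ y +ᴹ x)                 ≈⟨ Φ-plane t y x ⟩
                  (t * conj t * β + α) + Tr (t * Φ y x)         ≈⟨ +-cong (+-congʳ (*-congʳ (*-congˡ conj-t))) (Tr-solved ρρ′≈1 ζ-real) ⟩
                  (t * (ζ * conj κ * conj ρ′) * β + α) + ζ
                    ≈⟨ solve 7 (λ a z k k̄ r r̄ b →
                         ((:- (a :* z)) :* k :* r :* ((:- (a :* z)) :* k̄ :* r̄) :* b :+ a) :- a :* z :=
                         a :* ((con (+ 1) :+ (a :* b :* (k :* k̄) :* (r :* r̄)) :* (z :* z)) :- z))
                         refl α z κ (conj κ) ρ′ (conj ρ′) β ⟩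
                  α * ((1# + α * β * (κ * conj κ) * (ρ′ * conj ρ′) * (z * z)) - z) ≈⟨ *-congˡ (trans (+-congʳ (sym z≈)) (-‿inverseʳ z)) ⟩
                  α * 0#                                        ≈⟨ zeroʳ α ⟩
                  0#                                            ∎)
                where
                α = Φ x x
                β = Φ y y
                ζ = - (α * z)
                t = ζ * κ * ρ′
                ζ-real : conj ζ ≈ ζ
                ζ-real = trans (conj-neg _) (-‿cong (trans (conj-* _ _) (*-cong (self-real x) z-real)))
                conj-t : conj t ≈ ζ * conj κ * conj ρ′
                conj-t = trans (conj-* _ _) (*-congʳ (trans (conj-* _ _) (*-congʳ ζ-real)))
                vt : V (+ 1) t
                vt = V-cast (Z.solve 2 (λ j h → (con (+ 1) :+ (j :+ h)) :+ con (+ 0) :- h :- j := con (+ 1)) ≡.refl j h)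
                       (V-* (V-* (V-neg (V-* vα vz)) (W⇒V W-κ)) (W⇒V Wρ′))

        even-plane : ∀ {x y j} → W j (Φ x y) → V (+ 1 ℤ.+ (j ℤ.+ h)) (Φ x x) → V (+ 1 ℤ.+ (j ℤ.+ h)) (Φ y y) →
          Even (j ℤ.+ h) → ∃ λ t → 𝒪 t × W (j ℤ.+ h) (Φ (t *ₗ x +ᴹ y) (t *ₗ x +ᴹ y))
        even-plane {x} {y} {j} Wρ vα vβ (k , eq) with invert Wρ | real-exists k
        ... | ρ′ , ρρ′≈1 , Wρ′ | z , z-real , Wz = t , W⇒V Wt ,
            W-resp (sym (Φ-plane t x y)) (W-+ʳ (V-+ (V-cast (ℤ.+-identityˡ _) (V-* (V-* (W⇒V Wt) (V-conj (W⇒V Wt))) vα)) vβ)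
              (W-resp (sym (Tr-solved ρρ′≈1 z-real)) (W-cast (≡.sym eq) Wz)))
          where
          t = z * κ * ρ′
          Wt : W (+ 0) t
          Wt = W-cast (≡.trans (≡.cong (λ u → u ℤ.- h ℤ.- j) (≡.sym eq))
                 (Z.solve 2 (λ j h → (j :+ h) :- h :- j := con (+ 0)) ≡.refl j h)) (W-* (W-* Wz W-κ) Wρ′)

        record Plane {p} (M : Pred Carrierᴹ p) : Set (c ⊔ ℓ ⊔ v ⊔ ℓv ⊔ p) where
          field
            x y  : Carrierᴹ
            j    : ℤ
            x∈   : M x
            y∈   : M y
            xx   : Φ x x ≈ 0#
            yy   : Φ y y ≈ 0#
            W-xy : W j (Φ x y)
            Vx   : ∀ z → M z → V j (Φ z x)
            Vy   : ∀ z → M z → V j (Φ z y)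

        module Projection {p} {M : Pred Carrierᴹ p} (P : Plane M) where
          open Plane P

          ρ′ : Carrier
          ρ′ = proj₁ (invert W-xy)

          ρρ′≈1 : Φ x y * ρ′ ≈ 1#
          ρρ′≈1 = proj₁ (proj₂ (invert W-xy))

          W-ρ′ : W (ℤ.- j) ρ′
          W-ρ′ = proj₂ (proj₂ (invert W-xy))

          ρ̄ρ̄′≈1 : Φ y x * conj ρ′ ≈ 1#
          ρ̄ρ̄′≈1 = trans (*-congʳ (Φ-conj x y)) (trans (sym (conj-* _ _)) (trans (conj-cong ρρ′≈1) conj-1))

          α β : Carrierᴹ → Carrier
          α z = Φ z y * ρ′
          β z = Φ z x * conj ρ′

          scaled : ∀ y c → Functional (λ x → Φ x y * c)
          scaled y c = quasi-functional c y

          along : (Carrierᴹ → Carrier) → Carrierᴹ → Carrierᴹ → Carrierᴹ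
          along f s z = (- f z) *ₗ s +ᴹ z

          along-cong : ∀ {f} → Functional f → ∀ s {z z′} → z ≈ᴹ z′ → along f s z ≈ᴹ along f s z′
          along-cong F s z≈ = +ᴹ-cong (*ₗ-cong (-‿cong (Functional.cong F z≈)) ≈ᴹ-refl) z≈

          along-linear : ∀ {f} → Functional f → ∀ s a u z → along f s (a *ₗ u +ᴹ z) ≈ᴹ a *ₗ along f s u +ᴹ along f s z
          along-linear F s a u z = ≈ᴹ-trans (+ᴹ-cong (*ₗ-cong (trans (-‿cong (Functional.linear F a u z))
            (solve 3 (λ a x y → :- (a :* x :+ y) := a :* :- x :- y) refl a _ _)) ≈ᴹ-refl) ≈ᴹ-refl)
            (≈ᴹ-sym (regroup _ _ s u z a))

          q p′ : Carrierᴹ → Carrierᴹ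
          q  = along β y
          p′ = along α x ∘ q

          Fα : Functional α
          Fα = scaled y ρ′

          Fβ : Functional β
          Fβ = scaled x (conj ρ′)

          p-cong : ∀ {z z′} → z ≈ᴹ z′ → p′ z ≈ᴹ p′ z′
          p-cong z≈ = along-cong Fα x (along-cong Fβ y z≈)

          p-linear : ∀ a u z → p′ (a *ₗ u +ᴹ z) ≈ᴹ a *ₗ p′ u +ᴹ p′ z
          p-linear a u z = ≈ᴹ-trans (along-cong Fα x (along-linear Fβ y a u z)) (along-linear Fα x a (q u) (q z))

          p-0 : ∀ {z} → z ≈ᴹ 0ᴹ → p′ z ≈ᴹ 0ᴹ
          p-0 {z} z≈0 = ≈ᴹ-trans (p-cong z≈0) (≈ᴹ-trans (along-cong Fα x (zero-fixed Fβ y)) (zero-fixed Fα x))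
            where
            zero-fixed : ∀ {f} → Functional f → ∀ s → along f s 0ᴹ ≈ᴹ 0ᴹ
            zero-fixed F s = ≈ᴹ-trans (+ᴹ-identityʳ _) (≈ᴹ-trans (*ₗ-cong (trans (-‿cong (Functional.0-homo F))
              (solve 0 (:- con (+ 0) := con (+ 0)) refl)) ≈ᴹ-refl) (*ₗ-zeroˡ s))

          along-kills : ∀ f s → f s ≈ 1# → along f s s ≈ᴹ 0ᴹ
          along-kills f s eq = ≈ᴹ-trans (+ᴹ-cong (*ₗ-cong (-‿cong eq) ≈ᴹ-refl) (≈ᴹ-sym (*ₗ-identityˡ s)))
            (≈ᴹ-trans (≈ᴹ-sym (*ₗ-distribʳ s _ _)) (≈ᴹ-trans (*ₗ-cong (-‿inverseˡ 1#) ≈ᴹ-refl) (*ₗ-zeroˡ s)))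

          along-fixes : ∀ f s {z} → f z ≈ 0# → along f s z ≈ᴹ z
          along-fixes f s eq = ≈ᴹ-trans (+ᴹ-cong (≈ᴹ-trans (*ₗ-cong (trans (-‿cong eq)
              (solve 0 (:- con (+ 0) := con (+ 0)) refl)) ≈ᴹ-refl) (*ₗ-zeroˡ s)) ≈ᴹ-refl) (+ᴹ-identityˡ _)

          p-x : p′ x ≈ᴹ 0ᴹ
          p-x = ≈ᴹ-trans (along-cong Fα x (along-fixes β y (trans (*-congʳ xx) (zeroˡ _)))) (along-kills α x ρρ′≈1)

          p-y : p′ y ≈ᴹ 0ᴹ
          p-y = ≈ᴹ-trans (along-cong Fα x (≈ᴹ-trans (along-kills β y ρ̄ρ̄′≈1) ≈ᴹ-refl)) (≈ᴹ-trans (along-fixes α x (Functional.0-homo Fα)) ≈ᴹ-refl)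

          decompose : ∀ z → z ≈ᴹ β z *ₗ y +ᴹ (α (q z) *ₗ x +ᴹ p′ z)
          decompose z = ≈ᴹ-trans (split-off (β z) y z) (+ᴹ-cong ≈ᴹ-refl (split-off (α (q z)) x (q z)))

          ⊥x : ∀ z → Φ (p′ z) x ≈ 0#
          ⊥x z = begin
            Φ (p′ z) x                        ≈⟨ Φ-linearˡ _ _ _ _ ⟩
            - α (q z) * Φ x x + Φ (q z) x     ≈⟨ +-cong (trans (*-congˡ xx) (zeroʳ _)) (Φ-linearˡ _ _ _ _) ⟩
            0# + (- β z * Φ y x + Φ z x)
              ≈⟨ solve 3 (λ u r′ r → con (+ 0) :+ (:- (u :* r′) :* r :+ u) := u :* (con (+ 1) :- r :* r′)) refl (Φ z x) (conj ρ′) (Φ y x) ⟩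
            Φ z x * (1# - Φ y x * conj ρ′)    ≈⟨ *-congˡ (trans (+-congˡ (-‿cong ρ̄ρ̄′≈1)) (-‿inverseʳ _)) ⟩
            Φ z x * 0#                        ≈⟨ zeroʳ _ ⟩
            0#                                ∎

          Φ-qy : ∀ z → Φ (q z) y ≈ Φ z y
          Φ-qy z = trans (Φ-linearˡ _ _ _ _) (trans (+-congʳ (trans (*-congˡ yy) (zeroʳ _))) (+-identityˡ _))

          ⊥y : ∀ z → Φ (p′ z) y ≈ 0#
          ⊥y z = begin
            Φ (p′ z) y                        ≈⟨ Φ-linearˡ _ _ _ _ ⟩
            - α (q z) * Φ x y + Φ (q z) y
              ≈⟨ solve 3 (λ u r′ r → :- (u :* r′) :* r :+ u := u :* (con (+ 1) :- r :* r′)) refl (Φ (q z) y) ρ′ (Φ x y) ⟩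
            Φ (q z) y * (1# - Φ x y * ρ′)     ≈⟨ *-congˡ (trans (+-congˡ (-‿cong ρρ′≈1)) (-‿inverseʳ _)) ⟩
            Φ (q z) y * 0#                    ≈⟨ zeroʳ _ ⟩
            0#                                ∎

          integral : ∀ {u c} → V j u → W (ℤ.- j) c → 𝒪 (u * c)
          integral vu Wc = V-cast (ℤ.+-inverseʳ j) (V-* vu (W⇒V Wc))

          α-integral : ∀ z → M z → 𝒪 (α (q z))
          α-integral z z∈ = integral (V-resp (sym (Φ-qy z)) (Vy z z∈)) W-ρ′

          β-integral : ∀ z → M z → 𝒪 (β z)
          β-integral z z∈ = integral (Vx z z∈) (W-conj W-ρ′)

        module HyperbolicPlane {p} {M : Pred Carrierᴹ p} (SM : IsSubmodule M) {a b j} (a∈ : M a) (b∈ : M b)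
            (bound : ∀ {x y} → M x → M y → V j (Φ x y)) (Wρ : W j (Φ a b)) (vβ : V (+ 1 ℤ.+ (j ℤ.+ h)) (Φ b b))
            {t} (vt : V (+ 1) t) (xx≈0 : Φ (t *ₗ b +ᴹ a) (t *ₗ b +ᴹ a) ≈ 0#) where
          open IsSubmodule SM

          x : Carrierᴹ
          x = t *ₗ b +ᴹ a

          x∈ : M x
          x∈ = L-comb (V-mono (ℤ.+≤+ z≤n) vt) b∈ a∈

          Wxb : W j (Φ x b)
          Wxb = W-resp (sym (Φ-linearˡ _ _ _ _)) (W-+ʳ (V-mono (cert (+ 1 ℤ.+ h) (nonneg-+ nonneg 0≤h)
                  (Z.solve 2 (λ j h → con (+ 1) :+ (con (+ 1) :+ (j :+ h)) := (con (+ 1) :+ j) :+ (con (+ 1) :+ h)) ≡.refl j h))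
                  (V-* vt vβ)) Wρ)

          module _ {ρ′} (ρρ′≈1 : Φ x b * ρ′ ≈ 1#) (Wρ′ : W (ℤ.- j) ρ′) where
            r : Carrier
            r = (- Φ b b) * κ * ρ′

            y : Carrierᴹ
            y = r *ₗ x +ᴹ b

            y∈ : M y
            y∈ = L-comb (V-mono (ℤ.+≤+ (z≤n {1})) (V-cast (Z.solve 2 (λ j h → (con (+ 1) :+ (j :+ h)) :- h :- j := con (+ 1)) ≡.refl j h)
                   (V-* (V-* (V-neg vβ) (W⇒V W-κ)) (W⇒V Wρ′)))) x∈ b∈

            yy≈0 : Φ y y ≈ 0#
            yy≈0 = begin
              Φ y y                                       ≈⟨ Φ-plane r x b ⟩
              (r * conj r * Φ x x + Φ b b) + Tr (r * Φ x b) ≈⟨ +-cong (+-congʳ (trans (*-congˡ xx≈0) (zeroʳ _)))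
                                                              (Tr-solved ρρ′≈1 (trans (conj-neg _) (-‿cong (self-real b)))) ⟩
              (0# + Φ b b) - Φ b b                        ≈⟨ solve 1 (λ u → (con (+ 0) :+ u) :- u := con (+ 0)) refl _ ⟩
              0#                                          ∎

            W-xy : W j (Φ x y)
            W-xy = W-resp (sym (trans (Φ-linearʳ _ _ _ _) (trans (+-congʳ (trans (*-congˡ xx≈0) (zeroʳ _))) (+-identityˡ _)))) Wxb

            plane : Plane M
            plane = record
              { x = x ; y = y ; j = j ; x∈ = x∈ ; y∈ = y∈ ; xx = xx≈0 ; yy = yy≈0 ; W-xy = W-xy
              ; Vx = λ z z∈ → bound z∈ x∈ ; Vy = λ z z∈ → bound z∈ y∈ }

        vanishing : ∀ {n} {g : Fin n → Carrierᴹ} → NonDegenerate g → (∀ i k → Φ (g i) (g k) ≈ 0#) → Frame ⟨ g ⟩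
        vanishing {g = g} nd zeros = record
          { k = 0 ; x = λ () ; y = λ () ; σ = λ () ; odd = λ () ; x∈ = λ () ; y∈ = λ () ; xx = λ () ; yy = λ () ; xy = λ ()
          ; W-xy = λ ()
          ; spans = span-⊆ span-submodule λ { (i , ≡.refl) → null (nd (g i) (at g i) (zeros i)) }
          }

        module Extend {m n} {M : Pred Carrierᴹ m} {N : Pred Carrierᴹ n} (SM : IsSubmodule M) (SN : IsSubmodule N)
                      (P : Plane M) (N⊆M : N ⊆ M)
                      (N⊥x : ∀ z → N z → Φ z (Plane.x P) ≈ 0#) (N⊥y : ∀ z → N z → Φ z (Plane.y P) ≈ 0#)
                      (p-N : ∀ z → M z → N (Projection.p′ P z)) where
          open Projection P
          private module P = Plane P

          Φ-p : ∀ z s → N s → Φ z s ≈ Φ (p′ z) s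
          Φ-p z s s∈ = begin
            Φ z s                                            ≈⟨ Φ-cong (decompose z) ≈ᴹ-refl ⟩
            Φ (β z *ₗ P.y +ᴹ (α (q z) *ₗ P.x +ᴹ p′ z)) s     ≈⟨ trans (Φ-linearˡ _ _ _ _) (+-congˡ (Φ-linearˡ _ _ _ _)) ⟩
            β z * Φ P.y s + (α (q z) * Φ P.x s + Φ (p′ z) s) ≈⟨ +-cong (*-congˡ (sym-zero (N⊥y s s∈))) (+-congʳ (*-congˡ (sym-zero (N⊥x s s∈)))) ⟩
            β z * 0# + (α (q z) * 0# + Φ (p′ z) s)           ≈⟨ solve 3 (λ a b c → a :* con (+ 0) :+ (b :* con (+ 0) :+ c) := c) refl _ _ _ ⟩
            Φ (p′ z) s                                       ∎

          extend-good : GoodVector h N → GoodVector h M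
          extend-good G = record
            { s = G.s ; j = G.j ; k = G.k ; s∈ = N⊆M G.s∈
            ; bound = λ z z∈ → V-resp (sym (Φ-p z G.s G.s∈)) (G.bound (p′ z) (p-N z z∈))
            ; W-ss = G.W-ss ; k≤ = G.k≤ }
            where module G = GoodVector G

          extend-frame : Odd (P.j ℤ.+ h) → Frame N → Frame M
          extend-frame o F = record
            { k = suc F.k
            ; x = xs ; y = ys
            ; σ = λ { zero → P.j ; (suc i) → F.σ i }
            ; odd = λ { zero → o ; (suc i) → F.odd i }
            ; x∈ = λ { zero → P.x∈ ; (suc i) → N⊆M (F.x∈ i) } ; y∈ = λ { zero → P.y∈ ; (suc i) → N⊆M (F.y∈ i) }
            ; xx = λ { zero zero → P.xx ; zero (suc j) → sym-zero (N⊥x _ (F.x∈ j)) ; (suc i) zero → N⊥x _ (F.x∈ i) ; (suc i) (suc j) → F.xx i j }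
            ; yy = λ { zero zero → P.yy ; zero (suc j) → sym-zero (N⊥y _ (F.y∈ j)) ; (suc i) zero → N⊥y _ (F.y∈ i) ; (suc i) (suc j) → F.yy i j }
            ; xy = λ { zero zero 0≢0 → ⊥-elim (0≢0 ≡.refl) ; zero (suc j) _ → sym-zero (N⊥x _ (F.y∈ j)) ; (suc i) zero _ → N⊥y _ (F.x∈ i)
                     ; (suc i) (suc j) i≢j → F.xy i j (i≢j ∘ ≡.cong suc) }
            ; W-xy = λ { zero → P.W-xy ; (suc i) → F.W-xy i }
            ; spans = λ {z} z∈ → comb (β-integral z z∈) (gen (zero , inj₂ ≡.refl))
                (comb (α-integral z z∈) (gen (zero , inj₁ ≡.refl)) (weaken (F.spans (p-N z z∈))) ≈ᴹ-refl) (decompose z)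
            }
            where
            module F = Frame F
            xs ys : Fin (suc F.k) → Carrierᴹ
            xs zero    = P.x
            xs (suc i) = F.x i
            ys zero    = P.y
            ys (suc i) = F.y i
            weaken : ∀ {z} → Span (λ z → ∃ λ i → z ≡ F.x i ⊎ z ≡ F.y i) z → Span (λ z → ∃ λ i → z ≡ xs i ⊎ z ≡ ys i) z
            weaken = span-⊆ span-submodule λ { (i , inj₁ eq) → gen (suc i , inj₁ eq) ; (i , inj₂ eq) → gen (suc i , inj₂ eq) }

        good⊎frame : ∀ {n} (g : Fin n → Carrierᴹ) → NonDegenerate g → GoodVector h ⟨ g ⟩ ⊎ Frame ⟨ g ⟩

        reduce : ∀ {n} (g : Fin (suc (suc n)) → Carrierᴹ) → NonDegenerate g → ∀ a b → a ≢ b → (P : Plane ⟨ g ⟩) → ∀ {t r} →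
          Plane.x P ≈ᴹ t *ₗ g b +ᴹ g a → Plane.y P ≈ᴹ r *ₗ Plane.x P +ᴹ g b → Odd (Plane.j P ℤ.+ h) →
          GoodVector h ⟨ g ⟩ ⊎ Frame ⟨ g ⟩
        reduce {n} g nd a b a≢b P x≈ y≈ o = [ inj₁ ∘ E.extend-good , inj₂ ∘ E.extend-frame o ]′ (good⊎frame g′ nd′)
          where
          open Projection P
          module P = Plane P
          b′ : Fin (suc n)
          b′ = punchOut a≢b
          index : Fin n → Fin (suc (suc n))
          index = punchIn a ∘ punchIn b′
          cover₂ : ∀ i → i ≡ a ⊎ i ≡ b ⊎ ∃ λ k → i ≡ index k
          cover₂ i with cover a i
          ... | inj₁ i≡a = inj₁ i≡a
          ... | inj₂ (l , i≡l) with cover b′ l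
          ...   | inj₁ l≡b′ = inj₂ (inj₁ (≡.trans i≡l (≡.trans (≡.cong (punchIn a) l≡b′) (Fin.punchIn-punchOut a≢b))))
          ...   | inj₂ (k , l≡k) = inj₂ (inj₂ (k , ≡.trans i≡l (≡.cong (punchIn a) l≡k)))
          g′ : Fin n → Carrierᴹ
          g′ = p′ ∘ g ∘ index
          killed : ∀ {c u z} → p′ (c *ₗ u +ᴹ z) ≈ᴹ 0ᴹ → p′ u ≈ᴹ 0ᴹ → p′ z ≈ᴹ 0ᴹ
          killed {c} {u} {z} sum≈0 u≈0 = ≈ᴹ-trans (≈ᴹ-sym (≈ᴹ-trans (+ᴹ-cong (≈ᴹ-trans (*ₗ-cong refl u≈0) (*ₗ-zeroʳ c)) ≈ᴹ-refl) (+ᴹ-identityˡ _)))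
            (≈ᴹ-trans (≈ᴹ-sym (p-linear c u z)) sum≈0)
          p-b : p′ (g b) ≈ᴹ 0ᴹ
          p-b = killed (≈ᴹ-trans (p-cong (≈ᴹ-sym y≈)) p-y) p-x
          p-a : p′ (g a) ≈ᴹ 0ᴹ
          p-a = killed (≈ᴹ-trans (p-cong (≈ᴹ-sym x≈)) p-x) p-b
          p-g : ∀ i → ⟨ g′ ⟩ (p′ (g i))
          p-g i with cover₂ i
          ... | inj₁ ≡.refl = null p-a
          ... | inj₂ (inj₁ ≡.refl) = null p-b
          ... | inj₂ (inj₂ (k , ≡.refl)) = at g′ k
          p-span : ∀ z → ⟨ g ⟩ z → ⟨ g′ ⟩ (p′ z)
          p-span z (gen (i , ≡.refl)) = p-g i
          p-span z (null z≈0) = null (p-0 z≈0)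
          p-span z (comb {y = z′} c u v z≈) = comb c (p-span _ u) (p-span z′ v) (≈ᴹ-trans (p-cong z≈) (p-linear _ _ z′))
          orthogonal : ∀ u → (∀ z → Φ (p′ z) u ≈ 0#) → ∀ z → ⟨ g′ ⟩ z → Φ z u ≈ 0#
          orthogonal u h z = span-orthogonal u (λ { _ (k , ≡.refl) → h (g (index k)) })
          submodule = span-submodule {S = λ z → ∃ λ i → z ≡ g i}
          ⊆g : ⟨ g′ ⟩ ⊆ ⟨ g ⟩
          ⊆g = span-⊆ submodule λ { (k , ≡.refl) → project (g (index k)) (at g (index k)) }
            where
            open IsSubmodule submodule
            project : ∀ z → ⟨ g ⟩ z → ⟨ g ⟩ (p′ z)
            project z z∈ = L-comb (𝒪-neg (α-integral z z∈)) P.x∈ (L-comb (𝒪-neg (β-integral z z∈)) P.y∈ z∈)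
          module E = Extend submodule (span-submodule {S = λ z → ∃ λ i → z ≡ g′ i}) P ⊆g (orthogonal P.x ⊥x) (orthogonal P.y ⊥y) p-span
          nd′ : NonDegenerate g′
          nd′ z z∈ z⊥ = nd z (⊆g z∈) λ i → begin
            Φ z (g i)          ≈⟨ Φ-conj _ _ ⟩
            conj (Φ (g i) z)   ≈⟨ conj-cong (trans (E.Φ-p (g i) z z∈) (span-orthogonal z (λ { _ (k , ≡.refl) → sym-zero (z⊥ k) }) (p-g i))) ⟩
            conj 0#            ≈⟨ conj-0 ⟩
            0#                 ∎

        good⊎frame g nd with minimum₂ (λ i k → w (Φ (g i) (g k)))
        ... | inj₁ all = inj₂ (vanishing nd (λ i k → w-∞ _ (all i k)))
        ... | inj₂ (a , b , j , Wρ , bound) with Fin.all? (λ i → V? (+ 1 ℤ.+ (j ℤ.+ h)) (Φ (g i) (g i)))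
        ...   | no ¬diag = inj₁ (good (Fin.¬∀⟶∃¬ _ _ (λ i → V? (+ 1 ℤ.+ (j ℤ.+ h)) (Φ (g i) (g i))) ¬diag))
          where
          good : (∃ λ i → ¬ V (+ 1 ℤ.+ (j ℤ.+ h)) (Φ (g i) (g i))) → GoodVector h ⟨ g ⟩
          good (i , ¬v) with V-or-W (+ 1 ℤ.+ (j ℤ.+ h)) (Φ (g i) (g i))
          ... | inj₁ v = ⊥-elim (¬v v)
          ... | inj₂ (k , Wk , k<) = record
            { s = g i ; j = j ; k = k ; s∈ = at g i ; bound = λ z z∈ → gens-V bound z∈ (at g i) ; W-ss = Wk ; k≤ = suc-cancel-≤ k< }
        ...   | yes diag with parity (j ℤ.+ h)
        ...     | inj₁ e = inj₁ (good (even-plane Wρ (diag a) (diag b) e))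
          where
          good : (∃ λ t → 𝒪 t × W (j ℤ.+ h) (Φ (t *ₗ g a +ᴹ g b) (t *ₗ g a +ᴹ g b))) → GoodVector h ⟨ g ⟩
          good (t , t∈ , Ws) = record
            { s = t *ₗ g a +ᴹ g b ; j = j ; k = j ℤ.+ h ; s∈ = s∈ ; bound = λ z z∈ → gens-V bound z∈ s∈ ; W-ss = Ws ; k≤ = ℤ.≤-refl }
            where s∈ = IsSubmodule.L-comb span-submodule t∈ (at g a) (at g b)
        ...     | inj₂ o with a Fin.≟ b
        ...       | yes ≡.refl = ⊥-elim (suc≰ (ℤ.≤-trans (cert h 0≤h (Z.solve 2 (λ j h → con (+ 1) :+ (j :+ h) := (con (+ 1) :+ j) :+ h) ≡.refl j h))
                                      (W-V Wρ (diag a))))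
        good⊎frame {suc zero} g nd | inj₂ (zero , zero , _) | yes diag | inj₂ o | no a≢b = ⊥-elim (a≢b ≡.refl)
        good⊎frame {suc (suc n)} g nd | inj₂ (a , b , j , Wρ , bound) | yes diag | inj₂ o | no a≢b = finish (isotropic Wρ (diag a) (diag b))
          where
          finish : (∃ λ t → V (+ 1) t × Φ (t *ₗ g b +ᴹ g a) (t *ₗ g b +ᴹ g a) ≈ 0#) → GoodVector h ⟨ g ⟩ ⊎ Frame ⟨ g ⟩
          finish (t , vt , xx≈0) = conclude (invert H.Wxb)
            where
            module H = HyperbolicPlane span-submodule (at g a) (at g b) (gens-V bound) Wρ (diag b) vt xx≈0
            conclude : (∃ λ ρ′ → Φ H.x (g b) * ρ′ ≈ 1# × W (ℤ.- j) ρ′) → GoodVector h ⟨ g ⟩ ⊎ Frame ⟨ g ⟩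
            conclude (ρ′ , ρρ′≈1 , Wρ′) = reduce g nd a b a≢b (H.plane ρρ′≈1 Wρ′) ≈ᴹ-refl ≈ᴹ-refl o

        module _ {p} {L : Pred Carrierᴹ p} (SM : IsSubmodule L) (F : Frame L) where
          open Frame F
          open IsSubmodule SM

          V-xy : ∀ i {z} → L z → V (σ i) (Φ z (x i)) × V (σ i) (Φ z (y i))
          V-xy i z∈ = span-V (x i) left (spans z∈) , span-V (y i) right (spans z∈)
            where
            left : ∀ z → (∃ λ j → z ≡ x j ⊎ z ≡ y j) → V (σ i) (Φ z (x i))
            left _ (j , inj₁ ≡.refl) = V-zero (xx j i)
            left _ (j , inj₂ ≡.refl) with i Fin.≟ j
            ... | yes ≡.refl = V-resp (sym (Φ-conj (x i) (y i))) (V-conj (W⇒V (W-xy i)))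
            ... | no i≢j = V-zero (sym-zero (xy i j i≢j))
            right : ∀ z → (∃ λ j → z ≡ x j ⊎ z ≡ y j) → V (σ i) (Φ z (y i))
            right _ (j , inj₂ ≡.refl) = V-zero (yy j i)
            right _ (j , inj₁ ≡.refl) with j Fin.≟ i
            ... | yes ≡.refl = W⇒V (W-xy i)
            ... | no j≢i = V-zero (xy j i j≢i)

          nearly-good : Fin k → GoodVector (+ 1 ℤ.+ h) L
          nearly-good i = record
            { s = s ; j = σ i ; k = + 1 ℤ.+ (σ i ℤ.+ h) ; s∈ = L-comb t∈ (x∈ i) (y∈ i)
            ; bound = λ z z∈ → V-resp (sym (Φ-linearʳ t (x i) (y i) z))
                (V-+ (V-cast (ℤ.+-identityˡ (σ i)) (V-* (V-conj t∈) (proj₁ (V-xy i z∈)))) (proj₂ (V-xy i z∈)))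
            ; W-ss = W-resp (sym (trans (Φ-plane t (x i) (y i)) (trans (+-congʳ (trans (+-cong (trans (*-congˡ (xx i i)) (zeroʳ _)) (yy i i)) (+-identityˡ _)))
                (trans (+-identityˡ _) (Tr-solved ρρ′≈1 z-real))))) Wz
            ; k≤ = ℤ.≤-reflexive (Z.solve 2 (λ s h → con (+ 1) :+ (s :+ h) := s :+ (con (+ 1) :+ h)) ≡.refl (σ i) h)
            }
            where
            m = proj₁ (odd i)
            ρ′ = proj₁ (invert (W-xy i))
            ρρ′≈1 = proj₁ (proj₂ (invert (W-xy i)))
            z = proj₁ (real-exists (+ 1 ℤ.+ m))
            z-real = proj₁ (proj₂ (real-exists (+ 1 ℤ.+ m)))
            Wz : W (+ 1 ℤ.+ (σ i ℤ.+ h)) z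
            Wz = W-cast (≡.trans (Z.solve 1 (λ m → (con (+ 1) :+ m) :+ (con (+ 1) :+ m) := con (+ 1) :+ (con (+ 1) :+ (m :+ m))) ≡.refl m)
                   (≡.cong ℤ.suc (≡.sym (proj₂ (odd i))))) (proj₂ (proj₂ (real-exists (+ 1 ℤ.+ m))))
            t = z * κ * ρ′
            s = t *ₗ x i +ᴹ y i
            t∈ : 𝒪 t
            t∈ = V-mono (ℤ.+≤+ (z≤n {1})) (V-cast (Z.solve 2 (λ s h → con (+ 1) :+ (s :+ h) :- h :- s := con (+ 1)) ≡.refl (σ i) h)
                   (W⇒V (W-* (W-* Wz W-κ) (proj₂ (proj₂ (invert (W-xy i)))))))

        double : ℕ → ℕ
        double zero    = zero
        double (suc k) = suc (suc (double k))

        interleave : ∀ {a} {A : Set a} {k} → (Fin k → A) → (Fin k → A) → Fin (double k) → A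
        interleave {k = suc k} f g zero          = f zero
        interleave {k = suc k} f g (suc zero)    = g zero
        interleave {k = suc k} f g (suc (suc i)) = interleave (f ∘ suc) (g ∘ suc) i

        interleave-all : ∀ {a p} {A : Set a} (P : A → Set p) {k} {f g : Fin k → A} → (∀ i → P (f i)) → (∀ i → P (g i)) → ∀ i → P (interleave f g i)
        interleave-all P {suc k} pf pg zero          = pf zero
        interleave-all P {suc k} pf pg (suc zero)    = pg zero
        interleave-all P {suc k} pf pg (suc (suc i)) = interleave-all P (pf ∘ suc) (pg ∘ suc) i

        ∑ᶠ : ∀ k → (Fin k → Carrier) → Carrier
        ∑ᶠ zero    t = 0#
        ∑ᶠ (suc k) t = t zero + ∑ᶠ k (t ∘ suc)

        ∑ᶠ-cong : ∀ {k} {s t : Fin k → Carrier} → (∀ i → s i ≈ t i) → ∑ᶠ k s ≈ ∑ᶠ k t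
        ∑ᶠ-cong {zero} h = refl
        ∑ᶠ-cong {suc k} h = +-cong (h zero) (∑ᶠ-cong (h ∘ suc))

        ∑ᶠ-zero : ∀ {k} {t : Fin k → Carrier} → (∀ i → t i ≈ 0#) → ∑ᶠ k t ≈ 0#
        ∑ᶠ-zero {zero} h = refl
        ∑ᶠ-zero {suc k} h = trans (+-cong (h zero) (∑ᶠ-zero (h ∘ suc))) (+-identityˡ _)

        ∑ᶠ-single : ∀ {k} {t : Fin k → Carrier} j → (∀ i → i ≢ j → t i ≈ 0#) → ∑ᶠ k t ≈ t j
        ∑ᶠ-single {suc k} zero h = trans (+-congˡ (∑ᶠ-zero (λ i → h (suc i) λ ()))) (+-identityʳ _)
        ∑ᶠ-single {suc k} (suc j) h = trans (+-cong (h zero λ ()) (∑ᶠ-single j (λ i i≢j → h (suc i) (i≢j ∘ Fin.suc-injective)))) (+-identityˡ _)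

        combination : ∀ {k} → (Fin k → Carrierᴹ) → (Fin k → Carrierᴹ) → (Fin k → Carrier) → (Fin k → Carrier) → Carrierᴹ
        combination x y a b = sumᴹ (λ i → interleave a b i *ₗ interleave x y i)

        Φ-combination : ∀ {k} (x y : Fin k → Carrierᴹ) a b z →
          Φ (combination x y a b) z ≈ ∑ᶠ k (λ i → a i * Φ (x i) z + b i * Φ (y i) z)
        Φ-combination {zero} x y a b z = Φ-0ˡ z
        Φ-combination {suc k} x y a b z = trans (Φ-linearˡ _ _ _ _) (trans (+-congˡ (Φ-linearˡ _ _ _ _))
          (trans (sym (+-assoc _ _ _)) (+-congˡ (Φ-combination (x ∘ suc) (y ∘ suc) (a ∘ suc) (b ∘ suc) z))))

        -- A frame whose vectors y have been rescaled so that Φ (x i) (y i) is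
        -- a prescribed element P i of the same valuation.
        record Hyperbolic {p} (L : Pred Carrierᴹ p) {k} (P : Fin k → Carrier) : Set (c ⊔ ℓ ⊔ v ⊔ ℓv ⊔ p) where
          field
            x y   : Fin k → Carrierᴹ
            P′    : Fin k → Carrier
            PP′≈1 : ∀ i → P i * P′ i ≈ 1#
            x∈    : ∀ i → L (x i)
            y∈    : ∀ i → L (y i)
            xx    : ∀ i j → Φ (x i) (x j) ≈ 0#
            yy    : ∀ i j → Φ (y i) (y j) ≈ 0#
            xy    : ∀ i j → i ≢ j → Φ (x i) (y j) ≈ 0#
            xy-P  : ∀ i → Φ (x i) (y i) ≈ P i
            a∈    : ∀ i {z} → L z → 𝒪 (Φ z (y i) * P′ i)
            b∈    : ∀ i {z} → L z → 𝒪 (Φ z (x i) * conj (P′ i))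
            spans : L ⊆ Span (λ z → ∃ λ i → z ≡ x i ⊎ z ≡ y i)

        rescale : ∀ {p} {L : Pred Carrierᴹ p} → IsSubmodule L → (F : Frame L) → (P : Fin (Frame.k F) → Carrier) →
          (∀ i → W (Frame.σ F i) (P i)) → Hyperbolic L P
        rescale {L = L} SM F P W-P = record
          { x = F.x ; y = y ; P′ = P′ ; PP′≈1 = λ i → proj₁ (proj₂ (invert (W-P i))) ; x∈ = F.x∈ ; y∈ = λ i → L-* (c∈ i) (F.y∈ i)
          ; xx = F.xx
          ; yy = λ i j → trans (Φ-* _ _ _) (trans (*-congˡ (trans (Φ-y (F.y i) j) (trans (*-congˡ (F.yy i j)) (zeroʳ _)))) (zeroʳ _))
          ; xy = λ i j i≢j → trans (Φ-y (F.x i) j) (trans (*-congˡ (F.xy i j i≢j)) (zeroʳ _))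
          ; xy-P = λ i → trans (Φ-y (F.x i) i) (trans (*-congʳ (conj-involutive _))
              (trans (solve 3 (λ p r r′ → p :* r′ :* r := p :* (r :* r′)) refl (P i) _ (ρ′ i)) (trans (*-congˡ (proj₁ (proj₂ (invert (F.W-xy i))))) (*-identityʳ _))))
          ; a∈ = λ i z∈ → integral i (V-resp (sym (Φ-y _ i)) (V-cast (ℤ.+-identityˡ _) (V-* (V-conj (c∈ i)) (proj₂ (V-xy SM F i z∈))))) (W-P′ i)
          ; b∈ = λ i z∈ → integral i (proj₁ (V-xy SM F i z∈)) (W-conj (W-P′ i))
          ; spans = λ z∈ → span-⊆ span-submodule (λ
              { (i , inj₁ ≡.refl) → gen (i , inj₁ ≡.refl)
              ; (i , inj₂ ≡.refl) → comb (c′∈ i) (gen (i , inj₂ ≡.refl)) (null ≈ᴹ-refl) (unscale i) }) (F.spans z∈)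
          }
          where
          module F = Frame F
          open IsSubmodule SM
          ρ′ P′ c₁ c₁′ : Fin F.k → Carrier
          ρ′ i = proj₁ (invert (F.W-xy i))
          P′ i = proj₁ (invert (W-P i))
          W-P′ : ∀ i → W (ℤ.- F.σ i) (P′ i)
          W-P′ i = proj₂ (proj₂ (invert (W-P i)))
          c₁ i = conj (P i * ρ′ i)
          c₁′ i = conj (P′ i * Φ (F.x i) (F.y i))
          y : Fin F.k → Carrierᴹ
          y i = c₁ i *ₗ F.y i
          c∈ : ∀ i → 𝒪 (c₁ i)
          c∈ i = V-conj (V-cast (ℤ.+-inverseʳ (F.σ i)) (W⇒V (W-* (W-P i) (proj₂ (proj₂ (invert (F.W-xy i)))))))
          c′∈ : ∀ i → 𝒪 (c₁′ i)
          c′∈ i = V-conj (V-cast (ℤ.+-inverseˡ (F.σ i)) (W⇒V (W-* (W-P′ i) (F.W-xy i))))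
          Φ-y : ∀ z i → Φ z (y i) ≈ conj (c₁ i) * Φ z (F.y i)
          Φ-y z i = trans (Φ-conj _ _) (trans (conj-cong (Φ-* _ _ _)) (trans (conj-* _ _) (*-congˡ (sym (Φ-conj _ _)))))
          integral : ∀ i {u e} → V (F.σ i) u → W (ℤ.- F.σ i) e → 𝒪 (u * e)
          integral i vu We = V-cast (ℤ.+-inverseʳ (F.σ i)) (V-* vu (W⇒V We))
          unscale : ∀ i → F.y i ≈ᴹ c₁′ i *ₗ y i +ᴹ 0ᴹ
          unscale i = ≈ᴹ-sym (≈ᴹ-trans (+ᴹ-identityʳ _) (≈ᴹ-trans (≈ᴹ-sym (*ₗ-assoc _ _ _)) (≈ᴹ-trans (*ₗ-cong (begin
              conj (P′ i * ρ) * conj (P i * ρ′ i)  ≈⟨ conj-* _ _ ⟨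
              conj ((P′ i * ρ) * (P i * ρ′ i))     ≈⟨ conj-cong (solve 4 (λ p′ r p r′ → (p′ :* r) :* (p :* r′) := (p :* p′) :* (r :* r′)) refl (P′ i) ρ (P i) (ρ′ i)) ⟩
              conj ((P i * P′ i) * (ρ * ρ′ i))     ≈⟨ conj-cong (trans (*-cong (proj₁ (proj₂ (invert (W-P i)))) (proj₁ (proj₂ (invert (F.W-xy i))))) (*-identityˡ _)) ⟩
              conj 1#                              ≈⟨ conj-1 ⟩
              1#                                   ∎) ≈ᴹ-refl) (*ₗ-identityˡ _))))
            where ρ = Φ (F.x i) (F.y i)

        module Coordinates {p} {L : Pred Carrierᴹ p} (SM : IsSubmodule L)
            (nondeg : ∀ x → (∀ y → L y → Φ x y ≈ 0#) → x ≈ᴹ 0ᴹ) {k} {P : Fin k → Carrier} (H : Hyperbolic L P) where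
          open Hyperbolic H
          open IsSubmodule SM

          a b : Carrierᴹ → Fin k → Carrier
          a z i = Φ z (y i) * P′ i
          b z i = Φ z (x i) * conj (P′ i)

          P̄P̄′≈1 : ∀ i → conj (P i) * conj (P′ i) ≈ 1#
          P̄P̄′≈1 i = trans (sym (conj-* _ _)) (trans (conj-cong (PP′≈1 i)) conj-1)

          yx-P : ∀ i → Φ (y i) (x i) ≈ conj (P i)
          yx-P i = trans (Φ-conj (x i) (y i)) (conj-cong (xy-P i))

          Φ-y : ∀ r s j → Φ (combination x y r s) (y j) ≈ r j * P j
          Φ-y r s j = trans (Φ-combination x y r s (y j)) (trans (∑ᶠ-single j λ i i≢j →
              trans (+-cong (trans (*-congˡ (xy i j i≢j)) (zeroʳ _)) (trans (*-congˡ (yy i j)) (zeroʳ _))) (+-identityˡ _))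
            (trans (+-cong (*-congˡ (xy-P j)) (trans (*-congˡ (yy j j)) (zeroʳ _))) (+-identityʳ _)))

          Φ-x : ∀ r s j → Φ (combination x y r s) (x j) ≈ s j * conj (P j)
          Φ-x r s j = trans (Φ-combination x y r s (x j)) (trans (∑ᶠ-single j λ i i≢j →
              trans (+-cong (trans (*-congˡ (xx i j)) (zeroʳ _)) (trans (*-congˡ (sym-zero (xy j i (i≢j ∘ ≡.sym)))) (zeroʳ _))) (+-identityˡ _))
            (trans (+-cong (trans (*-congˡ (xx j j)) (zeroʳ _)) (*-congˡ (yx-P j))) (+-identityˡ _)))

          unfold : ∀ {r p p′} → p * p′ ≈ 1# → r * p * p′ ≈ r
          unfold pp′≈1 = trans (*-assoc _ _ _) (trans (*-congˡ pp′≈1) (*-identityʳ _))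

          unfold′ : ∀ {r p p′} → p * p′ ≈ 1# → r * p′ * p ≈ r
          unfold′ pp′≈1 = unfold (trans (*-comm _ _) pp′≈1)

          a-combination : ∀ r s j → a (combination x y r s) j ≈ r j
          a-combination r s j = trans (*-congʳ (Φ-y r s j)) (unfold (PP′≈1 j))

          b-combination : ∀ r s j → b (combination x y r s) j ≈ s j
          b-combination r s j = trans (*-congʳ (Φ-x r s j)) (unfold (P̄P̄′≈1 j))

          determined : ∀ z z′ → (∀ i → Φ z (y i) ≈ Φ z′ (y i)) → (∀ i → Φ z (x i) ≈ Φ z′ (x i)) → z ≈ᴹ z′
          determined z z′ ys xs = ≈ᴹ-trans (≈ᴹ-sym (≈ᴹ-trans (+ᴹ-cong ≈ᴹ-refl difference) (+ᴹ-identityʳ z)))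
              (≈ᴹ-trans (≈ᴹ-sym (+ᴹ-assoc _ _ _)) (≈ᴹ-trans (+ᴹ-cong (≈ᴹ-trans (+ᴹ-cong (≈ᴹ-sym (*ₗ-identityˡ z)) ≈ᴹ-refl)
                (≈ᴹ-trans (≈ᴹ-sym (*ₗ-distribʳ _ _ _)) (≈ᴹ-trans (*ₗ-cong (-‿inverseʳ 1#) ≈ᴹ-refl) (*ₗ-zeroˡ z)))) ≈ᴹ-refl) (+ᴹ-identityˡ z′)))
            where
            d = (- 1#) *ₗ z +ᴹ z′
            zero-on : ∀ {t} → Φ z t ≈ Φ z′ t → Φ t d ≈ 0#
            zero-on {t} eq = sym-zero (trans (Φ-linearˡ _ _ _ _) (trans (+-congˡ (sym eq)) (solve 1 (λ u → (:- con (+ 1)) :* u :+ u := con (+ 0)) refl _)))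
            difference : d ≈ᴹ 0ᴹ
            difference = nondeg d λ t t∈ → sym-zero (span-orthogonal d (λ
              { _ (i , inj₁ ≡.refl) → zero-on (xs i) ; _ (i , inj₂ ≡.refl) → zero-on (ys i) }) (spans t∈))

          expand : ∀ z → z ≈ᴹ combination x y (a z) (b z)
          expand z = determined _ _ (λ i → sym (trans (Φ-y (a z) (b z) i) (unfold′ (PP′≈1 i))))
                                    (λ i → sym (trans (Φ-x (a z) (b z) i) (unfold′ (P̄P̄′≈1 i))))

          Φ-expand : ∀ z z′ → Φ z z′ ≈ ∑ᶠ k (λ i → a z i * P i * conj (b z′ i) + b z i * conj (P i) * conj (a z′ i))
          Φ-expand z z′ = trans (Φ-cong (expand z) ≈ᴹ-refl) (trans (Φ-combination x y (a z) (b z) z′) (∑ᶠ-cong λ i → +-cong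
            (trans (*-congˡ (trans (Φ-conj z′ (x i)) (trans (conj-cong (sym (unfold′ (P̄P̄′≈1 i)))) (trans (conj-* _ _) (*-congˡ (conj-involutive _))))))
              (solve 3 (λ a b p → a :* (b :* p) := a :* p :* b) refl _ _ _))
            (trans (*-congˡ (trans (Φ-conj z′ (y i)) (trans (conj-cong (sym (unfold′ (PP′≈1 i)))) (conj-* _ _))))
              (solve 3 (λ a b p → a :* (b :* p) := a :* p :* b) refl _ _ _))))

          combination∈ : ∀ r s → (∀ i → 𝒪 (r i)) → (∀ i → 𝒪 (s i)) → L (combination x y r s)
          combination∈ r s r∈ s∈ = span-⊆ SM id (span-sum {S = L} (interleave r s) (interleave x y) (interleave-all 𝒪 r∈ s∈) (interleave-all L x∈ y∈))

          basis : Basis (double k)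
          basis = independent⇒basis (interleave x y) (λ z → interleave (a z) (b z)) expand independent
            where
            even odd : ∀ {k} → Fin k → Fin (double k)
            even zero = zero
            even (suc i) = suc (suc (even i))
            odd zero = suc zero
            odd (suc i) = suc (suc (odd i))
            recombine : ∀ {k} (r : Fin (double k) → Carrier) i → interleave {k = k} (r ∘ even) (r ∘ odd) i ≡ r i
            recombine {suc k} r zero = ≡.refl
            recombine {suc k} r (suc zero) = ≡.refl
            recombine {suc k} r (suc (suc i)) = recombine {k} (λ j → r (suc (suc j))) i
            independent : ∀ r → sumᴹ (λ i → r i *ₗ interleave x y i) ≈ᴹ 0ᴹ → ∀ i → r i ≈ 0#
            independent r sum≈0 i = trans (reflexive (≡.sym (recombine r i))) (interleave-all (_≈ 0#)
              (λ j → trans (sym (a-combination _ _ j)) (trans (*-congʳ (trans (Φ-cong zero′ ≈ᴹ-refl) (Φ-0ˡ _))) (zeroˡ _)))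
              (λ j → trans (sym (b-combination _ _ j)) (trans (*-congʳ (trans (Φ-cong zero′ ≈ᴹ-refl) (Φ-0ˡ _))) (zeroˡ _))) i)
              where
              zero′ : combination x y (r ∘ even) (r ∘ odd) ≈ᴹ 0ᴹ
              zero′ = ≈ᴹ-trans (sumᴹ-cong (λ i → *ₗ-cong (reflexive (recombine r i)) ≈ᴹ-refl)) sum≈0

        module Wall {p} (ramified : IsRamified R conj w h) (L : Pred Carrierᴹ p) where
          open Ramified ramified
          open IsRamified ramified using (ϖ; W-ϖ)

          Star : Set _
          Star = ∀ s j → L s → (∀ x → L x → V j (Φ s x)) → Even (j ℤ.+ h) → V (+ 1 ℤ.+ (j ℤ.+ h)) (Φ s s)

          Fixed : (Carrierᴹ → Carrierᴹ) → Pred Carrierᴹ _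
          Fixed φ x = φ x ≈ᴹ x

          Remaining : ∀ {n} → (Carrierᴹ → Carrierᴹ) → (Fin n → Carrierᴹ) → Pred Carrierᴹ _
          Remaining φ z x = (∃ λ i → x ≡ z i) ⊎ (L x × Fixed φ x)

          module _ {φ} (I : Isometry φ) where
            private module φ = Isometry I

            N : Carrierᴹ → Carrierᴹ
            N x = (- 1#) *ₗ φ x +ᴹ x

            χ : Carrierᴹ → Carrierᴹ → Carrier
            χ x y = Φ (N x) y

            χ≈ : ∀ x y → χ x y ≈ Φ x y - Φ (φ x) y
            χ≈ x y = trans (Φ-linearˡ _ _ _ _) (solve 2 (λ u v → (:- con (+ 1)) :* u :+ v := v :- u) refl _ _)

            χ-congˡ : ∀ {x x′} y → x ≈ᴹ x′ → χ x y ≈ χ x′ y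
            χ-congˡ y x≈ = Φ-cong (+ᴹ-cong (*ₗ-cong refl (φ.cong x≈)) x≈) ≈ᴹ-refl

            χ-congʳ : ∀ x {y y′} → y ≈ᴹ y′ → χ x y ≈ χ x y′
            χ-congʳ x y≈ = Φ-cong ≈ᴹ-refl y≈

            χ-linearˡ : ∀ a x x′ y → χ (a *ₗ x +ᴹ x′) y ≈ a * χ x y + χ x′ y
            χ-linearˡ a x x′ y = begin
              χ (a *ₗ x +ᴹ x′) y                                    ≈⟨ χ≈ _ y ⟩
              Φ (a *ₗ x +ᴹ x′) y - Φ (φ (a *ₗ x +ᴹ x′)) y           ≈⟨ +-cong (Φ-linearˡ a x x′ y)
                (-‿cong (trans (Φ-cong (φ.linear a x x′) ≈ᴹ-refl) (Φ-linearˡ a (φ x) (φ x′) y))) ⟩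
              (a * Φ x y + Φ x′ y) - (a * Φ (φ x) y + Φ (φ x′) y)
                ≈⟨ solve 5 (λ a u v p q → (a :* u :+ v) :- (a :* p :+ q) := a :* (u :- p) :+ (v :- q)) refl a _ _ _ _ ⟩
              a * (Φ x y - Φ (φ x) y) + (Φ x′ y - Φ (φ x′) y)       ≈⟨ +-cong (*-congˡ (χ≈ x y)) (χ≈ x′ y) ⟨
              a * χ x y + χ x′ y                                    ∎

            χ-linearʳ : ∀ a x y y′ → χ x (a *ₗ y +ᴹ y′) ≈ conj a * χ x y + χ x y′
            χ-linearʳ a x y y′ = Φ-linearʳ a y y′ (N x)

            χ-fixedˡ : ∀ {x} y → Fixed φ x → χ x y ≈ 0#
            χ-fixedˡ {x} y fx = trans (χ≈ x y) (trans (+-congˡ (-‿cong (Φ-cong fx ≈ᴹ-refl))) (-‿inverseʳ _))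

            χ-fixedʳ : ∀ x {y} → Fixed φ y → χ x y ≈ 0#
            χ-fixedʳ x {y} fy = trans (χ≈ x y) (trans (+-congˡ (-‿cong (trans (Φ-cong ≈ᴹ-refl (≈ᴹ-sym fy)) (φ.preserves x y)))) (-‿inverseʳ _))

            Φ-φN : ∀ v x → Φ (φ v) (N x) ≈ - χ v x
            Φ-φN v x = begin
              Φ (φ v) (N x)                       ≈⟨ Φ-linearʳ _ _ _ _ ⟩
              conj (- 1#) * Φ (φ v) (φ x) + Φ (φ v) x ≈⟨ +-congʳ (*-cong (trans (conj-neg 1#) (-‿cong conj-1)) (φ.preserves v x)) ⟩
              (- 1#) * Φ v x + Φ (φ v) x          ≈⟨ solve 2 (λ u v → (:- con (+ 1)) :* u :+ v := :- (u :- v)) refl _ _ ⟩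
              - (Φ v x - Φ (φ v) x)               ≈⟨ -‿cong (χ≈ v x) ⟨
              - χ v x                             ∎

            Φ-NN : ∀ x → Φ (N x) (N x) ≈ Tr (χ x x)
            Φ-NN x = begin
              Φ (N x) (N x)                         ≈⟨ Φ-linearˡ _ _ _ _ ⟩
              (- 1#) * Φ (φ x) (N x) + Φ x (N x)    ≈⟨ +-cong (*-congˡ (Φ-φN x x)) (Φ-conj (N x) x) ⟩
              (- 1#) * - χ x x + conj (χ x x)       ≈⟨ solve 2 (λ u v → (:- con (+ 1)) :* :- u :+ v := u :+ v) refl _ _ ⟩
              Tr (χ x x)                            ∎

            N-stable : (∀ {x} → L x → L (φ x)) → IsSubmodule L → ∀ {x} → L x → L (N x)
            N-stable stable SM x∈ = IsSubmodule.L-comb SM (𝒪-neg 𝒪-1) (stable x∈) x∈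

            -- Composing φ with a quasi-reflection along N x makes x fixed.
            module Fix x γ′ (γγ′≈1 : χ x x * γ′ ≈ 1#) where
              γ : Carrier
              γ = χ x x

              φ′ : Carrierᴹ → Carrierᴹ
              φ′ v = quasi γ′ (N x) (φ v)

              conj-γγ′ : conj γ * conj γ′ ≈ 1#
              conj-γγ′ = trans (sym (conj-* _ _)) (trans (conj-cong γγ′≈1) conj-1)

              balanced : Balanced γ′ (N x)
              balanced = begin
                γ′ + conj γ′                               ≈⟨ +-cong (trans (sym (*-identityˡ _)) (*-congʳ (sym conj-γγ′))) (trans (sym (*-identityˡ _)) (*-congʳ (sym γγ′≈1))) ⟩
                conj γ * conj γ′ * γ′ + γ * γ′ * conj γ′   ≈⟨ solve 4 (λ g ḡ k k̄ → ḡ :* k̄ :* k :+ g :* k :* k̄ := k :* k̄ :* (g :+ ḡ)) refl γ (conj γ) γ′ (conj γ′) ⟩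
                γ′ * conj γ′ * Tr γ                        ≈⟨ *-congˡ (Φ-NN x) ⟨
                γ′ * conj γ′ * Φ (N x) (N x)               ∎

              isometry : Isometry φ′
              isometry = record
                { isLinear  = record
                  { cong   = λ u≈v → quasi.cong (φ.cong u≈v)
                  ; linear = λ a u v → ≈ᴹ-trans (quasi.cong (φ.linear a u v)) (quasi.linear a (φ u) (φ v)) }
                ; preserves = λ u v → trans (quasi.preserves (φ u) (φ v)) (φ.preserves u v) }
                where module quasi = Isometry (quasi-isometry γ′ (N x) balanced)

              φ′≈ : ∀ v → φ′ v ≈ᴹ (χ v x * γ′) *ₗ N x +ᴹ φ v
              φ′≈ v = +ᴹ-cong (*ₗ-cong (trans (-‿cong (*-congʳ (Φ-φN v x))) (solve 2 (λ u c → :- ((:- u) :* c) := u :* c) refl _ _)) ≈ᴹ-refl) ≈ᴹ-refl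

              fixed-x : Fixed φ′ x
              fixed-x = ≈ᴹ-trans (φ′≈ x) (≈ᴹ-trans (+ᴹ-cong (≈ᴹ-trans (*ₗ-cong γγ′≈1 ≈ᴹ-refl) (*ₗ-identityˡ _)) (≈ᴹ-sym (*ₗ-identityˡ _)))
                (≈ᴹ-trans (≈ᴹ-trans (+ᴹ-cong (+ᴹ-comm _ _) ≈ᴹ-refl) (+ᴹ-assoc _ _ _))
                  (≈ᴹ-trans (+ᴹ-cong ≈ᴹ-refl (≈ᴹ-trans (≈ᴹ-sym (*ₗ-distribʳ _ _ _)) (≈ᴹ-trans (*ₗ-cong (-‿inverseˡ 1#) ≈ᴹ-refl) (*ₗ-zeroˡ _)))) (+ᴹ-identityʳ x))))

              fixed-mono : ∀ {y} → Fixed φ y → Fixed φ′ y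
              fixed-mono {y} fy = ≈ᴹ-trans (φ′≈ y) (≈ᴹ-trans (+ᴹ-cong (≈ᴹ-trans (*ₗ-cong (trans (*-congʳ (χ-fixedˡ x fy)) (zeroˡ _)) ≈ᴹ-refl) (*ₗ-zeroˡ _)) fy)
                (+ᴹ-identityˡ y))

              det-φ : ∀ {n} (B : Basis n) → Basis.detEnd B φ ≈ - (γ * conj γ′) * Basis.detEnd B φ′
              det-φ B = begin
                detEnd φ                                              ≈⟨ *-identityˡ _ ⟨
                1# * detEnd φ                                         ≈⟨ *-congʳ (*-identityˡ _) ⟨
                1# * 1# * detEnd φ                                    ≈⟨ *-congʳ (*-cong (sym γγ′≈1) (sym conj-γγ′)) ⟩
                γ * γ′ * (conj γ * conj γ′) * detEnd φ
                  ≈⟨ solve 5 (λ g k ḡ k̄ d → g :* k :* (ḡ :* k̄) :* d := (:- (g :* k̄)) :* ((g :* k :- (g :+ ḡ) :* k) :* d)) refl γ γ′ (conj γ) (conj γ′) _ ⟩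
                - (γ * conj γ′) * ((γ * γ′ - Tr γ * γ′) * detEnd φ)   ≈⟨ *-congˡ (*-congʳ (+-cong γγ′≈1 (-‿cong (*-congʳ (sym (Φ-NN x)))))) ⟩
                - (γ * conj γ′) * ((1# - Φ (N x) (N x) * γ′) * detEnd φ) ≈⟨ *-congˡ (*-congʳ (detEnd-quasi B γ′ (N x))) ⟨
                - (γ * conj γ′) * (detEnd (quasi γ′ (N x)) * detEnd φ) ≈⟨ *-congˡ (detEnd-∘ φ (quasi-linear γ′ (N x))) ⟨
                - (γ * conj γ′) * detEnd φ′                           ∎
                where open Basis B

          module Elimination (SM : IsSubmodule L) (star : Star)
              (dense : ∀ {φ} → LinearMap φ → (∀ x → L x → φ x ≈ᴹ x) → ∀ x → φ x ≈ᴹ x)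
              (nondeg : ∀ x → (∀ y → L y → Φ x y ≈ 0#) → x ≈ᴹ 0ᴹ) {m} (B : Basis m) where
            open Basis B using (detEnd; detEnd-cong; detEnd-id)
            open IsSubmodule SM

            record State {n} (φ : Carrierᴹ → Carrierᴹ) (z : Fin n → Carrierᴹ) : Set (c ⊔ ℓ ⊔ v ⊔ ℓv ⊔ p) where
              field
                isometry : Isometry φ
                stable   : ∀ {x} → L x → L (φ x)
                z∈       : ∀ i → L (z i)
                spans    : L ⊆ Span (Remaining φ z)

            module _ {n φ} {z : Fin n → Carrierᴹ} (S : State φ z) where
              open State S
              private X = χ isometry

              χ-V : ∀ {j} → (∀ i k → V j (X (z i) (z k))) → ∀ {x y} → L x → L y → V j (X x y)
              χ-V {j} bound {x} {y} x∈ y∈ = right (spans y∈) (λ i → left (z i) (λ k → bound k i) (spans x∈))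
                where
                combine-V : ∀ {a u v} → 𝒪 a → V j u → V j v → V j (a * u + v)
                combine-V a∈ vu vv = V-+ (V-cast (ℤ.+-identityˡ j) (V-* a∈ vu)) vv
                left : ∀ y → (∀ k → V j (X (z k) y)) → ∀ {x} → Span (Remaining φ z) x → V j (X x y)
                left y h (gen (inj₁ (i , ≡.refl))) = h i
                left y h (gen (inj₂ (_ , fx))) = V-zero (χ-fixedˡ isometry y fx)
                left y h (null x≈0) = V-zero (trans (χ-congˡ isometry y x≈0)
                  (χ-fixedˡ isometry y (LinearMap.0-homo (Isometry.isLinear isometry))))
                left y h (comb a s t z≈) = V-resp (sym (trans (χ-congˡ isometry y z≈) (χ-linearˡ isometry _ _ _ y))) (combine-V a (left y h s) (left y h t))
                right : ∀ {y} → Span (Remaining φ z) y → (∀ k → V j (X x (z k))) → V j (X x y)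
                right (gen (inj₁ (i , ≡.refl))) h = h i
                right (gen (inj₂ (_ , fy))) h = V-zero (χ-fixedʳ isometry x fy)
                right (null y≈0) h = V-zero (trans (χ-congʳ isometry x y≈0) (Φ-0ʳ _))
                right (comb a s t z≈) h = V-resp (sym (trans (χ-congʳ isometry x z≈) (χ-linearʳ isometry _ x _ _))) (combine-V (𝒪-conj a) (right s h) (right t h))

            N≈0⇒fixed : ∀ {φ} (I : Isometry φ) x → N I x ≈ᴹ 0ᴹ → Fixed φ x
            N≈0⇒fixed {φ} I x N≈0 = ≈ᴹ-trans (≈ᴹ-sym (≈ᴹ-trans (+ᴹ-cong N≈0 ≈ᴹ-refl) (+ᴹ-identityˡ _)))
              (≈ᴹ-trans (+ᴹ-cong (+ᴹ-comm _ _) (≈ᴹ-sym (*ₗ-identityˡ _))) (≈ᴹ-trans (+ᴹ-assoc _ _ _)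
                (≈ᴹ-trans (+ᴹ-cong ≈ᴹ-refl (≈ᴹ-trans (≈ᴹ-sym (*ₗ-distribʳ _ _ _)) (≈ᴹ-trans (*ₗ-cong (-‿inverseˡ 1#) ≈ᴹ-refl) (*ₗ-zeroˡ _)))) (+ᴹ-identityʳ x))))

            record Descent (φ : Carrierᴹ → Carrierᴹ) (x y : Carrierᴹ) : Set (c ⊔ ℓ ⊔ v ⊔ ℓv ⊔ p) where
              field
                φ′       : Carrierᴹ → Carrierᴹ
                isometry : Isometry φ′
                stable   : ∀ {v} → L v → L (φ′ v)
                fixed-x  : Fixed φ′ x
                fixed-y  : Fixed φ′ y
                mono     : ∀ {v} → Fixed φ v → Fixed φ′ v
                ratio    : Carrier
                even     : EvenRatio ratio
                det-φ      : detEnd φ ≈ ratio * detEnd φ′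

            descend : ∀ {n n′ φ x y} {z : Fin n → Carrierᴹ} {z′ : Fin n′ → Carrierᴹ} → State φ z → L x → L y → (D : Descent φ x y) →
              (∀ i → L (z′ i)) → (∀ i → Span (λ v → (v ≡ x ⊎ v ≡ y) ⊎ ∃ λ k → v ≡ z′ k) (z i)) →
              (State (Descent.φ′ D) z′ → EvenRatio (detEnd (Descent.φ′ D))) → EvenRatio (detEnd φ)
            descend {φ = φ} {z = z} {z′} S x∈ y∈ D z′∈ covers rec = EvenRatio-resp (sym D.det-φ) (EvenRatio-* D.even (rec (record
              { isometry = D.isometry
              ; stable   = D.stable
              ; z∈       = z′∈
              ; spans    = λ v∈ → span-⊆ span-submodule transfer (State.spans S v∈)
              })))
              where
              module D = Descent D
              transfer : Remaining φ z ⊆ Span (Remaining D.φ′ z′)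
              transfer (inj₁ (i , ≡.refl)) = span-⊆ span-submodule (λ
                { (inj₁ (inj₁ ≡.refl)) → gen (inj₂ (x∈ , D.fixed-x))
                ; (inj₁ (inj₂ ≡.refl)) → gen (inj₂ (y∈ , D.fixed-y))
                ; (inj₂ k) → gen (inj₁ k) }) (covers i)
              transfer (inj₂ (v∈ , fv)) = gen (inj₂ (v∈ , D.mono fv))

            module _ {φ} (I : Isometry φ) (stable : ∀ {v} → L v → L (φ v)) {j} (bound : ∀ {u v} → L u → L v → V j (χ I u v)) where

              invert-integral : ∀ {k u c} → V k u → W (ℤ.- k) c → 𝒪 (u * c)
              invert-integral {k} vu Wc = V-cast (ℤ.+-inverseʳ k) (V-* vu (W⇒V Wc))

              N-bound : ∀ {x} → L x → ∀ y → L y → V j (Φ (N I x) y)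
              N-bound x∈ y y∈ = bound x∈ y∈

              odd-diagonal : ∀ {x} → L x → W j (χ I x x) → Odd (j ℤ.+ h)
              odd-diagonal {x} x∈ Wγ with parity (j ℤ.+ h)
              ... | inj₂ o = o
              ... | inj₁ e = ⊥-elim (trace-exact Wγ e (V-resp (Φ-NN I x) (star (N I x) j (N-stable I stable SM x∈) (N-bound x∈) e)))

              single : ∀ {x} → L x → W j (χ I x x) → Descent φ x x
              single {x} x∈ Wγ with invert Wγ
              ... | γ′ , γγ′≈1 , Wγ′ = record
                { φ′ = F.φ′ ; isometry = F.isometry
                ; stable = λ v∈ → L-resp (≈ᴹ-sym (F.φ′≈ _)) (L-comb (invert-integral (bound v∈ x∈) Wγ′) (N-stable I stable SM x∈) (stable v∈))
                ; fixed-x = F.fixed-x ; fixed-y = F.fixed-x ; mono = F.fixed-mono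
                ; ratio = - (F.γ * conj γ′)
                ; even = EvenRatio-neg Wγ (odd-diagonal x∈ Wγ) (begin
                    - (F.γ * conj γ′) * conj F.γ    ≈⟨ solve 3 (λ g k ḡ → (:- (g :* k)) :* ḡ := :- (g :* (ḡ :* k))) refl F.γ (conj γ′) (conj F.γ) ⟩
                    - (F.γ * (conj F.γ * conj γ′))  ≈⟨ -‿cong (trans (*-congˡ F.conj-γγ′) (*-identityʳ _)) ⟩
                    - F.γ                           ∎)
                ; det-φ = F.det-φ B
                }
                where module F = Fix I x γ′ γγ′≈1

              module Block {x y k} (x∈ : L x) (y∈ : L y) (Wxy : W j (χ I x y)) (Wyx : W j (χ I y x)) (Wγ : W k (χ I x x))
                           (1+j≤k : + 1 ℤ.+ j ℤ.≤ k) (vy : V (+ 1 ℤ.+ j) (χ I y y)) where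
                γ′ : Carrier
                γ′ = proj₁ (invert Wγ)
                γγ′≈1 : χ I x x * γ′ ≈ 1#
                γγ′≈1 = proj₁ (proj₂ (invert Wγ))
                Wγ′ : W (ℤ.- k) γ′
                Wγ′ = proj₂ (proj₂ (invert Wγ))
                module F = Fix I x γ′ γγ′≈1

                J = F.isometry

                χ′≈ : ∀ u v → χ J u v ≈ χ I u v - χ I u x * γ′ * χ I x v
                χ′≈ u v = begin
                  χ J u v                                              ≈⟨ χ≈ J u v ⟩
                  Φ u v - Φ (F.φ′ u) v                                 ≈⟨ +-congˡ (-‿cong (trans (Φ-cong (F.φ′≈ u) ≈ᴹ-refl) (Φ-linearˡ _ _ _ _))) ⟩
                  Φ u v - (χ I u x * γ′ * χ I x v + Φ (φ u) v)         ≈⟨ solve 3 (λ a b c → a :- (b :+ c) := (a :- c) :- b) refl _ _ _ ⟩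
                  (Φ u v - Φ (φ u) v) - χ I u x * γ′ * χ I x v         ≈⟨ +-congʳ (χ≈ I u v) ⟨
                  χ I u v - χ I u x * γ′ * χ I x v                     ∎

                l = j ℤ.+ ℤ.- k ℤ.+ j

                l+1≤j : + 1 ℤ.+ l ℤ.≤ j
                l+1≤j = cert (k ℤ.- (+ 1 ℤ.+ j)) (diff 1+j≤k)
                  (Z.solve 2 (λ j k → j := (con (+ 1) :+ (j :- k :+ j)) :+ (k :- (con (+ 1) :+ j))) ≡.refl j k)

                Wγ₂ : W l (χ J y y)
                Wγ₂ = W-resp (sym (χ′≈ y y)) (W-+ʳ (V-mono (ℤ.≤-trans l+1≤j (ℤ.i≤j⇒i≤1+j ℤ.≤-refl)) vy) (W-neg (W-* (W-* Wyx Wγ′) Wxy)))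

                γ₂′ : Carrier
                γ₂′ = proj₁ (invert Wγ₂)
                γ₂γ₂′≈1 : χ J y y * γ₂′ ≈ 1#
                γ₂γ₂′≈1 = proj₁ (proj₂ (invert Wγ₂))
                Wγ₂′ : W (ℤ.- l) γ₂′
                Wγ₂′ = proj₂ (proj₂ (invert Wγ₂))
                module G = Fix J y γ₂′ γ₂γ₂′≈1

                μ λ′ : Carrierᴹ → Carrier
                μ v = χ J v y * γ₂′
                λ′ v = μ v * - (χ I y x * γ′) + χ I v x * γ′

                μ-integral : ∀ {v} → L v → 𝒪 (μ v)
                μ-integral {v} v∈ = invert-integral (V-resp (sym (χ′≈ v y))
                  (V-sub (V-mono (ℤ.≤-trans (ℤ.i≤j⇒i≤1+j ℤ.≤-refl) l+1≤j) (bound v∈ y∈))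
                    (V-* (V-* (bound v∈ x∈) (W⇒V Wγ′)) (bound x∈ y∈)))) Wγ₂′

                λ-integral : ∀ {v} → L v → 𝒪 (λ′ v)
                λ-integral {v} v∈ = V-cancel Wxy (V-cast (≡.sym (ℤ.+-identityʳ j)) (V-resp (begin
                    χ I v y - μ v * χ I y y
                      ≈⟨ solve 6 (λ D A C F g m → D :- m :* F := (D :- A :* g :* C) :+ (A :* g :* C :- m :* F)) refl
                           (χ I v y) (χ I v x) (χ I x y) (χ I y y) γ′ (μ v) ⟩
                    (χ I v y - χ I v x * γ′ * χ I x y) + (χ I v x * γ′ * χ I x y - μ v * χ I y y)
                      ≈⟨ +-congʳ (trans (sym (χ′≈ v y)) (sym μγ₂)) ⟩
                    μ v * χ J y y + (χ I v x * γ′ * χ I x y - μ v * χ I y y)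
                      ≈⟨ +-congʳ (*-congˡ (χ′≈ y y)) ⟩
                    μ v * (χ I y y - χ I y x * γ′ * χ I x y) + (χ I v x * γ′ * χ I x y - μ v * χ I y y)
                      ≈⟨ solve 6 (λ A B C F g m → m :* (F :- B :* g :* C) :+ (A :* g :* C :- m :* F) := C :* (m :* (:- (B :* g)) :+ A :* g)) refl
                           (χ I v x) (χ I y x) (χ I x y) (χ I y y) γ′ (μ v) ⟩
                    χ I x y * λ′ v ∎)
                  (V-sub (bound v∈ y∈) (V-cast (ℤ.+-identityˡ j) (V-* (μ-integral v∈) (bound y∈ y∈))))))
                  where
                  μγ₂ : μ v * χ J y y ≈ χ J v y
                  μγ₂ = trans (trans (*-assoc _ _ _) (*-congˡ (trans (*-comm _ _) γ₂γ₂′≈1))) (*-identityʳ _)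

                N′≈ : N J y ≈ᴹ (- (χ I y x * γ′)) *ₗ N I x +ᴹ N I y
                N′≈ = ≈ᴹ-trans (+ᴹ-cong (*ₗ-cong refl (F.φ′≈ y)) ≈ᴹ-refl)
                  (≈ᴹ-trans (+ᴹ-cong (≈ᴹ-trans (*ₗ-distribˡ _ _ _) (+ᴹ-cong (≈ᴹ-trans (≈ᴹ-sym (*ₗ-assoc _ _ _))
                      (*ₗ-cong (solve 1 (λ u → (:- con (+ 1)) :* u := :- u) refl _) ≈ᴹ-refl)) ≈ᴹ-refl)) ≈ᴹ-refl) (+ᴹ-assoc _ _ _))

                φ″≈ : ∀ v → G.φ′ v ≈ᴹ λ′ v *ₗ N I x +ᴹ (μ v *ₗ N I y +ᴹ φ v)
                φ″≈ v = ≈ᴹ-trans (G.φ′≈ v) (≈ᴹ-trans (+ᴹ-cong (*ₗ-cong refl N′≈) (F.φ′≈ v)) (regroup _ _ (N I x) _ _ _))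

                descent : Descent φ x y
                descent = record
                  { φ′ = G.φ′ ; isometry = G.isometry
                  ; stable = λ v∈ → L-resp (≈ᴹ-sym (φ″≈ _)) (L-comb (λ-integral v∈) (N-stable I stable SM x∈)
                        (L-comb (μ-integral v∈) (N-stable I stable SM y∈) (stable v∈)))
                  ; fixed-x = G.fixed-mono F.fixed-x ; fixed-y = G.fixed-x ; mono = λ f → G.fixed-mono (F.fixed-mono f)
                  ; ratio = - (F.γ * conj γ′) * - (G.γ * conj γ₂′)
                  ; even = F.γ * G.γ , k ℤ.+ l , W-* Wγ Wγ₂ , (j , Z.solve 2 (λ j k → k :+ (j :- k :+ j) := j :+ j) ≡.refl j k) , (begin
                      - (F.γ * conj γ′) * - (G.γ * conj γ₂′) * conj (F.γ * G.γ) ≈⟨ *-congˡ (conj-* _ _) ⟩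
                      - (F.γ * conj γ′) * - (G.γ * conj γ₂′) * (conj F.γ * conj G.γ)
                        ≈⟨ solve 6 (λ g k G K ḡ Ḡ → (:- (g :* k)) :* (:- (G :* K)) :* (ḡ :* Ḡ) := (g :* G) :* ((ḡ :* k) :* (Ḡ :* K))) refl
                             F.γ (conj γ′) G.γ (conj γ₂′) (conj F.γ) (conj G.γ) ⟩
                      (F.γ * G.γ) * ((conj F.γ * conj γ′) * (conj G.γ * conj γ₂′)) ≈⟨ *-congˡ (*-cong F.conj-γγ′ G.conj-γγ′) ⟩
                      (F.γ * G.γ) * (1# * 1#) ≈⟨ trans (*-congˡ (*-identityˡ _)) (*-identityʳ _) ⟩
                      F.γ * G.γ ∎)
                  ; det-φ = trans (F.det-φ B) (trans (*-congˡ (G.det-φ B)) (sym (*-assoc _ _ _)))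
                  }

            Claim : ℕ → Set _
            Claim n = ∀ {φ} (z : Fin n → Carrierᴹ) → State φ z → EvenRatio (detEnd φ)

            reduce₁ : ∀ {n φ} → Claim n → (z : Fin (suc n) → Carrierᴹ) → State φ z → ∀ i {x} → L x → Descent φ x x →
              Span (λ v → (v ≡ x ⊎ v ≡ x) ⊎ ∃ λ k → v ≡ z (punchIn i k)) (z i) → EvenRatio (detEnd φ)
            reduce₁ {n} rec z S i {x} x∈ D zi = descend S x∈ x∈ D (λ k → State.z∈ S (punchIn i k)) covers (rec (z ∘ punchIn i))
              where
              covers : ∀ l → Span (λ v → (v ≡ x ⊎ v ≡ x) ⊎ ∃ λ k → v ≡ z (punchIn i k)) (z l)
              covers l with cover i l
              ... | inj₁ ≡.refl = zi
              ... | inj₂ (k , ≡.refl) = gen (inj₂ (k , ≡.refl))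

            reduce₂ : ∀ {n φ} → Claim n → (z : Fin (suc (suc n)) → Carrierᴹ) → State φ z → ∀ a b → a ≢ b → ∀ {x y} → L x → L y → Descent φ x y →
              Span (λ v → v ≡ x ⊎ v ≡ y) (z a) → Span (λ v → v ≡ x ⊎ v ≡ y) (z b) → EvenRatio (detEnd φ)
            reduce₂ {n} rec z S a b a≢b {x} {y} x∈ y∈ D za zb = descend S x∈ y∈ D (λ k → State.z∈ S (index k)) covers (rec (z ∘ index))
              where
              b′ = punchOut a≢b
              index : Fin n → Fin (suc (suc n))
              index = punchIn a ∘ punchIn b′
              covers : ∀ l → Span (λ v → (v ≡ x ⊎ v ≡ y) ⊎ ∃ λ k → v ≡ z (index k)) (z l)
              covers l with cover a l
              ... | inj₁ ≡.refl = span-⊆ {S = λ v → v ≡ x ⊎ v ≡ y} span-submodule (gen ∘ inj₁) za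
              ... | inj₂ (l′ , ≡.refl) with cover b′ l′
              ...   | inj₁ ≡.refl = ≡.subst (λ i → Span (λ v → (v ≡ x ⊎ v ≡ y) ⊎ ∃ λ k → v ≡ z (index k)) (z i)) (≡.sym (Fin.punchIn-punchOut a≢b)) (span-⊆ {S = λ v → v ≡ x ⊎ v ≡ y} span-submodule (gen ∘ inj₁) zb)
              ...   | inj₂ (k , ≡.refl) = gen (inj₂ (k , ≡.refl))

            undo : ∀ t u v → v ≈ᴹ (- t) *ₗ u +ᴹ (t *ₗ u +ᴹ v)
            undo t u v = ≈ᴹ-sym (≈ᴹ-trans (≈ᴹ-sym (+ᴹ-assoc _ _ _)) (≈ᴹ-trans (+ᴹ-cong
              (≈ᴹ-trans (≈ᴹ-sym (*ₗ-distribʳ _ _ _)) (≈ᴹ-trans (*ₗ-cong (-‿inverseˡ t) ≈ᴹ-refl) (*ₗ-zeroˡ u))) ≈ᴹ-refl) (+ᴹ-identityˡ v)))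

            module Pivot {n φ} (rec₁ : Claim (suc n)) (rec₂ : Claim n) (z : Fin (suc (suc n)) → Carrierᴹ) (S : State φ z) {a b} (a≢b : a ≢ b) {j}
                         (Wab : W j (χ (State.isometry S) (z a) (z b)))
                         (bound : ∀ {u v} → L u → L v → V j (χ (State.isometry S) u v))
                         (diag : ∀ i → V (+ 1 ℤ.+ j) (χ (State.isometry S) (z i) (z i))) where
              open State S
              X = χ isometry
              x y : Carrierᴹ
              x = z a
              y = z b

              χ-plane : ∀ t → X (t *ₗ y +ᴹ x) (t *ₗ y +ᴹ x) ≈ t * X y x + conj t * X x y + (t * conj t * X y y + X x x)
              χ-plane t = trans (χ-linearˡ isometry _ _ _ _) (trans (+-cong (*-congˡ (χ-linearʳ isometry _ _ _ _)) (χ-linearʳ isometry _ _ _ _))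
                (solve 6 (λ t t̄ F B C A → t :* (t̄ :* F :+ B) :+ (t̄ :* C :+ A) := t :* B :+ t̄ :* C :+ (t :* t̄ :* F :+ A)) refl
                  t (conj t) (X y y) (X y x) (X x y) (X x x)))

              unit-sum : W j (X x y + X y x) → EvenRatio (detEnd φ)
              unit-sum Wm = reduce₁ rec₁ z S a s∈ (single isometry stable bound s∈ Wss)
                (comb (𝒪-neg 𝒪-1) (gen (inj₂ (punchOut a≢b , ≡.cong z (≡.sym (Fin.punchIn-punchOut a≢b))))) (gen (inj₁ (inj₁ ≡.refl))) (undo 1# y x))
                where
                s = 1# *ₗ y +ᴹ x
                s∈ = L-comb 𝒪-1 (z∈ b) (z∈ a)
                Wss : W j (X s s)
                Wss = W-resp (sym (χ-plane 1#)) (W-+ (W-resp (trans (+-comm _ _) (+-cong (sym (*-identityˡ _)) (sym (trans (*-congʳ conj-1) (*-identityˡ _))))) Wm)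
                  (V-+ (V-resp (sym (trans (*-congʳ (trans (*-identityˡ _) conj-1)) (*-identityˡ _))) (diag b)) (diag a)))

              block : V (+ 1 ℤ.+ j) (X x y + X y x) → EvenRatio (detEnd φ)
              block vm = choose (x≈0⊎W (X x x)) (x≈0⊎W (X y y))
                where
                Wyx : W j (X y x)
                Wyx = W-resp (solve 2 (λ C B → (C :+ B) :- C := B) refl (X x y) (X y x)) (W-+ʳ vm (W-neg Wab))
                skewed : X x x ≈ 0# → X y y ≈ 0# → ∀ t → 𝒪 t → V (+ 1 ℤ.+ j) (t * X y x + conj t * X x y) → ¬ (t * X y x + conj t * X x y ≈ 0#) → EvenRatio (detEnd φ)
                skewed xx≈0 yy≈0 t t∈ vt t≉0 with x≈0⊎W (t * X y x + conj t * X x y)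
                ... | inj₁ t≈0 = ⊥-elim (t≉0 t≈0)
                ... | inj₂ (k , Wk) = reduce₂ rec₂ z S a b a≢b s∈ (z∈ b)
                        (Block.descent isometry stable bound s∈ (z∈ b)
                          (W-resp (sym (trans (χ-linearˡ isometry _ _ _ _) (trans (+-congʳ (trans (*-congˡ yy≈0) (zeroʳ _))) (+-identityˡ _)))) Wab)
                          (W-resp (sym (trans (χ-linearʳ isometry _ _ _ _) (trans (+-congʳ (trans (*-congˡ yy≈0) (zeroʳ _))) (+-identityˡ _)))) Wyx)
                          (W-resp (sym eq) Wk) (W-V Wk vt) (diag b))
                        (comb (𝒪-neg t∈) (gen (inj₂ ≡.refl)) (gen (inj₁ ≡.refl)) (undo t y x)) (gen (inj₂ ≡.refl))
                  where
                  s∈ = L-comb t∈ (z∈ b) (z∈ a)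
                  eq : X (t *ₗ y +ᴹ x) (t *ₗ y +ᴹ x) ≈ t * X y x + conj t * X x y
                  eq = trans (χ-plane t) (trans (+-congˡ (trans (+-cong (trans (*-congˡ yy≈0) (zeroʳ _)) xx≈0) (+-identityˡ _))) (+-identityʳ _))
                isotropic-plane : X x x ≈ 0# → X y y ≈ 0# → X x y + X y x ≈ 0# ⊎ (∃ λ n → W n (X x y + X y x)) → EvenRatio (detEnd φ)
                isotropic-plane xx≈0 yy≈0 (inj₂ (k , Wk)) = skewed xx≈0 yy≈0 1# 𝒪-1 (V-resp eq vm) (λ ≈0 → W-≉0 Wk (trans eq ≈0))
                  where
                  eq : X x y + X y x ≈ 1# * X y x + conj 1# * X x y
                  eq = trans (+-comm _ _) (+-cong (sym (*-identityˡ _)) (sym (trans (*-congʳ conj-1) (*-identityˡ _))))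
                isotropic-plane xx≈0 yy≈0 (inj₁ m≈0) = skewed xx≈0 yy≈0 ϖ (≤-W W-ϖ nonneg)
                  (V-+ (V-* (W⇒V W-ϖ) (W⇒V Wyx)) (V-* (V-conj (W⇒V W-ϖ)) (W⇒V Wab)))
                  (λ ≈0 → even-odd (real-even (+ 1) ϖ (real ≈0) W-ϖ) (+ 0 , ≡.refl))
                  where
                  real : ϖ * X y x + conj ϖ * X x y ≈ 0# → conj ϖ ≈ ϖ
                  real ≈0 with invert Wab
                  ... | C′ , CC′≈1 , _ = begin
                    conj ϖ                                ≈⟨ *-identityʳ _ ⟨
                    conj ϖ * 1#                           ≈⟨ *-congˡ CC′≈1 ⟨
                    conj ϖ * (C * C′)                     ≈⟨ solve 5 (λ p p̄ A C C′ → p̄ :* (C :* C′) := p :* (C :* C′) :+ (p :* A :+ p̄ :* C) :* C′ :- p :* (C :+ A) :* C′) refl ϖ (conj ϖ) A C C′ ⟩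
                    ϖ * (C * C′) + (ϖ * A + conj ϖ * C) * C′ - ϖ * (C + A) * C′
                      ≈⟨ +-cong (+-cong (*-congˡ CC′≈1) (trans (*-congʳ ≈0) (zeroˡ _))) (-‿cong (trans (*-congʳ (trans (*-congˡ m≈0) (zeroʳ _))) (zeroˡ _))) ⟩
                    ϖ * 1# + 0# - 0#                      ≈⟨ solve 1 (λ p → p :* con (+ 1) :+ con (+ 0) :- con (+ 0) := p) refl ϖ ⟩
                    ϖ                                     ∎
                    where
                    A = X y x
                    C = X x y
                choose : X x x ≈ 0# ⊎ (∃ λ n → W n (X x x)) → X y y ≈ 0# ⊎ (∃ λ n → W n (X y y)) → EvenRatio (detEnd φ)
                choose (inj₂ (k , Wk)) _ = reduce₂ rec₂ z S a b a≢b (z∈ a) (z∈ b)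
                  (Block.descent isometry stable bound (z∈ a) (z∈ b) Wab Wyx Wk (W-V Wk (diag a)) (diag b)) (gen (inj₁ ≡.refl)) (gen (inj₂ ≡.refl))
                choose (inj₁ xx≈0) (inj₂ (k , Wk)) = reduce₂ rec₂ z S a b a≢b (z∈ b) (z∈ a)
                  (Block.descent isometry stable bound (z∈ b) (z∈ a) Wyx Wab Wk (W-V Wk (diag b)) (diag a)) (gen (inj₂ ≡.refl)) (gen (inj₁ ≡.refl))
                choose (inj₁ xx≈0) (inj₁ yy≈0) = isotropic-plane xx≈0 yy≈0 (x≈0⊎W _)

              pivot : EvenRatio (detEnd φ)
              pivot with V-or-W (+ 1 ℤ.+ j) (X x y + X y x)
              ... | inj₁ vm = block vm
              ... | inj₂ (k , Wk , k<) = unit-sum (W-cast (ℤ.≤-antisym (suc-cancel-≤ k<) (W-V Wk (V-+ (bound (z∈ a) (z∈ b)) (bound (z∈ b) (z∈ a))))) Wk)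

            step : ∀ n → (∀ {k} → k ℕ.< n → Claim k) → Claim n
            step n rec {φ} z S with minimum₂ (λ i k → w (χ (State.isometry S) (z i) (z k)))
            ... | inj₁ all = EvenRatio-resp (sym (trans (detEnd-cong trivial) detEnd-id)) EvenRatio-1
              where
              open State S
              trivial : ∀ x → φ x ≈ᴹ x
              trivial = dense (Isometry.isLinear isometry) λ x x∈ → N≈0⇒fixed isometry x
                (nondeg _ λ y y∈ → w-∞ _ (V-all λ j → χ-V S {j} (λ i k → V-⊤ (all i k)) x∈ y∈))
            ... | inj₂ (a , b , j , Wab , bound) with Fin.all? (λ i → V? (+ 1 ℤ.+ j) (χ (State.isometry S) (z i) (z i)))
            step (suc n) rec z S | inj₂ (a , b , j , Wab , bound) | no ¬diag = diagonal (Fin.¬∀⟶∃¬ _ _ (λ i → V? (+ 1 ℤ.+ j) (χ (State.isometry S) (z i) (z i))) ¬diag)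
              where
              open State S
              diagonal : (∃ λ i → ¬ V (+ 1 ℤ.+ j) (χ isometry (z i) (z i))) → EvenRatio _
              diagonal (i , ¬v) with V-or-W (+ 1 ℤ.+ j) (χ isometry (z i) (z i))
              ... | inj₁ v = ⊥-elim (¬v v)
              ... | inj₂ (k , Wk , k<) = reduce₁ (rec ℕ.≤-refl) z S i (z∈ i) (single isometry stable (χ-V S bound) (z∈ i)
                      (W-cast (ℤ.≤-antisym (suc-cancel-≤ k<) (W-V Wk (bound i i))) Wk)) (gen (inj₁ (inj₁ ≡.refl)))
            step n rec z S | inj₂ (a , b , j , Wab , bound) | yes diag with a Fin.≟ b
            ... | yes ≡.refl = ⊥-elim (suc≰ (W-V Wab (diag a)))
            step (suc zero) rec z S | inj₂ (zero , zero , _) | yes diag | no a≢b = ⊥-elim (a≢b ≡.refl)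
            step (suc (suc n)) rec z S | inj₂ (a , b , j , Wab , bound) | yes diag | no a≢b = Pivot.pivot (rec ℕ.≤-refl) (rec (ℕ.n≤1+n _)) z S a≢b Wab (χ-V S bound) diag

            evenRatio : ∀ n → Claim n
            evenRatio n = below (suc n) ℕ.≤-refl
              where
              below : ∀ n {k} → k ℕ.< n → Claim k
              below (suc n) {k} (s≤s k≤n) = step k (λ l<k → below n (ℕ.≤-trans l<k k≤n))

        module Conclusions {p} {L : Pred Carrierᴹ p} (SM : IsSubmodule L) {n} (g : Fin n → Carrierᴹ) (g∈ : ∀ i → L (g i))
            (L⊆ : L ⊆ ⟨ g ⟩) (hull : ∀ x → Hulls.Hull L x) {m} (B : Basis m) where
          open Basis B using (detEnd)

          nondegenerate-on : ∀ x → (∀ y → L y → Φ x y ≈ 0#) → x ≈ᴹ 0ᴹ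
          nondegenerate-on x zeros = nondegenerate x λ y → sym-zero (Hulls.hull-zero L hull (Φ-functional x) (λ z z∈ → sym-zero (zeros z z∈)) y)

          dichotomy : GoodVector h L ⊎ Frame L
          dichotomy = [ inj₁ ∘ good , inj₂ ∘ frame ]′ (good⊎frame g λ x x∈ zeros → nondegenerate-on x λ y y∈ →
              sym-zero (span-orthogonal x (λ { _ (i , ≡.refl) → sym-zero (zeros i) }) (L⊆ y∈)))
            where
            ⊆L : ⟨ g ⟩ ⊆ L
            ⊆L = span-⊆ SM λ { (i , ≡.refl) → g∈ i }
            good : GoodVector h ⟨ g ⟩ → GoodVector h L
            good G = record { s = G.s ; j = G.j ; k = G.k ; s∈ = ⊆L G.s∈ ; bound = λ x x∈ → G.bound x (L⊆ x∈) ; W-ss = G.W-ss ; k≤ = G.k≤ }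
              where module G = GoodVector G
            frame : Frame ⟨ g ⟩ → Frame L
            frame F = record
              { k = F.k ; x = F.x ; y = F.y ; σ = F.σ ; odd = F.odd ; x∈ = λ i → ⊆L (F.x∈ i) ; y∈ = λ i → ⊆L (F.y∈ i)
              ; xx = F.xx ; yy = F.yy ; xy = F.xy ; W-xy = F.W-xy ; spans = λ z∈ → F.spans (L⊆ z∈) }
              where module F = Frame F

          trivial-frame : (F : Frame L) → ¬ Fin (Frame.k F) → ∀ x → x ≈ᴹ 0ᴹ
          trivial-frame F empty = Hulls.hull-trivial L hull λ x x∈ → go (Frame.spans F x∈)
            where
            go : ∀ {x} → Span (λ z → ∃ λ i → z ≡ Frame.x F i ⊎ z ≡ Frame.y F i) x → x ≈ᴹ 0ᴹ
            go (gen (i , _)) = ⊥-elim (empty i)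
            go (null x≈0) = x≈0
            go (comb _ s t z≈) = ≈ᴹ-trans z≈ (≈ᴹ-trans (+ᴹ-cong (≈ᴹ-trans (*ₗ-cong refl (go s)) (*ₗ-zeroʳ _)) (go t)) (+ᴹ-identityʳ _))

          all-dets : GoodVector h L → ∀ u → u * conj u ≈ 1# → ∃ λ φ → Automorphism L φ × u ≈ detEnd φ
          all-dets G u Nru≈1 = good-det SM G B u Nru≈1 (unit-norm-bound Nru≈1)

          even-dets : IsRamified R conj w h → (F : Frame L) → Fin (Frame.k F) → ∀ u → u * conj u ≈ 1# → EvenRatio u →
            ∃ λ φ → Automorphism L φ × u ≈ detEnd φ
          even-dets ram F i u Nru≈1 e = good-det SM (nearly-good SM F i) B u Nru≈1 (Ramified.even-ratio-bound ram e)

          dets-even : (ram : IsRamified R conj w h) → Wall.Star ram L → ∀ {φ} → Isometry φ → (∀ {x} → L x → L (φ x)) → EvenRatio (detEnd φ)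
          dets-even ram star {φ} I stable = Wall.Elimination.evenRatio ram L SM star (Hulls.hull-dense L hull) nondegenerate-on B n g record
            { isometry = I ; stable = stable ; z∈ = g∈
            ; spans = λ x∈ → span-⊆ span-submodule (λ { (i , ≡.refl) → gen (inj₁ (i , ≡.refl)) }) (L⊆ x∈) }

      module Split (w : Carrier → ℤ∞) (isSplit : IsSplit R conj w) where
        open IsSplit isSplit
        open IsValuation isValuation using (w-cong; w-*)
        open Valuations R w isValuation
        open RawSemiringDefs (Semiring.rawSemiring semiring) using (_^_)
        private module Z = ℤ-Solver

        -- conj exchanges the two components of E ≅ K ⊕ K.
        V² : ℤ → Carrier → Set
        V² n x = V n x × V n (conj x)

        V²-0 : ∀ {n x} → x ≈ 0# → V² n x
        V²-0 x≈0 = V-zero x≈0 , V-zero (trans (conj-cong x≈0) conj-0)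

        V²-resp : ∀ {n x y} → x ≈ y → V² n x → V² n y
        V²-resp x≈y (v , v̄) = V-resp x≈y v , V-resp (conj-cong x≈y) v̄

        V²-+ : ∀ {n x y} → V² n x → V² n y → V² n (x + y)
        V²-+ (v , v̄) (u , ū) = V-+ v u , V-resp (sym (conj-+ _ _)) (V-+ v̄ ū)

        V²-* : ∀ {m n x y} → V² m x → V² n y → V² (m ℤ.+ n) (x * y)
        V²-* (v , v̄) (u , ū) = V-* v u , V-resp (sym (conj-* _ _)) (V-* v̄ ū)

        V²-neg : ∀ {n x} → V² n x → V² n (- x)
        V²-neg (v , v̄) = V-neg v , V-resp (sym (conj-neg _)) (V-neg v̄)

        V²-mono : ∀ {m n x} → m ℤ.≤ n → V² n x → V² m x
        V²-mono m≤n (v , v̄) = V-mono m≤n v , V-mono m≤n v̄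

        V²-cast : ∀ {m n x} → m ≡ n → V² m x → V² n x
        V²-cast ≡.refl v = v

        𝒪 : Carrier → Set
        𝒪 = V² (+ 0)

        isIntegers : IsIntegers 𝒪
        isIntegers = record
          { 𝒪-resp = V²-resp ; 𝒪-0 = V²-0 refl ; 𝒪-1 = W⇒V W-1 , W⇒V (W-resp (sym conj-1) W-1)
          ; 𝒪-+ = V²-+ ; 𝒪-* = V²-* ; 𝒪-neg = V²-neg ; 𝒪-conj = λ (v , v̄) → v̄ , V-resp (sym (conj-involutive _)) v }

        open Lattices 𝒪 isIntegers

        span-V² : ∀ {s} {S : Pred Carrierᴹ s} {j f} → Functional f → (∀ z → S z → V² j (f z)) → ∀ {x} → Span S x → V² j (f x)
        span-V² F h (gen s) = h _ s
        span-V² F h (null x≈0) = V²-0 (trans (Functional.cong F x≈0) (Functional.0-homo F))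
        span-V² {j = j} F h (comb a s t z≈) = V²-resp (sym (trans (Functional.cong F z≈) (Functional.linear F _ _ _)))
          (V²-+ (V²-cast (ℤ.+-identityˡ j) (V²-* a (span-V² F h s))) (span-V² F h t))

        module _ {p} {L : Pred Carrierᴹ p} (SM : IsSubmodule L) {n} (g : Fin n → Carrierᴹ) (g∈ : ∀ i → L (g i))
                 (L⊆ : L ⊆ Span (λ z → ∃ λ i → z ≡ g i)) where
          open IsSubmodule SM

          good-det : (∀ i k → Φ (g i) (g k) ≈ 0#) ⊎
            (∀ {m} (B : Basis m) u → 𝒪 u → u * conj u ≈ 1# → ∃ λ φ → Automorphism L φ × u ≈ Basis.detEnd B φ)
          good-det with minimum₂ (λ i k → w (Φ (g i) (g k)))
          ... | inj₁ all = inj₁ λ i k → w-∞ _ (all i k) (≡.trans (w-cong (sym (Φ-conj (g i) (g k)))) (all k i))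
          ... | inj₂ (a , b , j , Wρ , bound) = inj₂ λ B u u∈ Nru≈1 → reflect SM B s∈ αα′≈1 u∈ Nru≈1 λ x x∈ →
                  V²-cast (Z.solve 1 (λ j → j :+ (con (+ 0) :- j) := con (+ 0)) ≡.refl j)
                    (V²-* (all-V² x∈ s∈) (V²-* (V²-+ (IsIntegers.𝒪-1 isIntegers) (V²-neg u∈)) Vα′))
            where
            e₂ = conj e₁
            s = e₁ *ₗ g a +ᴹ (e₂ *ₗ g b +ᴹ 0ᴹ)
            e₁∈ : 𝒪 e₁
            e₁∈ = W⇒V W-e₁ , V-⊤ w-e₂
            s∈ : L s
            s∈ = L-comb e₁∈ (g∈ a) (L-comb (IsIntegers.𝒪-conj isIntegers e₁∈) (g∈ b) L-0)
            gen-V² : ∀ i k → V² j (Φ (g i) (g k))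
            gen-V² i k = bound i k , V-resp (Φ-conj (g i) (g k)) (bound k i)
            all-V² : ∀ {x y} → L x → L y → V² j (Φ x y)
            all-V² {x} {y} x∈ y∈ = span-V² (Φ-functional y) (λ { _ (i , ≡.refl) →
              V²-resp (trans (sym (Φ-conj y (g i))) refl) (conj-V² (span-V² (Φ-functional (g i)) (λ { _ (k , ≡.refl) → gen-V² k i }) (L⊆ y∈))) }) (L⊆ x∈)
              where
              conj-V² : ∀ {x} → V² j x → V² j (conj x)
              conj-V² (v , v̄) = v̄ , V-resp (sym (conj-involutive _)) v
            Φ-s : ∀ y → Φ s y ≈ e₁ * Φ (g a) y + e₂ * Φ (g b) y
            Φ-s y = trans (Φ-linearˡ _ _ _ _) (+-congˡ (trans (Φ-linearˡ _ _ _ _) (trans (+-congˡ (Φ-0ˡ y)) (+-identityʳ _))))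
            Φ-sʳ : ∀ y → Φ y s ≈ e₂ * Φ y (g a) + e₁ * Φ y (g b)
            Φ-sʳ y = trans (Φ-conj s y) (trans (conj-cong (Φ-s y)) (trans (conj-+ _ _)
              (+-cong (trans (conj-* _ _) (*-congˡ (sym (Φ-conj _ _)))) (trans (conj-* _ _) (*-cong (conj-involutive e₁) (sym (Φ-conj _ _)))))))
            α≈ : Φ s s ≈ e₁ * Φ (g a) (g b) + e₂ * (e₂ * Φ (g b) (g a))
            α≈ = begin
              Φ s s ≈⟨ Φ-s s ⟩
              e₁ * Φ (g a) s + e₂ * Φ (g b) s ≈⟨ +-cong (*-congˡ (Φ-sʳ (g a))) (*-congˡ (Φ-sʳ (g b))) ⟩
              e₁ * (e₂ * Φ (g a) (g a) + e₁ * Φ (g a) (g b)) + e₂ * (e₂ * Φ (g b) (g a) + e₁ * Φ (g b) (g b))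
                ≈⟨ solve 6 (λ e f A B C D → e :* (f :* A :+ e :* B) :+ f :* (f :* C :+ e :* D) :=
                     (e :* e :* B :+ f :* (f :* C)) :+ (e :* f) :* (A :+ D)) refl e₁ e₂ _ _ _ _ ⟩
              (e₁ * e₁ * Φ (g a) (g b) + e₂ * (e₂ * Φ (g b) (g a))) + (e₁ * e₂) * (Φ (g a) (g a) + Φ (g b) (g b))
                ≈⟨ +-cong (+-congʳ (*-congʳ idempotent)) (trans (*-congʳ orthogonal) (zeroˡ _)) ⟩
              (e₁ * Φ (g a) (g b) + e₂ * (e₂ * Φ (g b) (g a))) + 0# ≈⟨ +-identityʳ _ ⟩
              e₁ * Φ (g a) (g b) + e₂ * (e₂ * Φ (g b) (g a)) ∎
            Wα : W j (Φ s s)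
            Wα = W-resp (sym α≈) (W-+ (W-cast (ℤ.+-identityˡ j) (W-* W-e₁ Wρ)) (V-⊤ (≡.trans (w-* _ _) (≡.cong (_+∞ w (e₂ * Φ (g b) (g a))) w-e₂))))
            Wᾱ : W j (conj (Φ s s))
            Wᾱ = W-resp (sym (self-real s)) Wα
            α′ = proj₁ (inverse (Φ s s) Wα Wᾱ)
            αα′≈1 : Φ s s * α′ ≈ 1#
            αα′≈1 = proj₂ (inverse (Φ s s) Wα Wᾱ)
            Vα′ : V² (ℤ.- j) α′
            Vα′ = W⇒V (W-inv αα′≈1 Wα) , W⇒V (W-inv (trans (sym (conj-* _ _)) (trans (conj-cong αα′≈1) conj-1)) Wᾱ)

          module _ (hull : ∀ x → Hulls.Hull L x) {m} (B : Basis m) where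
            open Basis B

            orthogonal⇒trivial : (∀ i k → Φ (g i) (g k) ≈ 0#) → ∀ x → x ≈ᴹ 0ᴹ
            orthogonal⇒trivial zeros = Hulls.hull-trivial L hull λ x x∈ → nondegenerate x λ y →
                sym-zero (Hulls.hull-zero L hull (Φ-functional x) (λ z z∈ → span-zero (Φ-functional x) (λ { _ (i , ≡.refl) →
                  sym-zero (span-zero (Φ-functional (g i)) (λ { _ (k , ≡.refl) → zeros k i }) (L⊆ x∈)) }) (L⊆ z∈)) y)
              where
              sym-zero : ∀ {x y} → Φ x y ≈ 0# → Φ y x ≈ 0#
              sym-zero {x} {y} eq = trans (Φ-conj x y) (trans (conj-cong eq) conj-0)
              span-zero : ∀ {s} {S : Pred Carrierᴹ s} {f} → Functional f → (∀ z → S z → f z ≈ 0#) → ∀ {x} → Span S x → f x ≈ 0#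
              span-zero F h (gen s) = h _ s
              span-zero F h (null x≈0) = trans (Functional.cong F x≈0) (Functional.0-homo F)
              span-zero F h (comb a s t z≈) = trans (Functional.cong F z≈) (trans (Functional.linear F _ _ _)
                (trans (+-cong (trans (*-congˡ (span-zero F h s)) (zeroʳ _)) (span-zero F h t)) (+-identityʳ _)))

            finite-bound : ∀ {k} (f : Fin k → Carrier) → ∃ λ N → ∀ i → V² N (f i)
            finite-bound {zero} f = + 0 , λ ()
            finite-bound {suc k} f with finite-bound (f ∘ suc) | bounded (f zero)
              where
              half : ∀ x → ∃ λ N → V N x
              half x with finite x
              ... | inj₁ eq = + 0 , V-⊤ eq
              ... | inj₂ (N , WN) = N , W⇒V WN
              bounded : ∀ x → ∃ λ N → V² N x
              bounded x with half x | half (conj x)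
              ... | M , v | N , v̄ = M ℤ.⊓ N , V-mono (ℤ.i⊓j≤i M N) v , V-mono (ℤ.i⊓j≤j M N) v̄
            ... | N , h | M , v = N ℤ.⊓ M , λ { zero → V²-mono (ℤ.i⊓j≤j N M) v ; (suc i) → V²-mono (ℤ.i⊓j≤i N M) (h i) }

            finite-bound₂ : ∀ {k l} (f : Fin k → Fin l → Carrier) → ∃ λ N → ∀ i j → V² N (f i j)
            finite-bound₂ {zero} f = + 0 , λ ()
            finite-bound₂ {suc k} f with finite-bound₂ (f ∘ suc) | finite-bound (f zero)
            ... | N , h | M , v = N ℤ.⊓ M , λ { zero j → V²-mono (ℤ.i⊓j≤j N M) (v j) ; (suc i) j → V²-mono (ℤ.i⊓j≤i N M) (h i j) }

            record Endomorphism (ψ : Carrierᴹ → Carrierᴹ) : Set (c ⊔ ℓ ⊔ v ⊔ ℓv ⊔ p) where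
              field
                isLinear : LinearMap ψ
                stable   : ∀ {x} → L x → L (ψ x)

            lattice-bound : ∃ λ N → ∀ x → L x → ∀ j → V² N (coord x j)
            lattice-bound with finite-bound₂ (λ i j → coord (g i) j)
            ... | N , h = N , λ x x∈ j → span-V² (functional j) (λ { _ (i , ≡.refl) → h i j }) (L⊆ x∈)

            orbit-bound : ∀ x → Hulls.Hull L x → ∃ λ N → ∀ ψ → Endomorphism ψ → ∀ j → V² N (coord (ψ x) j)
            orbit-bound x (Hulls.gen x∈) with lattice-bound
            ... | N , h = N , λ ψ E j → h (ψ x) (Endomorphism.stable E x∈) j
            orbit-bound x (Hulls.null x≈0) = + 0 , λ ψ E j → let module ψ = LinearMap (Endomorphism.isLinear E) in
              V²-0 (trans (Functional.cong (functional j) (≈ᴹ-trans (ψ.cong x≈0) ψ.0-homo)) (Functional.0-homo (functional j)))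
            orbit-bound x (Hulls.comb {a} {y} {z} s t x≈) with orbit-bound y s | orbit-bound z t | finite-bound {1} (λ _ → a)
            ... | N , h | M , k | A , va = (A ℤ.+ N) ℤ.⊓ M , λ ψ E j → let module ψ = LinearMap (Endomorphism.isLinear E) in
              V²-resp (sym (trans (Functional.cong (functional j) (≈ᴹ-trans (ψ.cong x≈) (ψ.linear a y z))) (Functional.linear (functional j) a (ψ y) (ψ z))))
                (V²-+ (V²-mono (ℤ.i⊓j≤i (A ℤ.+ N) M) (V²-* (va zero) (h ψ E j))) (V²-mono (ℤ.i⊓j≤j (A ℤ.+ N) M) (k ψ E j)))

            basis-bound : ∀ {k} (f : Fin k → Carrierᴹ) → ∃ λ N → ∀ ψ → Endomorphism ψ → ∀ i j → V² N (coord (ψ (f i)) j)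
            basis-bound {zero} f = + 0 , λ ψ E ()
            basis-bound {suc k} f with basis-bound (f ∘ suc) | orbit-bound (f zero) (hull (f zero))
            ... | N , h | M , o = N ℤ.⊓ M , λ ψ E → λ
              { zero j → V²-mono (ℤ.i⊓j≤j N M) (o ψ E j) ; (suc i) j → V²-mono (ℤ.i⊓j≤i N M) (h ψ E i j) }

            scaled-bound : ℤ → ℕ → ℤ
            scaled-bound N zero = + 0
            scaled-bound N (suc k) = N ℤ.+ scaled-bound N k

            D-bound : ∀ {a b} {A : Set a} {B : Set b} (r : A → B → Carrier) {N} → (∀ x y → V² N (r x y)) → ∀ fs xs →
                      V² (scaled-bound N (length fs)) (D r fs xs)
            D-bound r h [] [] = IsIntegers.𝒪-1 isIntegers
            D-bound r h [] (x ∷ xs) = V²-0 refl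
            D-bound {B = B} r {N} h (f ∷ fs) xs = go (D r fs) (D-bound r h fs) xs
              where
              go : ∀ G → (∀ ys → V² (scaled-bound N (length fs)) (G ys)) → ∀ ys → V² (N ℤ.+ scaled-bound N (length fs)) (ι (r f) G ys)
              go G vG [] = V²-0 refl
              go G vG (y ∷ ys) = V²-+ (V²-* (h f y) (vG ys)) (V²-neg (go (λ zs → G (y ∷ zs)) (λ zs → vG (y ∷ zs)) ys))

            det-bound : ∃ λ N → ∀ ψ → Endomorphism ψ → V² N (detEnd ψ)
            det-bound with basis-bound b
            ... | N , h = scaled-bound N (length indices) , λ ψ E → V²-resp (sym (Determinants.det≈D R (λ (i : Fin m) j → coord (ψ (b j)) i) id id))
                    (D-bound (λ i j → coord (ψ (b j)) i) (λ i j → h ψ E j i) indices indices)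

            iterate : (Carrierᴹ → Carrierᴹ) → ℕ → Carrierᴹ → Carrierᴹ
            iterate φ zero = id
            iterate φ (suc k) = φ ∘ iterate φ k

            iterate-endomorphism : ∀ {φ} → Endomorphism φ → ∀ k → Endomorphism (iterate φ k)
            iterate-endomorphism E zero = record { isLinear = record { cong = id ; linear = λ a x y → ≈ᴹ-refl } ; stable = id }
            iterate-endomorphism E (suc k) = record
              { isLinear = record { cong = E.cong ∘ I.cong ; linear = λ a x y → ≈ᴹ-trans (E.cong (I.linear a x y)) (E.linear a _ _) }
              ; stable = Endomorphism.stable E ∘ Endomorphism.stable (iterate-endomorphism E k) }
              where
              module E = LinearMap (Endomorphism.isLinear E)
              module I = LinearMap (Endomorphism.isLinear (iterate-endomorphism E k))

            det-iterate : ∀ {φ} → Endomorphism φ → ∀ k → detEnd (iterate φ k) ≈ detEnd φ ^ k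
            det-iterate E zero = detEnd-id
            det-iterate {φ} E (suc k) = trans (detEnd-∘ (iterate φ k) (Endomorphism.isLinear E)) (*-congˡ (det-iterate E k))

            power-bounded : ∀ {N x} → (∀ k → V N (x ^ k)) → V (+ 0) x
            power-bounded {N} {x} h with V-or-W (+ 0) x
            ... | inj₁ v = v
            ... | inj₂ (k , Wk , k<0) = ⊥-elim (suc≰ {+ 0} (ℤ.≤-trans positive (W-bound (suc ℤ.∣ N ∣))))
              where
              W-power : ∀ i → W (scaled-bound k i) (x ^ i)
              W-power zero = W-1
              W-power (suc i) = W-* Wk (W-power i)
              small : ∀ i → + i ℤ.+ scaled-bound k i ℤ.≤ + 0
              small zero = ℤ.≤-refl
              small (suc i) = ℤ.≤-trans (ℤ.≤-reflexive (Z.solve 3 (λ i k s → (con (+ 1) :+ i) :+ (k :+ s) := (con (+ 1) :+ k) :+ (i :+ s)) ≡.refl (+ i) k (scaled-bound k i)))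
                (ℤ.+-mono-≤ k<0 (small i))
              W-bound : ∀ i → + i ℤ.+ N ℤ.≤ + 0
              W-bound i = ℤ.≤-trans (ℤ.+-monoʳ-≤ (+ i) (W-V (W-power i) (h i))) (small i)
              positive : + 1 ℤ.+ + 0 ℤ.≤ + suc ℤ.∣ N ∣ ℤ.+ N
              positive = lem N
                where
                lem : ∀ N → + 1 ℤ.≤ + suc ℤ.∣ N ∣ ℤ.+ N
                lem (+ n) = ℤ.+≤+ (s≤s z≤n)
                lem -[1+ n ] = ℤ.≤-reflexive (≡.sym (≡.trans (ℤ.⊖-≥ (ℕ.n≤1+n (suc n))) (≡.cong +_ (ℕ.m+n∸n≡m 1 (suc n)))))

            detEnd-integral : ∀ {φ} → Endomorphism φ → 𝒪 (detEnd φ)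
            detEnd-integral {φ} E with det-bound
            ... | N , h = power-bounded {N} (λ k → proj₁ (powers k)) , power-bounded {N} (λ k → V-resp (conj-power k) (proj₂ (powers k)))
              where
              powers : ∀ k → V² N (detEnd φ ^ k)
              powers k = V²-resp (det-iterate E k) (h _ (iterate-endomorphism E k))
              conj-power : ∀ k → conj (detEnd φ ^ k) ≈ conj (detEnd φ) ^ k
              conj-power zero = conj-1
              conj-power (suc k) = trans (conj-* _ _) (*-congˡ (conj-power k))

-- The element κ and the different

record IsExtension {c ℓ} (R : CommutativeRing c ℓ) (conj : CommutativeRing.Carrier R → CommutativeRing.Carrier R)
                   (w : CommutativeRing.Carrier R → ℤ∞) : Set (c ⊔ ℓ) where
  open CommutativeRing R
  field
    isValuation  : IsValuation R w
    w-conj       : ∀ x → w (conj x) ≡ w x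
    w-∞          : ∀ x → w x ≡ ⊤⁺ → x ≈ 0#
    inverse      : ∀ x → ¬ (x ≈ 0#) → ∃ λ y → x * y ≈ 1#
    real-even    : ∀ n x → conj x ≈ x → w x ≡ [ n ] → Even n
    real-exists  : ∀ k → ∃ λ x → conj x ≈ x × w x ≡ [ k ℤ.+ k ]
    hensel       : ∀ z → conj z ≈ z → [ + 1 ] ≤∞ w z → ∃ λ y → conj y ≈ y × [ + 0 ] ≤∞ w y × y ≈ 1# + z * (y * y)
    half         : Carrier
    half-real    : conj half ≈ half
    half-half    : half + half ≈ 1#
    δ            : Carrier
    δ-skew       : conj δ ≈ - δ
    d            : ℤ
    W-δ          : w δ ≡ [ d ]
    q            : ℕ
    residue      : Fin q → Carrier
    residue-real : ∀ i → conj (residue i) ≈ residue i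
    residue-onto : ∀ x → conj x ≈ x → [ + 0 ] ≤∞ w x → ∃ λ i → [ + 1 ] ≤∞ w (x - residue i)

module Extensions {c ℓ} (R : CommutativeRing c ℓ) (conj : CommutativeRing.Carrier R → CommutativeRing.Carrier R)
    (isConjugation : IsConjugation R conj) (w : CommutativeRing.Carrier R → ℤ∞) (isExtension : IsExtension R conj w) where
  open CommutativeRing R
  open IsConjugation isConjugation
  open IsExtension isExtension
  open Valuations R w isValuation
  open RingSolver R using (solve)
  open SetoidReasoning setoid
  private module Z = ℤ-Solver

  TraceOne : Carrier → Set ℓ
  TraceOne κ = κ + conj κ ≈ 1#

  Skew : Carrier → Set ℓ
  Skew s = conj s ≈ - s

  x≈0⊎W : ∀ x → x ≈ 0# ⊎ ∃ λ n → W n x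
  x≈0⊎W x = [ (λ eq → inj₁ (w-∞ x eq)) , inj₂ ]′ (finite x)

  invert : ∀ {n x} → W n x → ∃ λ y → x * y ≈ 1# × W (ℤ.- n) y
  invert {n} {x} Wx = let (y , xy≈1) = inverse x (W-≉0 Wx) in y , xy≈1 , W-inv xy≈1 Wx

  skew-even : ∀ {n s} → Skew s → W n s → Even (n ℤ.+ d)
  skew-even {n} {s} s-skew Ws = real-even (n ℤ.+ d) (s * δ) (trans (conj-* s δ) (trans (*-cong s-skew δ-skew)
    (solve 2 (λ x d → (:- x) :* (:- d) := x :* d) refl s δ))) (W-* Ws W-δ)

  trace-difference : ∀ {κ κ′} → TraceOne κ → TraceOne κ′ → Skew (κ′ - κ)
  trace-difference {κ} {κ′} t t′ = begin
    conj (κ′ - κ)                                     ≈⟨ conj-sub _ _ ⟩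
    conj κ′ - conj κ                                  ≈⟨ solve 4 (λ k k̄ l l̄ → l̄ :- k̄ := ((l :+ l̄) :- (k :+ k̄)) :- (l :- k)) refl κ (conj κ) κ′ (conj κ′) ⟩
    ((κ′ + conj κ′) - (κ + conj κ)) - (κ′ - κ)        ≈⟨ +-congʳ (trans (+-cong t′ (-‿cong t)) (-‿inverseʳ _)) ⟩
    0# - (κ′ - κ)                                     ≈⟨ +-identityˡ _ ⟩
    - (κ′ - κ)                                        ∎

  trace-one-W : ∀ {κ} → TraceOne κ → ∃ λ k → W k κ × k ℤ.≤ + 0
  trace-one-W {κ} t with x≈0⊎W κ
  ... | inj₁ κ≈0 = ⊥-elim (W-≉0 W-1 (trans (sym t) (trans (+-cong κ≈0 (trans (conj-cong κ≈0) conj-0)) (+-identityʳ 0#))))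
  ... | inj₂ (k , Wκ) = k , Wκ , W-V W-1 (V-resp t (V-+ (W⇒V Wκ) (W⇒V (≡.trans (w-conj κ) Wκ))))

  Maximal : ℤ → Set _
  Maximal k = ∀ κ → TraceOne κ → ∀ n → V n κ → n ℤ.≤ k

  record Optimum : Set (c ⊔ ℓ) where
    field
      κ       : Carrier
      k       : ℤ
      trace   : TraceOne κ
      W-κ     : W k κ
      maximal : Maximal k
      type    : (∀ n x → W n x → Even (n ℤ.- k)) ⊎ Odd (k ℤ.+ d)

  module _ {κ k} (trace : TraceOne κ) (W-κ : W k κ) where

    improve : ∀ {κ′ n} → V n κ′ → (n ℤ.≤ k) ⊎ (V (+ 1 ℤ.+ k) κ′ × W k (κ′ - κ))
    improve {κ′} {n} v with ≤-or-> n k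
    ... | inj₁ n≤k = inj₁ n≤k
    ... | inj₂ k<n = inj₂ (V-mono k<n v , W-+ʳ (V-mono k<n v) (W-neg W-κ))

    odd-maximal : Odd (k ℤ.+ d) → Maximal k
    odd-maximal o κ′ t′ n v with improve v
    ... | inj₁ n≤k = n≤k
    ... | inj₂ (_ , Ws) = ⊥-elim (even-odd (skew-even (trace-difference trace t′) Ws) o)

    module _ {s₀} (s₀-skew : Skew s₀) (W-s₀ : W k s₀) where
      s₀′ : Carrier
      s₀′ = proj₁ (invert W-s₀)

      s₀s₀′≈1 : s₀ * s₀′ ≈ 1#
      s₀s₀′≈1 = proj₁ (proj₂ (invert W-s₀))

      W-s₀′ : W (ℤ.- k) s₀′
      W-s₀′ = proj₂ (proj₂ (invert W-s₀))

      s₀′-skew : Skew s₀′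
      s₀′-skew = begin
        conj s₀′                              ≈⟨ solve 1 (λ x → x := x :* con (+ 1)) refl _ ⟩
        conj s₀′ * 1#                         ≈⟨ *-congˡ s₀s₀′≈1 ⟨
        conj s₀′ * (s₀ * s₀′)                 ≈⟨ solve 3 (λ x s y → x :* (s :* y) := :- (((:- s) :* x) :* y)) refl _ s₀ s₀′ ⟩
        - (((- s₀) * conj s₀′) * s₀′)         ≈⟨ -‿cong (*-congʳ (*-congʳ s₀-skew)) ⟨
        - ((conj s₀ * conj s₀′) * s₀′)        ≈⟨ -‿cong (*-congʳ (trans (sym (conj-* _ _)) (trans (conj-cong s₀s₀′≈1) conj-1))) ⟩
        - (1# * s₀′)                          ≈⟨ -‿cong (*-identityˡ _) ⟩
        - s₀′                                 ∎

      stuck-maximal : (∀ i → ¬ V (+ 1 ℤ.+ k) (κ + residue i * s₀)) → Maximal k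
      stuck-maximal stuck κ′ t′ n v with improve v
      ... | inj₁ n≤k = n≤k
      ... | inj₂ (v′ , Ws) = ⊥-elim (refute (residue-onto m m-real (≤-W (W-* Ws W-s₀′) (ℤ.≤-reflexive (≡.sym (ℤ.+-inverseʳ k))))))
        where
        s = κ′ - κ
        m = s * s₀′
        m-real : conj m ≈ m
        m-real = trans (conj-* _ _) (trans (*-cong (trace-difference trace t′) s₀′-skew)
          (solve 2 (λ x y → (:- x) :* (:- y) := x :* y) refl s s₀′))
        refute : (∃ λ i → V (+ 1) (m - residue i)) → ⊥
        refute (i , vi) = stuck i (V-resp (begin
            κ′ - (m - residue i) * s₀       ≈⟨ solve 5 (λ l k s′ r s → l :- ((l :- k) :* s′ :- r) :* s := (l :- (l :- k) :* (s :* s′)) :+ r :* s) refl κ′ κ s₀′ (residue i) s₀ ⟩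
            (κ′ - s * (s₀ * s₀′)) + residue i * s₀ ≈⟨ +-congʳ (+-congˡ (-‿cong (trans (*-congˡ s₀s₀′≈1) (*-identityʳ _)))) ⟩
            (κ′ - s) + residue i * s₀       ≈⟨ +-congʳ (solve 2 (λ l k → l :- (l :- k) := k) refl κ′ κ) ⟩
            κ + residue i * s₀              ∎)
          (V-sub v′ (V-* vi (W⇒V W-s₀))))

    even-values : Even (k ℤ.+ d) → Maximal k → ∀ n x → W n x → Even (n ℤ.- k)
    even-values e maximal n x Wx with x≈0⊎W (x + conj x)
    ... | inj₁ t≈0 = ≡.subst Even (Z.solve 3 (λ n k d → (n :+ d) :- (k :+ d) := n :- k) ≡.refl n k d)
            (even-+ (skew-even (trans (solve 2 (λ x x̄ → x̄ := (x :+ x̄) :- x) refl x (conj x)) (trans (+-congʳ t≈0) (+-identityˡ _))) Wx) (even-neg e))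
    ... | inj₂ (i , Wt) = ≡.subst Even (Z.solve 3 (λ n i k → ((n :- i) :- k) :+ i := n :- k) ≡.refl n i k)
            (even-+ (trace-one-even (proj₁ (proj₂ normalised)) (proj₂ (proj₂ normalised))) (real-even i (x + conj x) t-real Wt))
      where
      t-real : conj (x + conj x) ≈ x + conj x
      t-real = trans (conj-+ _ _) (trans (+-congˡ (conj-involutive x)) (+-comm _ _))
      normalised : ∃ λ κ′ → TraceOne κ′ × W (n ℤ.- i) κ′
      normalised = let (t′ , tt′≈1 , Wt′) = invert Wt
                       t′-real : conj t′ ≈ t′
                       t′-real = trans (solve 1 (λ u → u := u :* con (+ 1)) refl _) (trans (*-congˡ (sym tt′≈1))
                         (trans (solve 3 (λ u t t′ → u :* (t :* t′) := (t :* u) :* t′) refl _ _ _)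
                         (trans (*-congʳ (trans (*-congʳ (sym t-real)) (trans (sym (conj-* _ _)) (trans (conj-cong tt′≈1) conj-1)))) (*-identityˡ _))))
                   in x * t′ , trans (+-congˡ (trans (conj-* _ _) (*-congˡ t′-real))) (trans (sym (distribʳ _ _ _)) tt′≈1) , W-* Wx Wt′
      trace-one-even : ∀ {j κ′} → TraceOne κ′ → W j κ′ → Even (j ℤ.- k)
      trace-one-even {j} {κ′} t′ Wκ′ with ≤-or-> k j
      ... | inj₁ k≤j = ≡.subst (λ j → Even (j ℤ.- k)) (ℤ.≤-antisym k≤j (maximal κ′ t′ j (W⇒V Wκ′))) (+ 0 , ℤ.+-inverseʳ k)
      ... | inj₂ j<k = ≡.subst Even (Z.solve 3 (λ j k d → (j :+ d) :- (k :+ d) := j :- k) ≡.refl j k d)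
              (even-+ (skew-even (trace-difference trace t′) (W-+ Wκ′ (≤-W (W-neg W-κ) j<k))) (even-neg e))

  search : ∀ fuel {κ k} → TraceOne κ → W k κ → + 0 ℤ.≤ + fuel ℤ.+ k → Optimum
  search fuel {κ} {k} trace W-κ enough = [ even , odd ]′ (parity (k ℤ.+ d))
    where
    odd : Odd (k ℤ.+ d) → Optimum
    odd o = record { κ = κ ; k = k ; trace = trace ; W-κ = W-κ ; maximal = odd-maximal trace W-κ o ; type = inj₂ o }
    even : Even (k ℤ.+ d) → Optimum
    even e@(m , eq) with Fin.any? (λ i → V? (+ 1 ℤ.+ k) (κ + residue i * s₀))
      where
      c₀ = proj₁ (real-exists (m ℤ.- d))
      s₀ = c₀ * δ
    ... | no stuck = record { κ = κ ; k = k ; trace = trace ; W-κ = W-κ ; maximal = max ; type = inj₁ (even-values trace W-κ e max) }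
      where
      max : Maximal k
      max = stuck-maximal trace W-κ
        (trans (conj-* _ _) (trans (*-cong (proj₁ (proj₂ (real-exists (m ℤ.- d)))) δ-skew) (solve 2 (λ c d → c :* :- d := :- (c :* d)) refl _ _)))
        (W-cast (≡.trans (Z.solve 2 (λ m d → ((m :- d) :+ (m :- d)) :+ d := (m :+ m) :- d) ≡.refl m d)
          (≡.trans (≡.cong (ℤ._- d) (≡.sym eq)) (Z.solve 2 (λ k d → (k :+ d) :- d := k) ≡.refl k d)))
          (W-* (proj₂ (proj₂ (real-exists (m ℤ.- d)))) W-δ))
        (λ i v → stuck (i , v))
    ... | yes (i , v) = continue fuel enough (trace-one-W better)
      where
      c₀ = proj₁ (real-exists (m ℤ.- d))
      κ₁ = κ + residue i * (c₀ * δ)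
      better : TraceOne κ₁
      better = begin
        κ₁ + conj κ₁  ≈⟨ +-congˡ (trans (conj-+ _ _) (+-congˡ (trans (conj-* _ _) (*-cong (residue-real i) (trans (conj-* _ _) (*-cong (proj₁ (proj₂ (real-exists (m ℤ.- d)))) δ-skew)))))) ⟩
        (κ + residue i * (c₀ * δ)) + (conj κ + residue i * (c₀ * - δ))
          ≈⟨ solve 5 (λ k k̄ r c d → (k :+ r :* (c :* d)) :+ (k̄ :+ r :* (c :* :- d)) := k :+ k̄) refl κ (conj κ) (residue i) c₀ δ ⟩
        κ + conj κ    ≈⟨ trace ⟩
        1#            ∎
      continue : ∀ fuel → + 0 ℤ.≤ + fuel ℤ.+ k → (∃ λ k₁ → W k₁ κ₁ × k₁ ℤ.≤ + 0) → Optimum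
      continue zero enough (k₁ , Wκ₁ , k₁≤0) = ⊥-elim (suc≰ (ℤ.≤-trans (ℤ.+-monoʳ-≤ (+ 1) (≡.subst (+ 0 ℤ.≤_) (ℤ.+-identityˡ k) enough)) (ℤ.≤-trans (W-V Wκ₁ v) k₁≤0)))
      continue (suc fuel) enough (k₁ , Wκ₁ , _) = search fuel better Wκ₁ (ℤ.≤-trans enough
        (cert (k₁ ℤ.- (+ 1 ℤ.+ k)) (diff (W-V Wκ₁ v)) (Z.solve 3 (λ f k k₁ → f :+ k₁ := ((con (+ 1) :+ f) :+ k) :+ (k₁ :- (con (+ 1) :+ k))) ≡.refl (+ fuel) k k₁)))

  optimum : Optimum
  optimum = let (k , Wκ , _) = trace-one-W half-trace in search ℤ.∣ k ∣ half-trace Wκ (enough k)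
    where
    half-trace : TraceOne half
    half-trace = trans (+-congˡ half-real) half-half
    enough : ∀ k → + 0 ℤ.≤ + ℤ.∣ k ∣ ℤ.+ k
    enough (+ n) = nonneg
    enough -[1+ n ] = ℤ.≤-reflexive (≡.sym (ℤ.n⊖n≡0 (suc n)))

  isQuadratic : IsQuadratic R conj w
  isQuadratic = record
    { isValuation = isValuation ; w-conj = w-conj ; w-∞ = w-∞ ; inverse = inverse
    ; h = ℤ.- k ; κ = κ ; κ-trace = trace
    ; W-κ = W-cast (≡.sym (ℤ.neg-involutive k)) W-κ
    ; trace-bound = trace-bound
    ; real-even = real-even ; real-exists = real-exists ; hensel = hensel
    ; inert⊎ramified = [ inj₁ , inj₂ ∘ ramified ]′ type
    }
    where
    open Optimum optimum
    trace-bound : ∀ n x → V n x → V (n ℤ.- k) (x + conj x)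
    trace-bound n x v with x≈0⊎W (x + conj x)
    ... | inj₁ t≈0 = V-zero t≈0
    ... | inj₂ (i , Wt) = let (t′ , tt′≈1 , Wt′) = invert Wt
                              t-real = trans (conj-+ x (conj x)) (trans (+-congˡ (conj-involutive x)) (+-comm _ _))
                              t′-real : conj t′ ≈ t′
                              t′-real = trans (solve 1 (λ u → u := u :* con (+ 1)) refl _) (trans (*-congˡ (sym tt′≈1))
                                 (trans (solve 3 (λ u t t′ → u :* (t :* t′) := (t :* u) :* t′) refl _ _ _)
                                 (trans (*-congʳ (trans (*-congʳ (sym t-real)) (trans (sym (conj-* _ _)) (trans (conj-cong tt′≈1) conj-1)))) (*-identityˡ _))))
                          in ≤-W Wt (cert (k ℤ.- (n ℤ.- i)) (diff (maximal (x * t′)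
                               (trans (+-congˡ (trans (conj-* _ _) (*-congˡ t′-real))) (trans (sym (distribʳ _ _ _)) tt′≈1)) (n ℤ.- i) (V-* v (W⇒V Wt′))))
                               (Z.solve 3 (λ n i k → i := (n :- k) :+ (k :- (n :- i))) ≡.refl n i k))
    ramified : Odd (k ℤ.+ d) → IsRamified R conj w (ℤ.- k)
    ramified o@(m , eq) = record
      { δ = δ ; δ-skew = δ-skew ; d = d ; W-δ = W-δ
      ; odd-d+h = ≡.subst Odd (Z.solve 2 (λ k d → :- (k :+ k) :+ (k :+ d) := d :- k) ≡.refl k d) (even-odd-+ (even-neg (even-double k)) o)
      ; ϖ = κ * δ * proj₁ (real-exists (ℤ.- m))
      ; W-ϖ = W-cast (≡.trans (≡.cong (ℤ._+ (ℤ.- m ℤ.+ ℤ.- m)) eq) (Z.solve 1 (λ m → con (+ 1) :+ (m :+ m) :+ (:- m :- m) := con (+ 1)) ≡.refl m))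
                (W-* (W-* W-κ W-δ) (proj₂ (proj₂ (real-exists (ℤ.- m)))))
      }

module Differents {c ℓ} (R : CommutativeRing c ℓ) (conj : CommutativeRing.Carrier R → CommutativeRing.Carrier R)
    (isConjugation : IsConjugation R conj) (w : CommutativeRing.Carrier R → ℤ∞) (isQuadratic : IsQuadratic R conj w) where
  open CommutativeRing R
  open IsConjugation isConjugation
  open IsQuadratic isQuadratic
  open Valuations R w isValuation
  open RingSolver R using (solve)
  open SetoidReasoning setoid
  open RawSemiringDefs (Semiring.rawSemiring semiring) using (_^_)
  private module Z = ℤ-Solver

  invert : ∀ {n x} → W n x → ∃ λ y → x * y ≈ 1# × W (ℤ.- n) y
  invert {n} {x} Wx = let (y , xy≈1) = inverse x (W-≉0 Wx) in y , xy≈1 , W-inv xy≈1 Wx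

  codifferent : ∀ {β γ} → V (ℤ.- (+ 1 ℤ.+ h)) β → V (+ 0) γ → V (+ 0) (β * γ + conj (β * γ))
  codifferent {β} {γ} vβ vγ with V-or-W (+ 0) (β * γ + conj (β * γ))
  ... | inj₁ v = v
  ... | inj₂ (k , Wk , k<0) = ⊥-elim (even-odd (real-even k _ real Wk)
          (≡.subst Odd (ℤ.≤-antisym (≡.subst (ℤ._≤ k) bound (W-V Wk (trace-bound _ _ (V-* vβ vγ)))) (suc-cancel-≤ k<0)) (ℤ.- (+ 1) , ≡.refl)))
    where
    real : conj (β * γ + conj (β * γ)) ≈ β * γ + conj (β * γ)
    real = trans (conj-+ _ _) (trans (+-congˡ (conj-involutive _)) (+-comm _ _))
    bound : ℤ.- (+ 1 ℤ.+ h) ℤ.+ + 0 ℤ.+ h ≡ -[1+ 0 ]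
    bound = Z.solve 1 (λ h → :- (con (+ 1) :+ h) :+ con (+ 0) :+ h := con -[1+ 0 ]) ≡.refl h

  codifferent⁻¹ : ∀ {β} → (∀ γ → V (+ 0) γ → V (+ 0) (β * γ + conj (β * γ))) → V (ℤ.- (+ 1 ℤ.+ h)) β
  codifferent⁻¹ {β} integral with V-or-W (ℤ.- (+ 1 ℤ.+ h)) β
  ... | inj₁ v = v
  ... | inj₂ (k , Wβ , k<) = ⊥-elim (impossible (invert Wβ) (real-exists -[1+ 0 ]))
    where
    impossible : (∃ λ β′ → β * β′ ≈ 1# × W (ℤ.- k) β′) → (∃ λ z → conj z ≈ z × W -[1+ 1 ] z) → ⊥
    impossible (β′ , ββ′≈1 , Wβ′) (z , z-real , Wz) with W-V Wz (V-resp trace (integral γ (V-mono bound (W⇒V (W-* (W-* W-κ Wz) Wβ′)))))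
      where
      γ = κ * z * β′
      bound : + 0 ℤ.≤ ℤ.- h ℤ.+ -[1+ 1 ] ℤ.+ ℤ.- k
      bound = cert (ℤ.- (+ 1 ℤ.+ h) ℤ.- (+ 1 ℤ.+ k)) (diff k<) (Z.solve 2 (λ h k → :- h :+ con -[1+ 1 ] :- k := con (+ 0) :+ (:- (con (+ 1) :+ h) :- (con (+ 1) :+ k))) ≡.refl h k)
      βγ : β * γ ≈ κ * z
      βγ = trans (solve 3 (λ b p b′ → b :* (p :* b′) := p :* (b :* b′)) refl β (κ * z) β′) (trans (*-congˡ ββ′≈1) (*-identityʳ _))
      trace : β * γ + conj (β * γ) ≈ z
      trace = begin
        β * γ + conj (β * γ)    ≈⟨ +-cong βγ (conj-cong βγ) ⟩
        κ * z + conj (κ * z)    ≈⟨ +-congˡ (trans (conj-* κ z) (*-congˡ z-real)) ⟩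
        κ * z + conj κ * z      ≈⟨ distribʳ z κ (conj κ) ⟨
        (κ + conj κ) * z        ≈⟨ trans (*-congʳ κ-trace) (*-identityˡ z) ⟩
        z                       ∎
    ... | ()

  W-exists : IsRamified R conj w h → ∀ n → ∃ λ x → W n x
  W-exists ram n = [ even , odd ]′ (parity n)
    where
    open IsRamified ram using (ϖ; W-ϖ)
    even : Even n → ∃ λ x → W n x
    even (k , eq) = let (x , _ , Wx) = real-exists k in x , W-cast (≡.sym eq) Wx
    odd : Odd n → ∃ λ x → W n x
    odd (k , eq) = let (x , _ , Wx) = real-exists k in ϖ * x , W-cast (≡.sym eq) (W-* W-ϖ Wx)

  even-ratio⇒unit-ratio : ∀ {D} → (∃₂ λ x n → W n x × Even n × D * conj x ≈ x) →
    ∃₂ λ u u′ → W (+ 0) u × conj u * u′ ≈ 1# × D ≈ u * u′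
  even-ratio⇒unit-ratio {D} (x , n , Wx , (k , eq) , Dx̄≈x) =
    let (z , z-real , Wz) = real-exists (ℤ.- k)
        u = x * z
        Wu : W (+ 0) u
        Wu = W-cast (≡.trans (≡.cong (ℤ._+ (ℤ.- k ℤ.+ ℤ.- k)) eq) (Z.solve 1 (λ k → (k :+ k) :+ (:- k :- k) := con (+ 0)) ≡.refl k)) (W-* Wx Wz)
        (u′ , ūu′≈1 , _) = invert (≡.trans (w-conj u) Wu)
        Dū≈u : D * conj u ≈ u
        Dū≈u = trans (*-congˡ (trans (conj-* x z) (*-congˡ z-real))) (trans (sym (*-assoc _ _ _)) (*-congʳ Dx̄≈x))
    in u , u′ , Wu , ūu′≈1 , trans (sym (*-identityʳ D)) (trans (*-congˡ (sym ūu′≈1)) (trans (sym (*-assoc _ _ _)) (*-congʳ Dū≈u)))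

  hyperbolic-star : ∀ {i j a b ρ ρ̄} → ρ̄ ≈ conj ρ → W i ρ → Odd (i ℤ.+ h) → V (+ 0) a → V (+ 0) b →
    V j (a * ρ * conj 1# + b * ρ̄ * conj 0#) → V j (a * ρ * conj 0# + b * ρ̄ * conj 1#) → Even (j ℤ.+ h) →
    V (+ 1 ℤ.+ (j ℤ.+ h)) (a * ρ * conj b + b * ρ̄ * conj a)
  hyperbolic-star {i} {j} {a} {b} {ρ} {ρ̄} ρ̄≈ Wρ o va vb v₁ v₂ e = V-resp (+-congˡ trace)
      (V-cast (ℤ.+-assoc (+ 1) j h) (trace-bound (+ 1 ℤ.+ j) _ product))
    where
    V-conj : ∀ {n x} → V n x → V n (conj x)
    V-conj {n} {x} = ≡.subst ([ n ] ≤∞_) (≡.sym (w-conj x))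
    trace : conj (a * ρ * conj b) ≈ b * ρ̄ * conj a
    trace = trans (conj-* _ _) (trans (*-cong (conj-* _ _) (conj-involutive b)) (trans (*-congʳ (*-congˡ (sym ρ̄≈)))
      (solve 3 (λ a r b → a :* r :* b := b :* r :* a) refl _ _ _)))
    vaρ : V j (a * ρ)
    vaρ = V-resp (trans (+-cong (trans (*-congˡ conj-1) (*-identityʳ _)) (trans (*-congˡ conj-0) (zeroʳ _))) (+-identityʳ _)) v₁
    vbρ : V j (b * conj ρ)
    vbρ = V-resp (trans (+-cong (trans (*-congˡ conj-0) (zeroʳ _)) (trans (*-congˡ conj-1) (trans (*-identityʳ _) (*-congˡ ρ̄≈)))) (+-identityˡ _)) v₂
    product : V (+ 1 ℤ.+ j) (a * ρ * conj b)
    product with ≤-or-> i j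
    ... | inj₂ j<i = V-mono j<i (V-cast (Z.solve 1 (λ i → con (+ 0) :+ i :+ con (+ 0) := i) ≡.refl i) (V-* (V-* va (W⇒V Wρ)) (V-conj vb)))
    ... | inj₁ i≤j = V-mono bound (V-* vaρ (V-conj (V-cancel (≡.trans (w-conj ρ) Wρ) (V-cast (Z.solve 2 (λ i j → j := i :+ (j :- i)) ≡.refl i j) (V-resp (*-comm _ _) vbρ)))))
      where
      i<j : + 1 ℤ.+ i ℤ.≤ j
      i<j = ℤ.i<j⇒suc[i]≤j (ℤ.≤∧≢⇒< i≤j λ { ≡.refl → even-odd e o })
      bound : + 1 ℤ.+ j ℤ.≤ j ℤ.+ (j ℤ.- i)
      bound = cert (j ℤ.- (+ 1 ℤ.+ i)) (diff i<j) (Z.solve 2 (λ i j → j :+ (j :- i) := (con (+ 1) :+ j) :+ (j :- (con (+ 1) :+ i))) ≡.refl i j)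

  hyperbolic-congʳ : ∀ {a b ρ ρ̄ c d c′ d′} → c ≈ c′ → d ≈ d′ →
    a * ρ * conj d + b * ρ̄ * conj c ≈ a * ρ * conj d′ + b * ρ̄ * conj c′
  hyperbolic-congʳ c≈c′ d≈d′ = +-cong (*-congˡ (conj-cong d≈d′)) (*-congˡ (conj-cong c≈c′))

  hyperbolic-zeroʳ : ∀ {a b ρ ρ̄} → a * ρ * conj 0# + b * ρ̄ * conj 0# ≈ 0#
  hyperbolic-zeroʳ = trans (+-cong (trans (*-congˡ conj-0) (zeroʳ _)) (trans (*-congˡ conj-0) (zeroʳ _))) (+-identityʳ 0#)

  conj-power : ∀ x n → conj x ^ n ≈ conj (x ^ n)
  conj-power x zero    = sym conj-1
  conj-power x (suc n) = trans (*-congˡ (conj-power x n)) (sym (conj-* x (x ^ n)))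

  W-power : ∀ {x} → W (+ 1) x → ∀ n → W (+ n) (x ^ n)
  W-power Wx zero    = W-1
  W-power Wx (suc n) = W-* Wx (W-power Wx n)

  W-power⁻ : ∀ {x} → W -[1+ 0 ] x → ∀ n → W -[1+ n ] (x ^ suc n)
  W-power⁻ Wx zero    = W-* Wx W-1
  W-power⁻ Wx (suc n) = W-* Wx (W-power⁻ Wx n)

  norm-one-W : ∀ {u} → u * conj u ≈ 1# → W (+ 0) u
  norm-one-W {u} Nru≈1 = [ (λ eq → ⊥-elim (W-≉0 W-1 (trans (sym Nru≈1) (trans (*-congʳ (w-∞ u eq)) (zeroˡ _)))))
    , (λ (k , Wk) → W-cast (double-inj k (+ 0) (W-unique (W-* Wk (≡.trans (w-conj u) Wk)) (W-resp (sym Nru≈1) W-1))) Wk) ]′ (finite u)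

  unit-W : ∀ {u u′} → V (+ 0) u → V (+ 0) u′ → u * u′ ≈ 1# → W (+ 0) u
  unit-W {u} {u′} vu vu′ uu′≈1 = [ (λ eq → ⊥-elim (W-≉0 W-1 (trans (sym uu′≈1) (trans (*-congʳ (w-∞ u eq)) (zeroˡ _)))))
    , (λ (k , Wk) → W-cast (ℤ.≤-antisym (≡.subst₂ ℤ._≤_ (ℤ.neg-involutive k) ≡.refl (ℤ.neg-mono-≤ (W-V (W-inv uu′≈1 Wk) vu′))) (W-V Wk vu)) Wk) ]′ (finite u)

  unit-ratio⇒even-ratio : ∀ {u u′ x} → W (+ 0) u → conj u * u′ ≈ 1# → x ≈ u * u′ →
    x * conj x ≈ 1# × (∃₂ λ y n → W n y × Even n × x * conj y ≈ y)
  unit-ratio⇒even-ratio {u} {u′} {x} Wu ūu′≈1 x≈ = (begin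
      x * conj x                         ≈⟨ *-cong x≈ (trans (conj-cong x≈) (conj-* u u′)) ⟩
      (u * u′) * (conj u * conj u′)      ≈⟨ solve 4 (λ u u′ v v′ → (u :* u′) :* (v :* v′) := (v :* u′) :* (u :* v′)) refl u u′ _ _ ⟩
      (conj u * u′) * (u * conj u′)      ≈⟨ *-cong ūu′≈1 (trans (*-congʳ (sym (conj-involutive u))) (trans (sym (conj-* _ _)) (trans (conj-cong ūu′≈1) conj-1))) ⟩
      1# * 1#                            ≈⟨ *-identityˡ 1# ⟩
      1#                                 ∎) ,
    (u , + 0 , Wu , (+ 0 , ≡.refl) , trans (*-congʳ x≈) (trans (solve 3 (λ u u′ v → u :* u′ :* v := u :* (v :* u′)) refl u u′ _)
      (trans (*-congˡ ūu′≈1) (*-identityʳ u))))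

-- Quadratic extensions of local fields

module LocalFields {c ℓ} (F : LocalField c ℓ) where
  open LocalField F
  open IsField isField
  open RingSolver commutativeRing using (solve)
  private module Z = ℤ-Solver

  isValuation : IsValuation commutativeRing ord
  isValuation = record { w-cong = ord-cong ; w-0 = ord-0 ; w-1 = ord-1 ; w-* = ord-* ; w-+ = ord-+ }
    where
    ord-1 : ord 1# ≡ [ + 0 ]
    ord-1 = go (ord 1#) ≡.refl
      where
      go : ∀ o → ord 1# ≡ o → ord 1# ≡ [ + 0 ]
      go ⊤⁺ eq = ⊥-elim (1≉0 (ord-∞ 1# eq))
      go [ n ] eq = case ≡.trans (≡.sym (≡.cong₂ _+∞_ eq eq)) (≡.trans (≡.sym (ord-* 1# 1#)) (≡.trans (ord-cong (*-identityˡ 1#)) eq)) of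
        λ eq′ → ≡.trans eq (≡.cong (λ n → [ n ]) (zero′ n eq′))
        where
        zero′ : ∀ n → _≡_ {A = ℤ∞} [ n ℤ.+ n ] [ n ] → n ≡ + 0
        zero′ n eq = ≡.trans (Z.solve 1 (λ n → n := (n :+ n) :- n) ≡.refl n) (≡.trans (≡.cong (ℤ._- n) (inj eq)) (ℤ.+-inverseʳ n))
          where
          inj : ∀ {m n : ℤ} → _≡_ {A = ℤ∞} [ m ] [ n ] → m ≡ n
          inj ≡.refl = ≡.refl

  open Valuations commutativeRing ord isValuation public

  x≈0⊎W : ∀ x → x ≈ 0# ⊎ ∃ λ n → W n x
  x≈0⊎W x with finite x
  ... | inj₁ eq = inj₁ (ord-∞ x eq)
  ... | inj₂ h  = inj₂ h

  invert : ∀ {n x} → W n x → ∃ λ y → x * y ≈ 1# × W (ℤ.- n) y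
  invert {n} {x} Wx = let (y , xy≈1) = inverse x (W-≉0 Wx) in y , xy≈1 , W-inv xy≈1 Wx

  cancel-zero : ∀ {x y} → ¬ (x ≈ 0#) → x * y ≈ 0# → y ≈ 0#
  cancel-zero {x} {y} x≉0 xy≈0 with inverse x x≉0
  ... | x′ , xx′≈1 = trans (sym (*-identityˡ y)) (trans (*-congʳ (sym xx′≈1))
    (trans (solve 3 (λ x x′ y → x :* x′ :* y := x′ :* (x :* y)) refl x x′ y) (trans (*-congˡ xy≈0) (zeroʳ x′))))

  V-square⁻¹ : ∀ {n x} → V (n ℤ.+ n) (x * x) → V n x
  V-square⁻¹ {n} {x} v with finite x
  ... | inj₁ eq = V-⊤ eq
  ... | inj₂ (k , Wk) = ≤-W Wk (double-mono⁻¹ (W-V (W-* Wk Wk) v))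

  module Hensel {ε} (vε : V (+ 1) ε) where
    s : ℕ → Carrier
    s zero    = 1#
    s (suc n) = 1# + ε * (s n * s n)

    s-integral : ∀ n → V (+ 0) (s n)
    s-integral zero = W⇒V W-1
    s-integral (suc n) = V-+ (W⇒V W-1) (V-mono (ℤ.+≤+ z≤n) (V-* vε (V-* (s-integral n) (s-integral n))))

    step : ∀ n → V (+ n) (s (suc n) - s n)
    step zero = V-resp (solve 1 (λ e → e := (con (+ 1) :+ e :* (con (+ 1) :* con (+ 1))) :- con (+ 1)) refl ε) (V-mono (ℤ.+≤+ z≤n) vε)
    step (suc n) = V-resp (solve 3 (λ e x y → e :* ((x :- y) :* (x :+ y)) := (con (+ 1) :+ e :* (x :* x)) :- (con (+ 1) :+ e :* (y :* y)))
        refl ε (s (suc n)) (s n))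
      (V-cast (≡.cong ℤ.suc (ℤ.+-identityʳ (+ n))) (V-* vε (V-* (step n) (V-+ (s-integral (suc n)) (s-integral n)))))

    far : ∀ n k → V (+ n) (s (k ℕ.+ n) - s n)
    far n zero = V-zero (-‿inverseʳ (s n))
    far n (suc k) = V-resp (solve 3 (λ x y z → (x :- y) :+ (y :- z) := x :- z) refl (s (suc k ℕ.+ n)) (s (k ℕ.+ n)) (s n))
      (V-+ (V-mono (ℤ.+≤+ (ℕ.m≤n+m n k)) (step (k ℕ.+ n))) (far n k))

    far′ : ∀ n i → n ℕ.≤ i → V (+ n) (s i - s n)
    far′ n i n≤i = ≡.subst (λ i → V (+ n) (s i - s n)) (ℕ.m∸n+n≡m n≤i) (far n (i ℕ.∸ n))

    ≤∣∣ : ∀ n → n ℤ.≤ + ℤ.∣ n ∣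
    ≤∣∣ (+ n) = ℤ.≤-refl
    ≤∣∣ -[1+ n ] = ℤ.-≤+

    cauchy : Cauchy s
    cauchy n = ℤ.∣ n ∣ , λ i j Ni Nj → V-mono (≤∣∣ n) (V-resp
      (solve 3 (λ x y z → (x :- z) :- (y :- z) := x :- y) refl (s i) (s j) (s ℤ.∣ n ∣)) (V-sub (far′ _ i Ni) (far′ _ j Nj)))

    root : ∃ λ z → V (+ 0) z × z ≈ 1# + ε * (z * z)
    root with complete s cauchy
    ... | z , conv = z , vz , equation
      where
      vz : V (+ 0) z
      vz with conv (+ 0)
      ... | N , h = V-resp (solve 2 (λ x z → x :- (x :- z) := z) refl (s N) z) (V-sub (s-integral N) (h N ℕ.≤-refl))
      close : ∀ n → V n (z - (1# + ε * (z * z)))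
      close n with conv n
      ... | N , h = V-resp (solve 3 (λ z x e → :- ((con (+ 1) :+ e :* (x :* x)) :- z) :+ e :* ((x :- z) :* (x :+ z)) := z :- (con (+ 1) :+ e :* (z :* z)))
              refl z (s N) ε)
            (V-+ (V-neg (h (suc N) (ℕ.n≤1+n N)))
              (V-mono (cert (+ 1) nonneg (Z.solve 1 (λ n → con (+ 1) :+ (n :+ con (+ 0)) := n :+ con (+ 1)) ≡.refl n))
                (V-* vε (V-* (h N ℕ.≤-refl) (V-+ (s-integral N) vz)))))
      equation : z ≈ 1# + ε * (z * z)
      equation = trans (solve 2 (λ z w → z := (z :- w) :+ w) refl z _)
        (trans (+-congʳ (ord-∞ _ (V-all close))) (+-identityˡ _))

    -- 1 - 4 ε is the square of 1 - 2 ε z when z = 1 + ε z².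
    square-root : ∃ λ r → r * r ≈ 1# - (ε + ε + ε + ε)
    square-root = let (z , _ , z≈) = root in 1# - (ε + ε) * z , trans
      (solve 2 (λ e z → (con (+ 1) :- (e :+ e) :* z) :* (con (+ 1) :- (e :+ e) :* z) :=
        con (+ 1) :- (e :+ e :+ e :+ e) :* (z :- e :* (z :* z))) refl ε (proj₁ root))
      (trans (+-congˡ (-‿cong (*-congˡ (trans (+-congʳ z≈) (solve 1 (λ u → (con (+ 1) :+ u) :- u := con (+ 1)) refl _)))))
        (+-congˡ (-‿cong (*-identityʳ _))))

Char≢2 : ∀ {c ℓ} → LocalField c ℓ → Set ℓ
Char≢2 F = ¬ (1# + 1# ≈ 0#)
  where open LocalField F

module QuadraticExtension {c ℓ} (F : LocalField c ℓ) (a : LocalField.Carrier F)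
    (2≉0 : Char≢2 F) where
  module K where
    open LocalField F public
    open LocalFields F public
    open RingSolver commutativeRing public using (solve)
  open QuadraticAlgebra F a
  private module Z = ℤ-Solver

  nr : Carrier → K.Carrier
  nr (x , y) = x K.* x K.- a K.* (y K.* y)

  Nr≈ : ∀ α → Nr α ≈ ι (nr α)
  Nr≈ (x , y) = K.solve 3 (λ a x y → x :* x :+ a :* (y :* :- y) := x :* x :- a :* (y :* y)) K.refl a x y ,
                K.solve 2 (λ x y → x :* :- y :+ y :* x := con (+ 0)) K.refl x y

  Tr≈ : ∀ α → Tr α ≈ ι (proj₁ α K.+ proj₁ α)
  Tr≈ (x , y) = K.refl , K.-‿inverseʳ y

  isConjugation : IsConjugation E conj
  isConjugation = record
    { conj-cong = λ (p , q) → p , K.-‿cong q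
    ; conj-+ = λ (x , y) (z , w) → K.refl , K.solve 2 (λ y w → :- (y :+ w) := :- y :- w) K.refl y w
    ; conj-* = λ (x , y) (z , w) →
        K.solve 5 (λ a x y z w → x :* z :+ a :* (y :* w) := x :* z :+ a :* (:- y :* :- w)) K.refl a x y z w ,
        K.solve 4 (λ x y z w → :- (x :* w :+ y :* z) := x :* :- w :+ :- y :* z) K.refl x y z w
    ; conj-involutive = λ (x , y) → K.refl , K.solve 1 (λ y → :- :- y := y) K.refl y
    }

  ι-cong : ∀ {x y} → x K.≈ y → ι x ≈ ι y
  ι-cong x≈y = x≈y , K.refl

  ι-* : ∀ x y → ι x * ι y ≈ ι (x K.* y)
  ι-* x y = K.solve 3 (λ a x y → x :* y :+ a :* (con (+ 0) :* con (+ 0)) := x :* y) K.refl a x y ,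
            K.solve 2 (λ x y → x :* con (+ 0) :+ con (+ 0) :* y := con (+ 0)) K.refl x y

  ι-+ : ∀ x y → ι x + ι y ≈ ι (x K.+ y)
  ι-+ x y = K.refl , K.+-identityˡ K.0#

  nr-cong : ∀ {α β} → α ≈ β → nr α K.≈ nr β
  nr-cong (p , q) = K.+-cong (K.*-cong p p) (K.-‿cong (K.*-congˡ (K.*-cong q q)))

  nr-* : ∀ α β → nr (α * β) K.≈ nr α K.* nr β
  nr-* (x , y) (z , w) = K.solve 5 (λ a x y z w →
    (x :* z :+ a :* (y :* w)) :* (x :* z :+ a :* (y :* w)) :- a :* ((x :* w :+ y :* z) :* (x :* w :+ y :* z)) :=
    (x :* x :- a :* (y :* y)) :* (z :* z :- a :* (w :* w))) K.refl a x y z w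

  nr-ι : ∀ x → nr (ι x) K.≈ x K.* x
  nr-ι x = K.solve 2 (λ a x → x :* x :- a :* (con (+ 0) :* con (+ 0)) := x :* x) K.refl a x

  nr-conj : ∀ α → nr (conj α) K.≈ nr α
  nr-conj (x , y) = K.solve 3 (λ a x y → x :* x :- a :* (:- y :* :- y) := x :* x :- a :* (y :* y)) K.refl a x y

  halve : ∀ {x} → x K.+ x K.≈ K.0# → x K.≈ K.0#
  halve {x} h = K.cancel-zero 2≉0 (K.trans (K.solve 1 (λ x → (con (+ 1) :+ con (+ 1)) :* x := x :+ x) K.refl x) h)

  real : ∀ {α} → conj α ≈ α → α ≈ ι (proj₁ α)
  real {x , y} (_ , q) = K.refl , halve (K.trans (K.+-congˡ (K.sym q)) (K.-‿inverseʳ y))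

  module FieldCase (E-field : IsField E) where
    open IsField E-field renaming (1≉0 to 1≉0ₑ; inverse to inverseₑ)

    1≉0 : ¬ (K.1# K.≈ K.0#)
    1≉0 = IsField.1≉0 K.isField

    E-cancel-zero : ∀ {x y} → ¬ (x ≈ 0#) → x * y ≈ 0# → y ≈ 0#
    E-cancel-zero {x} {y} x≉0 xy≈0 with inverseₑ x x≉0
    ... | x′ , xx′≈1 = trans {y} {1# * y} {0#} (sym {1# * y} {y} (*-identityˡ y))
      (trans {1# * y} {(x * x′) * y} {0#} (*-congʳ {y} {1#} {x * x′} (sym {x * x′} {1#} xx′≈1))
      (trans {(x * x′) * y} {x′ * (x * y)} {0#}
        (trans {(x * x′) * y} {(x′ * x) * y} {x′ * (x * y)} (*-congʳ {y} {x * x′} {x′ * x} (*-comm x x′)) (*-assoc x′ x y))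
      (trans {x′ * (x * y)} {x′ * 0#} {0#} (*-congˡ {x′} {x * y} {0#} xy≈0) (zeroʳ x′))))

    nonsquare : ∀ s → ¬ (s K.* s K.≈ a)
    nonsquare s s²≈a = 1≉0 (proj₂ (E-cancel-zero {K.- s , K.1#} {s , K.1#} (λ (_ , q) → 1≉0 q)
      (K.trans (K.+-cong (K.solve 1 (λ s → :- s :* s := :- (s :* s)) K.refl s) (K.trans (K.*-congˡ (K.*-identityˡ _)) (K.*-identityʳ a)))
         (K.trans (K.+-congʳ (K.-‿cong s²≈a)) (K.-‿inverseˡ a)) ,
       K.solve 1 (λ s → :- s :* con (+ 1) :+ con (+ 1) :* s := con (+ 0)) K.refl s)))

    ratio-square : ∀ {x y} → ¬ (y K.≈ K.0#) → ¬ (x K.* x K.≈ a K.* (y K.* y))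
    ratio-square {x} {y} y≉0 h with IsField.inverse K.isField y y≉0
    ... | y′ , yy′≈1 = nonsquare (x K.* y′) (K.trans
      (K.solve 2 (λ x y → (x :* y) :* (x :* y) := (x :* x) :* (y :* y)) K.refl x y′)
      (K.trans (K.*-congʳ h) (K.trans (K.solve 3 (λ a y z → a :* (y :* y) :* (z :* z) := a :* ((y :* z) :* (y :* z))) K.refl a y y′)
        (K.trans (K.*-congˡ (K.trans (K.*-cong yy′≈1 yy′≈1) (K.*-identityˡ _))) (K.*-identityʳ a)))))

    nr≈0 : ∀ α → nr α K.≈ K.0# → α ≈ 0#
    nr≈0 (x , y) h with K.x≈0⊎W y | K.x≈0⊎W x
    ... | inj₂ (n , Wy) | _ = ⊥-elim (ratio-square (K.W-≉0 Wy) (K.trans (K.solve 2 (λ u v → u := (u :- v) :+ v) K.refl _ _)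
            (K.trans (K.+-congʳ h) (K.+-identityˡ _))))
    ... | inj₁ y≈0 | inj₁ x≈0 = x≈0 , y≈0
    ... | inj₁ y≈0 | inj₂ (n , Wx) = ⊥-elim (K.W-≉0 (K.W-* Wx Wx) (K.trans (K.solve 1 (λ u → u := u :- con (+ 0)) K.refl _)
            (K.trans (K.+-congˡ (K.-‿cong (K.sym (K.trans (K.*-congˡ (K.trans (K.*-congˡ y≈0) (K.zeroʳ y))) (K.zeroʳ a))))) h)))

    -- If the trace t were not integral, then 1 - 4 Nr(α) / t² would be a
    -- square, and hence so would a.
    trace-integral : ∀ α → K.V (+ 0) (nr α) → K.V (+ 0) (proj₁ α K.+ proj₁ α)
    trace-integral (x , y) vn with K.V-or-W (+ 0) (x K.+ x)
    ... | inj₁ v = v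
    ... | inj₂ (k , Wt , k<0) with K.x≈0⊎W y
    ...   | inj₁ y≈0 = K.V-+ vx vx
      where
      vx : K.V (+ 0) x
      vx = K.V-square⁻¹ {+ 0} (K.V-resp (K.trans (K.+-congˡ (K.-‿cong (K.trans (K.*-congˡ (K.trans (K.*-congˡ y≈0) (K.zeroʳ y))) (K.zeroʳ a))))
             (K.solve 1 (λ u → u :- con (+ 0) := u) K.refl _)) vn)
    ...   | inj₂ (l , Wy) = ⊥-elim (impossible (K.invert Wt))
      where
      t = x K.+ x
      impossible : (∃ λ t′ → t K.* t′ K.≈ K.1# × K.W (ℤ.- k) t′) → ⊥
      impossible (t′ , tt′≈1 , Wt′) = contradict (K.Hensel.square-root vε)
        where
        ε = nr (x , y) K.* (t′ K.* t′)
        vε : K.V (+ 1) ε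
        vε = K.V-mono (cert ((+ 0 ℤ.- (+ 1 ℤ.+ k)) ℤ.+ ((+ 0 ℤ.- (+ 1 ℤ.+ k)) ℤ.+ + 1)) (nonneg-+ (diff k<0) (nonneg-+ (diff k<0) nonneg))
               (Z.solve 1 (λ k → con (+ 0) :+ (:- k :- k) := con (+ 1) :+ ((con (+ 0) :- (con (+ 1) :+ k)) :+ ((con (+ 0) :- (con (+ 1) :+ k)) :+ con (+ 1)))) ≡.refl k))
               (K.V-* vn (K.W⇒V (K.W-* Wt′ Wt′)))
        m = (y K.+ y) K.* t′
        contradict : (∃ λ r → r K.* r K.≈ K.1# K.- (ε K.+ ε K.+ ε K.+ ε)) → ⊥
        contradict (r , r²≈) = ratio-square m≉0 (K.trans r²≈ (K.trans
            (K.+-congʳ (K.sym (K.trans (K.*-cong tt′≈1 tt′≈1) (K.*-identityˡ _))))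
            (K.solve 4 (λ x y a t′ → let t = x :+ x ; e = (x :* x :- a :* (y :* y)) :* (t′ :* t′) in
               (t :* t′) :* (t :* t′) :- (e :+ e :+ e :+ e) := a :* (((y :+ y) :* t′) :* ((y :+ y) :* t′))) K.refl x y a t′)))
          where
          m≉0 : ¬ (m K.≈ K.0#)
          m≉0 m≈0 = K.W-≉0 Wy (halve (K.cancel-zero (K.W-≉0 Wt′) (K.trans (K.*-comm _ _) m≈0)))

    w : Carrier → ℤ∞
    w α = K.ord (nr α)

    one-plus : ∀ α → K.V (+ 0) (nr α) → K.V (+ 0) (nr (1# + α))
    one-plus (x , y) v = K.V-resp (K.solve 3 (λ a x y → (con (+ 1) :+ (x :+ x)) :+ (x :* x :- a :* (y :* y)) :=
        (con (+ 1) :+ x) :* (con (+ 1) :+ x) :- a :* ((con (+ 0) :+ y) :* (con (+ 0) :+ y))) K.refl a x y)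
      (K.V-+ (K.V-+ (K.W⇒V K.W-1) (trace-integral (x , y) v)) v)

    ordered : ∀ {n} α β {i j} → K.W i (nr α) → K.W j (nr β) → i ℤ.≤ j → K.V n (nr α) → K.V n (nr (α + β))
    ordered {n} α β {i} {j} Wα Wβ i≤j vα with inverseₑ α (λ α≈0 → K.W-≉0 Wα (K.trans (nr-cong {α} {0#} α≈0) (K.trans (nr-ι K.0#) (K.zeroˡ _))))
    ... | α′ , αα′≈1 = K.V-resp (K.sym (K.trans (nr-cong {α + β} {α * (1# + β * α′)} factor) (nr-* α (1# + β * α′))))
            (K.V-cast (ℤ.+-identityʳ n) (K.V-* vα (one-plus (β * α′) (K.V-resp (K.sym (nr-* β α′))
              (K.V-mono (diff i≤j) (K.V-* (K.W⇒V Wβ) (K.W⇒V Wα′)))))))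
      where
      Wα′ : K.W (ℤ.- i) (nr α′)
      Wα′ = K.W-inv (K.trans (K.sym (nr-* α α′)) (K.trans (nr-cong {α * α′} {1#} αα′≈1) (K.trans (nr-ι K.1#) (K.*-identityˡ _)))) Wα
      factor : α + β ≈ α * (1# + β * α′)
      factor = sym {α * (1# + β * α′)} {α + β} (trans {α * (1# + β * α′)} {α * 1# + α * (β * α′)} {α + β} (distribˡ α 1# (β * α′))
        (+-cong {α * 1#} {α} {α * (β * α′)} {β} (*-identityʳ α)
          (trans {α * (β * α′)} {(α * β) * α′} {β} (sym {(α * β) * α′} {α * (β * α′)} (*-assoc α β α′))
          (trans {(α * β) * α′} {(β * α) * α′} {β} (*-congʳ {α′} {α * β} {β * α} (*-comm α β))
          (trans {(β * α) * α′} {β * (α * α′)} {β} (*-assoc β α α′)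
          (trans {β * (α * α′)} {β * 1#} {β} (*-congˡ {β} {α * α′} {1#} αα′≈1) (*-identityʳ β)))))))

    V-add : ∀ {n} α β → K.V n (nr α) → K.V n (nr β) → K.V n (nr (α + β))
    V-add {n} α β vα vβ with K.finite (nr α) | K.finite (nr β)
    ... | inj₁ eq | _ = K.V-resp (nr-cong {β} {α + β} (trans {β} {0# + β} {α + β} (sym {0# + β} {β} (+-identityˡ β))
            (+-congʳ {β} {0#} {α} (sym {α} {0#} (nr≈0 α (K.ord-∞ _ eq)))))) vβ
    ... | _ | inj₁ eq = K.V-resp (nr-cong {α} {α + β} (trans {α} {α + 0#} {α + β} (sym {α + 0#} {α} (+-identityʳ α))
            (+-congˡ {α} {0#} {β} (sym {β} {0#} (nr≈0 β (K.ord-∞ _ eq)))))) vα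
    ... | inj₂ (i , Wα) | inj₂ (j , Wβ) with ℤ.≤-total i j
    ...   | inj₁ i≤j = ordered α β Wα Wβ i≤j vα
    ...   | inj₂ j≤i = K.V-resp (nr-cong {β + α} {α + β} (+-comm β α)) (ordered β α Wβ Wα j≤i vβ)

    isValuationᴱ : IsValuation E w
    isValuationᴱ = record
      { w-cong = λ {α} {β} α≈β → K.ord-cong (nr-cong {α} {β} α≈β)
      ; w-0 = ≡.trans (K.ord-cong (K.trans (nr-ι K.0#) (K.zeroˡ _))) K.ord-0
      ; w-1 = ≡.trans (K.ord-cong (K.trans (nr-ι K.1#) (K.*-identityˡ _))) K.W-1
      ; w-* = λ α β → ≡.trans (K.ord-cong (nr-* α β)) (K.ord-* (nr α) (nr β))
      ; w-+ = λ α β → meet (w α) (w β) (w (α + β)) (λ n → V-add {n} α β)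
      }
      where
      meet : ∀ p q r → (∀ n → [ n ] ≤∞ p → [ n ] ≤∞ q → [ n ] ≤∞ r) → (p ⊓∞ q) ≤∞ r
      meet [ i ] [ j ] r h = h (i ℤ.⊓ j) [ ℤ.i⊓j≤i i j ] [ ℤ.i⊓j≤j i j ]
      meet [ i ] ⊤⁺ r h = h i [ ℤ.≤-refl ] ([ i ] ≤⊤⁺)
      meet ⊤⁺ [ j ] r h = h j ([ j ] ≤⊤⁺) [ ℤ.≤-refl ]
      meet ⊤⁺ ⊤⁺ ⊤⁺ h = ⊤⁺ ≤⊤⁺
      meet ⊤⁺ ⊤⁺ [ k ] h = ⊥-elim (suc≰ ([≤]-injective (h (+ 1 ℤ.+ k) (_ ≤⊤⁺) (_ ≤⊤⁺))))

    nr-real : ∀ {z} → conj z ≈ z → nr z K.≈ proj₁ z K.* proj₁ z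
    nr-real {z} z-real = K.trans (nr-cong {z} {ι (proj₁ z)} (real {z} z-real)) (nr-ι (proj₁ z))

    conj-ι : ∀ x → conj (ι x) ≈ ι x
    conj-ι x = K.refl , K.solve 0 (:- con (+ 0) := con (+ 0)) K.refl

    W-ι : ∀ {k x} → K.W k x → w (ι x) ≡ [ k ℤ.+ k ]
    W-ι {k} {x} Wx = ≡.trans (K.ord-cong (nr-ι x)) (K.W-* Wx Wx)

    V-ι : ∀ {k x} → K.V k x → [ k ℤ.+ k ] ≤∞ w (ι x)
    V-ι {k} {x} vx = K.V-resp (K.sym (nr-ι x)) (K.V-* vx vx)

    half : ∃ λ x → (K.1# K.+ K.1#) K.* x K.≈ K.1#
    half = IsField.inverse K.isField _ 2≉0

    X : Carrier
    X = K.0# , K.1#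

    W-X : ∃ λ d → w X ≡ [ d ]
    W-X = [ (λ X≈0 → ⊥-elim (1≉0 (proj₂ (nr≈0 X X≈0)))) , id ]′ (K.x≈0⊎W (nr X))

    isExtension : IsExtension E conj w
    isExtension = record
      { isValuation = isValuationᴱ
      ; w-conj = λ α → K.ord-cong (nr-conj α)
      ; w-∞ = λ α eq → nr≈0 α (K.ord-∞ _ eq)
      ; inverse = inverseₑ
      ; real-even = real-even
      ; real-exists = λ k → let (x , eq) = K.ord-surj [ k ] in ι x , conj-ι x , W-ι eq
      ; hensel = hensel
      ; half = ι (proj₁ half)
      ; half-real = conj-ι (proj₁ half)
      ; half-half = K.trans (K.solve 1 (λ x → x :+ x := (con (+ 1) :+ con (+ 1)) :* x) K.refl (proj₁ half)) (proj₂ half) , K.+-identityˡ _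
      ; δ = X
      ; δ-skew = K.solve 0 (con (+ 0) := :- con (+ 0)) K.refl , K.refl
      ; d = proj₁ W-X
      ; W-δ = proj₂ W-X
      ; q = K.q
      ; residue = ι ∘ K.residue
      ; residue-real = λ i → conj-ι (K.residue i)
      ; residue-onto = λ z z-real v → let (i , vi) = K.residue-onto (proj₁ z) (K.V-square⁻¹ {+ 0} (K.V-resp (nr-real {z} z-real) v)) in
          i , K.V-mono (ℤ.+≤+ (s≤s z≤n)) (K.V-resp (K.trans (K.sym (nr-ι _)) (nr-cong {ι (proj₁ z K.- K.residue i)} {z - ι (K.residue i)}
            (K.refl , K.trans (K.sym (K.-‿inverseʳ K.0#)) (K.+-congʳ (K.sym (proj₂ (real {z} z-real))))))) (K.V-* vi vi))
      }
      where
      real-even : ∀ n z → conj z ≈ z → w z ≡ [ n ] → Even n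
      real-even n z z-real Wz with K.x≈0⊎W (proj₁ z)
      ... | inj₁ x≈0 = ⊥-elim (K.W-≉0 Wz (K.trans (nr-real {z} z-real) (K.trans (K.*-congˡ x≈0) (K.zeroʳ _))))
      ... | inj₂ (k , Wx) = k , K.W-unique Wz (K.W-resp (K.sym (nr-real {z} z-real)) (K.W-* Wx Wx))
      hensel : ∀ z → conj z ≈ z → [ + 1 ] ≤∞ w z → ∃ λ y → conj y ≈ y × [ + 0 ] ≤∞ w y × y ≈ 1# + z * (y * y)
      hensel z z-real v = let (r , vr , r≈) = K.Hensel.root (vx (K.V-or-W (+ 1) (proj₁ z))) in
        ι r , conj-ι r , V-ι {+ 0} vr ,
        trans {ι r} {ι (K.1# K.+ proj₁ z K.* (r K.* r))} {1# + z * (ι r * ι r)} (ι-cong r≈)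
          (sym {1# + z * (ι r * ι r)} {ι (K.1# K.+ proj₁ z K.* (r K.* r))}
            (trans {1# + z * (ι r * ι r)} {1# + ι (proj₁ z) * ι (r K.* r)} {ι (K.1# K.+ proj₁ z K.* (r K.* r))}
              (+-congˡ {1#} {z * (ι r * ι r)} {ι (proj₁ z) * ι (r K.* r)} (*-cong {z} {ι (proj₁ z)} {ι r * ι r} {ι (r K.* r)} (real {z} z-real) (ι-* r r)))
            (trans {1# + ι (proj₁ z) * ι (r K.* r)} {1# + ι (proj₁ z K.* (r K.* r))} {ι (K.1# K.+ proj₁ z K.* (r K.* r))}
              (+-congˡ {1#} {ι (proj₁ z) * ι (r K.* r)} {ι (proj₁ z K.* (r K.* r))} (ι-* (proj₁ z) (r K.* r)))
              (ι-+ K.1# (proj₁ z K.* (r K.* r))))))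
        where
        vx : K.V (+ 1) (proj₁ z) ⊎ (∃ λ k → K.W k (proj₁ z) × + 1 ℤ.+ k ℤ.≤ + 1) → K.V (+ 1) (proj₁ z)
        vx (inj₁ v) = v
        vx (inj₂ (k , Wx , k<1)) = ⊥-elim (suc≰ {+ 0} (ℤ.≤-trans (K.W-V (K.W-* Wx Wx) (K.V-resp (nr-real {z} z-real) v))
          (ℤ.+-mono-≤ (suc-cancel-≤ {k} {+ 0} k<1) (suc-cancel-≤ {k} {+ 0} k<1))))

    opaque
      isQuadratic : IsQuadratic E conj w
      isQuadratic = Extensions.isQuadratic E conj isConjugation w isExtension

    𝒪⇒V : ∀ {α} → α ∈ 𝒪 → [ + 0 ] ≤∞ w α
    𝒪⇒V {α} (_ , k , vk , eq) = K.V-resp (K.trans (K.sym (proj₁ eq)) (proj₁ (Nr≈ α))) vk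

    V⇒𝒪 : ∀ {α} → [ + 0 ] ≤∞ w α → α ∈ 𝒪
    V⇒𝒪 {α} v = (proj₁ α K.+ proj₁ α , trace-integral α v , Tr≈ α) , (nr α , v , Nr≈ α)

    not-split : ¬ Split
    not-split S = 1≉0 (K.trans (K.sym (proj₂ toβ)) (K.trans (proj₂ (⟦⟧-cong {β} {0#} β≈0)) (proj₂ 0#-homo)))
      where
      open Split S
      module K² = CommutativeRing K²
      open IsRingIsomorphism isRingIsomorphism using (surjective; injective; ⟦⟧-cong; *-homo; 0#-homo)
      α = proj₁ (surjective (K.1# , K.0#))
      β = proj₁ (surjective (K.0# , K.1#))
      toα : to α K².≈ (K.1# , K.0#)
      toα = proj₂ (surjective (K.1# , K.0#)) {α} (refl {α})
      toβ : to β K².≈ (K.0# , K.1#)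
      toβ = proj₂ (surjective (K.0# , K.1#)) {β} (refl {β})
      αβ≈0 : α * β ≈ 0#
      αβ≈0 = injective {α * β} {0#} (K².trans (*-homo α β) (K².trans (K².*-cong toα toβ)
        (K².trans (K.zeroʳ _ , K.zeroˡ _) (K².sym 0#-homo))))
      β≈0 : β ≈ 0#
      β≈0 = E-cancel-zero {α} {β} (λ α≈0 → 1≉0 (K.trans (K.sym (proj₁ toα)) (K.trans (proj₁ (⟦⟧-cong {α} {0#} α≈0)) (proj₁ 0#-homo)))) αβ≈0

    open IsQuadratic isQuadratic using (h; inert⊎ramified; real-exists)
    module E = Valuations E w isValuationᴱ
    module Dif = Differents E conj isConjugation w isQuadratic

    product : ∀ {I J : Subset} {α x y} → x ∈ I → y ∈ J → α ≈ x * y → (I · J) α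
    product {α = α} {x} {y} x∈ y∈ α≈ = 1 , (λ _ → x) , (λ _ → y) , (λ _ → x∈) , (λ _ → y∈) ,
      trans {α} {x * y} {x * y + 0#} α≈ (sym {x * y + 0#} {x * y} (+-identityʳ (x * y)))

    V-sum : ∀ {n} k (t : Vector Carrier k) → (∀ i → E.V n (t i)) → E.V n (RawSemiringDefs.sum (Semiring.rawSemiring semiring) t)
    V-sum zero t h = E.V-0
    V-sum (suc k) t h = E.V-+ {_} {t zero} (h zero) (V-sum k (t ∘ suc) (h ∘ suc))

    V-product : ∀ {m n} {I J : Subset} → (∀ {x} → I x → E.V m x) → (∀ {y} → J y → E.V n y) → ∀ {α} → (I · J) α → E.V (m ℤ.+ n) α
    V-product {m} {n} I⊆ J⊆ {α} (k , x , y , x∈ , y∈ , α≈) = E.V-resp {m ℤ.+ n} {RawSemiringDefs.sum (Semiring.rawSemiring semiring) (λ i → x i * y i)} {α}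
      (sym {α} α≈) (V-sum k _ (λ i → E.V-* {m} {n} {x i} {y i} (I⊆ (x∈ i)) (J⊆ (y∈ i))))

    V-ι𝔭 : ∀ {α} → ι𝔭 α → E.V (+ 2) α
    V-ι𝔭 {α} (k , vk , α≈) = E.V-resp {+ 2} {ι k} {α} (sym {α} {ι k} α≈) (V-ι {+ 1} vk)

    V-𝔭𝒪 : ∀ {α} → 𝔭𝒪 α → E.V (+ 2) α
    V-𝔭𝒪 {α} α∈ = V-product {+ 2} {+ 0} {ι𝔭} {𝒪} (λ {x} → V-ι𝔭 {x}) (λ {x} → 𝒪⇒V {x}) {α} α∈

    invertᴱ : ∀ {n α} → E.W n α → ∃ λ β → α * β ≈ 1# × E.W (ℤ.- n) β
    invertᴱ {n} {α} Wα = Dif.invert {n} {α} Wα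

    cancelled : ∀ α {β γ} → β * γ ≈ 1# → α ≈ β * (α * γ)
    cancelled α {β} {γ} βγ≈1 = sym {β * (α * γ)} {α} (trans {β * (α * γ)} {α * (β * γ)} {α}
      (trans {β * (α * γ)} {(β * α) * γ} {α * (β * γ)} (sym {(β * α) * γ} {β * (α * γ)} (*-assoc β α γ))
        (trans {(β * α) * γ} {(α * β) * γ} {α * (β * γ)} (*-congʳ {γ} {β * α} {α * β} (*-comm β α)) (*-assoc α β γ)))
      (trans {α * (β * γ)} {α * 1#} {α} (*-congˡ {α} {β * γ} {1#} βγ≈1) (*-identityʳ α)))

    uniformizer : ∃ λ p → K.W (+ 1) p
    uniformizer = K.ord-surj [ + 1 ]

    W-uniformizer : E.W (+ 2) (ι (proj₁ uniformizer))
    W-uniformizer = W-ι {+ 1} (proj₂ uniformizer)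

    V⇒𝔭𝒪 : ∀ {α} → E.V (+ 2) α → 𝔭𝒪 α
    V⇒𝔭𝒪 {α} v = let (p , Wp) = uniformizer ; (π , pπ≈1 , Wπ) = invertᴱ {+ 2} {ι p} W-uniformizer in
      product {ι𝔭} {𝒪} {α} {ι p} {α * π} (p , K.W⇒V Wp , refl {ι p}) (V⇒𝒪 {α * π} (E.V-* {+ 2} {_} {α} {π} v (E.W⇒V {_} {π} Wπ))) (cancelled α {ι p} {π} pπ≈1)

    module Ideals (𝔓 : Subset) (is𝔓 : Is𝔓 𝔓) where
      maximalIdeal : IsMaximalIdeal 𝔓
      maximalIdeal = proj₂ is𝔓 not-split
      open IsMaximalIdeal maximalIdeal
      open IsIdeal isIdeal

      V-𝔓 : ∀ {α} → α ∈ 𝔓 → E.V (+ 1) α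
      V-𝔓 {α} α∈ = [ id , absurd ]′ (E.V-or-W (+ 1) α)
        where
        absurd : (∃ λ k → E.W k α × + 1 ℤ.+ k ℤ.≤ + 1) → E.V (+ 1) α
        absurd (k , Wk , k<) = let (β , αβ≈1 , Wβ) = invertᴱ {k} {α} Wk in ⊥-elim (proper (resp {β * α} {1#}
          (trans {β * α} {α * β} {1#} (*-comm β α) αβ≈1)
          (*-mem {β} {α} (V⇒𝒪 {β} (E.≤-W {_} {_} {β} Wβ (≡.subst (+ 0 ℤ.≤_) (ℤ.+-identityˡ _) (diff (suc-cancel-≤ {k} {+ 0} k<))))) α∈)))

      𝔓-V : ∀ {α} → E.V (+ 1) α → α ∈ 𝔓
      𝔓-V {α} v = maximal (λ α → Lift (c ⊔ ℓ) (E.V (+ 1) α)) (record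
        { ⊆𝒪 = λ {α} (lift v) → V⇒𝒪 {α} (E.V-mono {_} {_} {α} (ℤ.+≤+ z≤n) v)
        ; resp = λ {α} {β} α≈β (lift v) → lift (E.V-resp {_} {α} {β} α≈β v)
        ; 0∈ = lift E.V-0
        ; +-mem = λ {α} {β} (lift v) (lift u) → lift (E.V-+ {_} {α} {β} v u)
        ; *-mem = λ {ρ} {α} ρ∈ (lift v) → lift (E.V-* {+ 0} {+ 1} {ρ} {α} (𝒪⇒V {ρ} ρ∈) v)
        }) (λ (lift v) → case E.W-V {_} {_} {1#} E.W-1 v of λ { (ℤ.+≤+ ()) }) (λ {α} α∈ → lift (V-𝔓 {α} α∈)) (lift v)

      multiple : ℤ → ℕ → ℤ
      multiple g zero    = + 0
      multiple g (suc n) = g ℤ.+ multiple g n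

      multiple-1 : ∀ n → multiple (+ 1) n ≡ + n
      multiple-1 zero    = ≡.refl
      multiple-1 (suc n) = ≡.cong ℤ.suc (multiple-1 n)

      V-power : ∀ {g} → (∀ {α} → α ∈ 𝔓 → E.V g α) → ∀ n {α} → (𝔓 ^ᴵ n) α → E.V (multiple g n) α
      V-power 𝔓⊆ zero {α} α∈ = 𝒪⇒V {α} α∈
      V-power {g} 𝔓⊆ (suc n) {α} α∈ = V-product {g} {_} {𝔓} {𝔓 ^ᴵ n} (λ {x} → 𝔓⊆ {x}) (λ {x} → V-power 𝔓⊆ n {x}) {α} α∈

      inert⇒¬ramified : (∀ n x → E.W n x → Even (n ℤ.+ h)) → ¬ Ramified 𝔓
      inert⇒¬ramified inert (_ , 𝔭𝒪⊆ , _) = case E.W-V {_} {_} {ι p} W-uniformizer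
          (V-power {+ 2} (λ {α} α∈ → V-2 {α} α∈) 2 {ι p} (𝔭𝒪⊆ {ι p} (V⇒𝔭𝒪 {ι p} (E.W⇒V {_} {ι p} W-uniformizer)))) of
          λ { (ℤ.+≤+ (s≤s (s≤s ()))) }
        where
        p = proj₁ uniformizer
        even : ∀ {n α} → E.W n α → Even n
        even {n} {α} Wα = ≡.subst Even (Z.solve 2 (λ n h → (n :+ h) :- (con (+ 0) :+ h) := n) ≡.refl n h)
          (even-+ (inert n α Wα) (even-neg (inert (+ 0) 1# E.W-1)))
        V-2 : ∀ {α} → α ∈ 𝔓 → E.V (+ 2) α
        V-2 {α} α∈ with E.V-or-W (+ 2) α
        ... | inj₁ v = v
        ... | inj₂ (k , Wk , k<) = ⊥-elim (even-odd (even {k} {α} Wk) (≡.subst Odd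
                (ℤ.≤-antisym (E.W-V {_} {_} {α} Wk (V-𝔓 {α} α∈)) (suc-cancel-≤ {k} {+ 1} k<)) (+ 0 , ≡.refl)))

      module _ (ram : IsRamified E conj w h) where
        open IsRamified ram using (ϖ; W-ϖ)

        power-V : ∀ n {α} → E.V (+ n) α → (𝔓 ^ᴵ n) α
        power-V zero {α} v = V⇒𝒪 {α} v
        power-V (suc n) {α} v = let (π , ϖπ≈1 , Wπ) = invertᴱ {+ 1} {ϖ} W-ϖ in
          product {𝔓} {𝔓 ^ᴵ n} {α} {ϖ} {α * π} (𝔓-V {ϖ} (E.W⇒V {_} {ϖ} W-ϖ))
            (power-V n {α * π} (E.V-cast {_} {_} {α * π} (Z.solve 1 (λ n → (con (+ 1) :+ n) :- con (+ 1) := n) ≡.refl (+ n))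
              (E.V-* {_} {_} {α} {π} v (E.W⇒V {_} {π} Wπ)))) (cancelled α {ϖ} {π} ϖπ≈1)

        isRamified : Ramified 𝔓
        isRamified = E-field , (λ {α} α∈ → power-V 2 {α} (V-𝔭𝒪 {α} α∈)) , (λ {α} α∈ → V⇒𝔭𝒪 {α} (V-power {+ 1} (λ {x} → V-𝔓 {x}) 2 {α} α∈))

        W-prime : ∀ {π π⁻¹} → IsPrimeElement 𝔓 π π⁻¹ → E.W (+ 1) π
        W-prime {π} {π⁻¹} ((𝔓⊆ , ⊆𝔓) , ππ⁻¹≈1) = [ (λ π≈0 → ⊥-elim (1≉0 (proj₁ (trans {1#} {π * π⁻¹} {0#} (sym {π * π⁻¹} {1#} ππ⁻¹≈1)
              (trans {π * π⁻¹} {0# * π⁻¹} {0#} (*-congʳ {π⁻¹} {π} {0#} (nr≈0 π π≈0)) (zeroˡ π⁻¹))))))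
            , (λ (k , Wk) → ≡.trans Wk (≡.cong (λ k → [ k ]) (ℤ.≤-antisym (upper k Wk) (E.W-V {_} {_} {π} Wk Vπ)))) ]′ (K.x≈0⊎W (nr π))
          where
          Vπ : E.V (+ 1) π
          Vπ = V-𝔓 {π} (⊆𝔓 {π} (1# , V⇒𝒪 {1#} (E.W⇒V {_} {1#} E.W-1) , sym {π * 1#} {π} (*-identityʳ π)))
          upper : ∀ k → E.W k π → k ℤ.≤ + 1
          upper k Wk = let (β , β∈ , ϖ≈) = 𝔓⊆ {ϖ} (𝔓-V {ϖ} (E.W⇒V {_} {ϖ} W-ϖ)) in
            E.W-V {_} {_} {ϖ} W-ϖ (E.V-resp {k} {π * β} {ϖ} (sym {ϖ} {π * β} ϖ≈)
              (E.V-cast {_} {_} {π * β} (ℤ.+-identityʳ k) (E.V-* {k} {+ 0} {π} {β} (E.W⇒V {_} {π} Wk) (𝒪⇒V {β} β∈))))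

        V-different : ∀ {α} → α ∈ 𝔇 → E.V (+ 1 ℤ.+ h) α
        V-different {α} α∈ = let (β , Wβ) = Dif.W-exists ram (ℤ.- (+ 1 ℤ.+ h)) in
          E.V-cancel {ℤ.- (+ 1 ℤ.+ h)} {_} {β} {α} Wβ (E.V-cast {_} {_} {β * α} (≡.sym (ℤ.+-inverseˡ (+ 1 ℤ.+ h)))
            (E.V-resp {_} {α * β} {β * α} (*-comm α β) (𝒪⇒V {α * β} (α∈ β (λ γ γ∈ → trace-ι𝔬 (β * γ) (Dif.codifferent {β} {γ} (E.W⇒V {_} {β} Wβ) (𝒪⇒V {γ} γ∈)))))))
          where
          trace-ι𝔬 : ∀ γ → E.V (+ 0) (Tr γ) → Tr γ ∈ ι𝔬
          trace-ι𝔬 γ v = _ , K.V-square⁻¹ {+ 0} (K.V-resp (K.trans (nr-cong {Tr γ} {ι (proj₁ γ K.+ proj₁ γ)} (Tr≈ γ)) (nr-ι _)) v) , Tr≈ γ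

        different-V : ∀ {α} → E.V (+ 1 ℤ.+ h) α → α ∈ 𝔇
        different-V {α} v β β∈ = V⇒𝒪 {α * β} (E.V-cast {_} {_} {α * β} (ℤ.+-inverseʳ (+ 1 ℤ.+ h))
          (E.V-* {_} {_} {α} {β} v (Dif.codifferent⁻¹ {β} λ γ vγ → let (k , vk , eq) = β∈ γ (V⇒𝒪 {γ} vγ) in
            E.V-resp {_} {ι k} {Tr (β * γ)} (sym {Tr (β * γ)} {ι k} eq) (V-ι {+ 0} vk))))

        exponent : ∀ {e} → 𝔇 ≐ 𝔓 ^ᴵ e → + 1 ℤ.+ h ≡ + e
        exponent {e} (𝔇⊆ , ⊆𝔇) = ℤ.≤-antisym
          (let (y , Wy) = Dif.W-exists ram (+ e) in E.W-V {_} {_} {y} Wy (V-different {y} (⊆𝔇 {y} (power-V e {y} (E.W⇒V {_} {y} Wy)))))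
          (let (x , Wx) = Dif.W-exists ram (+ 1 ℤ.+ h) in E.W-V {_} {_} {x} Wx
            (≡.subst (λ n → E.V n x) (multiple-1 e) (V-power {+ 1} (λ {α} → V-𝔓 {α}) e {x} (𝔇⊆ {x} (different-V {x} (E.W⇒V {_} {x} Wx))))))

  module SplitCase (S : Split) where
    open Split S
    private module K² = CommutativeRing K²
    open IsRingIsomorphism isRingIsomorphism using (surjective; injective; ⟦⟧-cong; *-homo; +-homo; 0#-homo; 1#-homo)

    1≉0 : ¬ (K.1# K.≈ K.0#)
    1≉0 = IsField.1≉0 K.isField

    preimage : ∀ k → ∃ λ α → to α K².≈ k
    preimage k = let (α , h) = surjective k in α , h {α} (refl {α})

    X : Carrier
    X = K.0# , K.1#

    root : K.Carrier
    root = proj₁ (to X)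

    roots : proj₂ (to X) K.≈ K.- root
    roots = [ (λ r-s≈0 → ⊥-elim (1≉0 (proj₂ (injective {X} {ι root} (K².trans (K.refl , K.sym (equal r-s≈0)) (K².sym (to-ι root)))))))
            , (λ (n , W) → K.trans (K.solve 2 (λ r s → s := (r :+ s) :- r) K.refl root _)
                (K.trans (K.+-congʳ (K.cancel-zero (K.W-≉0 W) product≈0)) (K.+-identityˡ _))) ]′ (K.x≈0⊎W (root K.- proj₂ (to X)))
      where
      equal : root K.- proj₂ (to X) K.≈ K.0# → root K.≈ proj₂ (to X)
      equal h = K.trans (K.solve 2 (λ r s → r := (r :- s) :+ s) K.refl root _) (K.trans (K.+-congʳ h) (K.+-identityˡ _))
      X² : X * X ≈ ι a
      X² = K.solve 1 (λ a → con (+ 0) :* con (+ 0) :+ a :* (con (+ 1) :* con (+ 1)) := a) K.refl a ,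
           K.solve 0 (con (+ 0) :* con (+ 1) :+ con (+ 1) :* con (+ 0) := con (+ 0)) K.refl
      squares : to X K².* to X K².≈ (a , a)
      squares = K².trans (K².sym (*-homo X X)) (K².trans (⟦⟧-cong {X * X} {ι a} X²) (to-ι a))
      product≈0 : (root K.- proj₂ (to X)) K.* (root K.+ proj₂ (to X)) K.≈ K.0#
      product≈0 = K.trans (K.solve 2 (λ r s → (r :- s) :* (r :+ s) := r :* r :- s :* s) K.refl root _)
        (K.trans (K.+-cong (proj₁ squares) (K.-‿cong (proj₂ squares))) (K.-‿inverseʳ a))

    to≈ : ∀ x y → to (x , y) K².≈ (x K.+ y K.* root , x K.- y K.* root)
    to≈ x y = K².trans (⟦⟧-cong {x , y} {ι x + ι y * X}
        (K.solve 3 (λ a x y → x := x :+ (y :* con (+ 0) :+ a :* (con (+ 0) :* con (+ 1)))) K.refl a x y ,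
         K.solve 1 (λ y → y := con (+ 0) :+ (y :* con (+ 1) :+ con (+ 0) :* con (+ 0))) K.refl y))
      (K².trans (K².trans (+-homo (ι x) (ι y * X)) (K².+-cong (to-ι x) (K².trans (*-homo (ι y) X) (K².*-cong (to-ι y) (K.refl , roots)))))
        (K.refl , K.solve 3 (λ x y r → x :+ y :* :- r := x :- y :* r) K.refl x y root))

    conj-swaps : ∀ α → to (conj α) K².≈ (proj₂ (to α) , proj₁ (to α))
    conj-swaps (x , y) = K².trans (to≈ x (K.- y))
      (K.trans (K.solve 3 (λ x y r → x :+ (:- y) :* r := x :- y :* r) K.refl x y root) (K.sym (proj₂ (to≈ x y))) ,
       K.trans (K.solve 3 (λ x y r → x :- (:- y) :* r := x :+ y :* r) K.refl x y root) (K.sym (proj₁ (to≈ x y))))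

    w : Carrier → ℤ∞
    w α = K.ord (proj₁ (to α))

    isSplit : IsSplit E conj w
    isSplit = record
      { isValuation = record
        { w-cong = λ {α} {β} α≈β → K.ord-cong (proj₁ (⟦⟧-cong {α} {β} α≈β))
        ; w-0 = ≡.trans (K.ord-cong (proj₁ 0#-homo)) K.ord-0
        ; w-1 = ≡.trans (K.ord-cong (proj₁ 1#-homo)) K.W-1
        ; w-* = λ α β → ≡.trans (K.ord-cong (proj₁ (*-homo α β))) (K.ord-* _ _)
        ; w-+ = λ α β → ≡.subst ((w α ⊓∞ w β) ≤∞_) (≡.sym (K.ord-cong (proj₁ (+-homo α β)))) (K.ord-+ _ _)
        }
      ; e₁ = e₁
      ; idempotent = injective {e₁ * e₁} {e₁} (K².trans (*-homo e₁ e₁) (K².trans (K².*-cong toe₁ toe₁)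
          (K².trans (K.*-identityˡ _ , K.zeroˡ _) (K².sym toe₁))))
      ; orthogonal = injective {e₁ * conj e₁} {0#} (K².trans (*-homo e₁ (conj e₁)) (K².trans (K².*-cong toe₁ toē₁)
          (K².trans (K.zeroʳ _ , K.zeroˡ _) (K².sym 0#-homo))))
      ; W-e₁ = ≡.trans (K.ord-cong (proj₁ toe₁)) K.W-1
      ; w-e₂ = ≡.trans (K.ord-cong (proj₁ toē₁)) K.ord-0
      ; w-∞ = λ α eq eq′ → injective {α} {0#} (K².trans (K.ord-∞ _ eq , K.ord-∞ _ (≡.trans (≡.sym (K.ord-cong (proj₁ (conj-swaps α)))) eq′)) (K².sym 0#-homo))
      ; inverse = λ {m} {n} α Wα Wᾱ →
          let (x , xx′≈1 , _) = K.invert {m} Wα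
              (y , yy′≈1 , _) = K.invert {n} (≡.trans (≡.sym (K.ord-cong (proj₁ (conj-swaps α)))) Wᾱ)
              (β , toβ) = preimage (x , y)
          in β , injective {α * β} {1#} (K².trans (*-homo α β) (K².trans (K².*-cong (K².refl {to α}) toβ) (K².trans (xx′≈1 , yy′≈1) (K².sym 1#-homo))))
      }
      where
      e₁ = proj₁ (preimage (K.1# , K.0#))
      toe₁ : to e₁ K².≈ (K.1# , K.0#)
      toe₁ = proj₂ (preimage (K.1# , K.0#))
      toē₁ : to (conj e₁) K².≈ (K.0# , K.1#)
      toē₁ = K².trans (conj-swaps e₁) (proj₂ toe₁ , proj₁ toe₁)

    𝒪⇒V : ∀ {α} → α ∈ 𝒪 → [ + 0 ] ≤∞ w α × [ + 0 ] ≤∞ w (conj α)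
    𝒪⇒V {α} ((t , vt , Tr≈t) , (n , vn , Nr≈n)) = integral u v sum prod ,
      K.V-resp (K.sym (proj₁ (conj-swaps α))) (integral v u (K.V-resp (K.+-comm u v) sum) (K.V-resp (K.*-comm u v) prod))
      where
      u = proj₁ (to α)
      v = proj₂ (to α)
      sum : K.V (+ 0) (u K.+ v)
      sum = K.V-resp (K.sym (K.trans (K.+-congˡ (K.sym (proj₁ (conj-swaps α)))) (K.trans (K.sym (proj₁ (+-homo α (conj α))))
        (K.trans (proj₁ (⟦⟧-cong {Tr α} {ι t} Tr≈t)) (proj₁ (to-ι t)))))) vt
      prod : K.V (+ 0) (u K.* v)
      prod = K.V-resp (K.sym (K.trans (K.*-congˡ (K.sym (proj₁ (conj-swaps α)))) (K.trans (K.sym (proj₁ (*-homo α (conj α))))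
        (K.trans (proj₁ (⟦⟧-cong {Nr α} {ι n} Nr≈n)) (proj₁ (to-ι n)))))) vn
      integral : ∀ u v → K.V (+ 0) (u K.+ v) → K.V (+ 0) (u K.* v) → K.V (+ 0) u
      integral u v vs vp with K.V-or-W (+ 0) u
      ... | inj₁ v = v
      ... | inj₂ (i , Wu , i<0) = ⊥-elim (suc≰ (ℤ.≤-trans i<0 (K.W-V (K.W-+ Wu (K.V-mono bound
              (K.V-cancel {i} {ℤ.- i} Wu (K.V-cast (≡.sym (ℤ.+-inverseʳ i)) vp)))) vs)))
        where
        bound : + 1 ℤ.+ i ℤ.≤ ℤ.- i
        bound = cert ((+ 0 ℤ.- (+ 1 ℤ.+ i)) ℤ.+ ((+ 0 ℤ.- (+ 1 ℤ.+ i)) ℤ.+ + 1)) (nonneg-+ (diff i<0) (nonneg-+ (diff i<0) nonneg))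
          (Z.solve 1 (λ i → :- i := (con (+ 1) :+ i) :+ ((con (+ 0) :- (con (+ 1) :+ i)) :+ ((con (+ 0) :- (con (+ 1) :+ i)) :+ con (+ 1)))) ≡.refl i)

    V⇒𝒪 : ∀ {α} → [ + 0 ] ≤∞ w α → [ + 0 ] ≤∞ w (conj α) → α ∈ 𝒪
    V⇒𝒪 {α} vα vᾱ = (u K.+ v , K.V-+ vα vv , injective {Tr α} {ι (u K.+ v)} (K².trans (+-homo α (conj α))
          (K².trans (K².+-cong (K².refl {to α}) (conj-swaps α)) (K².trans (K.refl , K.+-comm v u) (K².sym (to-ι (u K.+ v)))))))
      , (u K.* v , K.V-* vα vv , injective {Nr α} {ι (u K.* v)} (K².trans (*-homo α (conj α))
          (K².trans (K².*-cong (K².refl {to α}) (conj-swaps α)) (K².trans (K.refl , K.*-comm v u) (K².sym (to-ι (u K.* v)))))))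
      where
      u = proj₁ (to α)
      v = proj₂ (to α)
      vv : K.V (+ 0) v
      vv = K.V-resp (proj₁ (conj-swaps α)) vᾱ

module ModuleMaps {c ℓ m ℓm n ℓn} {R : CommutativeRing c ℓ} (M : Module R m ℓm) (N : Module R n ℓn)
    {φ : Module.Carrierᴹ M → Module.Carrierᴹ N} where
  private
    module R = CommutativeRing R
    module M = Module M
    module N = Module N

  module _ (cong : ∀ {x y} → x M.≈ᴹ y → φ x N.≈ᴹ φ y) (linear : ∀ a x y → φ (a M.*ₗ x M.+ᴹ y) N.≈ᴹ a N.*ₗ φ x N.+ᴹ φ y) where
    private
      +-homo : ∀ x y → φ (x M.+ᴹ y) N.≈ᴹ φ x N.+ᴹ φ y
      +-homo x y = N.≈ᴹ-trans (cong (M.+ᴹ-cong (M.≈ᴹ-sym (M.*ₗ-identityˡ x)) M.≈ᴹ-refl))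
        (N.≈ᴹ-trans (linear R.1# x y) (N.+ᴹ-cong (N.*ₗ-identityˡ _) N.≈ᴹ-refl))

      cancel : ∀ {x y} → x N.+ᴹ y N.≈ᴹ x → y N.≈ᴹ N.0ᴹ
      cancel {x} {y} eq = N.≈ᴹ-trans (N.≈ᴹ-sym (N.+ᴹ-identityˡ y)) (N.≈ᴹ-trans (N.+ᴹ-cong (N.≈ᴹ-sym (N.-ᴹ‿inverseˡ x)) N.≈ᴹ-refl)
        (N.≈ᴹ-trans (N.+ᴹ-assoc _ _ _) (N.≈ᴹ-trans (N.+ᴹ-cong N.≈ᴹ-refl eq) (N.-ᴹ‿inverseˡ x))))

      0-homo : φ M.0ᴹ N.≈ᴹ N.0ᴹ
      0-homo = cancel (N.≈ᴹ-trans (N.≈ᴹ-sym (+-homo M.0ᴹ M.0ᴹ)) (cong (M.+ᴹ-identityʳ M.0ᴹ)))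

      *-homo : ∀ a x → φ (a M.*ₗ x) N.≈ᴹ a N.*ₗ φ x
      *-homo a x = N.≈ᴹ-trans (cong (M.≈ᴹ-sym (M.+ᴹ-identityʳ _))) (N.≈ᴹ-trans (linear a x M.0ᴹ)
        (N.≈ᴹ-trans (N.+ᴹ-cong N.≈ᴹ-refl 0-homo) (N.+ᴹ-identityʳ _)))

      neg-homo : ∀ x → φ (M.-ᴹ x) N.≈ᴹ N.-ᴹ φ x
      neg-homo x = N.≈ᴹ-trans (N.≈ᴹ-sym (N.+ᴹ-identityˡ _)) (N.≈ᴹ-trans (N.+ᴹ-cong (N.≈ᴹ-sym (N.-ᴹ‿inverseˡ (φ x))) N.≈ᴹ-refl)
        (N.≈ᴹ-trans (N.+ᴹ-assoc _ _ _) (N.≈ᴹ-trans (N.+ᴹ-cong N.≈ᴹ-refl (N.≈ᴹ-trans (N.≈ᴹ-sym (+-homo x (M.-ᴹ x))) (N.≈ᴹ-trans (cong (M.-ᴹ‿inverseʳ x)) 0-homo)))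
          (N.+ᴹ-identityʳ _))))

    isomorphism : (∀ {x y} → φ x N.≈ᴹ φ y → x M.≈ᴹ y) → (∀ y → ∃ λ x → φ x N.≈ᴹ y) → IsModuleIsomorphism M.rawModule N.rawModule φ
    isomorphism injective surjective = record
      { isModuleMonomorphism = record
        { isModuleHomomorphism = record
          { isBimoduleHomomorphism = record
            { +ᴹ-isGroupHomomorphism = record
              { isMonoidHomomorphism = record
                { isMagmaHomomorphism = record { isRelHomomorphism = record { cong = cong } ; homo = +-homo }
                ; ε-homo = 0-homo }
              ; ⁻¹-homo = neg-homo }
            ; *ₗ-homo = *-homo
            ; *ᵣ-homo = λ r x → N.≈ᴹ-trans (cong (M.≈ᴹ-sym (M.*ₗ-*ᵣ-coincident r x))) (N.≈ᴹ-trans (*-homo r x) (N.*ₗ-*ᵣ-coincident r (φ x)))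
            } }
        ; injective = injective }
      ; surjective = λ y → let (x , eq) = surjective y in x , λ z≈x → N.≈ᴹ-trans (cong z≈x) eq
      }

  module _ (iso : IsModuleIsomorphism M.rawModule N.rawModule φ) where
    open IsModuleIsomorphism iso using (+ᴹ-homo; *ₗ-homo) renaming (⟦⟧-cong to iso-cong)

    linear⁻ : ∀ a x y → φ (a M.*ₗ x M.+ᴹ y) N.≈ᴹ a N.*ₗ φ x N.+ᴹ φ y
    linear⁻ a x y = N.≈ᴹ-trans (+ᴹ-homo (a M.*ₗ x) y) (N.+ᴹ-cong (*ₗ-homo a x) N.≈ᴹ-refl)

module LatticeAdapters {c ℓ v ℓv p} (F : LocalField c ℓ) (a : LocalField.Carrier F)
    (2≉0 : Char≢2 F)
    {m} (L : QuadraticAlgebra.HermitianLattice F a m v ℓv p) where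
  open QuadraticAlgebra F a
  open HermitianLattice L
  private
    module Lat = IsLattice isLattice
    conjᴱ = QuadraticExtension.isConjugation F a 2≉0

  Form : Set _
  Form = LinearAlgebra.Hermitian.IsForm E space conj conjᴱ Φ

  isForm : Form
  isForm = record
    { Φ-cong = Φ-cong ; Φ-+ = Φ-+ ; Φ-* = Φ-* ; Φ-conj = Φ-conj ; nondegenerate = nondegenerate }
    where open IsHermitian isHermitian

  basisᴱ : LinearAlgebra.Basis E space m
  basisᴱ = LinearAlgebra.independent⇒basis E space basis (IsBasis.coord isBasis)
    (λ x → proj₂ (IsBasis.spans isBasis x)) (IsBasis.independent isBasis)

  hull : ∀ x → LinearAlgebra.Hulls.Hull E space lattice x
  hull x = let (n , b , b∈ , b-basis) = Lat.contains-K-basis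
               (r , x≈) = IsBasis.spans b-basis x
           in LinearAlgebra.Hulls.comb {a = 1#} (LinearAlgebra.Hulls.hull-sum E space lattice (ι ∘ r) b b∈) (LinearAlgebra.Hulls.null ≈ᴹ-refl)
                (≈ᴹ-trans x≈ (≈ᴹ-sym (≈ᴹ-trans (+ᴹ-identityʳ _) (*ₗ-identityˡ _))))

  generator-count : ℕ
  generator-count = proj₁ Lat.finitely-generated

  generator : Fin generator-count → Carrierᴹ
  generator = proj₁ (proj₂ Lat.finitely-generated)

  generator∈ : ∀ i → generator i ∈ lattice
  generator∈ = proj₁ (proj₂ (proj₂ Lat.finitely-generated))

  nonzero : .{{NonZero m}} → ¬ (1# ≈ 0#) → ¬ (∀ x → x ≈ᴹ 0ᴹ)
  nonzero 1≉0 zeros = absurd basisᴱ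
    where
    absurd : ∀ {m} .{{_ : NonZero m}} → LinearAlgebra.Basis E space m → ⊥
    absurd {suc m} B = 1≉0 (trans {1#} {coord (b zero) zero} {0#} (sym {coord (b zero) zero} {1#} (diagonal zero))
      (trans {coord (b zero) zero} {coord 0ᴹ zero} {0#} (LinearAlgebra.Functional.cong (functional zero) (zeros (b zero)))
        (LinearAlgebra.Functional.0-homo (functional zero))))
      where open LinearAlgebra.Basis B

  module _ {o} (𝒪′ : Pred Carrier o) (isIntegers : LinearAlgebra.Hermitian.IsIntegers E space conj conjᴱ 𝒪′)
           (⇒𝒪 : ∀ {α} → 𝒪′ α → α ∈ 𝒪) (𝒪⇒ : ∀ {α} → α ∈ 𝒪 → 𝒪′ α) where
    private module Lats = LinearAlgebra.Hermitian.Formed.Lattices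

    isSubmodule : Lats.IsSubmodule E space conj conjᴱ Φ isForm 𝒪′ isIntegers lattice
    isSubmodule = record { L-resp = Lat.resp ; L-0 = Lat.0∈ ; L-+ = Lat.+-mem ; L-* = λ {r} r∈ x∈ → Lat.*-mem (⇒𝒪 {r} r∈) x∈ }

    generated : lattice ⊆ Lats.Span E space conj conjᴱ Φ isForm 𝒪′ isIntegers (λ z → ∃ λ i → z ≡ generator i)
    generated {x} x∈ = let (r , r∈ , x≈) = proj₂ (proj₂ (proj₂ Lat.finitely-generated)) x x∈ in
      Lats.IsSubmodule.L-resp (Lats.span-submodule E space conj conjᴱ Φ isForm 𝒪′ isIntegers) (≈ᴹ-sym x≈)
        (Lats.span-sum E space conj conjᴱ Φ isForm 𝒪′ isIntegers r generator (λ i → 𝒪⇒ {r i} (r∈ i)) (λ i → i , ≡.refl))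

    automorphism⇒Aut : ∀ {φ} → Lats.Automorphism E space conj conjᴱ Φ isForm 𝒪′ isIntegers lattice φ → φ ∈ Aut L
    automorphism⇒Aut {φ} A = record
      { isModuleIsomorphism = ModuleMaps.isomorphism space space I.cong I.linear
          (λ {x} {y} φx≈φy → ≈ᴹ-trans (≈ᴹ-sym (A.inverseˡ x)) (≈ᴹ-trans (A.inverse-cong φx≈φy) (A.inverseˡ y)))
          (λ y → A.inverse y , A.inverseʳ y)
      ; preserves-Φ = I.preserves
      ; image = (λ (x , x∈ , φx≈y) → Lat.resp φx≈y (A.stable x∈)) , (λ {y} y∈ → A.inverse y , A.inverse-stable y∈ , A.inverseʳ y)
      }
      where
      module A = LinearAlgebra.Hermitian.Formed.Lattices.Automorphism A
      module I = LinearAlgebra.Hermitian.Formed.Isometry A.isometry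

  Aut⇒isometry : ∀ {φ} → φ ∈ Aut L → LinearAlgebra.Hermitian.Formed.Isometry E space conj conjᴱ Φ isForm φ
  Aut⇒isometry {φ} A = record
    { isLinear = record { cong = IsModuleIsomorphism.⟦⟧-cong isModuleIsomorphism ; linear = ModuleMaps.linear⁻ space space isModuleIsomorphism }
    ; preserves = preserves-Φ }
    where open IsIsometry A

  Aut⇒stable : ∀ {φ} → φ ∈ Aut L → ∀ {x} → x ∈ lattice → φ x ∈ lattice
  Aut⇒stable A {x} x∈ = proj₁ (IsIsometry.image A) (x , x∈ , ≈ᴹ-refl)

  norm-one : ∀ {φ} → φ ∈ Aut L → detEnd L φ * conj (detEnd L φ) ≈ 1#
  norm-one {φ} A = LinearAlgebra.Hermitian.Formed.detEnd-norm E space conj conjᴱ Φ isForm basisᴱ (Aut⇒isometry A)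

  𝓔₀-intro : ∀ {u φ} → φ ∈ Aut L → u ≈ detEnd L φ → detEnd L φ ∈ 𝒪 → conj (detEnd L φ) ∈ 𝒪 →
             (∀ {α β} → α ≈ β → α ∈ 𝒪 → β ∈ 𝒪) → u ∈ 𝓔₀
  𝓔₀-intro {u} {φ} A u≈ d∈ d̄∈ resp = (resp {d} {u} (sym {u} {d} u≈) d∈ , conj d , d̄∈ , u-norm) ,
      trans {u * conj u} {u * conj d} {1#} (*-congˡ {u} {conj u} {conj d} (IsConjugation.conj-cong conjᴱ {u} {d} u≈)) u-norm
    where
    d = detEnd L φ
    u-norm : u * conj d ≈ 1#
    u-norm = trans {u * conj d} {d * conj d} {1#} (*-congʳ {conj d} {u} {d} u≈) (norm-one A)

-- Orthogonal sums of hyperbolic planes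

module HyperbolicSums {c ℓ} (F : LocalField c ℓ) (a : LocalField.Carrier F)
    (2≉0 : Char≢2 F)
    (E-field : IsField (QuadraticAlgebra.E F a)) where
  open QuadraticAlgebra F a
  open QuadraticExtension F a 2≉0 using (isConjugation)
  open QuadraticExtension.FieldCase F a 2≉0 E-field using (w; isValuationᴱ; isQuadratic; 𝒪⇒V; V⇒𝒪)
  open IsQuadratic isQuadratic using (h)
  private
    module V = Valuations E w isValuationᴱ
    module D = Differents E conj isConjugation w isQuadratic

  Star : ∀ {v ℓv p} → FormedLattice v ℓv p → Set _
  Star M = ∀ s j → s ∈ lattice → (∀ x → x ∈ lattice → V.V j (Φ s x)) → Even (j ℤ.+ h) → V.V (+ 1 ℤ.+ (j ℤ.+ h)) (Φ s s)
    where open FormedLattice M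

  module _ (π π⁻¹ : Carrier) where

    zpow-conj : ∀ i → zpow (conj π) (conj π⁻¹) i ≈ conj (zpow π π⁻¹ i)
    zpow-conj (+ n)    = D.conj-power π n
    zpow-conj -[1+ n ] = D.conj-power π⁻¹ (suc n)

    ⨁H : ∀ {k} → Vector ℤ k → FormedLattice c ℓ (c ⊔ ℓ)
    ⨁H σ = ⨁ (H π π⁻¹ ∘ σ)

    ⨁-0∈ : ∀ {k} (σ : Vector ℤ k) → FormedLattice.0ᴹ (⨁H σ) ∈ FormedLattice.lattice (⨁H σ)
    ⨁-0∈ {zero} σ = tt
    ⨁-0∈ {suc k} σ = (V⇒𝒪 {0#} V.V-0 , V⇒𝒪 {0#} V.V-0) , ⨁-0∈ (σ ∘ suc)

    ⨁-zeroʳ : ∀ {k} (σ : Vector ℤ k) s → FormedLattice.Φ (⨁H σ) s (FormedLattice.0ᴹ (⨁H σ)) ≈ 0#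
    ⨁-zeroʳ {zero} σ s = refl {0#}
    ⨁-zeroʳ {suc k} σ ((a₁ , a₂) , s) = trans {p + q} {0# + 0#} {0#}
        (+-cong {p} {0#} {q} {0#} (D.hyperbolic-zeroʳ {a₁} {a₂} {zpow π π⁻¹ (σ zero)} {zpow (conj π) (conj π⁻¹) (σ zero)}) (⨁-zeroʳ (σ ∘ suc) s)) (+-identityʳ 0#)
      where
      p = FormedLattice.Φ (H π π⁻¹ (σ zero)) (a₁ , a₂) (0# , 0#)
      q = FormedLattice.Φ (⨁H (σ ∘ suc)) s (FormedLattice.0ᴹ (⨁H (σ ∘ suc)))

    ⨁-congʳ : ∀ {k} (σ : Vector ℤ k) s {x y} → FormedLattice._≈ᴹ_ (⨁H σ) x y → FormedLattice.Φ (⨁H σ) s x ≈ FormedLattice.Φ (⨁H σ) s y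
    ⨁-congʳ {zero} σ s _ = refl {0#}
    ⨁-congʳ {suc k} σ ((a₁ , a₂) , s) {(x₁ , x₂) , x} {(y₁ , y₂) , y} ((x₁≈ , x₂≈) , x≈) = +-cong
        {FormedLattice.Φ (H π π⁻¹ (σ zero)) (a₁ , a₂) (x₁ , x₂)} {FormedLattice.Φ (H π π⁻¹ (σ zero)) (a₁ , a₂) (y₁ , y₂)}
        {FormedLattice.Φ (⨁H (σ ∘ suc)) s x} {FormedLattice.Φ (⨁H (σ ∘ suc)) s y}
      (D.hyperbolic-congʳ {a₁} {a₂} {zpow π π⁻¹ (σ zero)} {zpow (conj π) (conj π⁻¹) (σ zero)} {x₁} {x₂} {y₁} {y₂} x₁≈ x₂≈) (⨁-congʳ (σ ∘ suc) s x≈)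

    star-transport : ∀ {v ℓv p k} {M : FormedLattice v ℓv p} (σ : Vector ℤ k) → M ≅ ⨁H σ → Star (⨁H σ) → Star M
    star-transport {M = M} σ (φ , iso) star s j s∈ bound e =
      V.V-resp {_} {S.Φ (φ s) (φ s)} {M.Φ s s} (preserves-Φ s s) (star (φ s) j (proj₁ image (s , s∈ , S.≈ᴹ-refl))
        (λ y y∈ → let (x , x∈ , φx≈y) = proj₂ image y∈ in
          V.V-resp {j} {M.Φ s x} {S.Φ (φ s) y} (trans {M.Φ s x} {S.Φ (φ s) (φ x)} {S.Φ (φ s) y}
            (sym {S.Φ (φ s) (φ x)} {M.Φ s x} (preserves-Φ s x)) (⨁-congʳ σ (φ s) φx≈y)) (bound x x∈)) e)
      where
      open IsIsometry iso
      module M = FormedLattice M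
      module S = FormedLattice (⨁H σ)

    module _ (W-π : V.W (+ 1) π) (ππ⁻¹≈1 : π * π⁻¹ ≈ 1#) where

      W-zpow : ∀ i → V.W i (zpow π π⁻¹ i)
      W-zpow (+ n)    = D.W-power {π} W-π n
      W-zpow -[1+ n ] = D.W-power⁻ {π⁻¹} (V.W-inv {+ 1} {π} {π⁻¹} ππ⁻¹≈1 W-π) n

      ⨁-star : ∀ {k} (σ : Vector ℤ k) → (∀ i → Odd (σ i ℤ.+ h)) → Star (⨁H σ)
      ⨁-star {zero} σ odd s j s∈ bound e = V.V-0
      ⨁-star {suc k} σ odd (s₀@(a₁ , a₂) , s) j ((a₁∈ , a₂∈) , s∈) bound e =
        V.V-+ {_} {H₀ s₀ s₀} {S.Φ s s}
          (D.hyperbolic-star {σ zero} {j} {a₁} {a₂} {zpow π π⁻¹ (σ zero)} {zpow (conj π) (conj π⁻¹) (σ zero)} (zpow-conj (σ zero)) (W-zpow (σ zero)) (odd zero)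
            (𝒪⇒V {a₁} a₁∈) (𝒪⇒V {a₂} a₂∈) (head 0# 1# 0∈ 1∈) (head 1# 0# 1∈ 0∈) e)
          (⨁-star (σ ∘ suc) (odd ∘ suc) s j s∈ (λ x x∈ → V.V-resp {j} {H₀ s₀ (0# , 0#) + S.Φ s x} {S.Φ s x}
            (trans {H₀ s₀ (0# , 0#) + S.Φ s x} {0# + S.Φ s x} {S.Φ s x}
              (+-congʳ {S.Φ s x} {H₀ s₀ (0# , 0#)} {0#} (D.hyperbolic-zeroʳ {a₁} {a₂} {zpow π π⁻¹ (σ zero)} {zpow (conj π) (conj π⁻¹) (σ zero)}))
              (+-identityˡ (S.Φ s x))) (bound ((0# , 0#) , x) ((0∈ , 0∈) , x∈))) e)
        where
        module S = FormedLattice (⨁H (σ ∘ suc))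
        H₀ = FormedLattice.Φ (H π π⁻¹ (σ zero))
        0∈ : 0# ∈ 𝒪
        0∈ = V⇒𝒪 {0#} V.V-0
        1∈ : 1# ∈ 𝒪
        1∈ = V⇒𝒪 {1#} (V.W⇒V {_} {1#} V.W-1)
        head : ∀ x y → x ∈ 𝒪 → y ∈ 𝒪 → V.V j (H₀ s₀ (x , y))
        head x y x∈ y∈ = V.V-resp {j} {H₀ s₀ (x , y) + S.Φ s S.0ᴹ} {H₀ s₀ (x , y)}
          (trans {H₀ s₀ (x , y) + S.Φ s S.0ᴹ} {H₀ s₀ (x , y) + 0#} {H₀ s₀ (x , y)}
            (+-congˡ {H₀ s₀ (x , y)} {S.Φ s S.0ᴹ} {0#} (⨁-zeroʳ (σ ∘ suc) s)) (+-identityʳ (H₀ s₀ (x , y))))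
          (bound ((x , y) , S.0ᴹ) ((x∈ , y∈) , ⨁-0∈ (σ ∘ suc)))

    assemble : ∀ {k} (σ : Vector ℤ k) → (Fin k → Carrier) → (Fin k → Carrier) → FormedLattice.Carrierᴹ (⨁H σ)
    assemble {zero} σ f g = tt
    assemble {suc k} σ f g = (f zero , g zero) , assemble (σ ∘ suc) (f ∘ suc) (g ∘ suc)

    assemble-cong : ∀ {k} (σ : Vector ℤ k) {f f′ g g′} → (∀ i → f i ≈ f′ i) → (∀ i → g i ≈ g′ i) →
      FormedLattice._≈ᴹ_ (⨁H σ) (assemble σ f g) (assemble σ f′ g′)
    assemble-cong {zero} σ _ _ = tt
    assemble-cong {suc k} σ p q = (p zero , q zero) , assemble-cong (σ ∘ suc) (p ∘ suc) (q ∘ suc)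

    assemble-linear : ∀ {k} (σ : Vector ℤ k) r f g f′ g′ → let open FormedLattice (⨁H σ) in
      assemble σ (λ i → r * f i + f′ i) (λ i → r * g i + g′ i) ≈ᴹ r *ₗ assemble σ f g +ᴹ assemble σ f′ g′
    assemble-linear {zero} σ r f g f′ g′ = tt
    assemble-linear {suc k} σ r f g f′ g′ = (refl {r * f zero + f′ zero} , refl {r * g zero + g′ zero}) ,
      assemble-linear (σ ∘ suc) r (f ∘ suc) (g ∘ suc) (f′ ∘ suc) (g′ ∘ suc)

    assemble-injective : ∀ {k} (σ : Vector ℤ k) {f f′ g g′} → FormedLattice._≈ᴹ_ (⨁H σ) (assemble σ f g) (assemble σ f′ g′) →
      ∀ i → f i ≈ f′ i × g i ≈ g′ i
    assemble-injective σ (p , _) zero = p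
    assemble-injective σ (_ , q) (suc i) = assemble-injective (σ ∘ suc) q i

    assemble-surjective : ∀ {k} (σ : Vector ℤ k) t → ∃₂ λ f g → FormedLattice._≈ᴹ_ (⨁H σ) (assemble σ f g) t
    assemble-surjective {zero} σ t = (λ ()) , (λ ()) , tt
    assemble-surjective {suc k} σ ((x , y) , t) = let (f , g , eq) = assemble-surjective (σ ∘ suc) t in
      (λ { zero → x ; (suc i) → f i }) , (λ { zero → y ; (suc i) → g i }) , ((refl {x} , refl {y}) , eq)

    assemble∈ : ∀ {k} (σ : Vector ℤ k) {f g} → (∀ i → f i ∈ 𝒪) → (∀ i → g i ∈ 𝒪) → assemble σ f g ∈ FormedLattice.lattice (⨁H σ)
    assemble∈ {zero} σ _ _ = tt
    assemble∈ {suc k} σ f∈ g∈ = (f∈ zero , g∈ zero) , assemble∈ (σ ∘ suc) (f∈ ∘ suc) (g∈ ∘ suc)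

    ∈assemble : ∀ {k} (σ : Vector ℤ k) t → t ∈ FormedLattice.lattice (⨁H σ) →
      ∃₂ λ f g → (∀ i → f i ∈ 𝒪) × (∀ i → g i ∈ 𝒪) × FormedLattice._≈ᴹ_ (⨁H σ) (assemble σ f g) t
    ∈assemble {zero} σ t t∈ = (λ ()) , (λ ()) , (λ ()) , (λ ()) , tt
    ∈assemble {suc k} σ ((x , y) , t) ((x∈ , y∈) , t∈) = let (f , g , f∈ , g∈ , eq) = ∈assemble (σ ∘ suc) t t∈ in
      (λ { zero → x ; (suc i) → f i }) , (λ { zero → y ; (suc i) → g i }) ,
      (λ { zero → x∈ ; (suc i) → f∈ i }) , (λ { zero → y∈ ; (suc i) → g∈ i }) , ((refl {x} , refl {y}) , eq)

    ∑ᶠ : ∀ k → (Fin k → Carrier) → Carrier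
    ∑ᶠ zero    t = 0#
    ∑ᶠ (suc k) t = t zero + ∑ᶠ k (t ∘ suc)

    assemble-Φ : ∀ {k} (σ : Vector ℤ k) f g f′ g′ → FormedLattice.Φ (⨁H σ) (assemble σ f g) (assemble σ f′ g′) ≈
      ∑ᶠ k (λ i → f i * zpow π π⁻¹ (σ i) * conj (g′ i) + g i * conj (zpow π π⁻¹ (σ i)) * conj (f′ i))
    assemble-Φ {zero} σ f g f′ g′ = refl {0#}
    assemble-Φ {suc k} σ f g f′ g′ = +-cong {u + g zero * ρ̄ * conj (f′ zero)} {u + g zero * conj ρ * conj (f′ zero)}
        {FormedLattice.Φ (⨁H (σ ∘ suc)) (assemble (σ ∘ suc) (f ∘ suc) (g ∘ suc)) (assemble (σ ∘ suc) (f′ ∘ suc) (g′ ∘ suc))}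
        {∑ᶠ k (λ i → f (suc i) * zpow π π⁻¹ (σ (suc i)) * conj (g′ (suc i)) + g (suc i) * conj (zpow π π⁻¹ (σ (suc i))) * conj (f′ (suc i)))}
      (+-congˡ {u} {g zero * ρ̄ * conj (f′ zero)} {g zero * conj ρ * conj (f′ zero)}
        (*-congʳ {conj (f′ zero)} {g zero * ρ̄} {g zero * conj ρ} (*-congˡ {g zero} {ρ̄} {conj ρ} (zpow-conj (σ zero)))))
      (assemble-Φ (σ ∘ suc) (f ∘ suc) (g ∘ suc) (f′ ∘ suc) (g′ ∘ suc))
      where
      ρ = zpow π π⁻¹ (σ zero)
      ρ̄ = zpow (conj π) (conj π⁻¹) (σ zero)
      u = f zero * ρ * conj (g′ zero)

-- The field case and the split case

module FieldTheorem {c ℓ v ℓv p} (F : LocalField c ℓ) (a : LocalField.Carrier F)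
    (2≉0 : Char≢2 F)
    (E-field : IsField (QuadraticAlgebra.E F a))
    {m} (L : QuadraticAlgebra.HermitianLattice F a m v ℓv p) where
  open QuadraticAlgebra F a
  open HermitianLattice L
  open QuadraticExtension F a 2≉0 using (isConjugation)
  open QuadraticExtension.FieldCase F a 2≉0 E-field using (w; isValuationᴱ; isQuadratic; 𝒪⇒V; V⇒𝒪)
  open IsQuadratic isQuadratic using (h; inert⊎ramified)
  private
    module V = Valuations E w isValuationᴱ
    module D = Differents E conj isConjugation w isQuadratic
    module A = LatticeAdapters F a 2≉0 L
    module S = HyperbolicSums F a 2≉0 E-field
    module Q = LinearAlgebra.Hermitian.Formed.Quadratic E space conj isConjugation Φ A.isForm w isQuadratic

  submodule = A.isSubmodule Q.𝒪 Q.isIntegers (λ {α} → V⇒𝒪 {α}) (λ {α} → 𝒪⇒V {α})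
  private
    module C = Q.Conclusions submodule A.generator A.generator∈
      (A.generated Q.𝒪 Q.isIntegers (λ {α} → V⇒𝒪 {α}) (λ {α} → 𝒪⇒V {α})) A.hull A.basisᴱ

  1≉0 : ¬ (1# ≈ 0#)
  1≉0 = IsField.1≉0 E-field

  𝓔⊆𝓔₀ : 𝓔 L ⊆ 𝓔₀
  𝓔⊆𝓔₀ {u} (φ , φ∈ , u≈) = A.𝓔₀-intro {u} φ∈ u≈ (V⇒𝒪 {d} (V.W⇒V {_} {d} Wd))
      (V⇒𝒪 {conj d} (V.W⇒V {_} {conj d} (≡.trans (IsQuadratic.w-conj isQuadratic d) Wd)))
      (λ {α} {β} α≈β α∈ → V⇒𝒪 {β} (V.V-resp {_} {α} {β} α≈β (𝒪⇒V {α} α∈)))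
    where
    d = detEnd L φ
    Wd : V.W (+ 0) d
    Wd = D.norm-one-W {d} (A.norm-one φ∈)

  realise : ∀ {u} → (∃ λ φ → LinearAlgebra.Hermitian.Formed.Lattices.Automorphism E space conj isConjugation Φ A.isForm Q.𝒪 Q.isIntegers lattice φ ×
      u ≈ LinearAlgebra.Basis.detEnd A.basisᴱ φ) → u ∈ 𝓔 L
  realise (φ , A , u≈) = φ , A.automorphism⇒Aut Q.𝒪 Q.isIntegers (λ {α} → V⇒𝒪 {α}) (λ {α} → 𝒪⇒V {α}) A , u≈

  good⇒𝓔₀⊆𝓔 : Q.GoodVector h lattice → 𝓔₀ ⊆ 𝓔 L
  good⇒𝓔₀⊆𝓔 G {u} (_ , Nru≈1) = realise {u} (C.all-dets G u Nru≈1)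

  frame-index : .{{NonZero m}} → (f : Q.Frame lattice) → Fin (Q.Frame.k f)
  frame-index f = go (Q.Frame.k f) (λ empty → A.nonzero 1≉0 (C.trivial-frame f empty))
    where
    go : ∀ k → ¬ ¬ Fin k → Fin k
    go zero ¬¬k = ⊥-elim (¬¬k λ ())
    go (suc k) _ = zero

  inert-good : .{{NonZero m}} → (∀ n x → V.W n x → Even (n ℤ.+ h)) → Q.GoodVector h lattice
  inert-good inert = [ id , (λ f → ⊥-elim (even-odd (inert _ _ (Q.Frame.W-xy f (frame-index f))) (Q.Frame.odd f (frame-index f)))) ]′ C.dichotomy

  module Ramified (ram : IsRamified E conj w h) (π π⁻¹ : Carrier) (W-π : V.W (+ 1) π) (ππ⁻¹≈1 : π * π⁻¹ ≈ 1#)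
                  {e} (exponent : + 1 ℤ.+ h ≡ + e) where

    congruent⇒odd : ∀ {i} → + 2 ∣ i ℤ.- + e → Odd (i ℤ.+ h)
    congruent⇒odd {i} 2∣ = let Signed.divides q eq = Signed.∣ᵤ⇒∣ {+ 2} {i ℤ.- + e} 2∣ in q ℤ.+ h ,
      ≡.trans (ℤ-Solver.solve 3 (λ i e h → i :+ h := (i :- e) :+ (e :+ h)) ≡.refl i (+ e) h)
        (≡.trans (≡.cong₂ (λ x e → x ℤ.+ (e ℤ.+ h)) eq (≡.sym exponent))
          (ℤ-Solver.solve 2 (λ q h → q :* con (+ 2) :+ ((con (+ 1) :+ h) :+ h) := con (+ 1) :+ ((q :+ h) :+ (q :+ h))) ≡.refl q h))

    odd⇒congruent : ∀ {i} → Odd (i ℤ.+ h) → + 2 ∣ i ℤ.- + e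
    odd⇒congruent {i} (n , eq) = Signed.∣⇒∣ᵤ (Signed.divides (n ℤ.- h)
      (≡.trans (≡.cong (λ x → i ℤ.- x) (≡.sym exponent)) (≡.trans (ℤ-Solver.solve 2 (λ i h → i :- (con (+ 1) :+ h) := (i :+ h) :- (con (+ 1) :+ (h :+ h))) ≡.refl i h)
        (≡.trans (≡.cong (λ x → x ℤ.- (+ 1 ℤ.+ (h ℤ.+ h))) eq)
          (ℤ-Solver.solve 2 (λ n h → (con (+ 1) :+ (n :+ n)) :- (con (+ 1) :+ (h :+ h)) := (n :- h) :* con (+ 2)) ≡.refl n h)))))

    sum⇒star : IsSumOfH L e π π⁻¹ → S.Star formedLattice
    sum⇒star (k , _ , σ , congruent , iso) = S.star-transport π π⁻¹ {M = formedLattice} σ iso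
      (S.⨁-star π π⁻¹ W-π ππ⁻¹≈1 σ (λ i → congruent⇒odd {σ i} (congruent i)))

    module _ (f : Q.Frame lattice) where
      private
        k = Q.Frame.k f
        σ = Q.Frame.σ f
        P : Fin k → Carrier
        P i = zpow π π⁻¹ (σ i)
        module Co = Q.Coordinates submodule C.nondegenerate-on {P = P} (Q.rescale submodule f P (λ i → S.W-zpow π π⁻¹ W-π ππ⁻¹≈1 (σ i)))
        module M = FormedLattice (S.⨁H π π⁻¹ σ)
        module Hyp = Q.Hyperbolic (Q.rescale submodule f P (λ i → S.W-zpow π π⁻¹ W-π ππ⁻¹≈1 (σ i)))

        double≡ : ∀ k → Q.double k ≡ 2 ℕ.* k
        double≡ zero = ≡.refl
        double≡ (suc k) = ≡.cong suc (≡.trans (≡.cong suc (double≡ k)) (≡.sym (ℕ.+-suc k (k ℕ.+ 0))))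

        rank : m ≡ 2 ℕ.* k
        rank = ≡.trans (ℕ.≤-antisym (LinearAlgebra.basis-≤ E space 1≉0 Co.basis A.basisᴱ) (LinearAlgebra.basis-≤ E space 1≉0 A.basisᴱ Co.basis)) (double≡ k)

        φ : Carrierᴹ → M.Carrierᴹ
        φ z = S.assemble π π⁻¹ σ (Co.a z) (Co.b z)

        scaled : ∀ s c → LinearAlgebra.Functional E space (λ z → Φ z s * c)
        scaled s c = LinearAlgebra.Hermitian.Formed.quasi-functional E space conj isConjugation Φ A.isForm c s

        φ-cong : ∀ {z z′} → z ≈ᴹ z′ → φ z M.≈ᴹ φ z′
        φ-cong z≈ = S.assemble-cong π π⁻¹ σ
          (λ i → LinearAlgebra.Functional.cong (scaled (Hyp.y i) (Hyp.P′ i)) z≈) (λ i → LinearAlgebra.Functional.cong (scaled (Hyp.x i) (conj (Hyp.P′ i))) z≈)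

        φ-linear : ∀ r z z′ → φ (r *ₗ z +ᴹ z′) M.≈ᴹ r M.*ₗ φ z M.+ᴹ φ z′
        φ-linear r z z′ = M.≈ᴹ-trans (S.assemble-cong π π⁻¹ σ
            (λ i → LinearAlgebra.Functional.linear (scaled (Hyp.y i) (Hyp.P′ i)) r z z′) (λ i → LinearAlgebra.Functional.linear (scaled (Hyp.x i) (conj (Hyp.P′ i))) r z z′))
          (S.assemble-linear π π⁻¹ σ r (Co.a z) (Co.b z) (Co.a z′) (Co.b z′))

        spanned : (Fin k → Carrier) → (Fin k → Carrier) → Carrierᴹ
        spanned = Q.combination Hyp.x Hyp.y

        φ-span : ∀ r s → φ (spanned r s) M.≈ᴹ S.assemble π π⁻¹ σ r s
        φ-span r s = S.assemble-cong π π⁻¹ σ (Co.a-combination r s) (Co.b-combination r s)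

        φ-injective : ∀ {z z′} → φ z M.≈ᴹ φ z′ → z ≈ᴹ z′
        φ-injective {z} {z′} eq = ≈ᴹ-trans (Co.expand z) (≈ᴹ-trans (≈ᴹ-trans
          (LinearAlgebra.sumᴹ-cong E space (λ i → *ₗ-cong (same-coordinates i) ≈ᴹ-refl)) ≈ᴹ-refl) (≈ᴹ-sym (Co.expand z′)))
          where
          components = S.assemble-injective π π⁻¹ σ eq
          same-coordinates : ∀ i → Q.interleave (Co.a z) (Co.b z) i ≈ Q.interleave (Co.a z′) (Co.b z′) i
          same-coordinates = go (λ i → proj₁ (components i)) (λ i → proj₂ (components i))
            where
            go : ∀ {k} {f f′ g g′ : Fin k → Carrier} → (∀ i → f i ≈ f′ i) → (∀ i → g i ≈ g′ i) → ∀ i → Q.interleave f g i ≈ Q.interleave f′ g′ i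
            go {suc k} p q zero = p zero
            go {suc k} p q (suc zero) = q zero
            go {suc k} p q (suc (suc i)) = go (p ∘ suc) (q ∘ suc) i

        ∑ᶠ≡ : ∀ k t → S.∑ᶠ π π⁻¹ k t ≡ Q.∑ᶠ k t
        ∑ᶠ≡ zero t = ≡.refl
        ∑ᶠ≡ (suc k) t = ≡.cong (λ x → t zero + x) (∑ᶠ≡ k (t ∘ suc))

        φ-isometry : IsIsometry formedLattice (S.⨁H π π⁻¹ σ) φ
        φ-isometry = record
          { isModuleIsomorphism = ModuleMaps.isomorphism space M.space φ-cong φ-linear φ-injective
              (λ t → let (r , s , eq) = S.assemble-surjective π π⁻¹ σ t in spanned r s , M.≈ᴹ-trans (φ-span r s) eq)
          ; preserves-Φ = λ z z′ → trans {M.Φ (φ z) (φ z′)} {S.∑ᶠ π π⁻¹ k (t z z′)} {Φ z z′} (S.assemble-Φ π π⁻¹ σ (Co.a z) (Co.b z) (Co.a z′) (Co.b z′))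
              (trans {S.∑ᶠ π π⁻¹ k (t z z′)} {Q.∑ᶠ k (t z z′)} {Φ z z′} (reflexive (∑ᶠ≡ k (t z z′))) (sym {Φ z z′} {Q.∑ᶠ k (t z z′)} (Co.Φ-expand z z′)))
          ; image = (λ {y} (z , z∈ , φz≈y) → lattice-resp σ {φ z} {y} φz≈y (S.assemble∈ π π⁻¹ σ
                (λ i → V⇒𝒪 {Co.a z i} (Hyp.a∈ i z∈)) (λ i → V⇒𝒪 {Co.b z i} (Hyp.b∈ i z∈)))) ,
              (λ {y} y∈ → let (r , s , r∈ , s∈ , eq) = S.∈assemble π π⁻¹ σ y y∈ in
                spanned r s , Co.combination∈ r s (λ i → 𝒪⇒V {r i} (r∈ i)) (λ i → 𝒪⇒V {s i} (s∈ i)) , M.≈ᴹ-trans (φ-span r s) eq)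
          }
          where
          t : Carrierᴹ → Carrierᴹ → Fin k → Carrier
          t z z′ i = Co.a z i * P i * conj (Co.b z′ i) + Co.b z i * conj (P i) * conj (Co.a z′ i)
          𝒪-resp : ∀ {α β} → α ≈ β → α ∈ 𝒪 → β ∈ 𝒪
          𝒪-resp {α} {β} α≈β α∈ = V⇒𝒪 {β} (V.V-resp {_} {α} {β} α≈β (𝒪⇒V {α} α∈))
          lattice-resp : ∀ {k} (σ : Vector ℤ k) {x y} → FormedLattice._≈ᴹ_ (S.⨁H π π⁻¹ σ) x y →
            x ∈ FormedLattice.lattice (S.⨁H π π⁻¹ σ) → y ∈ FormedLattice.lattice (S.⨁H π π⁻¹ σ)
          lattice-resp {zero} σ _ _ = tt
          lattice-resp {suc k} σ {(x₁ , x₂) , x} {(y₁ , y₂) , y} ((p , q) , r) ((x₁∈ , x₂∈) , x∈) =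
            (𝒪-resp {x₁} {y₁} p x₁∈ , 𝒪-resp {x₂} {y₂} q x₂∈) , lattice-resp (σ ∘ suc) r x∈

      frame⇒sum : IsSumOfH L e π π⁻¹
      frame⇒sum = k , rank , σ , (λ i → odd⇒congruent {σ i} (Q.Frame.odd f i)) , φ , φ-isometry

    𝓔⊆𝓔₁ : IsSumOfH L e π π⁻¹ → 𝓔 L ⊆ 𝓔₁
    𝓔⊆𝓔₁ sum {u} (φ , φ∈ , u≈) =
      let (y , y′ , Wy , ȳy′≈1 , d≈) = D.even-ratio⇒unit-ratio {detEnd L φ} (C.dets-even ram (sum⇒star sum) (A.Aut⇒isometry φ∈) (A.Aut⇒stable φ∈))
          (y⁻¹ , yy⁻¹≈1 , Wy⁻¹) = D.invert {_} {y} Wy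
      in y , y′ , (V⇒𝒪 {y} (V.W⇒V {_} {y} Wy) , y⁻¹ , V⇒𝒪 {y⁻¹} (V.W⇒V {_} {y⁻¹} Wy⁻¹) , yy⁻¹≈1) , ȳy′≈1 ,
         trans {u} {detEnd L φ} {y * y′} u≈ d≈

    𝓔₁⊆𝓔 : .{{NonZero m}} → 𝓔₁ ⊆ 𝓔 L
    𝓔₁⊆𝓔 {u} (y , y′ , (y∈ , y⁻¹ , y⁻¹∈ , yy⁻¹≈1) , ȳy′≈1 , u≈) =
      let (Nru≈1 , even) = D.unit-ratio⇒even-ratio {y} {y′} {u} (D.unit-W {y} {y⁻¹} (𝒪⇒V {y} y∈) (𝒪⇒V {y⁻¹} y⁻¹∈) yy⁻¹≈1) ȳy′≈1 u≈ in
      realise {u} ([ (λ G → C.all-dets G u Nru≈1) , (λ f → C.even-dets ram f (frame-index f) u Nru≈1 even) ]′ C.dichotomy)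

    not-sum⇒good : ¬ IsSumOfH L e π π⁻¹ → Q.GoodVector h lattice
    not-sum⇒good ¬sum = [ id , (λ f → ⊥-elim (¬sum (frame⇒sum f))) ]′ C.dichotomy

module SplitTheorem {c ℓ v ℓv p} (F : LocalField c ℓ) (a : LocalField.Carrier F)
    (2≉0 : Char≢2 F)
    (S : QuadraticAlgebra.Split F a)
    {m} (L : QuadraticAlgebra.HermitianLattice F a m v ℓv p) where
  open QuadraticAlgebra F a
  open HermitianLattice L
  open QuadraticExtension F a 2≉0 using (isConjugation)
  open QuadraticExtension.SplitCase F a 2≉0 S using (w; isSplit; 𝒪⇒V; V⇒𝒪; 1≉0)
  private
    module A = LatticeAdapters F a 2≉0 L
    module Q = LinearAlgebra.Hermitian.Formed.Split E space conj isConjugation Φ A.isForm w isSplit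

  ⇒𝒪 : ∀ {α} → Q.𝒪 α → α ∈ 𝒪
  ⇒𝒪 {α} (v , v̄) = V⇒𝒪 {α} v v̄

  𝒪⇒ : ∀ {α} → α ∈ 𝒪 → Q.𝒪 α
  𝒪⇒ {α} α∈ = 𝒪⇒V {α} α∈

  submodule = A.isSubmodule Q.𝒪 Q.isIntegers (λ {α} → ⇒𝒪 {α}) (λ {α} → 𝒪⇒ {α})
  generated = A.generated Q.𝒪 Q.isIntegers (λ {α} → ⇒𝒪 {α}) (λ {α} → 𝒪⇒ {α})

  𝓔⊆𝓔₀ : 𝓔 L ⊆ 𝓔₀
  𝓔⊆𝓔₀ {u} (φ , φ∈ , u≈) = A.𝓔₀-intro {u} φ∈ u≈ (⇒𝒪 {d} integral) (⇒𝒪 {conj d} (LinearAlgebra.Hermitian.IsIntegers.𝒪-conj Q.isIntegers {d} integral))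
      (λ {α} {β} α≈β α∈ → ⇒𝒪 {β} (LinearAlgebra.Hermitian.IsIntegers.𝒪-resp Q.isIntegers {α} {β} α≈β (𝒪⇒ {α} α∈)))
    where
    d = detEnd L φ
    integral : Q.𝒪 d
    integral = Q.detEnd-integral submodule A.generator A.generator∈ generated A.hull A.basisᴱ record
      { isLinear = LinearAlgebra.Hermitian.Formed.Isometry.isLinear (A.Aut⇒isometry φ∈) ; stable = A.Aut⇒stable φ∈ }

  realise : ∀ {u} → (∃ λ φ → LinearAlgebra.Hermitian.Formed.Lattices.Automorphism E space conj isConjugation Φ A.isForm Q.𝒪 Q.isIntegers lattice φ ×
      u ≈ LinearAlgebra.Basis.detEnd A.basisᴱ φ) → u ∈ 𝓔 L
  realise (φ , A , u≈) = φ , A.automorphism⇒Aut Q.𝒪 Q.isIntegers (λ {α} → ⇒𝒪 {α}) (λ {α} → 𝒪⇒ {α}) A , u≈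

  𝓔₀⊆𝓔 : .{{NonZero m}} → 𝓔₀ ⊆ 𝓔 L
  𝓔₀⊆𝓔 {u} ((u∈ , _) , Nru≈1) = [
      (λ zeros → ⊥-elim (A.nonzero (λ (p , _) → 1≉0 p) (Q.orthogonal⇒trivial submodule A.generator A.generator∈ generated A.hull A.basisᴱ zeros))) ,
      (λ dets → realise {u} (dets A.basisᴱ u (𝒪⇒ {u} u∈) Nru≈1)) ]′
    (Q.good-det submodule A.generator A.generator∈ generated)

theorem3p7 : ∀ {c ℓ v ℓv p} (K : LocalField c ℓ) (a : LocalField.Carrier K) →
    let module K = LocalField K
        open QuadraticAlgebra K a
    in
    ¬ (K.1# K.+ K.1# K.≈ K.0#) →
    IsÉtale →
    ∀ (𝔓 : Subset) → Is𝔓 𝔓 →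
    ∀ (e : ℕ) → 𝔇 ≐ 𝔓 ^ᴵ e →
    ∀ (π π⁻¹ : Carrier) → (Ramified 𝔓 → IsPrimeElement 𝔓 π π⁻¹) →
    ∀ (m : ℕ) .{{_ : NonZero m}} (L : HermitianLattice m v ℓv p) →
    (Ramified 𝔓 × IsSumOfH L e π π⁻¹ → 𝓔 L ≐ 𝓔₁) ×
    (¬ (Ramified 𝔓 × IsSumOfH L e π π⁻¹) → 𝓔 L ≐ 𝓔₀)
theorem3p7 K a 2≉0 (inj₁ E-field) 𝔓 is𝔓 e 𝔇≐ π π⁻¹ prime m L = [ inert , ramified ]′ inert⊎ramified
  where
  open QuadraticAlgebra K a
  open QuadraticExtension.FieldCase K a 2≉0 E-field using (w; isQuadratic; module Ideals)
  open IsQuadratic isQuadratic using (h; inert⊎ramified)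
  module I = Ideals 𝔓 is𝔓
  module T = FieldTheorem K a 2≉0 E-field L
  Result = (Ramified 𝔓 × IsSumOfH L e π π⁻¹ → 𝓔 L ≐ 𝓔₁) × (¬ (Ramified 𝔓 × IsSumOfH L e π π⁻¹) → 𝓔 L ≐ 𝓔₀)
  inert : (∀ n x → w x ≡ [ n ] → Even (n ℤ.+ h)) → Result
  inert even = (λ (ram , _) → ⊥-elim (I.inert⇒¬ramified even ram)) ,
    (λ _ → (λ {u} → T.𝓔⊆𝓔₀ {u}) , (λ {u} → T.good⇒𝓔₀⊆𝓔 (T.inert-good even) {u}))
  ramified : IsRamified E conj w h → Result
  ramified ram = (λ (_ , sum) → (λ {u} → R.𝓔⊆𝓔₁ sum {u}) , (λ {u} → R.𝓔₁⊆𝓔 {u})) ,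
    (λ exclude → (λ {u} → T.𝓔⊆𝓔₀ {u}) , (λ {u} → T.good⇒𝓔₀⊆𝓔 (R.not-sum⇒good (λ sum → exclude (I.isRamified ram , sum))) {u}))
    where
    module R = T.Ramified ram π π⁻¹ (I.W-prime ram (prime (I.isRamified ram))) (proj₂ (prime (I.isRamified ram))) (I.exponent ram {e} 𝔇≐)
theorem3p7 K a 2≉0 (inj₂ S) 𝔓 _ e _ π π⁻¹ _ m L =
    (λ ((E-field , _) , _) → ⊥-elim (QuadraticExtension.FieldCase.not-split K a 2≉0 E-field S)) ,
    (λ _ → (λ {u} → T.𝓔⊆𝓔₀ {u}) , (λ {u} → T.𝓔₀⊆𝓔 {u}))
  where
  module T = SplitTheorem K a 2≉0 S L
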